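{- Let $\Delta$ be a $(d-1)$-dimensional pseudomanifold with homologically isolated singularities. If $d\geq 5$, then $$g_2(\Delta)\geq \binom{d+1}{2}\left[\beta_{d-2}(\Delta)-\beta_{d-1}(\Delta)+1\right] +d \cdot\mathcal{K}_{d-2}(\Delta)- d\sum_{v\in V}\left[\beta_{d-3}(\operatorname{lk} v)-\beta_{d-2}(\operatorname{lk} v)+1\right].$$ The same assertion also holds if $d=4$ and $\Delta$ has at most 5 singularities.
   Context: Fix an infinite field $k$. $g_2=h_2-h_1$ with $h$ the $h$-vector; $\beta_i=\dim_k\tilde H_i(\cdot;k)$. A pseudomanifold with isolated singularities is a pure complex whose vertex links are $k$-homology manifolds; it has homologically isolated singularities if moreover, for $0\le i\le d-2$, the images of the inclusion-induced maps $\iota^*:H^i(\Delta,\{F:v\notin F\};k)\to\tilde H^i(\Delta;k)$, $v\in V$, are linearly independent subspaces. $\mathcal{K}_i(\Delta)$ is the dimension of the kernel of $\sum_v a_v\iota^*:\bigoplus_v H^i(\Delta,\{F:v\notin F\};k)\to\tilde H^i(\Delta;k)$ (any nonzero $a_v$). Singular vertices are those whose link is not a $k$-homology sphere. -}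

module Defs where

import Level
open import Level using (Level; _⊔_) renaming (suc to lsuc)
open import Algebra.Bundles using (CommutativeRing)
open import Data.Bool using (Bool; true; false; not; _∧_; if_then_else_)
open import Data.Nat as ℕ using (ℕ; zero; suc; _≤_; _<_; _∸_; _≡ᵇ_; _<ᵇ_)
open import Data.Nat.Combinatorics using (_C_)
open import Data.Integer as ℤ using (ℤ; +_)
open import Data.Fin using (Fin; toℕ)
open import Data.Fin.Subset using (Subset; ⁅_⁆; _∪_; _∩_; ∣_∣; _⊆_)
import Data.Fin.Subset
open import Data.Vec using ([]; _∷_; lookup)
open import Data.List using (List; []; _∷_; _++_; map; length)
open import Data.List.Membership.Propositional using (_∈_)
open import Data.Product using (Σ; ∃; ∃-syntax; _×_; _,_)
open import Relation.Nullary using (¬_)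
open import Relation.Binary.PropositionalEquality using (_≡_)

record Field (c ℓ : Level) : Set (lsuc (c ⊔ ℓ)) where
  field
    commRing : CommutativeRing c ℓ
  open CommutativeRing commRing public
  field
    0≉1      : ¬ (0# ≈ 1#)
    inverse  : ∀ x → ¬ (x ≈ 0#) → ∃[ y ] (x * y ≈ 1#)

Infinite : ∀ {c ℓ} → Field c ℓ → Set (c ⊔ ℓ)
Infinite 𝔽 = Σ (ℕ → Carrier) λ e → ∀ m n → e m ≈ e n → m ≡ n
  where open Field 𝔽

-- Finite combinatorics.  Vertex set V = Fin n; faces are subsets of
-- Fin n; a (raw) complex is a decidable family of faces.

Cx : ℕ → Set
Cx n = Subset n → Bool

allSubsets : ∀ n → List (Subset n)
allSubsets zero    = [] ∷ []
allSubsets (suc n) = map (false ∷_) (allSubsets n) ++ map (true ∷_) (allSubsets n)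

countL : ∀ {A : Set} → (A → Bool) → List A → ℕ
countL p []       = 0
countL p (x ∷ xs) = if p x then suc (countL p xs) else countL p xs

countFin : ∀ {n} → (Fin n → Bool) → ℕ
countFin {zero}  p = 0
countFin {suc n} p = (if p Fin.zero then 1 else 0) ℕ.+ countFin (λ i → p (Fin.suc i))
  where import Data.Fin as Fin

faceOfSize : ∀ {n} → Cx n → ℕ → Subset n → Bool
faceOfSize Δ s F = Δ F ∧ (∣ F ∣ ≡ᵇ s)

-- f-numbers indexed by number of vertices: fSize Δ i = f_{i-1}(Δ)
fSize : ∀ {n} → Cx n → ℕ → ℕ
fSize {n} Δ i = countL (faceOfSize Δ i) (allSubsets n)

below : ∀ {n} → Subset n → Fin n → ℕ
below F u = countFin (λ w → lookup F w ∧ (toℕ w <ᵇ toℕ u))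

link : ∀ {n} → Cx n → Subset n → Cx n
link Δ G F = (∣ F ∩ G ∣ ≡ᵇ 0) ∧ Δ (F ∪ G)

record IsComplex {n} (Δ : Cx n) : Set where
  field
    closed : ∀ F G → F ⊆ G → Δ G ≡ true → Δ F ≡ true

-- pure of dimension d - 1 (there is a face with d vertices and every
-- face lies in a face with d vertices)
PureOfDim : ∀ {n} → Cx n → ℕ → Set
PureOfDim Δ d =
  (∃[ F ] (Δ F ≡ true × ∣ F ∣ ≡ d)) ×
  (∀ F → Δ F ≡ true → ∃[ G ] (F ⊆ G × Δ G ≡ true × ∣ G ∣ ≡ d))

hVec : ∀ {n} → Cx n → ℕ → ℕ → ℤ
hVec Δ d k = go k
  where
    term : ℕ → ℤ
    term i = (if ℕ._%_ (k ∸ i) 2 ≡ᵇ 0 then + 1 else ℤ.- + 1)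
               ℤ.* (+ ((d ∸ i) C (k ∸ i)) ℤ.* + fSize Δ i)
    go : ℕ → ℤ
    go zero    = term 0
    go (suc i) = go i ℤ.+ term (suc i)

g₂ : ∀ {n} → Cx n → ℕ → ℤ
g₂ Δ d = hVec Δ d 2 ℤ.- hVec Δ d 1

module WithField {c ℓ} (𝔽 : Field c ℓ) where
  open Field 𝔽

  ΣFin : ∀ {m} → (Fin m → Carrier) → Carrier
  ΣFin {zero}  f = 0#
  ΣFin {suc m} f = f Fin.zero + ΣFin (λ i → f (Fin.suc i))
    where import Data.Fin as Fin

  _≐_ : ∀ {I : Set} → (I → Carrier) → (I → Carrier) → Set ℓ
  f ≐ g = ∀ x → f x ≈ g x

  zeroV : ∀ {I : Set} → I → Carrier
  zeroV _ = 0#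

  lincomb : ∀ {I : Set} {r} → (Fin r → Carrier) → (Fin r → I → Carrier) → I → Carrier
  lincomb c e x = ΣFin (λ j → c j * e j x)

  LinIndep : ∀ {I : Set} {r} → (Fin r → I → Carrier) → Set (c ⊔ ℓ)
  LinIndep e = ∀ γ → lincomb γ e ≐ zeroV → ∀ j → γ j ≈ 0#

  Dim : ∀ {I : Set} {p} → ((I → Carrier) → Set p) → ℕ → Set (c ⊔ ℓ ⊔ p)
  Dim {I} S r =
    Σ (Fin r → I → Carrier) λ e →
      (∀ j → S (e j)) × LinIndep e ×
      (∀ x → S x → ∃[ γ ] (x ≐ lincomb γ e))

  sgn : ℕ → Carrier
  sgn zero    = 1#
  sgn (suc m) = - sgn m

  module _ {n : ℕ} (Δ : Cx n) where

    -- (co)chains supported on faces of Δ with s vertices (degree s - 1)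
    Chain : ℕ → (Subset n → Carrier) → Set ℓ
    Chain s ψ = ∀ F → faceOfSize Δ s F ≡ false → ψ F ≈ 0#

    ∂ : ℕ → (Subset n → Carrier) → Subset n → Carrier
    ∂ s ψ F = if faceOfSize Δ s F
      then ΣFin (λ u → if not (lookup F u) ∧ Δ (F ∪ ⁅ u ⁆)
                         then sgn (below F u) * ψ (F ∪ ⁅ u ⁆) else 0#)
      else 0#

    δ : ℕ → (Subset n → Carrier) → Subset n → Carrier
    δ s φ G = if faceOfSize Δ (suc s) G
      then ΣFin (λ u → if lookup G u then sgn (below G u) * φ (Data.Fin.Subset._-_ G u) else 0#)
      else 0#

    -- reduced simplicial homology in degree t - 1
    Cycles : ℕ → (Subset n → Carrier) → Set ℓ
    Cycles zero    ψ = Chain 0 ψ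
    Cycles (suc s) ψ = Chain (suc s) ψ × ∂ s ψ ≐ zeroV

    Boundaries : ℕ → (Subset n → Carrier) → Set (c ⊔ ℓ)
    Boundaries t x = ∃[ ψ ] (Chain (suc t) ψ × x ≐ ∂ t ψ)

    -- Betti Δ t b :  β_{t-1}(Δ) = dim_k H̃_{t-1}(Δ; k) = b
    Betti : ℕ → ℕ → Set (c ⊔ ℓ)
    Betti t b = ∃[ z ] ∃[ bb ] (Dim (Cycles t) z × Dim (Boundaries t) bb × b ℕ.+ bb ≡ z)

    -- reduced coboundaries of Δ in degree t - 1
    Coboundary : ℕ → (Subset n → Carrier) → Set (c ⊔ ℓ)
    Coboundary zero    x = Level.Lift c (x ≐ zeroV)
    Coboundary (suc s) x = ∃[ φ ] (Chain s φ × x ≐ δ s φ)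

    -- relative cochains of the pair (Δ, {F : v ∉ F}): supported on faces containing v
    RelCochain : Fin n → ℕ → (Subset n → Carrier) → Set ℓ
    RelCochain v s φ = Chain s φ × (∀ F → lookup F v ≡ false → φ F ≈ 0#)

    RelCocycle : Fin n → ℕ → (Subset n → Carrier) → Set ℓ
    RelCocycle v t φ = RelCochain v t φ × δ t φ ≐ zeroV

    RelCoboundary : Fin n → ℕ → (Subset n → Carrier) → Set (c ⊔ ℓ)
    RelCoboundary v zero    x = Level.Lift c (x ≐ zeroV)
    RelCoboundary v (suc s) x = ∃[ ψ ] (RelCochain v s ψ × x ≐ δ s ψ)

    -- the images of ι* : H^{t-1}(Δ, Δ∖v) → H̃^{t-1}(Δ), v ∈ V, are
    -- linearly independent subspaces (Σ_v ι*[z_v] = 0 ⇒ each ι*[z_v] = 0)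
    IndependentImages : ℕ → Set (c ⊔ ℓ)
    IndependentImages t =
      ∀ (z : Fin n → Subset n → Carrier) →
      (∀ v → RelCocycle v t (z v)) →
      Coboundary t (λ F → ΣFin (λ v → z v F)) →
      ∀ v → Coboundary t (z v)

    -- KerDim t κ : 𝒦_{t-1}(Δ) = κ, the dimension of the kernel of
    -- Σ_v ι* : ⊕_v H^{t-1}(Δ, Δ∖v) → H̃^{t-1}(Δ)
    -- (= dim {(z_v) relative cocycles : Σ z_v coboundary} − dim ⊕_v B^{t-1}(Δ,Δ∖v))
    KerDim : ℕ → ℕ → Set (c ⊔ ℓ)
    KerDim t κ = ∃[ w ] ∃[ bb ]
      ( Dim {Fin n × Subset n}
          (λ x → (∀ v → RelCocycle v t (λ F → x (v , F))) ×
                 Coboundary t (λ F → ΣFin (λ v → x (v , F)))) w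
      × Dim {Fin n × Subset n}
          (λ x → ∀ v → RelCoboundary v t (λ F → x (v , F))) bb
      × κ ℕ.+ bb ≡ w )

  -- L is a k-homology sphere of dimension e - 1 (e = 0: the (-1)-sphere {∅})
  IsHomologySphere : ∀ {n} → Cx n → ℕ → Set (c ⊔ ℓ)
  IsHomologySphere L e = ∀ t → Betti L t (if t ≡ᵇ e then 1 else 0)

  -- L is a k-homology manifold of dimension e - 1: faces have ≤ e vertices,
  -- and the link of every nonempty face G is a homology sphere of
  -- dimension (e - 1) - ∣G∣
  IsHomologyManifold : ∀ {n} → Cx n → ℕ → Set (c ⊔ ℓ)
  IsHomologyManifold L e =
    (∀ G → L G ≡ true → ∣ G ∣ ≤ e) ×
    (∀ G → L G ≡ true → 0 < ∣ G ∣ → IsHomologySphere (link L G) (e ∸ ∣ G ∣))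

  record PseudomanifoldIsolatedSing {n} (Δ : Cx n) (d : ℕ) : Set (c ⊔ ℓ) where
    field
      complex      : IsComplex Δ
      pure         : PureOfDim Δ d
      vertices     : ∀ v → Δ ⁅ v ⁆ ≡ true
      linkManifold : ∀ v → IsHomologyManifold (link Δ ⁅ v ⁆) (d ∸ 1)

  record HomologicallyIsolatedSing {n} (Δ : Cx n) (d : ℕ) : Set (c ⊔ ℓ) where
    field
      pseudomanifold : PseudomanifoldIsolatedSing Δ d
      -- for 0 ≤ i ≤ d - 2, i.e. t = i + 1 ∈ [1, d - 1]
      independent    : ∀ t → 1 ≤ t → t ≤ d ∸ 1 → IndependentImages Δ t

  Singular : ∀ {n} → Cx n → ℕ → Fin n → Set (c ⊔ ℓ)
  Singular Δ d v = ¬ IsHomologySphere (link Δ ⁅ v ⁆) (d ∸ 1)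

  AtMostSingularities : ∀ {n} → Cx n → ℕ → ℕ → Set (c ⊔ ℓ)
  AtMostSingularities {n} Δ d m =
    ∃[ S ] (length S ≤ m × (∀ v → Singular Δ d v → v ∈ S))

sumFin : ∀ {n} → (Fin n → ℤ) → ℤ
sumFin {zero}  f = + 0
sumFin {suc n} f = f Fin.zero ℤ.+ sumFin (λ i → f (Fin.suc i))
  where import Data.Fin as Fin

{-# OPTIONS --safe #-}
module Submission where

-- Let W = k^(d+1) carry a generic point p_v for each vertex v.  Consider the
-- (d-2)-cycles c of Δ with values in the alternating forms on W together with,
-- for each v, a (d-2)-chain m_v of lk v with values in the functionals that
-- kill p_v, such that the boundary of m_v is minus the contraction of c with v,
-- evaluated at p_v.  The equations have redundancies along the kernel of
-- Σ ι*; adding unknowns in dual directions absorbs them, and homological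
-- isolation forces these unknowns to be zero.
-- Imposing in addition one equation per edge (u, v), which makes the
-- one-dimensional discrepancy m_v(p_u) - m_u(p_v) in lk uv vanish, and
-- binomial(d+1, 2) equations per facet forces every m_v to be zero.  Then
-- c(F)(p_v, ·) = 0 for all v ∈ F, and such a stress is zero: contracted with
-- d - 3 vertices it lives on a 2-sphere (or on a triple of singular vertices if
-- d = 4, where five points of k⁵ suffice), and there it is an infinitesimal
-- motion, trivial by Fogelsanger's theorem on minimal cycles.  Hence there are
-- at least as many equations as unknowns, and this count is the inequality.
--
-- The conclusion is decidable, so everything may be proved up to double
-- negation, over the field in which ≈ is replaced by ¬ ¬ ≈.

open import Defs
open import Level using (Level; _⊔_; Lift; lift)
open import Algebra.Bundles using (CommutativeRing; RawRing)
open import Axiom.UniquenessOfIdentityProofs using (module Decidable⇒UIP)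
import Data.Bool
open import Data.Bool using (Bool; true; false; not; _∧_; _∨_; if_then_else_)
import Data.Bool.Properties as Bool
open import Data.Empty using (⊥; ⊥-elim)
open import Data.Fin as Fin using (Fin; zero; suc; punchIn; punchOut; toℕ)
import Data.Fin.Properties as Fin
open import Data.Fin.Subset using (Subset; ∣_∣; ⁅_⁆; _∪_; _∩_)
import Data.Fin.Subset as Sub
import Data.Fin.Subset.Properties as Sub
open import Data.Integer as ℤ using (ℤ; +_)
import Data.Integer.Properties as ℤ
import Data.Integer.Tactic.RingSolver as ℤSolver
open import Data.List as List using (List; []; _∷_; length; filter)
import Data.List.Membership.DecPropositional as DecList
open import Data.List.Membership.Propositional using (_∈_)
import Data.List.Membership.Propositional.Properties as List
import Data.List.Properties as List
open import Data.List.Relation.Unary.Any using (here; there)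
import Data.List.Relation.Unary.Any as Any
open import Data.Maybe using (Maybe; just; nothing)
import Data.Nat
open import Data.Nat as ℕ using (ℕ; zero; suc; _≤_; _<_; _∸_; z≤n; s≤s; _≡ᵇ_; _<ᵇ_)
import Data.Nat.Properties as ℕ
import Data.Nat.Tactic.RingSolver as ℕSolver
open import Data.Product using (Σ; ∃-syntax; _×_; _,_; proj₁; proj₂)
open import Data.Product.Function.NonDependent.Propositional using (_×-↔_)
open import Data.Sum using (_⊎_; inj₁; inj₂; [_,_]′)
open import Data.Sum.Function.Propositional using (_⊎-↔_)
open import Data.Unit using (⊤; tt)
open import Data.Vec as Vec using (Vec; []; _∷_; lookup; tabulate; _∷ʳ_)
import Data.Vec.Properties as Vec
open import Function.Base using (_∘_; id; _$_)
open import Function.Bundles using (_↔_; Inverse; mk↔ₛ′)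
open import Function.Properties.Inverse using (↔-refl; ↔-sym; ↔-trans)
open import Relation.Binary.Definitions using (tri<; tri≈; tri>)
open import Relation.Binary.PropositionalEquality as ≡ using (_≡_; _≢_)
open import Relation.Nullary using (¬_; Dec; yes; no; does)
open import Relation.Nullary.Decidable using (¬?; decidable-stable)

-- The coefficients of the inequality are dimensions: alternating forms on W have dimension
-- binomial(d+1, 2), functionals killing `p_v` have dimension d, and the edge equations contribute
-- the number of edges, the leading term of g₂. The obstacle is genericity over a field that is only
-- infinite. Lines between configurations replace polynomials: a condition is open if, once it holds
-- at a point, it holds at all but finitely many points of every line through it. Injectivity of a
-- system whose equations are affine along lines is open in this sense, so rigidity is restated as
-- injectivity of a pinned system, and finitely many open conditions, each with its own witness,
-- have a common solution.

DN : ∀ {a} → Set a → Set a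
DN A = ¬ ¬ A

return : ∀ {a} {A : Set a} → A → DN A
return x k = k x

infixl 1 _>>=_
_>>=_ : ∀ {a b} {A : Set a} {B : Set b} → DN A → (A → DN B) → DN B
(m >>= f) k = m (λ x → f x k)

infixl 4 _<$>_
_<$>_ : ∀ {a b} {A : Set a} {B : Set b} → (A → B) → DN A → DN B
(f <$> m) k = m (λ x → k (f x))

lem : ∀ {a} (A : Set a) → DN (A ⊎ ¬ A)
lem A k = k (inj₂ (λ x → k (inj₁ x)))

dn-Fin : ∀ {a} {n} {P : Fin n → Set a} → (∀ i → DN (P i)) → DN (∀ i → P i)
dn-Fin {n = zero}  f = return λ ()
dn-Fin {n = suc n} f = f zero >>= λ p → dn-Fin (f ∘ suc) >>= λ q →
  return λ { zero → p ; (suc i) → q i }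

dn-Subset : ∀ {a} {n} {P : Subset n → Set a} → (∀ F → DN (P F)) → DN (∀ F → P F)
dn-Subset {n = zero}  f = f [] >>= λ p → return λ { [] → p }
dn-Subset {n = suc n} f =
  dn-Subset (f ∘ (false ∷_)) >>= λ p → dn-Subset (f ∘ (true ∷_)) >>= λ q →
  return λ { (false ∷ F) → p F ; (true ∷ F) → q F }

dn-Vec : ∀ {a} {n m} {P : Vec (Fin n) m → Set a} → (∀ F → DN (P F)) → DN (∀ F → P F)
dn-Vec {m = zero}  f = f [] >>= λ p → return λ { [] → p }
dn-Vec {m = suc m} f = dn-Fin (λ i → dn-Vec (λ v → f (i ∷ v))) >>= λ p →
  return λ { (i ∷ v) → p i v }

dn-→ : ∀ {a b} {A : Set a} {B : Set b} → (A → DN B) → DN (A → B)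
dn-→ {A = A} f = lem A >>= λ
  { (inj₁ x) → f x >>= λ y → return (λ _ → y)
  ; (inj₂ n) → return (λ x → ⊥-elim (n x)) }

-- Integer coefficients for the ring solver, as formal differences of
-- naturals: a field has no decidable equality to normalise with.
module Solver {c ℓ : Level} (R : CommutativeRing c ℓ) where
  open CommutativeRing R
  open import Algebra.Properties.Ring ring
    using (-‿distribˡ-*; -‿distribʳ-*; -‿involutive; -0#≈0#)
  open import Algebra.Properties.AbelianGroup +-abelianGroup using (⁻¹-∙-comm)
  open import Algebra.Properties.CommutativeSemigroup +-commutativeSemigroup using (interchange)
  open import Algebra.Properties.Semiring.Mult semiring
    using (×-homo-+; ×1-homo-*) renaming (_×_ to _·_)
  open import Algebra.Solver.Ring.AlmostCommutativeRing
  open import Relation.Binary.Reasoning.Setoid setoid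

  -- Cancelling common successors leaves one component zero, so that equal integers become equal
  -- pairs and `equal?` can compare components.
  norm : ℕ → ℕ → ℕ × ℕ
  norm (suc a) (suc b) = norm a b
  norm a       b       = a , b

  gen : ℕ → ℕ → Carrier
  gen a b = a · 1# - b · 1#

  gen-norm : ∀ a b → gen (proj₁ (norm a b)) (proj₂ (norm a b)) ≈ gen a b
  gen-norm zero    b       = refl
  gen-norm (suc a) zero    = refl
  gen-norm (suc a) (suc b) = trans (gen-norm a b) (begin
    a · 1# - b · 1#                       ≈⟨ +-identityˡ _ ⟨
    0# + (a · 1# - b · 1#)                ≈⟨ +-congʳ (-‿inverseʳ 1#) ⟨
    (1# - 1#) + (a · 1# - b · 1#)         ≈⟨ interchange _ _ _ _ ⟩
    (1# + a · 1#) + (- 1# - b · 1#)       ≈⟨ +-congˡ (⁻¹-∙-comm _ _) ⟩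
    (1# + a · 1#) - (1# + b · 1#)         ∎)

  -- The clauses for 0 and 1 make the solver's constants mean `0#` and `1#` on the nose, so that
  -- goals containing these match directly.
  val : ℕ × ℕ → Carrier
  val (zero , zero)     = 0#
  val (suc zero , zero) = 1#
  val (a , b)           = gen a b

  val-gen : ∀ x → val x ≈ gen (proj₁ x) (proj₂ x)
  val-gen (zero , zero)        = sym (-‿inverseʳ 0#)
  val-gen (zero , suc b)       = refl
  val-gen (suc zero , zero)    = sym (trans (+-cong (+-identityʳ _) -0#≈0#) (+-identityʳ _))
  val-gen (suc zero , suc b)   = refl
  val-gen (suc (suc a) , b)    = refl

  val-norm : ∀ a b → val (norm a b) ≈ gen a b
  val-norm a b = trans (val-gen (norm a b)) (gen-norm a b)

  Diff : RawRing _ _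
  Diff = record
    { Carrier = ℕ × ℕ
    ; _≈_ = _≡_
    ; _+_ = λ { (a , b) (a' , b') → norm (a ℕ.+ a') (b ℕ.+ b') }
    ; _*_ = λ { (a , b) (a' , b') → norm (a ℕ.* a' ℕ.+ b ℕ.* b') (a ℕ.* b' ℕ.+ b ℕ.* a') }
    ; -_ = λ { (a , b) → b , a }
    ; 0# = 0 , 0
    ; 1# = 1 , 0
    }

  gen-+ : ∀ a b a' b' → gen (a ℕ.+ a') (b ℕ.+ b') ≈ gen a b + gen a' b'
  gen-+ a b a' b' = begin
    (a ℕ.+ a') · 1# - (b ℕ.+ b') · 1#
      ≈⟨ +-cong (×-homo-+ 1# a a') (-‿cong (×-homo-+ 1# b b')) ⟩
    (a · 1# + a' · 1#) - (b · 1# + b' · 1#)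
      ≈⟨ +-congˡ (⁻¹-∙-comm _ _) ⟨
    (a · 1# + a' · 1#) + (- (b · 1#) + - (b' · 1#))
      ≈⟨ interchange _ _ _ _ ⟩
    (a · 1# - b · 1#) + (a' · 1# - b' · 1#) ∎

  diff-* : ∀ x y x' y' →
    (x * x' + y * y') - (x * y' + y * x') ≈ (x - y) * (x' - y')
  diff-* x y x' y' = sym (begin
    (x - y) * (x' - y')
      ≈⟨ distribʳ _ _ _ ⟩
    x * (x' - y') + - y * (x' - y')
      ≈⟨ +-cong (distribˡ _ _ _) (distribˡ _ _ _) ⟩
    (x * x' + x * - y') + (- y * x' + - y * - y')
      ≈⟨ +-cong (+-congˡ (sym (-‿distribʳ-* _ _)))
           (+-cong (sym (-‿distribˡ-* _ _))
             (trans (sym (-‿distribˡ-* _ _))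
               (trans (-‿cong (sym (-‿distribʳ-* _ _))) (-‿involutive _)))) ⟩
    (x * x' + - (x * y')) + (- (y * x') + y * y')
      ≈⟨ +-congˡ (+-comm _ _) ⟩
    (x * x' + - (x * y')) + (y * y' + - (y * x'))
      ≈⟨ interchange _ _ _ _ ⟩
    (x * x' + y * y') + (- (x * y') + - (y * x'))
      ≈⟨ +-congˡ (⁻¹-∙-comm _ _) ⟩
    (x * x' + y * y') - (x * y' + y * x') ∎)

  morphism : Diff -Raw-AlmostCommutative⟶ fromCommutativeRing R
  morphism = record
    { ⟦_⟧ = val
    ; +-homo = λ { x@(a , b) y@(a' , b') → trans (val-norm (a ℕ.+ a') (b ℕ.+ b')) (trans (gen-+ a b a' b')
        (sym (+-cong (val-gen x) (val-gen y)))) }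
    ; *-homo = λ { x@(a , b) y@(a' , b') → trans (val-norm (a ℕ.* a' ℕ.+ b ℕ.* b') (a ℕ.* b' ℕ.+ b ℕ.* a')) (trans (trans
        (+-cong (trans (×-homo-+ 1# (a ℕ.* a') (b ℕ.* b')) (+-cong (×1-homo-* a a') (×1-homo-* b b')))
          (-‿cong (trans (×-homo-+ 1# (a ℕ.* b') (b ℕ.* a')) (+-cong (×1-homo-* a b') (×1-homo-* b a')))))
        (diff-* _ _ _ _)) (sym (*-cong (val-gen x) (val-gen y)))) }
    ; -‿homo = λ { x@(a , b) → trans (val-gen (b , a)) (trans (trans (+-comm _ _)
        (trans (+-congˡ (sym (-‿involutive _))) (⁻¹-∙-comm _ _))) (-‿cong (sym (val-gen x)))) }
    ; 0-homo = refl
    ; 1-homo = refl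
    }

  equal? : ∀ x y → Maybe (val x ≈ val y)
  equal? (a , b) (a' , b') with a ℕ.≟ a' | b ℕ.≟ b'
  ... | yes ≡.refl | yes ≡.refl = just refl
  ... | _          | _          = nothing

  open import Algebra.Solver.Ring Diff (fromCommutativeRing R) morphism equal?
    using (solve; _:=_; _:+_; _:*_; _:-_; :-_; con; Polynomial) public

  :0 : ∀ {n} → Polynomial n
  :0 = con (0 , 0)

  :1 : ∀ {n} → Polynomial n
  :1 = con (1 , 0)

-- Faces as subsets: insertion, deletion, links

subset-ext : ∀ {n} {F G : Subset n} → (∀ w → lookup F w ≡ lookup G w) → F ≡ G
subset-ext {F = F} {G} h = ≡.trans (≡.sym (Vec.tabulate∘lookup F)) (≡.trans (Vec.tabulate-cong h) (Vec.tabulate∘lookup G))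

ins : ∀ {n} → Fin n → Subset n → Subset n
ins u F = F ∪ ⁅ u ⁆

lookup-⊥ : ∀ {n} (w : Fin n) → lookup Sub.⊥ w ≡ false
lookup-⊥ w = Vec.lookup-replicate w false

lookup-⁅⁆ : ∀ {n} (u : Fin n) → lookup ⁅ u ⁆ u ≡ true
lookup-⁅⁆ zero    = ≡.refl
lookup-⁅⁆ (suc u) = lookup-⁅⁆ u

lookup-⁅⁆-≢ : ∀ {n} {u w : Fin n} → w ≢ u → lookup ⁅ u ⁆ w ≡ false
lookup-⁅⁆-≢ {u = zero}  {zero}  n = ⊥-elim (n ≡.refl)
lookup-⁅⁆-≢ {u = zero}  {suc w} n = lookup-⊥ w
lookup-⁅⁆-≢ {u = suc u} {zero}  n = ≡.refl
lookup-⁅⁆-≢ {u = suc u} {suc w} n = lookup-⁅⁆-≢ (n ∘ ≡.cong suc)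

lookup-∪ : ∀ {n} (F G : Subset n) w → lookup (F ∪ G) w ≡ lookup F w ∨ lookup G w
lookup-∪ F G w = Vec.lookup-zipWith _∨_ w F G

ins-≡ : ∀ {n} (u : Fin n) F → lookup (ins u F) u ≡ true
ins-≡ u F = ≡.trans (lookup-∪ F _ u) (≡.trans (≡.cong (lookup F u ∨_) (lookup-⁅⁆ u)) (Bool.∨-zeroʳ _))

ins-≢ : ∀ {n} {u w : Fin n} F → w ≢ u → lookup (ins u F) w ≡ lookup F w
ins-≢ {w = w} F n = ≡.trans (lookup-∪ F _ w) (≡.trans (≡.cong (lookup F w ∨_) (lookup-⁅⁆-≢ n)) (Bool.∨-identityʳ _))

ins-mono : ∀ {n} (u : Fin n) {w} F → lookup F w ≡ true → lookup (ins u F) w ≡ true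
ins-mono u {w} F e = ≡.trans (lookup-∪ F _ w) (≡.cong (_∨ _) e)

ins-∉ : ∀ {n} (u : Fin n) {w} F → lookup (ins u F) w ≡ false → lookup F w ≡ false
ins-∉ u {w} F e with lookup F w in q
... | false = ≡.refl
... | true  = ⊥-elim (case (≡.trans (≡.sym (ins-mono u F q)) e))
  where
    case : true ≡ false → ⊥
    case ()

ins-comm : ∀ {n} (u v : Fin n) F → ins u (ins v F) ≡ ins v (ins u F)
ins-comm u v F = ≡.trans (Sub.∪-assoc F _ _) (≡.trans (≡.cong (F ∪_) (Sub.∪-comm _ _)) (≡.sym (Sub.∪-assoc F _ _)))

del : ∀ {n} → Fin n → Subset n → Subset n
del u F = F Sub.- u

lookup-─ : ∀ {n} (F G : Subset n) w → lookup G w ≡ false → lookup (F Sub.─ G) w ≡ lookup F w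
lookup-─ (x ∷ F) (false ∷ G) zero    e = ≡.refl
lookup-─ (x ∷ F) (y ∷ G)     (suc w) e = lookup-─ F G w e

lookup-─-∈ : ∀ {n} (F G : Subset n) w → lookup G w ≡ true → lookup (F Sub.─ G) w ≡ false
lookup-─-∈ (x ∷ F) (true ∷ G) zero    e = ≡.refl
lookup-─-∈ (x ∷ F) (y ∷ G)    (suc w) e = lookup-─-∈ F G w e

del-≡ : ∀ {n} (u : Fin n) F → lookup (del u F) u ≡ false
del-≡ u F = lookup-─-∈ F _ u (lookup-⁅⁆ u)

del-≢ : ∀ {n} {u w : Fin n} F → w ≢ u → lookup (del u F) w ≡ lookup F w
del-≢ F n = lookup-─ F _ _ (lookup-⁅⁆-≢ n)

ins-del : ∀ {n} (u : Fin n) F → lookup F u ≡ true → ins u (del u F) ≡ F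
ins-del u F e = subset-ext λ w → go w (w Fin.≟ u)
  where
    go : ∀ w → Dec (w ≡ u) → lookup (ins u (del u F)) w ≡ lookup F w
    go w (yes ≡.refl) = ≡.trans (ins-≡ w (del u F)) (≡.sym e)
    go w (no n)       = ≡.trans (ins-≢ (del u F) n) (del-≢ F n)

del-ins : ∀ {n} (u : Fin n) F → lookup F u ≡ false → del u (ins u F) ≡ F
del-ins u F e = subset-ext λ w → go w (w Fin.≟ u)
  where
    go : ∀ w → Dec (w ≡ u) → lookup (del u (ins u F)) w ≡ lookup F w
    go w (yes ≡.refl) = ≡.trans (del-≡ w (ins u F)) (≡.sym e)
    go w (no n)       = ≡.trans (del-≢ (ins u F) n) (ins-≢ F n)

size-ins : ∀ {n} (u : Fin n) F → lookup F u ≡ false → ∣ ins u F ∣ ≡ suc ∣ F ∣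
size-ins zero    (false ∷ F) e = ≡.cong suc (≡.cong ∣_∣ (Sub.∪-identityʳ F))
size-ins (suc u) (false ∷ F) e = size-ins u F e
size-ins (suc u) (true ∷ F)  e = ≡.cong suc (size-ins u F e)

size-del : ∀ {n} (u : Fin n) F → lookup F u ≡ true → ∣ F ∣ ≡ suc ∣ del u F ∣
size-del u F e = ≡.trans (≡.cong ∣_∣ (≡.sym (ins-del u F e))) (size-ins u (del u F) (del-≡ u F))

bool-case : ∀ {a} {A : Set a} (b : Bool) → (b ≡ true → A) → (b ≡ false → A) → A
bool-case true  f g = f ≡.refl
bool-case false f g = g ≡.refl

true≢false : ∀ {b} → b ≡ true → b ≡ false → ⊥
true≢false ≡.refl ()

-- Inserting a vertex changes `below`, and hence every sign, in one summand only.
countFin-one : ∀ {n} (u : Fin n) (p q : Fin n → Bool) → (∀ w → w ≢ u → q w ≡ p w) → p u ≡ false →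
  countFin q ≡ (if q u then 1 else 0) ℕ.+ countFin p
countFin-one {suc n} zero p q h e rewrite e = ≡.cong ((if q zero then 1 else 0) ℕ.+_) (same (λ w → h (suc w) (λ ())))
  where
    same : ∀ {n} {p q : Fin n → Bool} → (∀ w → q w ≡ p w) → countFin q ≡ countFin p
    same {zero}  h = ≡.refl
    same {suc n} h = ≡.cong₂ (λ b k → (if b then 1 else 0) ℕ.+ k) (h zero) (same (h ∘ suc))
countFin-one {suc n} (suc u) p q h e rewrite h zero (λ ()) | countFin-one u (p ∘ suc) (q ∘ suc) (λ w n → h (suc w) (n ∘ Fin.suc-injective)) e =
  swap (if p zero then 1 else 0) (if q (suc u) then 1 else 0) _
  where
    swap : ∀ a b c → a ℕ.+ (b ℕ.+ c) ≡ b ℕ.+ (a ℕ.+ c)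
    swap a b c = ≡.trans (≡.sym (ℕ.+-assoc a b c)) (≡.trans (≡.cong (ℕ._+ c) (ℕ.+-comm a b)) (ℕ.+-assoc b a c))

below-ins : ∀ {n} (u v : Fin n) F → lookup F u ≡ false →
  below (ins u F) v ≡ (if toℕ u <ᵇ toℕ v then 1 else 0) ℕ.+ below F v
below-ins u v F e = ≡.trans
  (countFin-one u (λ w → lookup F w ∧ (toℕ w <ᵇ toℕ v)) (λ w → lookup (ins u F) w ∧ (toℕ w <ᵇ toℕ v))
    (λ w n → ≡.cong (_∧ _) (ins-≢ F n)) (≡.cong (_∧ _) e))
  (≡.cong (λ b → (if b ∧ (toℕ u <ᵇ toℕ v) then 1 else 0) ℕ.+ below F v) (ins-≡ u F))

below-del : ∀ {n} (u : Fin n) F → below (del u F) u ≡ below F u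
below-del u F = bool-case (lookup F u)
  (λ e → ≡.trans (≡.sym (≡.cong (λ b → (if b then 1 else 0) ℕ.+ below (del u F) u) (irr (toℕ u))))
    (≡.trans (≡.sym (below-ins u u (del u F) (del-≡ u F))) (≡.cong (λ G → below G u) (ins-del u F e))))
  (λ e → ≡.cong (λ G → below G u) (subset-ext {F = del u F} {F} (λ w → go e w (w Fin.≟ u))))
  where
    irr : ∀ k → (k <ᵇ k) ≡ false
    irr zero    = ≡.refl
    irr (suc k) = irr k
    go : lookup F u ≡ false → ∀ w → Dec (w ≡ u) → lookup (del u F) w ≡ lookup F w
    go e w (yes ≡.refl) = ≡.trans (del-≡ w F) (≡.sym e)
    go e w (no n)       = del-≢ F n

<ᵇ-flip : ∀ {n} {u v : Fin n} → u ≢ v → (toℕ u <ᵇ toℕ v) ≡ not (toℕ v <ᵇ toℕ u)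
<ᵇ-flip n = go _ _ (n ∘ Fin.toℕ-injective)
  where
    go : ∀ a b → a ≢ b → (a <ᵇ b) ≡ not (b <ᵇ a)
    go zero    zero    n = ⊥-elim (n ≡.refl)
    go zero    (suc b) n = ≡.refl
    go (suc a) zero    n = ≡.refl
    go (suc a) (suc b) n = go a b (n ∘ ≡.cong suc)

∧-true : ∀ {a b} → a ∧ b ≡ true → a ≡ true × b ≡ true
∧-true {true} {true} _ = ≡.refl , ≡.refl

≡ᵇ-true : ∀ {a b} → (a ≡ᵇ b) ≡ true → a ≡ b
≡ᵇ-true {a} {b} e = ℕ.≡ᵇ⇒≡ a b (≡.subst Data.Bool.T (≡.sym e) _)

≡ᵇ-refl : ∀ a → (a ≡ᵇ a) ≡ true
≡ᵇ-refl zero    = ≡.refl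
≡ᵇ-refl (suc a) = ≡ᵇ-refl a

face-of : ∀ {n} {Γ : Cx n} {s F} → faceOfSize Γ s F ≡ true → Γ F ≡ true × ∣ F ∣ ≡ s
face-of e = proj₁ (∧-true e) , ≡ᵇ-true (proj₂ (∧-true e))

face-intro : ∀ {n} {Γ : Cx n} {s F} → Γ F ≡ true → ∣ F ∣ ≡ s → faceOfSize Γ s F ≡ true
face-intro {F = F} e ≡.refl rewrite e = ≡ᵇ-refl ∣ F ∣

disjoint-vertex : ∀ {n} (F : Subset n) v → (∣ F ∩ ⁅ v ⁆ ∣ ≡ᵇ 0) ≡ not (lookup F v)
disjoint-vertex {suc n} (x ∷ F) zero with x
... | true  = ≡.refl
... | false = ≡.cong (_≡ᵇ 0) (≡.trans (≡.cong ∣_∣ (Sub.∩-zeroʳ F)) (Sub.∣⊥∣≡0 n))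
disjoint-vertex (true ∷ F)  (suc v) = disjoint-vertex F v
disjoint-vertex (false ∷ F) (suc v) = disjoint-vertex F v

link-face : ∀ {n} {Γ : Cx n} {v F} → link Γ ⁅ v ⁆ F ≡ true → lookup F v ≡ false × Γ (ins v F) ≡ true
link-face {v = v} {F} e with ∧-true e
... | p , q = not-true (≡.trans (≡.sym (disjoint-vertex F v)) p) , q
  where
    not-true : ∀ {b} → not b ≡ true → b ≡ false
    not-true {false} _ = ≡.refl

link-intro : ∀ {n} {Γ : Cx n} {v F} → lookup F v ≡ false → Γ (ins v F) ≡ true → link Γ ⁅ v ⁆ F ≡ true
link-intro {v = v} {F} e f rewrite disjoint-vertex F v | e = f

-- Removing one vertex at a time is all that boundaries require, and in this form closure passes to
-- links at once.
Down : ∀ {n} → Cx n → Set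
Down Γ = ∀ u F → Γ (ins u F) ≡ true → Γ F ≡ true

down-link : ∀ {n} {Γ : Cx n} v → Down Γ → Down (link Γ ⁅ v ⁆)
down-link {Γ = Γ} v d u F e with link-face {Γ = Γ} {v} {ins u F} e
... | p , q = link-intro {Γ = Γ} {v} {F} (ins-∉ u F p) (d u (ins v F) (≡.subst (λ G → Γ G ≡ true) (ins-comm v u F) q))

-- lk Γ (j₁ ∷ … ∷ jᵣ ∷ []) is the link of {j₁, …, jᵣ}, as an iterated vertex link.
lk : ∀ {n r} → Cx n → Vec (Fin n) r → Cx n
lk Γ []      = Γ
lk Γ (j ∷ J) = link (lk Γ J) ⁅ j ⁆

down-lk : ∀ {n r} {Γ : Cx n} (J : Vec (Fin n) r) → Down Γ → Down (lk Γ J)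
down-lk []      d = d
down-lk {Γ = Γ} (j ∷ J) d = down-link {Γ = lk Γ J} j (down-lk J d)

bool-ext : ∀ {a b : Bool} → (a ≡ true → b ≡ true) → (b ≡ true → a ≡ true) → a ≡ b
bool-ext {true}  {b}     f g = ≡.sym (f ≡.refl)
bool-ext {false} {true}  f g = g ≡.refl
bool-ext {false} {false} f g = ≡.refl

link-swap : ∀ {n} (Γ : Cx n) a b F → link (link Γ ⁅ a ⁆) ⁅ b ⁆ F ≡ link (link Γ ⁅ b ⁆) ⁅ a ⁆ F
link-swap Γ a b F = bool-ext (go a b) (go b a)
  where
    go : ∀ a b → link (link Γ ⁅ a ⁆) ⁅ b ⁆ F ≡ true → link (link Γ ⁅ b ⁆) ⁅ a ⁆ F ≡ true
    go a b e with link-face {Γ = link Γ ⁅ a ⁆} {b} {F} e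
    ... | bF , e' with link-face {Γ = Γ} {a} {ins b F} e'
    ... | aF , e'' = link-intro {Γ = link Γ ⁅ b ⁆} (ins-∉ b F aF)
      (link-intro {Γ = Γ} (≡.trans (ins-≢ F b≢a) bF) (≡.subst (λ G → Γ G ≡ true) (ins-comm a b F) e''))
      where
        b≢a : b ≢ a
        b≢a ≡.refl = true≢false (ins-≡ b F) aF

size-0 : ∀ {n} (F : Subset n) → ∣ F ∣ ≡ 0 → F ≡ Sub.⊥
size-0 []          e = ≡.refl
size-0 (false ∷ F) e = ≡.cong (false ∷_) (size-0 F e)

member : ∀ {n s} (F : Subset n) → ∣ F ∣ ≡ suc s → ∃[ a ] lookup F a ≡ true
member (true ∷ F)  e = zero , ≡.refl
member (false ∷ F) e = suc (proj₁ (member F e)) , proj₂ (member F e)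

size-⊥ : ∀ {n} → ∣ Sub.⊥ {n} ∣ ≡ 0
size-⊥ {n} = Sub.∣⊥∣≡0 n

below-⊥ : ∀ {n} (u : Fin n) → below Sub.⊥ u ≡ 0
below-⊥ {n} u = go (λ w → lookup (Sub.⊥ {n}) w ∧ (toℕ w <ᵇ toℕ u)) (λ w → ≡.cong (_∧ (toℕ w <ᵇ toℕ u)) (lookup-⊥ w))
  where
    go : ∀ {m} (p : Fin m → Bool) → (∀ w → p w ≡ false) → countFin p ≡ 0
    go {zero}  p h = ≡.refl
    go {suc m} p h rewrite h zero = go (p ∘ suc) (h ∘ suc)

-- The empty set lies in the iterated link exactly when the entries of J are distinct and form a
-- face; this version recurses along J together with `lk`.
Face : ∀ {n r} → Cx n → Vec (Fin n) r → Set
Face Γ J = lk Γ J Sub.⊥ ≡ true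

face-tail : ∀ {n r} (Γ : Cx n) j (J : Vec (Fin n) r) → Down Γ → Face Γ (j ∷ J) → Face Γ J
face-tail Γ j J d e = down-lk J d j Sub.⊥ (proj₂ (link-face {Γ = lk Γ J} {j} {Sub.⊥} e))

face-swap : ∀ {n r} (Γ : Cx n) a b (J : Vec (Fin n) r) → Face Γ (a ∷ b ∷ J) → Face Γ (b ∷ a ∷ J)
face-swap Γ a b J e = ≡.trans (≡.sym (link-swap (lk Γ J) b a Sub.⊥)) e

face-swap′ : ∀ {n r} (Γ : Cx n) a b c (J : Vec (Fin n) r) → Face Γ (a ∷ b ∷ c ∷ J) → Face Γ (a ∷ c ∷ b ∷ J)
face-swap′ Γ a b c J e with link-face {Γ = lk Γ (b ∷ c ∷ J)} {a} {Sub.⊥} e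
... | p , q = link-intro {Γ = lk Γ (c ∷ b ∷ J)} {a} {Sub.⊥} p (≡.trans (≡.sym (link-swap (lk Γ J) c b (ins a Sub.⊥))) q)

face-reverse : ∀ {n r} (Γ : Cx n) a b c (J : Vec (Fin n) r) → Face Γ (a ∷ b ∷ c ∷ J) → Face Γ (c ∷ b ∷ a ∷ J)
face-reverse Γ a b c J e = face-swap Γ b c (a ∷ J) (face-swap′ Γ b a c J (face-swap Γ a b (c ∷ J) e))

lk-small : ∀ {n r d} {Γ : Cx n} → (∀ F → Γ F ≡ true → ∣ F ∣ ≤ d) → (J : Vec (Fin n) r) → ∀ F → lk Γ J F ≡ true → ∣ F ∣ ℕ.+ r ≤ d
lk-small {d = d} h [] F e = ≡.subst (_≤ d) (≡.sym (ℕ.+-identityʳ _)) (h F e)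
lk-small {r = suc r} {d} {Γ} h (j ∷ J) F e with link-face {Γ = lk Γ J} {j} {F} e
... | p , q = ≡.subst (_≤ d) (≡.trans (≡.cong (ℕ._+ r) (size-ins j F p)) (≡.sym (ℕ.+-suc ∣ F ∣ r))) (lk-small {Γ = Γ} h J (ins j F) q)

face-distinct : ∀ {n r} {Γ : Cx n} (J : Vec (Fin n) r) → Down Γ → Face Γ J → ∀ i j → lookup J i ≡ lookup J j → i ≡ j
face-distinct {Γ = Γ} J d f = proj₁ (go J Sub.⊥ f)
  where
    go : ∀ {r} (J : Vec (Fin _) r) F → lk Γ J F ≡ true →
      (∀ i j → lookup J i ≡ lookup J j → i ≡ j) × (∀ i → lookup F (lookup J i) ≡ false)
    go [] F e = (λ ()) , (λ ())
    go (j ∷ J) F e with link-face {Γ = lk Γ J} {j} {F} e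
    ... | p , q with go J (ins j F) q
    ... | dis , out = inj , λ { zero → p ; (suc k) → ins-∉ j F (out k) }
      where
        fresh : ∀ k → j ≢ lookup J k
        fresh k eq = true≢false (ins-≡ j F) (≡.trans (≡.cong (lookup (ins j F)) eq) (out k))
        inj : ∀ i k → lookup (j ∷ J) i ≡ lookup (j ∷ J) k → i ≡ k
        inj zero    zero    _  = ≡.refl
        inj zero    (suc k) eq = ⊥-elim (fresh k eq)
        inj (suc k) zero    eq = ⊥-elim (fresh k (≡.sym eq))
        inj (suc i) (suc k) eq = ≡.cong suc (dis i k eq)

-- Here the bound five is spent: five minus the three vertices of a triangle leaves two, just as
-- many points as complete the triangle to a basis of k⁵.
at-most-two : ∀ {n} (S : List (Fin n)) → length S ≤ 5 → ∀ {u v j} → u ≢ v → u ≢ j → v ≢ j → u ∈ S → v ∈ S → j ∈ S →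
  ∃[ R ] (length R ≤ 2 × (∀ {s} → s ∈ S → s ≢ u → s ≢ v → s ≢ j → s ∈ R) × (∀ {s} → s ∈ R → s ≢ u × s ≢ v × s ≢ j))
at-most-two S le {u} {v} {j} uv uj vj u∈ v∈ j∈ =
  S₃ , ℕ.≤-pred (ℕ.≤-trans (drop j∈₂) (ℕ.≤-pred (ℕ.≤-trans (drop v∈₁) (ℕ.≤-pred (ℕ.≤-trans (drop u∈) le)))))
  , (λ s∈ su sv sj → keep (keep (keep s∈ su) sv) sj)
  , λ s∈ → let (s∈₂ , sj) = List.∈-filter⁻ (≢? j) {xs = S₂} s∈
               (s∈₁ , sv) = List.∈-filter⁻ (≢? v) {xs = S₁} s∈₂
               (_ , su) = List.∈-filter⁻ (≢? u) {xs = S} s∈₁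
           in su , sv , sj
  where
    ≢? : ∀ a (s : Fin _) → Dec (s ≢ a)
    ≢? a s = ¬? (s Fin.≟ a)
    S₁ = filter (≢? u) S
    S₂ = filter (≢? v) S₁
    S₃ = filter (≢? j) S₂
    keep : ∀ {a s} {T : List (Fin _)} → s ∈ T → s ≢ a → s ∈ filter (≢? a) T
    keep {a} s∈ n = List.∈-filter⁺ (≢? a) s∈ n
    v∈₁ : v ∈ S₁
    v∈₁ = keep v∈ (uv ∘ ≡.sym)
    j∈₂ : j ∈ S₂
    j∈₂ = keep (keep j∈ (uj ∘ ≡.sym)) (vj ∘ ≡.sym)
    drop : ∀ {a} {T : List (Fin _)} → a ∈ T → length (filter (≢? a) T) < length T
    drop {a} {T} a∈ = List.filter-notAll (≢? a) T (Any.map (λ e n → n (≡.sym e)) a∈)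

-- Cardinalities of the index types of unknowns and equations

sumN : ∀ {n} → (Fin n → ℕ) → ℕ
sumN {zero}  f = 0
sumN {suc n} f = f zero ℕ.+ sumN (f ∘ suc)

size-⊎ : ∀ {A B : Set} {a b} → A ↔ Fin a → B ↔ Fin b → (A ⊎ B) ↔ Fin (a ℕ.+ b)
size-⊎ f g = ↔-trans (f ⊎-↔ g) (↔-sym Fin.+↔⊎)

size-× : ∀ {A B : Set} {a b} → A ↔ Fin a → B ↔ Fin b → (A × B) ↔ Fin (a ℕ.* b)
size-× f g = ↔-trans (f ×-↔ g) (↔-sym Fin.*↔×)

size-Σ : ∀ {n} {A : Fin n → Set} {a : Fin n → ℕ} → (∀ v → A v ↔ Fin (a v)) → Σ (Fin n) A ↔ Fin (sumN a)
size-Σ {zero} f = mk↔ₛ′ (λ { (() , _) }) (λ ()) (λ ()) (λ { (() , _) })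
size-Σ {suc n} {A} f = ↔-trans
  (mk↔ₛ′ (λ { (zero , x) → inj₁ x ; (suc v , x) → inj₂ (v , x) })
    (λ { (inj₁ x) → zero , x ; (inj₂ (v , x)) → suc v , x })
    (λ { (inj₁ x) → ≡.refl ; (inj₂ _) → ≡.refl })
    (λ { (zero , x) → ≡.refl ; (suc v , x) → ≡.refl }))
  (size-⊎ (f zero) (size-Σ (f ∘ suc)))

size-cast : ∀ {A : Set} {a b} → a ≡ b → A ↔ Fin a → A ↔ Fin b
size-cast ≡.refl f = f

countL-++ : ∀ {A : Set} (p : A → Bool) xs ys → countL p (xs List.++ ys) ≡ countL p xs ℕ.+ countL p ys
countL-++ p []       ys = ≡.refl
countL-++ p (x ∷ xs) ys with p x
... | true  = ≡.cong suc (countL-++ p xs ys)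
... | false = countL-++ p xs ys

countL-map : ∀ {A B : Set} (p : B → Bool) (f : A → B) xs → countL p (List.map f xs) ≡ countL (p ∘ f) xs
countL-map p f []       = ≡.refl
countL-map p f (x ∷ xs) with p (f x)
... | true  = ≡.cong suc (countL-map p f xs)
... | false = countL-map p f xs

count-split : ∀ n (p : Subset (suc n) → Bool) →
  countL p (allSubsets (suc n)) ≡ countL (p ∘ (false ∷_)) (allSubsets n) ℕ.+ countL (p ∘ (true ∷_)) (allSubsets n)
count-split n p = ≡.trans (countL-++ p (List.map (false ∷_) (allSubsets n)) _)
  (≡.cong₂ ℕ._+_ (countL-map p (false ∷_) (allSubsets n)) (countL-map p (true ∷_) (allSubsets n)))

size-subsets : ∀ n (p : Subset n → Bool) → Σ (Subset n) (λ F → p F ≡ true) ↔ Fin (countL p (allSubsets n))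
size-subsets zero p with p [] in e
... | true  = mk↔ₛ′ (λ _ → zero) (λ _ → [] , e) (λ { zero → ≡.refl }) (λ { ([] , q) → ≡.cong ([] ,_) (Decidable⇒UIP.≡-irrelevant Bool._≟_ e q) })
... | false = mk↔ₛ′ (λ { ([] , q) → ⊥-elim (true≢false q e) }) (λ ()) (λ ()) (λ { ([] , q) → ⊥-elim (true≢false q e) })
size-subsets (suc n) p = size-cast (≡.sym (count-split n p)) (↔-trans
  (mk↔ₛ′ (λ { (false ∷ F , q) → inj₁ (F , q) ; (true ∷ F , q) → inj₂ (F , q) })
    (λ { (inj₁ (F , q)) → false ∷ F , q ; (inj₂ (F , q)) → true ∷ F , q })
    (λ { (inj₁ _) → ≡.refl ; (inj₂ _) → ≡.refl })
    (λ { (false ∷ F , q) → ≡.refl ; (true ∷ F , q) → ≡.refl }))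
  (size-⊎ (size-subsets n (p ∘ (false ∷_))) (size-subsets n (p ∘ (true ∷_)))))

FaceT : ∀ {n} → Cx n → ℕ → Set
FaceT {n} Γ s = Σ (Subset n) λ F → faceOfSize Γ s F ≡ true

size-faces : ∀ {n} (Γ : Cx n) s → FaceT Γ s ↔ Fin (fSize Γ s)
size-faces Γ s = size-subsets _ (faceOfSize Γ s)

-- The pairs lo < hi in Fin N: inj₁ b stands for (0 , 1 + b).
Pair : ℕ → Set
Pair zero    = ⊥
Pair (suc N) = Fin N ⊎ Pair N

pairs : ℕ → ℕ
pairs zero    = 0
pairs (suc N) = N ℕ.+ pairs N

size-pairs : ∀ N → Pair N ↔ Fin (pairs N)
size-pairs zero    = mk↔ₛ′ (λ ()) (λ ()) (λ ()) (λ ())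
size-pairs (suc N) = size-⊎ ↔-refl (size-pairs N)

lo hi : ∀ {N} → Pair N → Fin N
lo {suc N} (inj₁ k) = zero
lo {suc N} (inj₂ τ) = suc (lo τ)
hi {suc N} (inj₁ k) = suc k
hi {suc N} (inj₂ τ) = suc (hi τ)

lo<hi : ∀ {N} (τ : Pair N) → lo τ Fin.< hi τ
lo<hi {suc N} (inj₁ k) = s≤s z≤n
lo<hi {suc N} (inj₂ τ) = s≤s (lo<hi τ)

lo-hi-inj : ∀ {N} (σ τ : Pair N) → lo σ ≡ lo τ → hi σ ≡ hi τ → σ ≡ τ
lo-hi-inj {suc N} (inj₁ k) (inj₁ .k) e ≡.refl = ≡.refl
lo-hi-inj {suc N} (inj₂ σ) (inj₂ τ) e f = ≡.cong inj₂ (lo-hi-inj σ τ (Fin.suc-injective e) (Fin.suc-injective f))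

pair-of : ∀ {N} (a b : Fin N) → a Fin.< b → ∃[ τ ] (lo τ ≡ a × hi τ ≡ b)
pair-of zero    (suc b) lt = inj₁ b , ≡.refl , ≡.refl
pair-of (suc a) (suc b) (s≤s lt) with pair-of a b lt
... | τ , e , f = inj₂ τ , ≡.cong suc e , ≡.cong suc f

down-⊥ : ∀ {n} {Γ : Cx n} → Down Γ → ∀ {F} → Γ F ≡ true → Γ Sub.⊥ ≡ true
down-⊥ {Γ = Γ} d {F} f = go ∣ F ∣ F ≡.refl f
  where
    go : ∀ k F → ∣ F ∣ ≡ k → Γ F ≡ true → Γ Sub.⊥ ≡ true
    go zero    F sz f = ≡.subst (λ G → Γ G ≡ true) (size-0 F sz) f
    go (suc k) F sz f =
      let (a , aF) = member F sz
      in go k (del a F) (ℕ.suc-injective (≡.trans (≡.sym (size-del a F aF)) sz))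
           (d a (del a F) (≡.subst (λ G → Γ G ≡ true) (≡.sym (ins-del a F aF)) f))

del-ins-swap : ∀ {n} {u v : Fin n} → u ≢ v → ∀ F → del u (ins v F) ≡ ins v (del u F)
del-ins-swap {u = u} {v} ne F = subset-ext {F = del u (ins v F)} λ w → go w (w Fin.≟ u) (w Fin.≟ v)
  where
    go : ∀ w → Dec (w ≡ u) → Dec (w ≡ v) → lookup (del u (ins v F)) w ≡ lookup (ins v (del u F)) w
    go w (yes ≡.refl) (yes ≡.refl) = ⊥-elim (ne ≡.refl)
    go w (yes ≡.refl) (no wv) = ≡.trans (del-≡ w (ins v F)) (≡.sym (≡.trans (ins-≢ (del w F) wv) (del-≡ w F)))
    go w (no wu) (yes ≡.refl) = ≡.trans (del-≢ (ins w F) wu) (≡.trans (ins-≡ w F) (≡.sym (ins-≡ w (del u F))))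
    go w (no wu) (no wv) = ≡.trans (del-≢ (ins v F) wu) (≡.trans (ins-≢ F wv) (≡.sym (≡.trans (ins-≢ (del u F) wv) (del-≢ F wu))))

record Enumeration {n : ℕ} (F : Subset n) (k : ℕ) : Set where
  field
    vertex : Fin k → Fin n
    inside : ∀ j → lookup F (vertex j) ≡ true
    inj    : ∀ i j → vertex i ≡ vertex j → i ≡ j
    onto   : ∀ v → lookup F v ≡ true → ∃[ j ] vertex j ≡ v

enumerate : ∀ {n} k (F : Subset n) → ∣ F ∣ ≡ k → Enumeration F k
enumerate zero F sz = record
  { vertex = λ () ; inside = λ () ; inj = λ ()
  ; onto = λ v q → ⊥-elim (true≢false q (≡.trans (≡.cong (λ G → lookup G v) (size-0 F sz)) (lookup-⊥ v))) }
enumerate (suc k) F sz with member F sz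
... | a , aF = record
  { vertex = V
  ; inside = λ { zero → aF ; (suc j) → in-F j }
  ; inj = λ { zero zero _ → ≡.refl
            ; zero (suc j) e → ⊥-elim (a≢ j (≡.sym e))
            ; (suc i) zero e → ⊥-elim (a≢ i e)
            ; (suc i) (suc j) e → ≡.cong suc (R.inj i j e) }
  ; onto = λ v q → onto v q (v Fin.≟ a) }
  where
    module R = Enumeration (enumerate k (del a F) (ℕ.suc-injective (≡.trans (≡.sym (size-del a F aF)) sz)))
    a≢ : ∀ j → R.vertex j ≢ a
    a≢ j e = true≢false (R.inside j) (≡.trans (≡.cong (lookup (del a F)) e) (del-≡ a F))
    in-F : ∀ j → lookup F (R.vertex j) ≡ true
    in-F j = ≡.trans (≡.sym (del-≢ F (a≢ j))) (R.inside j)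
    V : Fin (suc k) → Fin _
    V zero    = a
    V (suc j) = R.vertex j
    onto : ∀ v → lookup F v ≡ true → Dec (v ≡ a) → ∃[ j ] V j ≡ v
    onto v q (yes ≡.refl) = zero , ≡.refl
    onto v q (no ne) = let (j , e) = R.onto v (≡.trans (del-≢ F ne) q) in suc j , e

dn-sized : ∀ {a} {A : Set} {k} {P : A → Set a} → A ↔ Fin k → (∀ x → DN (P x)) → DN (∀ x → P x)
dn-sized {P = P} sz f = dn-Fin (λ j → f (Inverse.from sz j)) >>= λ g →
  return (λ x → ≡.subst P (Inverse.strictlyInverseʳ sz x) (g (Inverse.to sz x)))

disjoint : ∀ {n} (A B : Subset n) → (∣ A ∩ B ∣ ≡ᵇ 0) ≡ true → ∀ w → lookup A w ≡ true → lookup B w ≡ false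
disjoint (true ∷ A)  (false ∷ B) e zero    q = ≡.refl
disjoint (true ∷ A)  (true ∷ B)  () w q
disjoint (true ∷ A)  (false ∷ B) e (suc w) q = disjoint A B e w q
disjoint (false ∷ A) (b ∷ B)     e (suc w) q = disjoint A B e w q

disjoint-intro : ∀ {n} (A B : Subset n) → (∀ w → lookup A w ≡ true → lookup B w ≡ false) → (∣ A ∩ B ∣ ≡ᵇ 0) ≡ true
disjoint-intro []          []          h = ≡.refl
disjoint-intro (true ∷ A)  (true ∷ B)  h = ⊥-elim (true≢false (≡.sym (h zero ≡.refl)) ≡.refl)
disjoint-intro (true ∷ A)  (false ∷ B) h = disjoint-intro A B (λ w → h (suc w))
disjoint-intro (false ∷ A) (b ∷ B)     h = disjoint-intro A B (λ w → h (suc w))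

link-split : ∀ {n} {Γ : Cx n} {G F} → link Γ G F ≡ true → (∀ w → lookup F w ≡ true → lookup G w ≡ false) × Γ (F ∪ G) ≡ true
link-split {G = G} {F} e = disjoint F G (proj₁ (∧-true e)) , proj₂ (∧-true e)

link-join : ∀ {n} {Γ : Cx n} {G F} → (∀ w → lookup F w ≡ true → lookup G w ≡ false) → Γ (F ∪ G) ≡ true → link Γ G F ≡ true
link-join {G = G} {F} h e rewrite disjoint-intro F G h = e

link-ins : ∀ {n} (Γ : Cx n) G j F → lookup G j ≡ false → link (link Γ G) ⁅ j ⁆ F ≡ link Γ (ins j G) F
link-ins Γ G j F jG = bool-ext to from
  where
    sets : ins j F ∪ G ≡ F ∪ ins j G
    sets = ≡.trans (Sub.∪-assoc F ⁅ j ⁆ G) (≡.cong (F ∪_) (Sub.∪-comm ⁅ j ⁆ G))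
    to : link (link Γ G) ⁅ j ⁆ F ≡ true → link Γ (ins j G) F ≡ true
    to e with link-face {Γ = link Γ G} {j} {F} e
    ... | jF , e' with link-split {Γ = Γ} {G} {ins j F} e'
    ... | dis , f = link-join {Γ = Γ} {ins j G} {F}
      (λ w q → ≡.trans (ins-≢ G (λ { ≡.refl → true≢false q jF })) (dis w (ins-mono j F q)))
      (≡.subst (λ H → Γ H ≡ true) sets f)
    from : link Γ (ins j G) F ≡ true → link (link Γ G) ⁅ j ⁆ F ≡ true
    from e with link-split {Γ = Γ} {ins j G} {F} e
    ... | dis , f = link-intro {Γ = link Γ G} {j} {F} jF
      (link-join {Γ = Γ} {G} {ins j F} (λ w q → go w q (w Fin.≟ j)) (≡.subst (λ H → Γ H ≡ true) (≡.sym sets) f))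
      where
        jF : lookup F j ≡ false
        jF = bool-case (lookup F j) (λ q → ⊥-elim (true≢false (ins-≡ j G) (dis j q))) id
        go : ∀ w → lookup (ins j F) w ≡ true → Dec (w ≡ j) → lookup G w ≡ false
        go w q (yes ≡.refl) = jG
        go w q (no ne) = ins-∉ j G (dis w (≡.trans (≡.sym (ins-≢ F ne)) q))

vertexSet : ∀ {n r} → Vec (Fin n) r → Subset n
vertexSet []      = Sub.⊥
vertexSet (j ∷ J) = ins j (vertexSet J)

link-⊥ : ∀ {n} (Γ : Cx n) F → link Γ Sub.⊥ F ≡ Γ F
link-⊥ Γ F = bool-ext
  (λ e → ≡.subst (λ G → Γ G ≡ true) (Sub.∪-identityʳ F) (proj₂ (link-split {Γ = Γ} {Sub.⊥} {F} e)))
  (λ e → link-join {Γ = Γ} {Sub.⊥} {F} (λ w _ → lookup-⊥ w) (≡.subst (λ G → Γ G ≡ true) (≡.sym (Sub.∪-identityʳ F)) e))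

-- A bridge between two kinds of link: the definition of a homology manifold takes the link of a
-- face, the proof iterates vertex links.
lk-link : ∀ {n r} (Γ : Cx n) (J : Vec (Fin n) r) → Down Γ → Face Γ J →
  (∀ F → lk Γ J F ≡ link Γ (vertexSet J) F) × Γ (vertexSet J) ≡ true × ∣ vertexSet J ∣ ≡ r
lk-link {n} Γ [] d f = (λ F → ≡.sym (link-⊥ Γ F)) , f , size-⊥ {n}
lk-link Γ (j ∷ J) d f with lk-link Γ J d (face-tail Γ j J d f)
... | same , fJ , sz = (λ F → ≡.trans (≡.cong ((∣ F ∩ ⁅ j ⁆ ∣ ≡ᵇ 0) ∧_) (same (F ∪ ⁅ j ⁆))) (link-ins Γ (vertexSet J) j F jJ)) ,
    ≡.subst (λ G → Γ G ≡ true) sets (proj₂ split) , ≡.trans (size-ins j (vertexSet J) jJ) (≡.cong suc sz)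
  where
    inner : lk Γ J (ins j Sub.⊥) ≡ true
    inner = proj₂ (link-face {Γ = lk Γ J} {j} {Sub.⊥} f)
    split = link-split {Γ = Γ} {vertexSet J} {ins j Sub.⊥} (≡.trans (≡.sym (same (ins j Sub.⊥))) inner)
    jJ : lookup (vertexSet J) j ≡ false
    jJ = proj₁ split j (ins-≡ j Sub.⊥)
    sets : ins j Sub.⊥ ∪ vertexSet J ≡ ins j (vertexSet J)
    sets = ≡.trans (≡.cong (_∪ vertexSet J) (Sub.∪-identityˡ ⁅ j ⁆)) (Sub.∪-comm ⁅ j ⁆ (vertexSet J))

-- The last entry of a list is the vertex whose link is taken first. The hypotheses concern links
-- inside a vertex link, so a list has to be split at its end.
lk-∷ʳ : ∀ {n r} (Γ : Cx n) (J : Vec (Fin n) r) v F → lk Γ (J ∷ʳ v) F ≡ lk (link Γ ⁅ v ⁆) J F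
lk-∷ʳ Γ []      v F = ≡.refl
lk-∷ʳ Γ (j ∷ J) v F = ≡.cong ((∣ F ∩ ⁅ j ⁆ ∣ ≡ᵇ 0) ∧_) (lk-∷ʳ Γ J v (F ∪ ⁅ j ⁆))

from-injective : ∀ {A : Set} {k} (f : A ↔ Fin k) i j → Inverse.from f i ≡ Inverse.from f j → i ≡ j
from-injective f i j q = ≡.trans (≡.sym (Inverse.strictlyInverseˡ f i)) (≡.trans (≡.cong (Inverse.to f) q) (Inverse.strictlyInverseˡ f j))

faceT-≡ : ∀ {n} {Γ : Cx n} {s} {F G : FaceT Γ s} → proj₁ F ≡ proj₁ G → F ≡ G
faceT-≡ {F = F , p} {.F , q} ≡.refl = ≡.cong (F ,_) (Decidable⇒UIP.≡-irrelevant Bool._≟_ p q)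

Distinct : ∀ {n D} → Vec (Fin n) D → Set
Distinct ρ = ∀ i j → lookup ρ i ≡ lookup ρ j → i ≡ j

distinct-[] : ∀ {n} → Distinct {n} []
distinct-[] ()

infixr 5 _distinct-∷_
_distinct-∷_ : ∀ {n D} {a : Fin n} {ρ : Vec (Fin n) D} → (∀ j → a ≢ lookup ρ j) → Distinct ρ → Distinct (a ∷ ρ)
(n distinct-∷ d) zero    zero    e = ≡.refl
(n distinct-∷ d) zero    (suc j) e = ⊥-elim (n j e)
(n distinct-∷ d) (suc i) zero    e = ⊥-elim (n i (≡.sym e))
(n distinct-∷ d) (suc i) (suc j) e = ≡.cong suc (d i j e)

skip-lookup : ∀ {A : Set} {k} (g h : A) (ρ : Vec A k) a → lookup (g ∷ h ∷ ρ) (punchIn (suc zero) a) ≡ lookup (g ∷ ρ) a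
skip-lookup g h ρ zero    = ≡.refl
skip-lookup g h ρ (suc a) = ≡.refl

distinct-skip : ∀ {n k} {g h : Fin n} {ρ : Vec (Fin n) k} → Distinct (g ∷ h ∷ ρ) → Distinct (g ∷ ρ)
distinct-skip {g = g} {h} {ρ} d a b e = Fin.punchIn-injective (suc zero) a b
  (d _ _ (≡.trans (skip-lookup g h ρ a) (≡.trans e (≡.sym (skip-lookup g h ρ b)))))

-- Indices of the frame of a facet: an auxiliary point, then the vertices, which are shifted past
-- the two auxiliary indices.
coned : ∀ {k n} → (Fin k → Fin n) → Fin (suc k) → Fin (suc (suc n))
coned f zero    = zero
coned f (suc k) = suc (suc (f k))

coned-injective : ∀ {k n} {f : Fin k → Fin n} → (∀ a b → f a ≡ f b → a ≡ b) → ∀ a b → coned f a ≡ coned f b → a ≡ b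
coned-injective inj zero    zero    _ = ≡.refl
coned-injective inj (suc a) (suc b) e = ≡.cong suc (inj a b (Fin.suc-injective (Fin.suc-injective e)))

coned-distinct : ∀ {k n} {f : Fin k → Fin n} → (∀ a b → f a ≡ f b → a ≡ b) → Distinct (tabulate (coned f))
coned-distinct {f = f} inj a b e = coned-injective inj a b
  (≡.trans (≡.sym (Vec.lookup∘tabulate (coned f) a)) (≡.trans e (Vec.lookup∘tabulate (coned f) b)))

Fin₄-cases : ∀ {p} {P : Fin 4 → Set p} → P zero → P (suc zero) → P (suc (suc zero)) → P (suc (suc (suc zero))) → ∀ k → P k
Fin₄-cases a b c d zero                   = a
Fin₄-cases a b c d (suc zero)             = b
Fin₄-cases a b c d (suc (suc zero))       = c
Fin₄-cases a b c d (suc (suc (suc zero))) = d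

2≢3+ : ∀ {n} {k : Fin n} → suc (suc zero) ≢ Fin.suc (suc (suc k))
2≢3+ ()

-- Of at most five vertices, those other than u, v, j are covered by two points
-- g and h; the two auxiliary points of Fin (2 + n) fill in when there are fewer.
module Covering {n : ℕ} (S : List (Fin n)) (le : length S ≤ 5) where

  private
    ι : Fin n → Fin (suc (suc n))
    ι v = suc (suc v)

    ≢ι : ∀ {a b} → a ≢ b → ι a ≢ ι b
    ≢ι n e = n (Fin.suc-injective (Fin.suc-injective e))

  Others : (u v j : Fin n) (g h : Fin (suc (suc n))) → Set
  Others u v j g h = Distinct (g ∷ h ∷ ι u ∷ ι v ∷ ι j ∷ []) ×
    (∀ {s} → s ∈ S → s ≢ u → s ≢ v → s ≢ j → ι s ≡ g ⊎ ι s ≡ h)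

  others : ∀ {u v j} → u ≢ v → u ≢ j → v ≢ j → u ∈ S → v ∈ S → j ∈ S → ∃[ g ] ∃[ h ] Others u v j g h
  others {u} {v} {j} uv uj vj u∈ v∈ j∈ =
    let (R , len , cover , fresh) = at-most-two S le uv uj vj u∈ v∈ j∈ in pick R len cover fresh
    where
      base-distinct : Distinct (ι u ∷ ι v ∷ ι j ∷ [])
      base-distinct = (λ { zero → ≢ι uv ; (suc zero) → ≢ι uj }) distinct-∷ (λ { zero → ≢ι vj }) distinct-∷ (λ ()) distinct-∷ distinct-[]
      off : ∀ {s} → s ≢ u × s ≢ v × s ≢ j → ∀ k → ι s ≢ lookup (ι u ∷ ι v ∷ ι j ∷ []) k
      off (a , _ , _) zero = ≢ι a
      off (_ , b , _) (suc zero) = ≢ι b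
      off (_ , _ , c) (suc (suc zero)) = ≢ι c
      ph : ∀ (g : Fin 2) k → (Fin._↑ˡ_ g n) ≢ lookup (ι u ∷ ι v ∷ ι j ∷ []) k
      ph zero zero ()
      ph zero (suc zero) ()
      ph zero (suc (suc zero)) ()
      ph (suc zero) zero ()
      ph (suc zero) (suc zero) ()
      ph (suc zero) (suc (suc zero)) ()
      one : ∀ x → x ≢ u × x ≢ v × x ≢ j → Distinct (ι x ∷ zero ∷ ι u ∷ ι v ∷ ι j ∷ [])
      one x fx = (λ { zero () ; (suc k) → off fx k }) distinct-∷ ph zero distinct-∷ base-distinct
      pick : ∀ R → length R ≤ 2 → (∀ {s} → s ∈ S → s ≢ u → s ≢ v → s ≢ j → s ∈ R) →
        (∀ {s} → s ∈ R → s ≢ u × s ≢ v × s ≢ j) → ∃[ g ] ∃[ h ] Others u v j g h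
      pick [] len cover fresh = zero , suc zero , (λ { zero () ; (suc k) → ph zero k }) distinct-∷ ph (suc zero) distinct-∷ base-distinct ,
        λ s∈ a b c → ⊥-elim (empty (cover s∈ a b c))
        where
          empty : ∀ {s : Fin n} → s ∈ [] → ⊥
          empty ()
      pick (x ∷ []) len cover fresh = ι x , zero , one x (fresh (here ≡.refl)) , λ s∈ a b c → only (cover s∈ a b c)
        where
          only : ∀ {s} → s ∈ x ∷ [] → ι s ≡ ι x ⊎ ι s ≡ zero
          only (here ≡.refl) = inj₁ ≡.refl
      pick (x ∷ y ∷ []) len cover fresh with x Fin.≟ y
      ... | yes ≡.refl = ι x , zero , one x (fresh (here ≡.refl)) , λ s∈ a b c → only (cover s∈ a b c)
        where
          only : ∀ {s} → s ∈ x ∷ x ∷ [] → ι s ≡ ι x ⊎ ι s ≡ zero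
          only (here ≡.refl) = inj₁ ≡.refl
          only (there (here ≡.refl)) = inj₁ ≡.refl
      ... | no xy = ι x , ι y , (λ { zero → ≢ι xy ; (suc k) → off (fresh (here ≡.refl)) k }) distinct-∷ off (fresh (there (here ≡.refl))) distinct-∷ base-distinct ,
            λ s∈ a b c → only (cover s∈ a b c)
        where
          only : ∀ {s} → s ∈ x ∷ y ∷ [] → ι s ≡ ι x ⊎ ι s ≡ ι y
          only (here ≡.refl) = inj₁ ≡.refl
          only (there (here ≡.refl)) = inj₂ ≡.refl
      pick (x ∷ y ∷ w ∷ R) (s≤s (s≤s ())) cover fresh

ins-pair : ∀ {n} (u v : Fin n) {a} → lookup (ins v (ins u Sub.⊥)) a ≡ true → a ≡ u ⊎ a ≡ v
ins-pair u v {a} q with a Fin.≟ u | a Fin.≟ v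
... | yes e | _ = inj₁ e
... | no _ | yes e = inj₂ e
... | no nu | no nv = ⊥-elim (true≢false q (≡.trans (ins-≢ (ins u Sub.⊥) nv) (≡.trans (ins-≢ Sub.⊥ nu) (lookup-⊥ a))))

-- Linear algebra over a field with stable equality

module StableField {c ℓ : Level} (𝔽 : Field c ℓ)
  (stable : ∀ {x y : Field.Carrier 𝔽} → DN (Field._≈_ 𝔽 x y) → Field._≈_ 𝔽 x y)
  (infinite : Infinite 𝔽) where

  open Field 𝔽 public hiding (zero; refl; sym; trans; reflexive; +-cong; +-congˡ; +-congʳ; *-cong; *-congˡ; *-congʳ; -‿cong)
  open WithField 𝔽 public
    using (ΣFin; _≐_; zeroV; sgn)
  open Solver commRing public
  open import Algebra.Properties.Ring ring public
    using (-‿distribˡ-*; -‿distribʳ-*; -‿involutive; -0#≈0#)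

  -- The types the library gives to these unfold through its whole algebraic
  -- hierarchy at every use; stated directly they are cheap to check.
  refl : ∀ {x} → x ≈ x
  refl = Field.refl 𝔽

  sym : ∀ {x y} → x ≈ y → y ≈ x
  sym = Field.sym 𝔽

  trans : ∀ {x y z} → x ≈ y → y ≈ z → x ≈ z
  trans = Field.trans 𝔽

  reflexive : ∀ {x y} → x ≡ y → x ≈ y
  reflexive ≡.refl = refl

  +-cong : ∀ {x y u v} → x ≈ y → u ≈ v → x + u ≈ y + v
  +-cong = Field.+-cong 𝔽

  +-congˡ : ∀ {x y z} → y ≈ z → x + y ≈ x + z
  +-congˡ = +-cong refl

  +-congʳ : ∀ {x y z} → y ≈ z → y + x ≈ z + x
  +-congʳ e = +-cong e refl

  *-cong : ∀ {x y u v} → x ≈ y → u ≈ v → x * u ≈ y * v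
  *-cong = Field.*-cong 𝔽

  *-congˡ : ∀ {x y z} → y ≈ z → x * y ≈ x * z
  *-congˡ = *-cong refl

  *-congʳ : ∀ {x y z} → y ≈ z → y * x ≈ z * x
  *-congʳ e = *-cong e refl

  -‿cong : ∀ {x y} → x ≈ y → - x ≈ - y
  -‿cong = Field.-‿cong 𝔽

  infix  1 begin_
  infixr 2 step-≈-⟩ step-≈-⟨
  infix  3 _∎

  begin_ : ∀ {x y} → x ≈ y → x ≈ y
  begin e = e

  step-≈-⟩ : ∀ x {y z} → y ≈ z → x ≈ y → x ≈ z
  step-≈-⟩ x q p = trans p q

  step-≈-⟨ : ∀ x {y z} → y ≈ z → y ≈ x → x ≈ z
  step-≈-⟨ x q p = trans (sym p) q

  _∎ : ∀ x → x ≈ x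
  x ∎ = refl

  syntax step-≈-⟩ x q p = x ≈⟨ p ⟩ q
  syntax step-≈-⟨ x q p = x ≈⟨ p ⟨ q

  infix 4 _≉0
  _≉0 : Carrier → Set ℓ
  x ≉0 = ¬ (x ≈ 0#)

  1≉0 : 1# ≉0
  1≉0 e = 0≉1 (sym e)

  -- Stability of equations is what allows excluded middle in their proofs.
  by-cases : ∀ {a} (A : Set a) {x y : Carrier} → (A → x ≈ y) → (¬ A → x ≈ y) → x ≈ y
  by-cases A f g = stable (lem A >>= λ { (inj₁ a) → return (f a) ; (inj₂ n) → return (g n) })

  unless0 : ∀ x {y z} → (x ≈ 0# → y ≈ z) → (x ≉0 → y ≈ z) → y ≈ z
  unless0 x = by-cases (x ≈ 0#)

  inv : ∀ x → x ≉0 → Carrier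
  inv x n = proj₁ (inverse x n)

  inv-r : ∀ {x} (n : x ≉0) → x * inv x n ≈ 1#
  inv-r {x} n = proj₂ (inverse x n)

  cancel : ∀ {x y} → x ≉0 → x * y ≈ 0# → y ≈ 0#
  cancel {x} {y} n e = begin
    y                     ≈⟨ *-identityˡ y ⟨
    1# * y                ≈⟨ *-congʳ (inv-r n) ⟨
    x * inv x n * y       ≈⟨ solve 3 (λ a b c → a :* b :* c := b :* (a :* c)) refl _ _ _ ⟩
    inv x n * (x * y)     ≈⟨ *-congˡ e ⟩
    inv x n * 0#          ≈⟨ zeroʳ _ ⟩
    0#                    ∎

  *-≉0 : ∀ {x y} → x ≉0 → y ≉0 → x * y ≉0
  *-≉0 nx ny e = ny (cancel nx e)

  inv-≉0 : ∀ {x} (n : x ≉0) → inv x n ≉0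
  inv-≉0 {x} n e = 1≉0 (trans (sym (inv-r n)) (trans (*-congˡ e) (zeroʳ _)))

  *-0ˡ : ∀ {x y} → x ≈ 0# → x * y ≈ 0#
  *-0ˡ e = trans (*-congʳ e) (zeroˡ _)

  *-0ʳ : ∀ {x y} → y ≈ 0# → x * y ≈ 0#
  *-0ʳ e = trans (*-congˡ e) (zeroʳ _)

  +-0 : ∀ {x y} → x ≈ 0# → y ≈ 0# → x + y ≈ 0#
  +-0 e f = trans (+-cong e f) (+-identityˡ 0#)

  neg-0 : ∀ {x} → x ≈ 0# → - x ≈ 0#
  neg-0 e = trans (-‿cong e) -0#≈0#

  ≉0-resp : ∀ {x y} → x ≈ y → x ≉0 → y ≉0
  ≉0-resp e n f = n (trans e f)

  -- Sealed, so that the number of summands can be inferred from a sum.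
  opaque
    ∑ : ∀ {m} → (Fin m → Carrier) → Carrier
    ∑ = ΣFin

    ∑-def : ∀ {m} (f : Fin m → Carrier) → ∑ f ≡ ΣFin f
    ∑-def f = ≡.refl

    ∑-zero : (f : Fin 0 → Carrier) → ∑ f ≈ 0#
    ∑-zero f = refl

    ∑-suc : ∀ {m} (f : Fin (suc m) → Carrier) → ∑ f ≈ f zero + ∑ (f ∘ suc)
    ∑-suc f = refl

  Σ-cong : ∀ {m} {f g : Fin m → Carrier} → (∀ i → f i ≈ g i) → ∑ f ≈ ∑ g
  Σ-cong {zero}  e = trans (∑-zero _) (sym (∑-zero _))
  Σ-cong {suc m} e = trans (∑-suc _) (trans (+-cong (e zero) (Σ-cong (e ∘ suc))) (sym (∑-suc _)))

  Σ-0 : ∀ {m} {f : Fin m → Carrier} → (∀ i → f i ≈ 0#) → ∑ f ≈ 0#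
  Σ-0 {zero}  e = ∑-zero _
  Σ-0 {suc m} e = trans (∑-suc _) (+-0 (e zero) (Σ-0 (e ∘ suc)))

  Σ-+ : ∀ {m} (f g : Fin m → Carrier) → ∑ (λ i → f i + g i) ≈ ∑ f + ∑ g
  Σ-+ {zero}  f g = trans (∑-zero _) (sym (+-0 (∑-zero f) (∑-zero g)))
  Σ-+ {suc m} f g = begin
    ∑ (λ i → f i + g i)                                       ≈⟨ ∑-suc _ ⟩
    (f zero + g zero) + ∑ (λ i → f (suc i) + g (suc i))       ≈⟨ +-congˡ (Σ-+ (f ∘ suc) (g ∘ suc)) ⟩
    (f zero + g zero) + (∑ (f ∘ suc) + ∑ (g ∘ suc))
      ≈⟨ solve 4 (λ a b s t → (a :+ b) :+ (s :+ t) := (a :+ s) :+ (b :+ t)) refl _ _ _ _ ⟩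
    (f zero + ∑ (f ∘ suc)) + (g zero + ∑ (g ∘ suc))           ≈⟨ +-cong (∑-suc f) (∑-suc g) ⟨
    ∑ f + ∑ g                                                 ∎

  Σ-* : ∀ {m} a (f : Fin m → Carrier) → ∑ (λ i → a * f i) ≈ a * ∑ f
  Σ-* {zero}  a f = trans (∑-zero _) (sym (*-0ʳ (∑-zero f)))
  Σ-* {suc m} a f = begin
    ∑ (λ i → a * f i)                       ≈⟨ ∑-suc _ ⟩
    a * f zero + ∑ (λ i → a * f (suc i))    ≈⟨ +-congˡ (Σ-* a (f ∘ suc)) ⟩
    a * f zero + a * ∑ (f ∘ suc)            ≈⟨ distribˡ _ _ _ ⟨
    a * (f zero + ∑ (f ∘ suc))              ≈⟨ *-congˡ (∑-suc f) ⟨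
    a * ∑ f                                 ∎

  Σ-neg : ∀ {m} (f : Fin m → Carrier) → ∑ (λ i → - f i) ≈ - ∑ f
  Σ-neg f = begin
    ∑ (λ i → - f i)         ≈⟨ Σ-cong (λ i → solve 1 (λ y → :- y := :- :1 :* y) refl _) ⟩
    ∑ (λ i → - 1# * f i)    ≈⟨ Σ-* _ f ⟩
    - 1# * ∑ f              ≈⟨ solve 1 (λ y → :- :1 :* y := :- y) refl _ ⟩
    - ∑ f                   ∎

  Σ-sub : ∀ {m} (f g : Fin m → Carrier) → ∑ (λ i → f i - g i) ≈ ∑ f - ∑ g
  Σ-sub f g = trans (Σ-+ f _) (+-congˡ (Σ-neg g))

  Σ-*ʳ : ∀ {m} (f : Fin m → Carrier) a → ∑ (λ i → f i * a) ≈ ∑ f * a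
  Σ-*ʳ f a = trans (Σ-cong (λ i → *-comm _ _)) (trans (Σ-* a f) (*-comm _ _))

  Σ-swap : ∀ {m k} (f : Fin m → Fin k → Carrier) →
    ∑ (λ i → ∑ (λ j → f i j)) ≈ ∑ (λ j → ∑ (λ i → f i j))
  Σ-swap {zero}  f = trans (∑-zero _) (sym (Σ-0 (λ _ → ∑-zero _)))
  Σ-swap {suc m} f = begin
    ∑ (λ i → ∑ (λ j → f i j))                                 ≈⟨ ∑-suc _ ⟩
    ∑ (f zero) + ∑ (λ i → ∑ (λ j → f (suc i) j))              ≈⟨ +-congˡ (Σ-swap (f ∘ suc)) ⟩
    ∑ (f zero) + ∑ (λ j → ∑ (λ i → f (suc i) j))              ≈⟨ Σ-+ _ _ ⟨
    ∑ (λ j → f zero j + ∑ (λ i → f (suc i) j))                ≈⟨ Σ-cong (λ j → ∑-suc _) ⟨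
    ∑ (λ j → ∑ (λ i → f i j))                                 ∎

  -- The diagonal hypothesis makes this true in characteristic two as well.
  Σ-alt : ∀ {m} (f : Fin m → Fin m → Carrier) →
    (∀ i j → f i j ≈ - f j i) → (∀ i → f i i ≈ 0#) → ∑ (λ i → ∑ (f i)) ≈ 0#
  Σ-alt {zero}  f a d = ∑-zero _
  Σ-alt {suc m} f a d = begin
    ∑ (λ i → ∑ (f i))
      ≈⟨ trans (∑-suc _) (+-cong (∑-suc _) (Σ-cong (λ i → ∑-suc _))) ⟩
    (f zero zero + ∑ (λ j → f zero (suc j))) + ∑ (λ i → f (suc i) zero + ∑ (λ j → f (suc i) (suc j)))
      ≈⟨ +-cong (+-congʳ (d zero)) (Σ-+ _ _) ⟩
    (0# + ∑ (λ j → f zero (suc j))) + (∑ (λ i → f (suc i) zero) + ∑ (λ i → ∑ (λ j → f (suc i) (suc j))))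
      ≈⟨ +-cong (+-identityˡ _) (+-cong (trans (Σ-cong (λ i → a (suc i) zero)) (Σ-neg _))
           (Σ-alt (λ i j → f (suc i) (suc j)) (λ i j → a _ _) (λ i → d _))) ⟩
    ∑ (λ j → f zero (suc j)) + (- ∑ (λ j → f zero (suc j)) + 0#)
      ≈⟨ solve 1 (λ x → x :+ (:- x :+ :0) := :0) refl _ ⟩
    0# ∎

  lincomb : ∀ {I : Set} {r} → (Fin r → Carrier) → (Fin r → I → Carrier) → I → Carrier
  lincomb γ e x = ∑ (λ j → γ j * e j x)

  LinIndep : ∀ {I : Set} {r} → (Fin r → I → Carrier) → Set (c ⊔ ℓ)
  LinIndep e = ∀ γ → lincomb γ e ≐ zeroV → ∀ j → γ j ≈ 0#

  -- Kronecker's symbol, so that `δ i` is a unit vector; the coboundary keeps its qualified name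
  -- `WithField.δ`.
  δ : ∀ {m} → Fin m → Fin m → Carrier
  δ i j = if does (i Fin.≟ j) then 1# else 0#

  δ-≡ : ∀ {m} (i : Fin m) → δ i i ≡ 1#
  δ-≡ i with i Fin.≟ i
  ... | yes _ = ≡.refl
  ... | no n  = ⊥-elim (n ≡.refl)

  δ-≢ : ∀ {m} {i j : Fin m} → i ≢ j → δ i j ≡ 0#
  δ-≢ {i = i} {j} n with i Fin.≟ j
  ... | yes e = ⊥-elim (n e)
  ... | no _  = ≡.refl

  Σ-δ : ∀ {m} (i : Fin m) (f : Fin m → Carrier) → ∑ (λ j → δ i j * f j) ≈ f i
  Σ-δ zero    f = trans (∑-suc _) $ trans (+-cong (*-identityˡ _) (Σ-0 (λ j → zeroˡ _))) (+-identityʳ _)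
  Σ-δ (suc i) f = trans (∑-suc _) $ trans (+-cong (zeroˡ _) (trans (Σ-cong (λ j → *-congʳ (reflexive (δ-suc j)))) (Σ-δ i (f ∘ suc))))
                    (+-identityˡ _)
    where
      δ-suc : ∀ j → δ (suc i) (suc j) ≡ δ i j
      δ-suc j with i Fin.≟ j
      ... | yes _ = ≡.refl
      ... | no _  = ≡.refl

  Σ-δʳ : ∀ {m} (i : Fin m) (f : Fin m → Carrier) → ∑ (λ j → f j * δ j i) ≈ f i
  Σ-δʳ i f = trans (Σ-cong (λ j → trans (*-comm _ _) (*-congʳ (reflexive (δ-sym j))))) (Σ-δ i f)
    where
      δ-sym : ∀ j → δ j i ≡ δ i j
      δ-sym j with j Fin.≟ i | i Fin.≟ j
      ... | yes _ | yes _ = ≡.refl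
      ... | no _  | no _  = ≡.refl
      ... | yes e | no n  = ⊥-elim (n (≡.sym e))
      ... | no n  | yes e = ⊥-elim (n (≡.sym e))

  -- Linear systems are families of such functionals. The combinators below carry linearity along,
  -- so that no equation has to be written as a matrix row.
  record Func (I : Set) : Set (c ⊔ ℓ) where
    field
      fn   : (I → Carrier) → Carrier
      cong : ∀ {x y} → x ≐ y → fn x ≈ fn y
      add  : ∀ x y → fn (λ i → x i + y i) ≈ fn x + fn y
      mul  : ∀ a x → fn (λ i → a * x i) ≈ a * fn x

    zer : ∀ {x} → x ≐ zeroV → fn x ≈ 0#
    zer {x} e = begin
      fn x                  ≈⟨ cong (λ i → trans (e i) (sym (zeroˡ 0#))) ⟩
      fn (λ i → 0# * 0#)    ≈⟨ mul 0# (λ _ → 0#) ⟩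
      0# * fn (λ _ → 0#)    ≈⟨ zeroˡ _ ⟩
      0#                    ∎

    sum : ∀ {m} (γ : Fin m → Carrier) (x : Fin m → I → Carrier) →
      fn (lincomb γ x) ≈ ∑ (λ j → γ j * fn (x j))
    sum {zero}  γ x = trans (zer (λ _ → ∑-zero _)) (sym (∑-zero _))
    sum {suc m} γ x = trans (cong (λ _ → ∑-suc _)) (trans (add _ _)
      (trans (+-cong (mul _ _) (sum (γ ∘ suc) (x ∘ suc))) (sym (∑-suc _))))

  open Func public using (fn)

  ev : ∀ {I} → I → Func I
  ev i = record { fn = λ x → x i ; cong = λ e → e i ; add = λ _ _ → refl ; mul = λ _ _ → refl }

  0F : ∀ {I} → Func I
  0F = record { fn = λ _ → 0# ; cong = λ _ → refl
              ; add = λ _ _ → sym (+-identityˡ 0#) ; mul = λ a _ → sym (zeroʳ a) }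

  infixl 6 _+F_
  infixr 7 _*F_

  _+F_ : ∀ {I} → Func I → Func I → Func I
  f +F g = record
    { fn = λ x → fn f x + fn g x
    ; cong = λ e → +-cong (Func.cong f e) (Func.cong g e)
    ; add = λ x y → trans (+-cong (Func.add f x y) (Func.add g x y))
        (solve 4 (λ a b s t → (a :+ b) :+ (s :+ t) := (a :+ s) :+ (b :+ t)) refl _ _ _ _)
    ; mul = λ a x → trans (+-cong (Func.mul f a x) (Func.mul g a x)) (sym (distribˡ _ _ _)) }

  _*F_ : ∀ {I} → Carrier → Func I → Func I
  b *F f = record
    { fn = λ x → b * fn f x
    ; cong = λ e → *-congˡ (Func.cong f e)
    ; add = λ x y → trans (*-congˡ (Func.add f x y)) (distribˡ _ _ _)
    ; mul = λ a x → trans (*-congˡ (Func.mul f a x))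
        (solve 3 (λ b a x → b :* (a :* x) := a :* (b :* x)) refl _ _ _) }

  ΣF : ∀ {I m} → (Fin m → Func I) → Func I
  ΣF f = record
    { fn = λ x → ∑ (λ i → fn (f i) x)
    ; cong = λ e → Σ-cong (λ i → Func.cong (f i) e)
    ; add = λ x y → trans (Σ-cong (λ i → Func.add (f i) x y)) (Σ-+ _ _)
    ; mul = λ a x → trans (Σ-cong (λ i → Func.mul (f i) a x)) (Σ-* _ _) }

  infixl 7 _Fʳ*_
  _Fʳ*_ : ∀ {I} → Func I → Carrier → Func I
  f Fʳ* b = record
    { fn = λ x → fn f x * b
    ; cong = λ e → *-congʳ (Func.cong f e)
    ; add = λ x y → trans (*-congʳ (Func.add f x y)) (distribʳ _ _ _)
    ; mul = λ a x → trans (*-congʳ (Func.mul f a x)) (*-assoc _ _ _) }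

  lincombF : ∀ {I : Set} {r} → (Fin r → I → Carrier) → I → Func (Fin r)
  lincombF e a = ΣF (λ i → ev i Fʳ* e i a)

  infixr 9 _∘F_
  _∘F_ : ∀ {I J} → Func J → (J → Func I) → Func I
  f ∘F g = record
    { fn = λ x → fn f (λ j → fn (g j) x)
    ; cong = λ e → Func.cong f (λ j → Func.cong (g j) e)
    ; add = λ x y → trans (Func.cong f (λ j → Func.add (g j) x y)) (Func.add f _ _)
    ; mul = λ a x → trans (Func.cong f (λ j → Func.mul (g j) a x)) (Func.mul f _ _) }

  sub : ∀ {I} (f : Func I) x y → fn f (λ i → x i - y i) ≈ fn f x - fn f y
  sub f x y = trans (Func.add f x (λ i → - y i)) (+-congˡ (begin
    fn f (λ i → - y i)          ≈⟨ Func.cong f (λ i → solve 1 (λ y → :- y := :- :1 :* y) refl _) ⟩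
    fn f (λ i → - 1# * y i)     ≈⟨ Func.mul f _ _ ⟩
    - 1# * fn f y               ≈⟨ solve 1 (λ y → :- :1 :* y := :- y) refl _ ⟩
    - fn f y                    ∎))

  on-units : ∀ {s} (f : Func (Fin s)) → (∀ j → fn f (δ j) ≈ 0#) → ∀ x → fn f x ≈ 0#
  on-units f e x = begin
    fn f x                          ≈⟨ Func.cong f (λ i → sym (Σ-δʳ i x)) ⟩
    fn f (lincomb x δ)              ≈⟨ Func.sum f x δ ⟩
    ∑ (λ j → x j * fn f (δ j))   ≈⟨ Σ-0 (λ j → *-0ʳ (e j)) ⟩
    0#                              ∎

  find≉0 : ∀ {I : Set} {x : I → Carrier} → ¬ (∀ i → x i ≈ 0#) → DN (∃[ i ] x i ≉0)
  find≉0 n k = n (λ i → stable (λ m → k (i , m)))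

  -- Gaussian elimination: either the first equation kills every unit vector and is void, or some
  -- unit vector `δ j₀` survives and the coordinate j₀ can be eliminated.
  underdetermined : ∀ {r s} → r < s → (M : Fin r → Func (Fin s)) →
    DN (∃[ x ] (¬ (∀ j → x j ≈ 0#)) × (∀ i → fn (M i) x ≈ 0#))
  underdetermined {zero} {suc s} lt M = return ((λ _ → 1#) , (λ e → 1≉0 (e zero)) , λ ())
  underdetermined {suc r} {suc s} (s≤s lt) M = lem (∀ j → fn (M zero) (δ j) ≈ 0#) >>= λ
    { (inj₁ z) → underdetermined (ℕ.m<n⇒m<1+n lt) (M ∘ suc) >>= λ { (x , n , e) →
        return (x , n , λ { zero → on-units (M zero) z x ; (suc i) → e i }) }
    ; (inj₂ n) → find≉0 n >>= λ { (j₀ , p) → pivot j₀ p } }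
    where
      module Pivot (j₀ : Fin (suc s)) (p : fn (M zero) (δ j₀) ≉0) where
        a⁻¹ = inv _ p

        padF : Fin (suc s) → Func (Fin s)
        padF j with j₀ Fin.≟ j
        ... | yes _ = 0F
        ... | no ne = ev (punchOut ne)

        -- The kernel of the first equation, parametrised by the coordinates other than j₀:
        -- coordinate j₀ is set to minus the value of the equation on the rest, divided by the
        -- pivot.
        E : Fin (suc s) → Func (Fin s)
        E j = padF j +F (δ j₀ j * (- a⁻¹)) *F (M zero ∘F padF)

        kills : ∀ y → fn (M zero) (λ j → fn (E j) y) ≈ 0#
        kills y = begin
          fn (M zero) (λ j → fn (padF j) y + δ j₀ j * (- a⁻¹) * t)
            ≈⟨ Func.add (M zero) _ _ ⟩
          t + fn (M zero) (λ j → δ j₀ j * (- a⁻¹) * t)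
            ≈⟨ +-congˡ (Func.cong (M zero) (λ j → solve 3 (λ d a t → d :* a :* t := a :* t :* d) refl _ _ _)) ⟩
          t + fn (M zero) (λ j → - a⁻¹ * t * δ j₀ j)
            ≈⟨ +-congˡ (Func.mul (M zero) _ _) ⟩
          t + - a⁻¹ * t * fn (M zero) (δ j₀)
            ≈⟨ solve 3 (λ t a b → t :+ :- a :* t :* b := t :- b :* a :* t) refl _ _ _ ⟩
          t - fn (M zero) (δ j₀) * a⁻¹ * t
            ≈⟨ +-congˡ (-‿cong (*-congʳ (inv-r p))) ⟩
          t - 1# * t
            ≈⟨ solve 1 (λ t → t :- :1 :* t := :0) refl _ ⟩
          0# ∎
          where t = fn (M zero) (λ j → fn (padF j) y)

        restrict : ∀ y j → fn (E (punchIn j₀ j)) y ≈ y j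
        restrict y j with j₀ Fin.≟ punchIn j₀ j
        ... | yes e = ⊥-elim (Fin.punchInᵢ≢i j₀ j (≡.sym e))
        ... | no ne = trans (+-cong (reflexive (≡.cong y (Fin.punchOut-punchIn j₀)))
                              (trans (*-congʳ (zeroˡ _)) (zeroˡ _))) (+-identityʳ _)

      pivot : ∀ j₀ → fn (M zero) (δ j₀) ≉0 → DN _
      pivot j₀ p = underdetermined lt (λ i → M (suc i) ∘F Pivot.E j₀ p) >>= λ { (y , n , e) →
        return ((λ j → fn (Pivot.E j₀ p j) y)
          , (λ z → n (λ j → trans (sym (Pivot.restrict j₀ p y j)) (z (punchIn j₀ j))))
          , λ { zero → Pivot.kills j₀ p y ; (suc i) → e i }) }

  Size : Set → ℕ → Set
  Size A n = A ↔ Fin n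

  underdetermined′ : ∀ {U E r s} → Size U s → Size E r → r < s → (M : E → Func U) →
    DN (∃[ x ] (¬ (∀ j → x j ≈ 0#)) × (∀ i → fn (M i) x ≈ 0#))
  underdetermined′ su se lt M =
    underdetermined lt (λ i → M (Inverse.from se i) ∘F (λ u → ev (Inverse.to su u))) >>= λ { (x , n , e) →
    return (x ∘ Inverse.to su
      , (λ z → n (λ j → trans (reflexive (≡.cong x (≡.sym (Inverse.strictlyInverseˡ su j)))) (z (Inverse.from su j))))
      , λ i → ≡.subst (λ k → fn (M k) (x ∘ Inverse.to su) ≈ 0#) (Inverse.strictlyInverseʳ se i)
          (e (Inverse.to se i))) }

  -- With s > r the s coefficient vectors in k^r would be dependent, and `Comb` would carry the
  -- dependence over to e. The double negation is harmless as `s ≤ r` is decidable.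
  spanned-bound : ∀ {A R : Set} {r s} → Size R r → (Comb : A → Func R) →
    (e : Fin s → A → Carrier) → LinIndep e →
    (∀ j → DN (∃[ γ ] ∀ a → e j a ≈ fn (Comb a) γ)) → s ≤ r
  spanned-bound {A} {R} {r} {s} sr Comb e li span with s ℕ.≤? r
  ... | yes le = le
  ... | no nle = ⊥-elim (contra id)
    where
      contra : DN ⊥
      contra = dn-Fin span >>= λ Γ →
        underdetermined (ℕ.≰⇒> nle)
          (λ i → ΣF (λ j → proj₁ (Γ j) (Inverse.from sr i) *F ev j)) >>= λ { (x , n , z) →
        return (n (li x (λ a → begin
          ∑ (λ j → x j * e j a)
            ≈⟨ Σ-cong (λ j → *-congˡ (proj₂ (Γ j) a)) ⟩
          ∑ (λ j → x j * fn (Comb a) (proj₁ (Γ j)))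
            ≈⟨ Func.sum (Comb a) x (proj₁ ∘ Γ) ⟨
          fn (Comb a) (lincomb x (proj₁ ∘ Γ))
            ≈⟨ Func.zer (Comb a) (λ ρ → trans
                 (Σ-cong (λ j → trans (*-comm _ _) (*-congʳ (reflexive
                    (≡.cong (proj₁ (Γ j)) (≡.sym (Inverse.strictlyInverseʳ sr ρ)))))))
                 (z (Inverse.to sr ρ))) ⟩
          0# ∎))) }

  -- This is `Dim` with spanning asserted up to double negation only, which is the form that
  -- survives the passage to the stabilised field.
  Basis : ∀ {p} {I : Set} → ((I → Carrier) → Set p) → ℕ → Set (c ⊔ ℓ ⊔ p)
  Basis {I = I} S r = Σ (Fin r → I → Carrier) λ e →
    (∀ j → S (e j)) × LinIndep e × (∀ x → S x → DN (∃[ γ ] (x ≐ lincomb γ e)))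

  LinIndep-≉0 : ∀ {I : Set} {r} {e : Fin r → I → Carrier} → LinIndep e → ∀ j → ¬ (e j ≐ zeroV)
  LinIndep-≉0 {e = e} li j z = 1≉0 (trans (sym (reflexive (δ-≡ j)))
    (li (δ j) (λ x → trans (Σ-δ j (λ i → e i x)) (z x)) j))

  -- The vector x and the r basis vectors of S' lie in the r-dimensional S, hence are dependent; x
  -- has a nonzero coefficient because the others are independent.
  same-dimension : ∀ {p q} {I : Set} {S : (I → Carrier) → Set p} {S' : (I → Carrier) → Set q} {r} →
    Basis S r → (b : Basis S' r) → (∀ x → S' x → S x) → ∀ x → S x →
    DN (∃[ γ ] (x ≐ lincomb γ (proj₁ b)))
  same-dimension {I = I} {S} {S'} {r} (e , eS , li , sp) (e' , eS' , li' , _) inc x Sx =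
    sp x Sx >>= λ { (ξ , ξ-eq) → dn-Fin (λ j → sp (e' j) (inc _ (eS' j))) >>= λ Γ →
    underdetermined {r} {suc r} ℕ.≤-refl
      (λ i → ξ i *F ev zero +F ΣF (λ j → proj₁ (Γ j) i *F ev (suc j))) >>= λ { (y , n , z) →
    let rel : ∀ a → y zero * x a + ∑ (λ j → y (suc j) * e' j a) ≈ 0#
        rel a = begin
          y zero * x a + ∑ (λ j → y (suc j) * e' j a)
            ≈⟨ +-cong (*-congˡ (ξ-eq a)) (Σ-cong (λ j → *-congˡ (proj₂ (Γ j) a))) ⟩
          y zero * fn (C a) ξ + ∑ (λ j → y (suc j) * fn (C a) (proj₁ (Γ j)))
            ≈⟨ ∑-suc _ ⟨
          ∑ (λ j → y j * fn (C a) (vecs ξ Γ j))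
            ≈⟨ Func.sum (C a) y (vecs ξ Γ) ⟨
          fn (C a) (lincomb y (vecs ξ Γ))
            ≈⟨ Func.zer (C a) (λ i → trans (∑-suc _) (trans (+-cong (*-comm _ _) (Σ-cong (λ j → *-comm _ _))) (z i))) ⟩
          0# ∎
    in lem (y zero ≈ 0#) >>= λ
      { (inj₁ y0) → ⊥-elim (n (λ { zero → y0
          ; (suc j) → li' (y ∘ suc) (λ a → trans (sym (trans (+-congʳ (*-0ˡ y0)) (+-identityˡ _))) (rel a)) j }))
      ; (inj₂ y≉) → return ((λ j → - inv _ y≉ * y (suc j)) , λ a → begin
          x a ≈⟨ *-identityˡ _ ⟨
          1# * x a ≈⟨ *-congʳ (inv-r y≉) ⟨
          y zero * inv _ y≉ * x a
            ≈⟨ solve 4 (λ y i x s → y :* i :* x := i :* (y :* x :+ s) :- i :* s) refl _ _ _ _ ⟩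
          inv _ y≉ * (y zero * x a + ∑ (λ j → y (suc j) * e' j a)) - inv _ y≉ * ∑ (λ j → y (suc j) * e' j a)
            ≈⟨ +-congʳ (*-0ʳ (rel a)) ⟩
          0# - inv _ y≉ * ∑ (λ j → y (suc j) * e' j a)
            ≈⟨ solve 2 (λ i s → :0 :- i :* s := :- i :* s) refl _ _ ⟩
          - inv _ y≉ * ∑ (λ j → y (suc j) * e' j a)
            ≈⟨ Σ-* _ _ ⟨
          ∑ (λ j → - inv _ y≉ * (y (suc j) * e' j a))
            ≈⟨ Σ-cong (λ j → sym (*-assoc _ _ _)) ⟩
          ∑ (λ j → - inv _ y≉ * y (suc j) * e' j a) ∎) } } }
    where
      C : I → Func (Fin r)
      C = lincombF e

      vecs : ∀ {P : Fin r → (Fin r → Carrier) → Set ℓ} → (Fin r → Carrier) →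
        (∀ j → Σ (Fin r → Carrier) (P j)) → Fin (suc r) → Fin r → Carrier
      vecs ξ Γ zero    = ξ
      vecs ξ Γ (suc j) = proj₁ (Γ j)

  -- Equips functions on A with the standard bilinear pairing. It serves for vectors of coordinates,
  -- for chains against cochains and for families of these indexed by vertices.
  record Summable (A : Set) : Set (c ⊔ ℓ) where
    field
      total : Func A
      unit  : A → A → Carrier
      pick  : ∀ b (x : A → Carrier) → fn total (λ a → unit b a * x a) ≈ x b
      unit-off : ∀ b a → b ≢ a → unit b a ≈ 0#
      unit-on  : ∀ b → unit b b ≈ 1#

    pair : (A → Carrier) → (A → Carrier) → Carrier
    pair y x = fn total (λ a → y a * x a)

    pairF : (A → Carrier) → Func A
    pairF x = total ∘F (λ a → ev a Fʳ* x a)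

    pair-cong : ∀ {y y' x x'} → y ≐ y' → x ≐ x' → pair y x ≈ pair y' x'
    pair-cong e f = Func.cong total (λ a → *-cong (e a) (f a))

    pair-0 : ∀ {y x} → (∀ a → y a * x a ≈ 0#) → pair y x ≈ 0#
    pair-0 = Func.zer total

  open Summable public using (pair; pairF)

  units-indep : ∀ {A : Set} (S : Summable A) {s} (g : Fin s → A) → (∀ i j → g i ≡ g j → i ≡ j) →
    LinIndep (λ j → Summable.unit S (g j))
  units-indep S g inj γ z i = begin
    γ i                                           ≈⟨ Σ-δ i γ ⟨
    ∑ (λ j → δ i j * γ j)                         ≈⟨ Σ-cong (λ j → by-cases (i ≡ j)
        (λ { ≡.refl → trans (*-cong (reflexive (δ-≡ i)) refl) (trans (*-comm _ _) (*-congˡ (sym (Summable.unit-on S (g i))))) })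
        (λ ne → trans (*-0ˡ (reflexive (δ-≢ ne))) (sym (*-0ʳ (Summable.unit-off S (g j) (g i) (λ e → ne (≡.sym (inj j i e)))))))) ⟩
    ∑ (λ j → γ j * Summable.unit S (g j) (g i))   ≈⟨ z (g i) ⟩
    0#                                            ∎

  summable-Fin : ∀ n → Summable (Fin n)
  summable-Fin n = record { total = ΣF ev ; unit = δ ; pick = Σ-δ ; unit-off = λ b a n → reflexive (δ-≢ n)
    ; unit-on = λ b → reflexive (δ-≡ b) }

  sumSub : ∀ {n} → (Subset n → Carrier) → Carrier
  sumSub {zero}  f = f []
  sumSub {suc n} f = sumSub (f ∘ (false ∷_)) + sumSub (f ∘ (true ∷_))

  sumSub-cong : ∀ {n} {f g : Subset n → Carrier} → f ≐ g → sumSub f ≈ sumSub g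
  sumSub-cong {zero}  e = e []
  sumSub-cong {suc n} e = +-cong (sumSub-cong (e ∘ (false ∷_))) (sumSub-cong (e ∘ (true ∷_)))

  sumSub-0 : ∀ {n} {f : Subset n → Carrier} → (∀ F → f F ≈ 0#) → sumSub f ≈ 0#
  sumSub-0 {zero}  e = e []
  sumSub-0 {suc n} e = +-0 (sumSub-0 (e ∘ (false ∷_))) (sumSub-0 (e ∘ (true ∷_)))

  sumSubF : ∀ {n} → Func (Subset n)
  sumSubF {n} = record { fn = sumSub ; cong = sumSub-cong ; add = sum-+ ; mul = sum-* }
    where
      sum-+ : ∀ {n} (f g : Subset n → Carrier) → sumSub (λ i → f i + g i) ≈ sumSub f + sumSub g
      sum-+ {zero}  f g = refl
      sum-+ {suc n} f g = trans (+-cong (sum-+ {n} _ _) (sum-+ {n} _ _))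
        (solve 4 (λ a b s t → (a :+ b) :+ (s :+ t) := (a :+ s) :+ (b :+ t)) refl _ _ _ _)
      sum-* : ∀ {n} a (f : Subset n → Carrier) → sumSub (λ i → a * f i) ≈ a * sumSub f
      sum-* {zero}  a f = refl
      sum-* {suc n} a f = trans (+-cong (sum-* {n} _ _) (sum-* {n} _ _)) (sym (distribˡ _ _ _))

  unitSub : ∀ {n} → Subset n → Subset n → Carrier
  unitSub []          []          = 1#
  unitSub (false ∷ F) (false ∷ G) = unitSub F G
  unitSub (true ∷ F)  (true ∷ G)  = unitSub F G
  unitSub (false ∷ F) (true ∷ G)  = 0#
  unitSub (true ∷ F)  (false ∷ G) = 0#

  unitSub-≡ : ∀ {n} (F : Subset n) → unitSub F F ≈ 1#
  unitSub-≡ []          = refl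
  unitSub-≡ (false ∷ F) = unitSub-≡ F
  unitSub-≡ (true ∷ F)  = unitSub-≡ F

  summable-Subset : ∀ n → Summable (Subset n)
  summable-Subset n = record { total = sumSubF ; unit = unitSub ; pick = pick ; unit-off = off ; unit-on = unitSub-≡ }
    where
      pick : ∀ {n} (F : Subset n) (x : Subset n → Carrier) → sumSub (λ G → unitSub F G * x G) ≈ x F
      pick []          x = *-identityˡ _
      pick {suc n} (false ∷ F) x = trans (+-cong (pick F _) (sumSub-0 {n} (λ G → zeroˡ _))) (+-identityʳ _)
      pick {suc n} (true ∷ F)  x = trans (+-cong (sumSub-0 {n} (λ G → zeroˡ _)) (pick F _)) (+-identityˡ _)
      off : ∀ {n} (F G : Subset n) → F ≢ G → unitSub F G ≈ 0#
      off []          []          n = ⊥-elim (n ≡.refl)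
      off (false ∷ F) (false ∷ G) n = off F G (n ∘ ≡.cong (false ∷_))
      off (true ∷ F)  (true ∷ G)  n = off F G (n ∘ ≡.cong (true ∷_))
      off (false ∷ F) (true ∷ G)  n = refl
      off (true ∷ F)  (false ∷ G) n = refl

  summable-× : ∀ {n} {B : Set} → Summable B → Summable (Fin n × B)
  summable-× {n} {B} sb = record
    { total = ΣF (λ v → B.total ∘F (λ b → ev (v , b)))
    ; unit = λ { (v , b) (v' , b') → δ v v' * B.unit b b' }
    ; pick = λ { (v , b) x → begin
        ∑ (λ v' → fn B.total (λ b' → δ v v' * B.unit b b' * x (v' , b')))
          ≈⟨ Σ-cong (λ v' → trans (Func.cong B.total (λ b' → *-assoc _ _ _)) (Func.mul B.total _ _)) ⟩
        ∑ (λ v' → δ v v' * fn B.total (λ b' → B.unit b b' * x (v' , b')))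
          ≈⟨ Σ-δ v _ ⟩
        fn B.total (λ b' → B.unit b b' * x (v , b'))
          ≈⟨ B.pick b (λ b' → x (v , b')) ⟩
        x (v , b) ∎ }
    ; unit-off = λ { (v , b) (v' , b') n → by-cases (v ≡ v')
        (λ { ≡.refl → *-0ʳ (B.unit-off b b' (λ { ≡.refl → n ≡.refl })) })
        (λ ne → *-0ˡ (reflexive (δ-≢ ne))) }
    ; unit-on = λ { (v , b) → trans (*-cong (reflexive (δ-≡ v)) (B.unit-on b)) (*-identityˡ _) } }
    where module B = Summable sb

  -- The field `support` makes the dual vectors of cochains of a complex vanish off its faces, so
  -- that they are chains of the same complex.
  record Dual {A : Set} (S : Summable A) {w} (x : Fin w → A → Carrier) : Set (c ⊔ ℓ) where
    field
      vec     : Fin w → A → Carrier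
      support : ∀ i a → (∀ j → x j a ≈ 0#) → vec i a ≈ 0#
      dual    : ∀ i j → pair S (vec i) (x j) ≈ δ i j

  -- Induction in the manner of Gram and Schmidt, with a coordinate in place of an inner product:
  -- the first vector, reduced by the later ones, is nonzero at some a₀.
  dual-basis : ∀ {A : Set} (S : Summable A) {w} (x : Fin w → A → Carrier) → LinIndep x → DN (Dual S x)
  dual-basis S {zero}  x li = return (record { vec = λ () ; support = λ () ; dual = λ () })
  dual-basis {A} S {suc w} x li = dual-basis S (x ∘ suc) li-tail >>= step
    where
      open Summable S using (total; unit; pick; unit-off)

      li-tail : LinIndep (x ∘ suc)
      li-tail γ e j = li (λ { zero → 0# ; (suc i) → γ i })
        (λ a → trans (∑-suc _) (trans (+-cong (zeroˡ _) (e a)) (+-identityˡ _))) (suc j)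

      step : Dual S (x ∘ suc) → DN (Dual S x)
      step D = find≉0 nonzero >>= λ { (a₀ , n) → return (make a₀ n) }
        where
          module D = Dual D
          t : Fin w → Carrier
          t i = pair S (D.vec i) (x zero)

          x' : A → Carrier
          x' a = x zero a - ∑ (λ i → t i * x (suc i) a)

          coef : Fin (suc w) → Carrier
          coef zero    = 1#
          coef (suc i) = - t i

          nonzero : ¬ (∀ a → x' a ≈ 0#)
          nonzero z = 1≉0 (li coef (λ a → begin
            ∑ (λ j → coef j * x j a)
              ≈⟨ ∑-suc _ ⟩
            1# * x zero a + ∑ (λ i → - t i * x (suc i) a)
              ≈⟨ +-cong (*-identityˡ _) (trans (Σ-cong (λ i → sym (-‿distribˡ-* _ _))) (Σ-neg _)) ⟩
            x' a
              ≈⟨ z a ⟩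
            0# ∎) zero)

          make : ∀ a₀ → x' a₀ ≉0 → Dual S x
          make a₀ n = record { vec = Y ; support = sup ; dual = du }
            where
              -- Evaluation at a₀, corrected so as to kill the later vectors and scaled to give 1 on
              -- the first.
              y₀ : A → Carrier
              y₀ a = inv _ n * (unit a₀ a - ∑ (λ i → x (suc i) a₀ * D.vec i a))

              Y : Fin (suc w) → A → Carrier
              Y zero    = y₀
              Y (suc i) a = D.vec i a - t i * y₀ a

              sup₀ : ∀ a → (∀ j → x j a ≈ 0#) → y₀ a ≈ 0#
              sup₀ a z = *-0ʳ (+-0 (unit-off a₀ a (λ { ≡.refl → n (+-0 (z zero)
                  (neg-0 (Σ-0 (λ i → *-0ʳ (z (suc i)))))) }))
                (neg-0 (Σ-0 (λ i → *-0ʳ (D.support i a (z ∘ suc))))))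

              sup : ∀ i a → (∀ j → x j a ≈ 0#) → Y i a ≈ 0#
              sup zero    a z = sup₀ a z
              sup (suc i) a z = +-0 (D.support i a (z ∘ suc)) (neg-0 (*-0ʳ (sup₀ a z)))

              pair-y₀ : ∀ u → pair S y₀ u ≈ inv _ n * (u a₀ - ∑ (λ i → x (suc i) a₀ * pair S (D.vec i) u))
              pair-y₀ u = trans (Func.mul (pairF S u) _ _) (*-congˡ (trans (sub (pairF S u) _ _)
                (+-cong (pick a₀ u) (-‿cong (Func.sum (pairF S u) _ _)))))

              du₀ : pair S y₀ (x zero) ≈ 1#
              du₀ = trans (pair-y₀ (x zero)) (trans (*-comm _ _) (trans (*-congʳ (+-congˡ (-‿cong
                (Σ-cong (λ i → *-comm _ _))))) (inv-r n)))

              du₁ : ∀ j → pair S y₀ (x (suc j)) ≈ 0#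
              du₁ j = trans (pair-y₀ (x (suc j))) (*-0ʳ (trans (+-congˡ (-‿cong (trans
                (Σ-cong (λ i → *-congˡ (D.dual i j))) (Σ-δʳ j (λ i → x (suc i) a₀))))) (-‿inverseʳ _)))

              shifted : ∀ i u → pair S (Y (suc i)) u ≈ pair S (D.vec i) u - t i * pair S y₀ u
              shifted i u = trans (sub (pairF S u) _ _) (+-congˡ (-‿cong (Func.mul (pairF S u) _ _)))

              δ-suc : ∀ i j → δ {suc w} (suc i) (suc j) ≡ δ i j
              δ-suc i j with i Fin.≟ j
              ... | yes _ = ≡.refl
              ... | no _  = ≡.refl

              du : ∀ i j → pair S (Y i) (x j) ≈ δ i j
              du zero    zero    = du₀
              du zero    (suc j) = du₁ j
              du (suc i) zero    = trans (shifted i (x zero)) (trans (+-congˡ (-‿cong (*-congˡ du₀)))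
                (solve 1 (λ t → t :- t :* :1 := :0) refl _))
              du (suc i) (suc j) = trans (shifted i (x (suc j))) (trans (+-congˡ (-‿cong (*-congˡ (du₁ j))))
                (trans (solve 2 (λ p t → p :- t :* :0 := p) refl _ _)
                  (trans (D.dual i j) (reflexive (≡.sym (δ-suc i j))))))

  -- Alternating forms and generic configurations

  module Geometry where

    V : ℕ → Set c
    V N = Fin N → Carrier

    dot : ∀ {N} → V N → V N → Carrier
    dot f x = ∑ (λ i → f i * x i)

    dotF : ∀ {N} → V N → Func (Fin N)
    dotF f = ΣF (λ i → f i *F ev i)

    dot-cong : ∀ {N} {f g x y : V N} → f ≐ g → x ≐ y → dot f x ≈ dot g y
    dot-cong e h = Σ-cong (λ i → *-cong (e i) (h i))

    dot-0ˡ : ∀ {N} {f x : V N} → f ≐ zeroV → dot f x ≈ 0#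
    dot-0ˡ e = Σ-0 (λ i → *-0ˡ (e i))

    dot-subˡ : ∀ {N} (f g x : V N) → dot (λ i → f i - g i) x ≈ dot f x - dot g x
    dot-subˡ f g x = trans (Σ-cong (λ i → solve 3 (λ f g x → (f :- g) :* x := f :* x :- g :* x) refl _ _ _)) (Σ-sub _ _)

    dot-δ : ∀ {N} (f : V N) i → dot f (δ i) ≈ f i
    dot-δ f i = trans (Σ-cong (λ j → *-comm _ _)) (Σ-δ i f)

    coords : ∀ {N} → Func (Fin N) → V N
    coords f i = fn f (δ i)

    dot-coords : ∀ {N} (f : Func (Fin N)) x → dot (coords f) x ≈ fn f x
    dot-coords f x = begin
      ∑ (λ i → fn f (δ i) * x i)      ≈⟨ Σ-cong (λ i → *-comm _ _) ⟩
      ∑ (λ i → x i * fn f (δ i))      ≈⟨ Func.sum f x δ ⟨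
      fn f (lincomb x δ)              ≈⟨ Func.cong f (λ i → Σ-δʳ i x) ⟩
      fn f x                          ∎

    -- Linearity is built in for the first argument and follows for the second by `anti`. The field
    -- `alt` is separate because `anti` does not imply it in characteristic two.
    record Alt (N : ℕ) : Set (c ⊔ ℓ) where
      field
        form : V N → Func (Fin N)
        anti : ∀ x y → fn (form y) x ≈ - fn (form x) y
        alt  : ∀ x → fn (form x) x ≈ 0#

      app : V N → V N → Carrier
      app x y = fn (form y) x

      appF : V N → Func (Fin N)
      appF x = record
        { fn = app x
        ; cong = λ {y} {y'} e → trans (anti x y) (trans (-‿cong (Func.cong (form x) e)) (sym (anti x y')))
        ; add = λ y z → trans (anti x _) (trans (-‿cong (Func.add (form x) y z))
            (trans (solve 2 (λ a b → :- (a :+ b) := :- a :+ :- b) refl _ _) (sym (+-cong (anti x y) (anti x z)))))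
        ; mul = λ a y → trans (anti x _) (trans (-‿cong (Func.mul (form x) a y))
            (trans (solve 2 (λ a b → :- (a :* b) := a :* :- b) refl _ _) (*-congˡ (sym (anti x y))))) }

    open Alt public using (app; appF)

    0A : ∀ {N} → Alt N
    0A = record { form = λ _ → 0F ; anti = λ _ _ → sym -0#≈0# ; alt = λ _ → refl }

    infixl 6 _+A_
    infixr 7 _*A_

    _+A_ : ∀ {N} → Alt N → Alt N → Alt N
    B +A C = record
      { form = λ y → Alt.form B y +F Alt.form C y
      ; anti = λ x y → trans (+-cong (Alt.anti B x y) (Alt.anti C x y))
          (solve 2 (λ a b → :- a :+ :- b := :- (a :+ b)) refl _ _)
      ; alt = λ x → +-0 (Alt.alt B x) (Alt.alt C x) }

    _*A_ : ∀ {N} → Carrier → Alt N → Alt N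
    a *A B = record
      { form = λ y → a *F Alt.form B y
      ; anti = λ x y → trans (*-congˡ (Alt.anti B x y)) (solve 2 (λ a b → a :* :- b := :- (a :* b)) refl _ _)
      ; alt = λ x → *-0ʳ (Alt.alt B x) }

    ΣA : ∀ {N m} → (Fin m → Alt N) → Alt N
    ΣA B = record
      { form = λ y → ΣF (λ i → Alt.form (B i) y)
      ; anti = λ x y → trans (Σ-cong (λ i → Alt.anti (B i) x y)) (Σ-neg _)
      ; alt = λ x → Σ-0 (λ i → Alt.alt (B i) x) }

    wedge : ∀ {N} → Func (Fin N) → Func (Fin N) → Alt N
    wedge f g = record
      { form = λ y → f Fʳ* fn g y +F (- fn f y) *F g
      ; anti = λ x y → solve 4 (λ fx fy gx gy → fx :* gy :+ :- fy :* gx := :- (fy :* gx :+ :- fx :* gy)) refl _ _ _ _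
      ; alt = λ x → solve 2 (λ f g → f :* g :+ :- f :* g := :0) refl _ _ }

    -- Adding the vectors one at a time, the correction a₀ ∧ (m₀ − B(P₀,·))
    -- leaves the values on the earlier vectors unchanged by compatibility.
    extend : ∀ {N D} (P m a : Fin D → V N) →
      (∀ i j → dot (a i) (P j) ≈ δ i j) →
      (∀ i → dot (m i) (P i) ≈ 0#) →
      (∀ i j → i ≢ j → dot (m i) (P j) + dot (m j) (P i) ≈ 0#) →
      Σ (Alt N) λ B → ∀ i y → app B (P i) y ≈ dot (m i) y
    extend {D = zero}  P m a du self comp = 0A , λ ()
    extend {N} {suc D} P m a du self comp = B , values
      where
        rec = extend (P ∘ suc) (m ∘ suc) (a ∘ suc)
          (λ i j → trans (du (suc i) (suc j)) (reflexive (δ-suc i j)))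
          (self ∘ suc) (λ i j n → comp (suc i) (suc j) (n ∘ Fin.suc-injective))
          where
            δ-suc : ∀ {w} (i j : Fin w) → δ {suc w} (suc i) (suc j) ≡ δ i j
            δ-suc i j with i Fin.≟ j
            ... | yes _ = ≡.refl
            ... | no _  = ≡.refl
        B₀ = proj₁ rec
        g : Func (Fin N)
        g = dotF (m zero) +F (- 1#) *F appF B₀ (P zero)
        B : Alt N
        B = B₀ +A wedge (dotF (a zero)) g
        values : ∀ i y → app B (P i) y ≈ dot (m i) y
        values zero y = begin
          app B₀ (P zero) y + (dot (a zero) (P zero) * fn g y + - dot (a zero) y * fn g (P zero))
            ≈⟨ +-congˡ (+-cong (*-congʳ (du zero zero)) (*-0ʳ (+-0 (self zero) (*-0ʳ (Alt.alt B₀ _))))) ⟩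
          app B₀ (P zero) y + (1# * (dot (m zero) y + - 1# * app B₀ (P zero) y) + 0#)
            ≈⟨ solve 2 (λ b m → b :+ (:1 :* (m :+ :- :1 :* b) :+ :0) := m) refl _ _ ⟩
          dot (m zero) y ∎
        values (suc i) y = begin
          app B₀ (P (suc i)) y + (dot (a zero) (P (suc i)) * fn g y + - dot (a zero) y * fn g (P (suc i)))
            ≈⟨ +-cong (proj₂ rec i y) (+-0 (*-0ˡ (du zero (suc i))) (*-0ʳ gz)) ⟩
          dot (m (suc i)) y + 0#
            ≈⟨ +-identityʳ _ ⟩
          dot (m (suc i)) y ∎
          where
            gz : fn g (P (suc i)) ≈ 0#
            gz = begin
              dot (m zero) (P (suc i)) + - 1# * app B₀ (P zero) (P (suc i))
                ≈⟨ +-congˡ (*-congˡ (trans (Alt.anti B₀ _ _) (-‿cong (proj₂ rec i (P zero))))) ⟩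
              dot (m zero) (P (suc i)) + - 1# * - dot (m (suc i)) (P zero)
                ≈⟨ solve 2 (λ x y → x :+ :- :1 :* :- y := x :+ y) refl _ _ ⟩
              dot (m zero) (P (suc i)) + dot (m (suc i)) (P zero)
                ≈⟨ comp zero (suc i) (λ ()) ⟩
              0# ∎

    extend′ : ∀ {N D} (P m : Fin D → V N) → LinIndep P →
      (∀ i → dot (m i) (P i) ≈ 0#) →
      (∀ i j → i ≢ j → dot (m i) (P j) + dot (m j) (P i) ≈ 0#) →
      DN (Σ (Alt N) λ B → ∀ i y → app B (P i) y ≈ dot (m i) y)
    extend′ {N} P m li self comp = dual-basis (summable-Fin N) P li >>= λ D →
      return (extend P m (Dual.vec D) (Dual.dual D) self comp)

    -- Two vectors of k^(D+1) are dependent modulo D independent ones.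
    alt-zero : ∀ {D} (P : Fin D → V (suc D)) → LinIndep P → (B : Alt (suc D)) →
      (∀ i y → app B (P i) y ≈ 0#) → ∀ x y → app B x y ≈ 0#
    alt-zero {D} P li B kills x y = stable
      (underdetermined {suc D} {suc (suc D)} ℕ.≤-refl (λ i →
        ev zero Fʳ* x i +F (ev (suc zero) Fʳ* y i +F ΣF (λ j → ev (suc (suc j)) Fʳ* P j i))) >>= go)
      where
        go : _ → DN (app B x y ≈ 0#)
        go (γ , n , z) = lem (γ zero ≈ 0#) >>= λ
          { (inj₂ ξ≉) → return (cancel ξ≉ (begin
              ξ * app B x y                   ≈⟨ solve 2 (λ a b → a := a :+ b :* :0) refl _ _ ⟩
              ξ * app B x y + η * 0#          ≈⟨ +-congˡ (*-congˡ (Alt.alt B y)) ⟨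
              ξ * app B x y + η * app B y y   ≈⟨ rel y ⟩
              0# ∎))
          ; (inj₁ ξ0) → lem (γ (suc zero) ≈ 0#) >>= λ
              { (inj₂ η≉) → return (trans (Alt.anti B x y) (neg-0 (cancel η≉ (begin
                  η * app B y x                   ≈⟨ solve 2 (λ a b → a := b :* :0 :+ a) refl _ _ ⟩
                  ξ * 0# + η * app B y x          ≈⟨ +-congʳ (*-congˡ (Alt.alt B x)) ⟨
                  ξ * app B x x + η * app B y x   ≈⟨ rel x ⟩
                  0# ∎))))
              ; (inj₁ η0) → ⊥-elim (n (λ
                  { zero → ξ0 ; (suc zero) → η0
                  ; (suc (suc j)) → li (λ j → γ (suc (suc j))) (λ i → begin
                      ∑ (λ j → γ (suc (suc j)) * P j i)
                        ≈⟨ solve 1 (λ s → s := :0 :+ (:0 :+ s)) refl _ ⟩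
                      0# + (0# + ∑ (λ j → γ (suc (suc j)) * P j i))
                        ≈⟨ +-cong (*-0ˡ ξ0) (+-congʳ (*-0ˡ η0)) ⟨
                      ξ * x i + (η * y i + ∑ (λ j → γ (suc (suc j)) * P j i))
                        ≈⟨ z i ⟩
                      0# ∎) j })) } }
          where
            ξ = γ zero
            η = γ (suc zero)
            rel : ∀ u → ξ * app B x u + η * app B y u ≈ 0#
            rel u = begin
              ξ * app B x u + η * app B y u
                ≈⟨ solve 2 (λ a b → a :+ b := a :+ (b :+ :0)) refl _ _ ⟩
              ξ * app B x u + (η * app B y u + 0#)
                ≈⟨ +-congˡ (+-congˡ (Σ-0 (λ j → *-0ʳ (kills j u)))) ⟨
              ξ * app B x u + (η * app B y u + ∑ (λ j → γ (suc (suc j)) * app B (P j) u))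
                ≈⟨ +-cong (Func.mul f _ _) (+-cong (Func.mul f _ _) (Func.sum f _ _)) ⟨
              fn f (λ i → ξ * x i) + (fn f (λ i → η * y i) + fn f (lincomb (λ j → γ (suc (suc j))) P))
                ≈⟨ trans (Func.add f _ _) (+-congˡ (Func.add f _ _)) ⟨
              fn f (λ i → ξ * x i + (η * y i + ∑ (λ j → γ (suc (suc j)) * P j i)))
                ≈⟨ Func.zer f z ⟩
              0# ∎
              where f = Alt.form B u

    func-zero : ∀ {D} (P : Fin D → V D) → LinIndep P → (f : Func (Fin D)) →
      (∀ i → fn f (P i) ≈ 0#) → ∀ x → fn f x ≈ 0#
    func-zero {D} P li f kills x = stable
      (underdetermined {D} {suc D} ℕ.≤-refl (λ i → ev zero Fʳ* x i +F ΣF (λ j → ev (suc j) Fʳ* P j i)) >>= go)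
      where
        go : _ → DN (fn f x ≈ 0#)
        go (γ , n , z) = lem (γ zero ≈ 0#) >>= λ
          { (inj₁ γ0) → ⊥-elim (n (λ { zero → γ0 ; (suc j) → li (γ ∘ suc) (λ i → begin
              ∑ (λ j → γ (suc j) * P j i)                 ≈⟨ +-identityˡ _ ⟨
              0# + ∑ (λ j → γ (suc j) * P j i)            ≈⟨ +-congʳ (*-0ˡ γ0) ⟨
              γ zero * x i + ∑ (λ j → γ (suc j) * P j i)  ≈⟨ z i ⟩
              0# ∎) j }))
          ; (inj₂ γ≉) → return (cancel γ≉ (begin
              γ zero * fn f x                                           ≈⟨ +-identityʳ _ ⟨
              γ zero * fn f x + 0#                                      ≈⟨ +-congˡ (Σ-0 (λ j → *-0ʳ (kills j))) ⟨
              γ zero * fn f x + ∑ (λ j → γ (suc j) * fn f (P j))        ≈⟨ +-cong (Func.mul f _ _) (Func.sum f _ _) ⟨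
              fn f (λ i → γ zero * x i) + fn f (lincomb (γ ∘ suc) P)    ≈⟨ Func.add f _ _ ⟨
              fn f (λ i → γ zero * x i + ∑ (λ j → γ (suc j) * P j i))   ≈⟨ Func.zer f z ⟩
              0# ∎)) }

    cons : ∀ {D N} → V N → (Fin D → V N) → Fin (suc D) → V N
    cons q P zero    = q
    cons q P (suc i) = P i

    -- Some nonzero functional kills all the P j; a unit vector on which it does not vanish lies
    -- outside their span.
    complete : ∀ {D} (P : Fin D → V (suc D)) → LinIndep P → DN (∃[ q ] LinIndep (cons q P))
    complete {D} P li = underdetermined {D} {suc D} ℕ.≤-refl (λ j → ΣF (λ i → ev i Fʳ* P j i)) >>= λ { (f , nf , kills) →
      find≉0 nf >>= λ { (i , fi) → return (δ i , λ γ z →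
        let γ0 : γ zero ≈ 0#
            γ0 = cancel fi (begin
              f i * γ zero                                              ≈⟨ *-comm _ _ ⟩
              γ zero * f i                                              ≈⟨ *-congˡ (dot-δ f i) ⟨
              γ zero * dot f (δ i)                                      ≈⟨ +-identityʳ _ ⟨
              γ zero * dot f (δ i) + 0#                                 ≈⟨ +-congˡ (Σ-0 (λ j → *-0ʳ (kills j))) ⟨
              γ zero * dot f (δ i) + ∑ (λ j → γ (suc j) * dot f (P j))  ≈⟨ ∑-suc _ ⟨
              ∑ (λ j → γ j * dot f (cons (δ i) P j))                    ≈⟨ Func.sum (dotF f) γ (cons (δ i) P) ⟨
              dot f (lincomb γ (cons (δ i) P))                          ≈⟨ Func.zer (dotF f) z ⟩
              0#                                                        ∎)
        in λ { zero → γ0 ; (suc j) → li (λ j → γ (suc j)) (λ k → begin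
              ∑ (λ j → γ (suc j) * P j k)                               ≈⟨ +-identityˡ _ ⟨
              0# + ∑ (λ j → γ (suc j) * P j k)                          ≈⟨ +-congʳ (*-0ˡ γ0) ⟨
              γ zero * δ i k + ∑ (λ j → γ (suc j) * P j k)              ≈⟨ ∑-suc _ ⟨
              ∑ (λ j → γ j * cons (δ i) P j k)                          ≈⟨ z k ⟩
              0#                                                        ∎) j }) } }

    Injective : ∀ {x} {X : Set x} {U : Set} → (X → Func U) → Set (c ⊔ ℓ ⊔ x)
    Injective A = ∀ m → (∀ x → fn (A x) m ≈ 0#) → ∀ u → m u ≈ 0#

    -- Stands for "all but finitely many scalars". Requiring the property from some index on along
    -- every injective sequence avoids listing the exceptions and makes conjunction a maximum of two
    -- indices.
    record Cof {q} (Q : Carrier → Set q) : Set (c ⊔ ℓ ⊔ q) where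
      constructor cof
      field
        along : ∀ (e : ℕ → Carrier) → (∀ i j → e i ≈ e j → i ≡ j) → DN (∃[ n ] (∀ i → n ≤ i → Q (e i)))

    open Cof public

    cof-∧ : ∀ {p q} {P : Carrier → Set p} {Q : Carrier → Set q} → Cof P → Cof Q → Cof (λ s → P s × Q s)
    cof-∧ cp cq .along e ie = along cp e ie >>= λ { (n , f) → along cq e ie >>= λ { (m , g) →
      return (n ℕ.⊔ m , λ i le → f i (ℕ.≤-trans (ℕ.m≤m⊔n n m) le) , g i (ℕ.≤-trans (ℕ.m≤n⊔m n m) le)) } }

    cof-map : ∀ {p q} {P : Carrier → Set p} {Q : Carrier → Set q} → (∀ {s} → P s → Q s) → Cof P → Cof Q
    cof-map h cp .along e ie = along cp e ie >>= λ { (n , f) → return (n , λ i le → h (f i le)) }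

    cof-≉0 : Cof _≉0
    cof-≉0 .along e ie = lem (∃[ k ] e k ≈ 0#) >>= λ
      { (inj₁ (k , z)) → return (suc k , λ i lt w → ℕ.<-irrefl (ie k i (trans z (sym w))) lt)
      ; (inj₂ n) → return (0 , λ i _ z → n (i , z)) }

    -- A solution of A + sᵢB is an eigenvector for the eigenvalue 1/sᵢ, and
    -- eigenvectors for distinct eigenvalues are independent.
    module Pencil {x} {X : Set x} {U : Set} (A B : X → Func U) (inj : Injective A) where

      Sol : Carrier → (U → Carrier) → Set (ℓ ⊔ x)
      Sol s m = ∀ x → fn (A x) m + s * fn (B x) m ≈ 0#

      sol-≉0 : ∀ {s m} → Sol s m → ¬ (∀ u → m u ≈ 0#) → s ≉0
      sol-≉0 {s} {m} so n z = n (inj m (λ x → trans (sym (trans (+-congˡ (*-0ˡ z)) (+-identityʳ _))) (so x)))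

      eigen : ∀ {r} (s : Fin r → Carrier) (m : Fin r → U → Carrier) →
        (∀ i j → i ≢ j → ¬ (s i ≈ s j)) → (∀ i → Sol (s i) (m i)) → (∀ i → ¬ (∀ u → m i u ≈ 0#)) → LinIndep m
      eigen {zero} s m di so nz γ rel ()
      eigen {suc r} s m di so nz γ rel = λ { zero → γ0 ; (suc j) → γs j }
        where
          μ : Fin (suc r) → Carrier
          μ i = inv (s i) (sol-≉0 (so i) (nz i))

          -- Since A mᵢ = -sᵢ B mᵢ, the map A sends this combination to minus B of the given
          -- relation, which is zero; A is injective. Subtracting `μ zero` times the relation then
          -- removes its first term.
          rel₂ : ∀ u → lincomb (λ i → μ i * γ i) m u ≈ 0#
          rel₂ = inj _ (λ x → begin
            fn (A x) (lincomb (λ i → μ i * γ i) m)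
              ≈⟨ Func.sum (A x) _ _ ⟩
            ∑ (λ i → μ i * γ i * fn (A x) (m i))
              ≈⟨ Σ-cong (λ i → begin
                   μ i * γ i * fn (A x) (m i)
                     ≈⟨ solve 5 (λ μ g a s b → μ :* g :* a := μ :* g :* (a :+ s :* b) :- s :* μ :* (g :* b)) refl _ _ _ _ _ ⟩
                   μ i * γ i * (fn (A x) (m i) + s i * fn (B x) (m i)) - s i * μ i * (γ i * fn (B x) (m i))
                     ≈⟨ +-cong (*-0ʳ (so i x)) (-‿cong (*-congʳ (inv-r _))) ⟩
                   0# - 1# * (γ i * fn (B x) (m i))
                     ≈⟨ solve 1 (λ y → :0 :- :1 :* y := :- y) refl _ ⟩
                   - (γ i * fn (B x) (m i)) ∎) ⟩
            ∑ (λ i → - (γ i * fn (B x) (m i)))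
              ≈⟨ Σ-neg _ ⟩
            - ∑ (λ i → γ i * fn (B x) (m i))
              ≈⟨ -‿cong (Func.sum (B x) γ m) ⟨
            - fn (B x) (lincomb γ m)
              ≈⟨ neg-0 (Func.zer (B x) rel) ⟩
            0# ∎)

          tail-rel : ∀ u → lincomb (λ i → (μ (suc i) - μ zero) * γ (suc i)) (m ∘ suc) u ≈ 0#
          tail-rel u = begin
            ∑ (λ i → (μ (suc i) - μ zero) * γ (suc i) * m (suc i) u)
              ≈⟨ solve 3 (λ a g t → t := (a :- a) :* g :+ t) refl (μ zero) (γ zero * m zero u) _ ⟩
            (μ zero - μ zero) * (γ zero * m zero u) + ∑ (λ i → (μ (suc i) - μ zero) * γ (suc i) * m (suc i) u)
              ≈⟨ +-congʳ (sym (*-assoc _ _ _)) ⟩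
            (μ zero - μ zero) * γ zero * m zero u + ∑ (λ i → (μ (suc i) - μ zero) * γ (suc i) * m (suc i) u)
              ≈⟨ ∑-suc _ ⟨
            ∑ (λ i → (μ i - μ zero) * γ i * m i u)
              ≈⟨ Σ-cong (λ i → solve 4 (λ a b g x → (a :- b) :* g :* x := a :* g :* x :- b :* (g :* x)) refl _ _ _ _) ⟩
            ∑ (λ i → μ i * γ i * m i u - μ zero * (γ i * m i u))
              ≈⟨ trans (Σ-sub _ _) (+-congˡ (-‿cong (Σ-* _ _))) ⟩
            ∑ (λ i → μ i * γ i * m i u) - μ zero * ∑ (λ i → γ i * m i u)
              ≈⟨ +-0 (rel₂ u) (neg-0 (*-0ʳ (rel u))) ⟩
            0# ∎

          μ-≢ : ∀ j → (μ (suc j) - μ zero) ≉0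
          μ-≢ j z = di (suc j) zero (λ ()) (begin
            s (suc j)                                 ≈⟨ *-identityʳ _ ⟨
            s (suc j) * 1#                            ≈⟨ *-congˡ (inv-r _) ⟨
            s (suc j) * (s zero * μ zero)             ≈⟨ solve 4 (λ s t a b → s :* (t :* b) := t :* (s :* a) :- s :* t :* (a :- b)) refl _ _ (μ (suc j)) _ ⟩
            s zero * (s (suc j) * μ (suc j)) - s (suc j) * s zero * (μ (suc j) - μ zero)
                                                      ≈⟨ +-cong (*-congˡ (inv-r _)) (neg-0 (*-0ʳ z)) ⟩
            s zero * 1# + 0#                          ≈⟨ trans (+-identityʳ _) (*-identityʳ _) ⟩
            s zero ∎)

          γs : ∀ j → γ (suc j) ≈ 0#
          γs j = cancel (μ-≢ j) (eigen (s ∘ suc) (m ∘ suc) (λ i j n → di _ _ (n ∘ Fin.suc-injective))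
            (so ∘ suc) (nz ∘ suc) _ tail-rel j)

          γ0 : γ zero ≈ 0#
          γ0 = stable (find≉0 (nz zero) >>= λ { (u , n) → return (cancel n (begin
            m zero u * γ zero                                     ≈⟨ *-comm _ _ ⟩
            γ zero * m zero u                                     ≈⟨ +-identityʳ _ ⟨
            γ zero * m zero u + 0#                                ≈⟨ +-congˡ (Σ-0 (λ j → *-0ˡ (γs j))) ⟨
            γ zero * m zero u + ∑ (λ j → γ (suc j) * m (suc j) u) ≈⟨ ∑-suc _ ⟨
            lincomb γ m u                                         ≈⟨ rel u ⟩
            0# ∎)) })

      Good : Carrier → Set (c ⊔ ℓ ⊔ x)
      Good s = ∀ m → Sol s m → ∀ u → m u ≈ 0#

      Good-stable : ∀ {s} → DN (Good s) → Good s
      Good-stable g m so u = stable (g >>= λ h → return (h m so u))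

      record Bad (e : ℕ → Carrier) (r : ℕ) : Set (c ⊔ ℓ ⊔ x) where
        field
          bnd  : ℕ
          idx  : Fin r → ℕ
          idx< : ∀ i → idx i < bnd
          inje : ∀ i j → idx i ≡ idx j → i ≡ j
          vec  : Fin r → U → Carrier
          sol  : ∀ i → Sol (e (idx i)) (vec i)
          nz   : ∀ i → ¬ (∀ u → vec i u ≈ 0#)

      -- If bad scalars kept appearing along the sequence, M + 1 of them could be collected, each
      -- with a nonzero solution; by `eigen` these are independent, too many for M coordinates.
      cofinite : ∀ {M} → Size U M → Cof Good
      cofinite {M} su .along e ie none = bad (suc M) too-many
        where
          step : ∀ {r} → Bad e r → DN (Bad e (suc r))
          step b k = none (Bad.bnd b , λ i le → Good-stable (λ ng → ng (λ m so → λ u → stable (λ nu →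
            k (record
              { bnd = suc i
              ; idx = λ { zero → i ; (suc j) → Bad.idx b j }
              ; idx< = λ { zero → ℕ.≤-refl ; (suc j) → ℕ.m≤n⇒m≤1+n (ℕ.≤-trans (Bad.idx< b j) le) }
              ; inje = λ { zero zero _ → ≡.refl
                         ; zero (suc j) q → ⊥-elim (ℕ.<-irrefl (≡.sym q) (ℕ.<-≤-trans (Bad.idx< b j) le))
                         ; (suc j) zero q → ⊥-elim (ℕ.<-irrefl q (ℕ.<-≤-trans (Bad.idx< b j) le))
                         ; (suc i') (suc j) q → ≡.cong suc (Bad.inje b i' j q) }
              ; vec = λ { zero → m ; (suc j) → Bad.vec b j }
              ; sol = λ { zero → so ; (suc j) → Bad.sol b j }
              ; nz = λ { zero z → nu (z u) ; (suc j) → Bad.nz b j } })))))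

          bad : ∀ r → DN (Bad e r)
          bad zero = return (record { bnd = 0 ; idx = λ () ; idx< = λ () ; inje = λ () ; vec = λ () ; sol = λ () ; nz = λ () })
          bad (suc r) = bad r >>= step

          too-many : Bad e (suc M) → ⊥
          too-many b = ℕ.<-irrefl ≡.refl (spanned-bound su ev (Bad.vec b)
            (eigen (e ∘ Bad.idx b) (Bad.vec b) (λ i j n q → n (Bad.inje b i j (ie _ _ q))) (Bad.sol b) (Bad.nz b))
            (λ j → return (Bad.vec b j , λ a → refl)))

    Pts : ℕ → ℕ → Set c
    Pts n N = Fin n → V N

    line : ∀ {n N} → Pts n N → Pts n N → Carrier → Pts n N
    line a b s v i = a v i + s * (b v i - a v i)

    -- Zariski openness tested on lines only; this is enough to combine finitely many conditions.
    record Open {q} {n N} (P : Pts n N → Set q) : Set (c ⊔ ℓ ⊔ q) where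
      field
        resp : ∀ {a b} → (∀ v → a v ≐ b v) → P a → P b
        open′ : ∀ a b → P a → Cof (λ s → P (line a b s))

    open-∧ : ∀ {p q} {n N} {P : Pts n N → Set p} {Q : Pts n N → Set q} →
      Open P → Open Q → Open (λ a → P a × Q a)
    open-∧ op oq = record
      { resp = λ { e (x , y) → Open.resp op e x , Open.resp oq e y }
      ; open′ = λ { a b (x , y) → cof-∧ (Open.open′ op a b x) (Open.open′ oq a b y) } }

    open-∀ : ∀ {p} {n N k} {P : Fin k → Pts n N → Set p} → (∀ i → Open (P i)) → Open (λ a → ∀ i → P i a)
    open-∀ {k = zero} o = record { resp = λ _ _ → λ () ; open′ = λ a b _ → cof (λ e _ → return (0 , λ i _ → λ ())) }
    open-∀ {k = suc k} {P = P} o = record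
      { resp = λ e f i → Open.resp (o i) e (f i)
      ; open′ = λ a b f → cof-map (λ { (x , y) → λ { zero → x ; (suc i) → y i } })
          (Open.open′ (open-∧ (o zero) (open-∀ (o ∘ suc))) a b (f zero , f ∘ suc)) }

    open-∀Vec : ∀ {p} {n N k m} {P : Vec (Fin k) m → Pts n N → Set p} →
      (∀ v → Open (P v)) → Open (λ a → ∀ v → P v a)
    open-∀Vec {m = zero} o = record
      { resp = λ e f v → Open.resp (o v) e (f v)
      ; open′ = λ a b f → cof-map (λ x → λ { [] → x }) (Open.open′ (o []) a b (f [])) }
    open-∀Vec {m = suc m} o = record
      { resp = λ e f v → Open.resp (o v) e (f v)
      ; open′ = λ a b f → cof-map (λ x → λ { (i ∷ v) → x i v })
          (Open.open′ (open-∀ (λ i → open-∀Vec (λ v → o (i ∷ v)))) a b (λ i v → f (i ∷ v))) }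

    open-const : ∀ {p q} {n N} {A : Set q} {P : Pts n N → Set p} → (A → Open P) → Open (λ a → A → P a)
    open-const {A = A} o = record
      { resp = λ e f x → Open.resp (o x) e (f x)
      ; open′ = λ a b f → cof λ e ie → lem A >>= λ
          { (inj₁ x) → along (Open.open′ (o x) a b (f x)) e ie >>= λ { (n , g) → return (n , λ i le _ → g i le) }
          ; (inj₂ na) → return (0 , λ i _ x → ⊥-elim (na x)) } }

    -- Along the line joining the two witnesses both conditions hold for almost all parameters. The
    -- second is read from the other end, whence the sequence 1 - e i.
    meet : ∀ {p q} {n N} {P : Pts n N → Set p} {Q : Pts n N → Set q} → Open P → Open Q →
      DN (∃[ a ] P a) → DN (∃[ a ] Q a) → DN (∃[ a ] (P a × Q a))
    meet {P = P} {Q} op oq wp wq = wp >>= λ { (a , pa) → wq >>= λ { (b , qb) →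
      along (Open.open′ op a b pa) e ie >>= λ { (n₁ , f) →
      along (Open.open′ oq b a qb) (λ i → 1# - e i) (λ i j q → ie i j (flip q)) >>= λ { (n₂ , g) →
      return (line a b (e (n₁ ℕ.⊔ n₂)) , f _ (ℕ.m≤m⊔n n₁ n₂) , Open.resp oq
        (λ v i → solve 3 (λ a b s → b :+ (:1 :- s) :* (a :- b) := a :+ s :* (b :- a)) refl _ _ _)
        (g _ (ℕ.m≤n⊔m n₁ n₂))) } } } }
      where
        e = proj₁ infinite
        ie = proj₂ infinite
        flip : ∀ {x y} → 1# - x ≈ 1# - y → x ≈ y
        flip {x} {y} q = begin
          x                 ≈⟨ solve 1 (λ x → x := :1 :- (:1 :- x)) refl _ ⟩
          1# - (1# - x)     ≈⟨ +-congˡ (-‿cong q) ⟩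
          1# - (1# - y)     ≈⟨ solve 1 (λ x → :1 :- (:1 :- x) := x) refl _ ⟩
          y                 ∎

    meet-∀ : ∀ {p} {n N k} {P : Fin k → Pts n N → Set p} → (∀ i → Open (P i)) →
      (∀ i → DN (∃[ a ] P i a)) → DN (∃[ a ] ∀ i → P i a)
    meet-∀ {k = zero}  o w = return ((λ _ _ → 0#) , λ ())
    meet-∀ {k = suc k} o w = meet (o zero) (open-∀ (o ∘ suc)) (w zero) (meet-∀ (o ∘ suc) (w ∘ suc)) >>= λ
      { (a , x , y) → return (a , λ { zero → x ; (suc i) → y i }) }

    meet-∀Vec : ∀ {p} {n N k m} {P : Vec (Fin k) m → Pts n N → Set p} →
      (∀ v → Open (P v)) → (∀ v → DN (∃[ a ] P v a)) → DN (∃[ a ] ∀ v → P v a)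
    meet-∀Vec {m = zero}  o w = w [] >>= λ { (a , x) → return (a , λ { [] → x }) }
    meet-∀Vec {m = suc m} o w = meet-∀ (λ i → open-∀Vec (λ v → o (i ∷ v)))
      (λ i → meet-∀Vec (λ v → o (i ∷ v)) (λ v → w (i ∷ v))) >>= λ { (a , x) → return (a , λ { (i ∷ v) → x i v }) }

    witness-→ : ∀ {p q} {n N} {A : Set q} {P : Pts n N → Set p} → (A → DN (∃[ a ] P a)) → DN (∃[ a ] (A → P a))
    witness-→ {A = A} w = lem A >>= λ
      { (inj₁ x) → w x >>= λ { (a , y) → return (a , λ _ → y) }
      ; (inj₂ na) → return ((λ _ _ → 0#) , λ x → ⊥-elim (na x)) }

    -- An equation on U whose coefficients are affine in the points along each line, so that a
    -- system of them restricts to a pencil A + sB.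
    record PFunc (n N : ℕ) (U : Set) : Set (c ⊔ ℓ) where
      field
        at     : Pts n N → Func U
        resp   : ∀ {a b} → (∀ v → a v ≐ b v) → ∀ m → fn (at a) m ≈ fn (at b) m
        affine : ∀ a b s m → fn (at (line a b s)) m ≈ fn (at a) m + s * (fn (at b) m - fn (at a) m)

    open PFunc public using (at)

    constP : ∀ {n N U} → Func U → PFunc n N U
    constP f = record { at = λ _ → f ; resp = λ _ _ → refl
      ; affine = λ a b s m → solve 2 (λ f s → f := f :+ s :* (f :- f)) refl _ _ }

    infixl 6 _+P_
    _+P_ : ∀ {n N U} → PFunc n N U → PFunc n N U → PFunc n N U
    f +P g = record
      { at = λ a → at f a +F at g a
      ; resp = λ e m → +-cong (PFunc.resp f e m) (PFunc.resp g e m)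
      ; affine = λ a b s m → trans (+-cong (PFunc.affine f a b s m) (PFunc.affine g a b s m))
          (solve 5 (λ f g s f' g' → (f :+ s :* (f' :- f)) :+ (g :+ s :* (g' :- g))
            := (f :+ g) :+ s :* ((f' :+ g') :- (f :+ g))) refl _ _ _ _ _) }

    atP : ∀ {n N U} → (Fin N → Func U) → Fin n → PFunc n N U
    atP μ v = record
      { at = λ p → ΣF (λ i → μ i Fʳ* p v i)
      ; resp = λ e m → Σ-cong (λ i → *-congˡ (e v i))
      ; affine = λ a b s m → trans (Σ-cong (λ i →
            solve 4 (λ μ a b s → μ :* (a :+ s :* (b :- a)) := μ :* a :+ s :* (μ :* b :- μ :* a)) refl _ _ _ _))
          (trans (Σ-+ _ _) (+-congˡ (trans (Σ-* _ _) (*-congˡ (Σ-sub _ _))))) }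

    ΣP : ∀ {n N U k} → (Fin k → PFunc n N U) → PFunc n N U
    ΣP f = record
      { at = λ a → ΣF (λ i → at (f i) a)
      ; resp = λ e m → Σ-cong (λ i → PFunc.resp (f i) e m)
      ; affine = λ a b s m → trans (Σ-cong (λ i → PFunc.affine (f i) a b s m))
          (trans (Σ-+ _ _) (+-congˡ (trans (Σ-* _ _) (*-congˡ (Σ-sub _ _))))) }

    -- On the line from a to b the system is the pencil with A its value at a and B the difference
    -- of its values at b and a, so `Pencil.cofinite` applies.
    open-injective : ∀ {x n N M} {X : Set x} {U : Set} → Size U M → (A : X → PFunc n N U) →
      Open (λ p → Injective (λ x → at (A x) p))
    open-injective su A = record
      { resp = λ e f m z → f m (λ x → trans (PFunc.resp (A x) e m) (z x))
      ; open′ = λ a b f → cof-map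
          (λ {s} g m z → g m (λ x → trans (sym (trans (PFunc.affine (A x) a b s m)
            (+-congˡ (*-congˡ (+-congˡ (solve 1 (λ y → :- y := :- :1 :* y) refl _)))))) (z x)))
          (Pencil.cofinite (λ x → at (A x) a) (λ x → at (A x) b +F (- 1#) *F at (A x) a) f su) }

    at-pts : ∀ {n N D} → Pts n N → Vec (Fin n) D → Fin D → V N
    at-pts p ρ i = p (lookup ρ i)

    Ind : ∀ {n N} → ℕ → Pts n N → Set (c ⊔ ℓ)
    Ind {n} D p = ∀ (ρ : Vec (Fin n) D) → Distinct ρ → LinIndep (at-pts p ρ)

    coordP : ∀ {n N U} → Func U → Fin n → Fin N → PFunc n N U
    coordP f v i = record
      { at = λ p → f Fʳ* p v i
      ; resp = λ e m → *-congˡ (e v i)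
      ; affine = λ a b s m →
          solve 4 (λ f a b s → f :* (a :+ s :* (b :- a)) := f :* a :+ s :* (f :* b :- f :* a)) refl _ _ _ _ }

    open-Ind : ∀ {n N} D → Open {n = n} {N} (Ind D)
    open-Ind D = open-∀Vec (λ ρ → open-const (λ _ → open-injective (↔-refl) (λ i → ΣP (λ j → coordP (ev j) (lookup ρ j) i))))

    δ-inj : ∀ {k m} (f : Fin k → Fin m) → (∀ i j → f i ≡ f j → i ≡ j) → ∀ i j → δ (f i) (f j) ≡ δ i j
    δ-inj f inj i j with i Fin.≟ j
    ... | yes ≡.refl = δ-≡ (f i)
    ... | no n       = δ-≢ (λ e → n (inj i j e))

    -- No explicit configuration in general position is constructed: by openness each list of D
    -- vertices may have its own witness, which sends that list to unit vectors.
    exists-Ind : ∀ {n N} D → D ≤ N → DN (∃[ p ] Ind {n} {N} D p)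
    exists-Ind {n} {N} D le = meet-∀Vec
      (λ ρ → open-const (λ _ → open-injective (↔-refl) (λ i → ΣP (λ j → coordP (ev j) (lookup ρ j) i))))
      (λ ρ → witness-→ (λ d → return (p ρ , indep ρ d)))
      where
        ι : Fin D → Fin N
        ι j = Fin.inject≤ j le

        p : Vec (Fin n) D → Pts n N
        p ρ v i = ∑ (λ j → δ (ι j) i * δ (lookup ρ j) v)

        value : ∀ ρ → Distinct ρ → ∀ j k → p ρ (lookup ρ j) (ι k) ≈ δ k j
        value ρ d j k = begin
          ∑ (λ j' → δ (ι j') (ι k) * δ (lookup ρ j') (lookup ρ j))
            ≈⟨ Σ-cong (λ j' → trans (*-cong (reflexive (δ-inj ι (λ i i' → Fin.inject≤-injective le le i i') j' k))
                 (reflexive (δ-inj (lookup ρ) d j' j))) (*-comm _ _)) ⟩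
          ∑ (λ j' → δ j' j * δ j' k)
            ≈⟨ Σ-δʳ k (λ j' → δ j' j) ⟩
          δ k j ∎

        indep : ∀ ρ → Distinct ρ → LinIndep (at-pts (p ρ) ρ)
        indep ρ d γ z k = begin
          γ k                                         ≈⟨ Σ-δ k γ ⟨
          ∑ (λ j → δ k j * γ j)                       ≈⟨ Σ-cong (λ j → trans (*-comm _ _) (*-congˡ (sym (value ρ d j k)))) ⟩
          ∑ (λ j → γ j * p ρ (lookup ρ j) (ι k))      ≈⟨ z (ι k) ⟩
          0#                                          ∎

  module _ (n : ℕ) where

    -- Two-dimensional cycles as alternating functions of three vertices

    module Cycles where

      Tri : Set c
      Tri = Fin n → Fin n → Fin n → Carrier

      record Alt₂ (r : Fin n → Fin n → Carrier) : Set ℓ where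
        field
          anti : ∀ a b → r a b ≈ - r b a
          diag : ∀ a → r a a ≈ 0#

      record Cyc₂ (r : Fin n → Fin n → Carrier) : Set ℓ where
        field
          alt₂  : Alt₂ r
          cycle : ∀ a → ∑ (r a) ≈ 0#
        open Alt₂ alt₂ public

      -- The value at (a, b, c) is the coefficient of an oriented triangle, and `cycle` is the
      -- vanishing of the boundary at the edge ab. No ambient complex is fixed, which leaves room
      -- for contractions and for triangles outside Δ.
      record Cyc (z : Tri) : Set ℓ where
        field
          sw    : ∀ a b c → z a b c ≈ - z b a c
          sw′   : ∀ a b c → z a b c ≈ - z a c b
          dg    : ∀ a c → z a a c ≈ 0#
          cycle : ∀ a b → ∑ (z a b) ≈ 0#

        rot : ∀ a b c → z a b c ≈ z b c a
        rot a b c = trans (sw a b c) (trans (-‿cong (sw′ b a c)) (-‿involutive _))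

        rot² : ∀ a b c → z a b c ≈ z c a b
        rot² a b c = trans (rot a b c) (rot b c a)

        dg₂₃ : ∀ a b → z a b b ≈ 0#
        dg₂₃ a b = trans (rot a b b) (dg b a)

        dg₁₃ : ∀ a b → z a b a ≈ 0#
        dg₁₃ a b = trans (rot² a b a) (dg a b)

        linkAt : ∀ a → Cyc₂ (z a)
        linkAt a = record { alt₂ = record { anti = sw′ a ; diag = dg₂₃ a } ; cycle = cycle a }

        ≢₁₂ : ∀ {a b c} → z a b c ≉0 → a ≢ b
        ≢₁₂ n ≡.refl = n (dg _ _)

        ≢₂₃ : ∀ {a b c} → z a b c ≉0 → b ≢ c
        ≢₂₃ n ≡.refl = n (dg₂₃ _ _)

        ≢₁₃ : ∀ {a b c} → z a b c ≉0 → a ≢ c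
        ≢₁₃ n ≡.refl = n (dg₁₃ _ _)

      cyc-sub : ∀ {z y} → Cyc z → Cyc y → ∀ t → Cyc (λ a b c → z a b c - t * y a b c)
      cyc-sub {z} {y} cz cy t = record
        { sw = λ a b c → trans (+-cong (Cyc.sw cz a b c) (-‿cong (*-congˡ (Cyc.sw cy a b c))))
            (solve 3 (λ z t y → :- z :- t :* :- y := :- (z :- t :* y)) refl _ _ _)
        ; sw′ = λ a b c → trans (+-cong (Cyc.sw′ cz a b c) (-‿cong (*-congˡ (Cyc.sw′ cy a b c))))
            (solve 3 (λ z t y → :- z :- t :* :- y := :- (z :- t :* y)) refl _ _ _)
        ; dg = λ a c → +-0 (Cyc.dg cz a c) (neg-0 (*-0ʳ (Cyc.dg cy a c)))
        ; cycle = λ a b → trans (Σ-sub _ _) (+-0 (Cyc.cycle cz a b) (neg-0 (trans (Σ-* _ _) (*-0ʳ (Cyc.cycle cy a b))))) }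

      cyc-scale : ∀ {y} → Cyc y → ∀ t → Cyc (λ a b c → t * y a b c)
      cyc-scale cy t = record
        { sw = λ a b c → trans (*-congˡ (Cyc.sw cy a b c)) (solve 2 (λ t y → t :* :- y := :- (t :* y)) refl _ _)
        ; sw′ = λ a b c → trans (*-congˡ (Cyc.sw′ cy a b c)) (solve 2 (λ t y → t :* :- y := :- (t :* y)) refl _ _)
        ; dg = λ a c → *-0ʳ (Cyc.dg cy a c)
        ; cycle = λ a b → trans (Σ-* _ _) (*-0ʳ (Cyc.cycle cy a b)) }

      cyc-+ : ∀ {z y} → Cyc z → Cyc y → Cyc (λ a b c → z a b c + y a b c)
      cyc-+ {z} {y} cz cy = record
        { sw = λ a b c → trans (+-cong (Cyc.sw cz a b c) (Cyc.sw cy a b c)) (solve 2 (λ z y → :- z :+ :- y := :- (z :+ y)) refl _ _)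
        ; sw′ = λ a b c → trans (+-cong (Cyc.sw′ cz a b c) (Cyc.sw′ cy a b c)) (solve 2 (λ z y → :- z :+ :- y := :- (z :+ y)) refl _ _)
        ; dg = λ a c → +-0 (Cyc.dg cz a c) (Cyc.dg cy a c)
        ; cycle = λ a b → trans (Σ-+ _ _) (+-0 (Cyc.cycle cz a b) (Cyc.cycle cy a b)) }

      cyc-∑ : ∀ {m} {y : Fin m → Tri} → (∀ i → Cyc (y i)) → Cyc (λ a b c → ∑ (λ i → y i a b c))
      cyc-∑ cy = record
        { sw = λ a b c → trans (Σ-cong (λ i → Cyc.sw (cy i) a b c)) (Σ-neg _)
        ; sw′ = λ a b c → trans (Σ-cong (λ i → Cyc.sw′ (cy i) a b c)) (Σ-neg _)
        ; dg = λ a c → Σ-0 (λ i → Cyc.dg (cy i) a c)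
        ; cycle = λ a b → trans (Σ-swap _) (Σ-0 (λ i → Cyc.cycle (cy i) a b)) }

      infix 4 _⊑_
      _⊑_ : Tri → Tri → Set ℓ
      y ⊑ z = ∀ a b c → z a b c ≈ 0# → y a b c ≈ 0#

      NonZero : Tri → Set ℓ
      NonZero z = ¬ (∀ a b c → z a b c ≈ 0#)

      find₃ : ∀ {z : Tri} → NonZero z → DN (∃[ a ] ∃[ b ] ∃[ c ] z a b c ≉0)
      find₃ n k = n (λ a b c → stable (λ m → k (a , b , c , m)))

      record Minimal (z : Tri) : Set (c ⊔ ℓ) where
        field
          cyc    : Cyc z
          nonzero : NonZero z
          unique : ∀ y → Cyc y → y ⊑ z → DN (∃[ t ] ∀ a b c → y a b c ≈ t * z a b c)

      minimal-scale : ∀ {z} → Minimal z → ∀ {t} → t ≉0 → Minimal (λ a b c → t * z a b c)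
      minimal-scale {z} mz {t} nt = record
        { cyc = cyc-scale cyc t
        ; nonzero = λ zz → nonzero (λ a b c → cancel nt (zz a b c))
        ; unique = λ y cy le → unique y cy (λ a b c e → le a b c (*-0ʳ e)) >>= λ { (s , e) →
            return (s * inv t nt , λ a b c → trans (e a b c) (begin
              s * z a b c                       ≈⟨ *-congʳ (trans (sym (*-identityʳ _)) (*-congˡ (sym (inv-r nt)))) ⟩
              s * (t * inv t nt) * z a b c      ≈⟨ solve 4 (λ s t i z → s :* (t :* i) :* z := s :* i :* (t :* z)) refl _ _ _ _ ⟩
              s * inv t nt * (t * z a b c)      ∎)) } }
        where open Minimal mz

      -- Encoding triples makes a bound on the support a `Subset`, whose size is the measure for the
      -- recursions below.
      code : Fin n → Fin n → Fin n → Fin (n ℕ.* (n ℕ.* n))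
      code a b c = Fin.combine a (Fin.combine b c)

      code-inj : ∀ {a b c a' b' c'} → code a b c ≡ code a' b' c' → a ≡ a' × b ≡ b' × c ≡ c'
      code-inj {a} {b} {c} {a'} {b'} {c'} e with Fin.combine-injective a _ a' _ e
      ... | p , q with Fin.combine-injective b c b' c' q
      ... | r , s = p , r , s

      Within : Subset (n ℕ.* (n ℕ.* n)) → Tri → Set ℓ
      Within T z = ∀ a b c → z a b c ≉0 → code a b c Sub.∈ T

      cancelled : ∀ {z y : Tri} {a b c} (ny : y a b c ≉0) →
        z a b c - z a b c * inv _ ny * y a b c ≈ 0#
      cancelled {z} {y} {a} {b} {c} ny = begin
        z a b c - z a b c * inv _ ny * y a b c    ≈⟨ solve 3 (λ z i y → z :- z :* i :* y := z :- z :* (y :* i)) refl _ _ _ ⟩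
        z a b c - z a b c * (y a b c * inv _ ny)  ≈⟨ +-congˡ (-‿cong (*-congˡ (inv-r ny))) ⟩
        z a b c - z a b c * 1#                    ≈⟨ solve 1 (λ z → z :- z :* :1 := :0) refl _ ⟩
        0#                                        ∎

      reduce-within : ∀ {z y : Tri} {T a b c} → Within T z → y ⊑ z → (ny : y a b c ≉0) →
        Within (T Sub.- code a b c) (λ a' b' c' → z a' b' c' - z a b c * inv _ ny * y a' b' c')
      reduce-within {z} {y} {T} {a} {b} {c} wz le ny a' b' c' nr = Sub.x∈p∧x≢y⇒x∈p-y
        (wz a' b' c' (λ zz → nr (+-0 zz (neg-0 (*-0ʳ (le _ _ _ zz))))))
        (λ e → absurd (code-inj e))
        where
          absurd : a' ≡ a × b' ≡ b × c' ≡ c → ⊥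
          absurd (≡.refl , ≡.refl , ≡.refl) = nr (cancelled {z} {y} ny)

      ⊑-≉0 : ∀ {y z a b c} → y ⊑ z → y a b c ≉0 → z a b c ≉0
      ⊑-≉0 le ny zz = ny (le _ _ _ zz)

      -- If z is not minimal, some cycle y within z is not a multiple of it. Subtracting the
      -- multiple of y that cancels one coefficient shrinks the support, and the result is nonzero,
      -- for otherwise y would be a multiple of z.
      exists-minimal : ∀ k {z T} → ∣ T ∣ ≤ k → Within T z → Cyc z → NonZero z →
        DN (∃[ y ] Minimal y × y ⊑ z)
      exists-minimal zero {z} {T} le wz cz nz = find₃ nz >>= λ { (a , b , c , ne) →
        ⊥-elim (ℕ.n≮0 (ℕ.<-≤-trans (Sub.x∈p⇒∣p-x∣<∣p∣ (wz a b c ne)) le)) }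
      exists-minimal (suc k) {z} {T} le wz cz nz = lem (Minimal z) >>= λ
        { (inj₁ mz) → return (z , mz , λ a b c e → e)
        ; (inj₂ nm) → split nm }
        where
          Other : Set (c ⊔ ℓ)
          Other = ∃[ y ] (Cyc y × y ⊑ z × ¬ (∃[ t ] ∀ a b c → y a b c ≈ t * z a b c))

          split : ¬ Minimal z → DN (∃[ y ] Minimal y × y ⊑ z)
          split nm = (λ (k : ¬ Other) → nm (record { cyc = cz ; nonzero = nz
                        ; unique = λ y cy l nt → k (y , cy , l , nt) })) >>= λ { (y , cy , l , nt) →
            find₃ {y} (λ zz → nt (0# , λ a b c → trans (zz a b c) (sym (zeroˡ _)))) >>= λ { (a , b , c , ny) →
            let t = z a b c * inv _ ny
                nzt : t ≉0
                nzt = *-≉0 (⊑-≉0 l ny) (inv-≉0 ny)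
            in exists-minimal k
                (ℕ.≤-pred (ℕ.≤-trans (Sub.x∈p⇒∣p-x∣<∣p∣ (wz a b c (⊑-≉0 l ny))) le))
                (reduce-within wz l ny) (cyc-sub cz cy t)
                (λ zz → nt (inv t nzt , λ a' b' c' → begin
                  y a' b' c'                                  ≈⟨ *-identityˡ _ ⟨
                  1# * y a' b' c'                             ≈⟨ *-congʳ (inv-r nzt) ⟨
                  t * inv t nzt * y a' b' c'
                    ≈⟨ solve 4 (λ t i y z → t :* i :* y := i :* z :- i :* (z :- t :* y)) refl t (inv t nzt) (y a' b' c') (z a' b' c') ⟩
                  inv t nzt * z a' b' c' - inv t nzt * (z a' b' c' - t * y a' b' c')
                    ≈⟨ +-congˡ (neg-0 (*-0ʳ (zz a' b' c'))) ⟩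
                  inv t nzt * z a' b' c' + 0#                 ≈⟨ +-identityʳ _ ⟩
                  inv t nzt * z a' b' c'                      ∎)) >>= λ { (x , mx , lx) →
            return (x , mx , λ a' b' c' e → lx a' b' c' (+-0 e (neg-0 (*-0ʳ (l _ _ _ e))))) } } }

      record Decomposition (z : Tri) : Set (c ⊔ ℓ) where
        field
          size    : ℕ
          part    : Fin size → Tri
          minimal : ∀ i → Minimal (part i)
          within   : ∀ i → part i ⊑ z
          total   : ∀ a b c → z a b c ≈ ∑ (λ i → part i a b c)

      -- Peels off a minimal cycle within z, scaled to cancel one coefficient; the remainder has
      -- smaller support.
      decompose′ : ∀ k {z T} → ∣ T ∣ ≤ k → Within T z → Cyc z → DN (Decomposition z)
      decompose′ k {z} {T} le wz cz = lem (∀ a b c → z a b c ≈ 0#) >>= λ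
        { (inj₁ zz) → return (record { size = 0 ; part = λ () ; minimal = λ () ; within = λ ()
            ; total = λ a b c → trans (zz a b c) (sym (∑-zero _)) })
        ; (inj₂ nz) → peel k le nz }
        where
          peel : ∀ k → ∣ T ∣ ≤ k → NonZero z → DN (Decomposition z)
          peel k le nz = exists-minimal k le wz cz nz >>= λ { (y , my , l) →
            find₃ (Minimal.nonzero my) >>= λ { (a , b , c , ny) → rest k le y my l a b c ny } }
            where
              rest : ∀ k → ∣ T ∣ ≤ k → ∀ y → Minimal y → y ⊑ z → ∀ a b c → y a b c ≉0 → DN (Decomposition z)
              rest zero le y my l a b c ny =
                ⊥-elim (ℕ.n≮0 (ℕ.<-≤-trans (Sub.x∈p⇒∣p-x∣<∣p∣ (wz a b c (⊑-≉0 l ny))) le))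
              rest (suc k) le y my l a b c ny =
                decompose′ k (ℕ.≤-pred (ℕ.≤-trans (Sub.x∈p⇒∣p-x∣<∣p∣ (wz a b c (⊑-≉0 l ny))) le))
                  (reduce-within wz l ny) (cyc-sub cz (Minimal.cyc my) t) >>= λ D → return (record
                    { size = suc (Decomposition.size D)
                    ; part = λ { zero → λ a' b' c' → t * y a' b' c' ; (suc i) → Decomposition.part D i }
                    ; minimal = λ { zero → minimal-scale my (*-≉0 (⊑-≉0 l ny) (inv-≉0 ny)) ; (suc i) → Decomposition.minimal D i }
                    ; within = λ { zero → λ a' b' c' e → *-0ʳ (l _ _ _ e)
                                ; (suc i) → λ a' b' c' e → Decomposition.within D i a' b' c' (+-0 e (neg-0 (*-0ʳ (l _ _ _ e)))) }
                    ; total = λ a' b' c' → begin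
                        z a' b' c'
                          ≈⟨ solve 2 (λ z y → z := y :+ (z :- y)) refl _ (t * y a' b' c') ⟩
                        t * y a' b' c' + (z a' b' c' - t * y a' b' c')
                          ≈⟨ +-congˡ (Decomposition.total D a' b' c') ⟩
                        t * y a' b' c' + ∑ (λ i → Decomposition.part D i a' b' c')
                          ≈⟨ ∑-suc _ ⟨
                        _ ∎ })
                where t = z a b c * inv _ ny

      decompose : ∀ {z} → Cyc z → DN (Decomposition z)
      decompose cz = decompose′ _ {T = Sub.⊤} ℕ.≤-refl (λ a b c _ → Sub.∈⊤) cz

      -- The exterior product of a 0-chain and a 1-chain. For f = v - u and a 1-cycle r it is the
      -- suspension of r with apexes v and u.
      _∧₃_ : (Fin n → Carrier) → (Fin n → Fin n → Carrier) → Tri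
      (f ∧₃ r) a b c = f a * r b c + (- f b * r a c + f c * r a b)

      cyc-∧ : ∀ {f r} → ∑ f ≈ 0# → Cyc₂ r → Cyc (f ∧₃ r)
      cyc-∧ {f} {r} sf cr = record
        { sw = λ a b c → trans (+-congˡ (+-congˡ (*-congˡ (anti a b))))
            (solve 6 (λ fa fb fc rbc rac rba → fa :* rbc :+ (:- fb :* rac :+ fc :* :- rba)
              := :- (fb :* rac :+ (:- fa :* rbc :+ fc :* rba))) refl _ _ _ _ _ _)
        ; sw′ = λ a b c → trans (+-congʳ (*-congˡ (anti b c)))
            (solve 6 (λ fa fb fc rcb rac rab → fa :* :- rcb :+ (:- fb :* rac :+ fc :* rab)
              := :- (fa :* rcb :+ (:- fc :* rab :+ fb :* rac))) refl _ _ _ _ _ _)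
        ; dg = λ a c → trans (+-congˡ (+-congˡ (*-0ʳ (diag a))))
            (solve 2 (λ f r → f :* r :+ (:- f :* r :+ :0) := :0) refl _ _)
        ; cycle = λ a b → begin
            ∑ (λ c → f a * r b c + (- f b * r a c + f c * r a b))
              ≈⟨ trans (Σ-+ _ _) (+-congˡ (Σ-+ _ _)) ⟩
            ∑ (λ c → f a * r b c) + (∑ (λ c → - f b * r a c) + ∑ (λ c → f c * r a b))
              ≈⟨ +-0 (trans (Σ-* _ _) (*-0ʳ (cycle b)))
                   (+-0 (trans (Σ-* _ _) (*-0ʳ (cycle a))) (trans (Σ-*ʳ _ _) (*-0ˡ sf))) ⟩
            0# ∎ }
        where open Cyc₂ cr

      module Close (u : Fin n) where

        -- Turns a 1-chain into a cycle by joining its boundary to u. A cycle is conversely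
        -- recovered by `close` from its edges away from u, as its coefficient on an edge au is
        -- dictated by the cycle condition at a.
        close : (Fin n → Fin n → Carrier) → Fin n → Fin n → Carrier
        close S a b = S a b + (- δ u b * ∑ (S a) + δ u a * ∑ (S b))

        cyc-close : ∀ {S} → Alt₂ S → Cyc₂ (close S)
        cyc-close {S} aS = record
          { alt₂ = record
              { anti = λ a b → trans (+-congʳ (Alt₂.anti aS a b))
                  (solve 5 (λ s x y p q → :- s :+ (:- x :* p :+ y :* q) := :- (s :+ (:- y :* q :+ x :* p))) refl _ _ _ _ _)
              ; diag = λ a → trans (+-congʳ (Alt₂.diag aS a)) (solve 2 (λ x p → :0 :+ (:- x :* p :+ x :* p) := :0) refl _ _) }
          ; cycle = λ a → begin
              ∑ (λ b → S a b + (- δ u b * ∑ (S a) + δ u a * ∑ (S b)))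
                ≈⟨ trans (Σ-+ _ _) (+-congˡ (Σ-+ _ _)) ⟩
              ∑ (S a) + (∑ (λ b → - δ u b * ∑ (S a)) + ∑ (λ b → δ u a * ∑ (S b)))
                ≈⟨ +-congˡ (+-cong (trans (Σ-cong (λ b → solve 2 (λ d s → :- d :* s := d :* :- s) refl _ _)) (Σ-δ u _))
                     (trans (Σ-* _ _) (*-0ʳ (Σ-alt S (Alt₂.anti aS) (Alt₂.diag aS))))) ⟩
              ∑ (S a) + (- ∑ (S a) + 0#)
                ≈⟨ solve 1 (λ s → s :+ (:- s :+ :0) := :0) refl _ ⟩
              0# ∎ }

        χ : Fin n → Carrier
        χ a = 1# - δ u a

        χ-u : χ u ≈ 0#
        χ-u = trans (+-congˡ (-‿cong (reflexive (δ-≡ u)))) (-‿inverseʳ _)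

        χ-≢ : ∀ {a} → u ≢ a → χ a ≈ 1#
        χ-≢ n = trans (+-congˡ (neg-0 (reflexive (δ-≢ n)))) (+-identityʳ _)

        away : (Fin n → Fin n → Carrier) → Fin n → Fin n → Carrier
        away R a b = χ a * χ b * R a b

        alt-away : ∀ {R} → Alt₂ R → Alt₂ (away R)
        alt-away aR = record
          { anti = λ a b → trans (*-congˡ (Alt₂.anti aR a b)) (solve 3 (λ x y r → x :* y :* :- r := :- (y :* x :* r)) refl _ _ _)
          ; diag = λ a → *-0ʳ (Alt₂.diag aR a) }

        at-u : ∀ {R} → Cyc₂ R → ∀ {a} → u ≢ a → R a u ≈ - ∑ (away R a)
        at-u {R} cR {a} na = sym (begin
          - ∑ (λ b → χ a * χ b * R a b)
            ≈⟨ -‿cong (Σ-cong (λ b → trans (*-congʳ (trans (*-congʳ (χ-≢ na)) (*-identityˡ _)))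
                 (solve 2 (λ d r → (:1 :- d) :* r := r :- d :* r) refl _ _))) ⟩
          - ∑ (λ b → R a b - δ u b * R a b)
            ≈⟨ -‿cong (trans (Σ-sub _ _) (+-cong (Cyc₂.cycle cR a) (-‿cong (Σ-δ u (R a))))) ⟩
          - (0# - R a u)
            ≈⟨ solve 1 (λ r → :- (:0 :- r) := r) refl _ ⟩
          R a u ∎)

        close-away : ∀ {R} → Cyc₂ R → ∀ a b → R a b ≈ close (away R) a b
        close-away {R} cR a b = go (u Fin.≟ a) (u Fin.≟ b)
          where
            p = ∑ (away R a)
            q = ∑ (away R b)

            put : ∀ {x y} → δ u a ≡ x → δ u b ≡ y →
              close (away R) a b ≈ (1# - x) * (1# - y) * R a b + (- y * p + x * q)
            put e f = reflexive (≡.cong₂ (λ x y → (1# - x) * (1# - y) * R a b + (- y * p + x * q)) e f)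

            go : Dec (u ≡ a) → Dec (u ≡ b) → R a b ≈ close (away R) a b
            go (yes ≡.refl) (yes ≡.refl) = trans (Cyc₂.diag cR u) (sym (trans (put (δ-≡ u) (δ-≡ u))
              (solve 2 (λ s r → (:1 :- :1) :* (:1 :- :1) :* r :+ (:- :1 :* s :+ :1 :* s) := :0) refl _ _)))
            go (no na) (no nb) = sym (trans (put (δ-≢ na) (δ-≢ nb))
              (solve 3 (λ r p q → (:1 :- :0) :* (:1 :- :0) :* r :+ (:- :0 :* p :+ :0 :* q) := r) refl _ _ _))
            go (no na) (yes ≡.refl) = trans (at-u cR na) (sym (trans (put (δ-≢ na) (δ-≡ u))
              (solve 3 (λ r p q → (:1 :- :0) :* (:1 :- :1) :* r :+ (:- :1 :* p :+ :0 :* q) := :- p) refl _ _ _)))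
            go (yes ≡.refl) (no nb) = trans (Cyc₂.anti cR u b) (trans (-‿cong (at-u cR nb)) (trans (-‿involutive _)
              (sym (trans (put (δ-≡ u) (δ-≢ nb))
                (solve 3 (λ r p q → (:1 :- :1) :* (:1 :- :0) :* r :+ (:- :0 :* p :+ :1 :* q) := q) refl _ _ _)))))

    -- Infinitesimal rigidity in projective 3-space, edge contraction and vertex splitting

    module Rigidity where

      open Geometry
      open Cycles

      -- Rigidity phrased as injectivity, to which `open-injective` applies: pinning one triangle
      -- removes the trivial motions, and vertices off z are held at zero. The vertices of J are
      -- apexes of an iterated cone over z, themselves at rest, which is why `cone` has one term
      -- where `edge` has two.
      module Pins {n' N r : ℕ} (ι : Fin n → Fin n') (J : Fin r → Fin n') (z : Tri) (a₀ b₀ c₀ : Fin n) where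

        data Eq : Set ℓ where
          self : Fin n → Eq
          edge : ∀ a b c → z a b c ≉0 → Eq
          cone : Fin n → Fin r → Eq
          pin  : ∀ a → a ≡ a₀ ⊎ a ≡ b₀ ⊎ a ≡ c₀ → Fin N → Eq
          off  : ∀ a → (∀ b c → z a b c ≈ 0#) → Fin N → Eq

        μ : Fin n → Fin N → Func (Fin n × Fin N)
        μ a i = ev (a , i)

        eq : Eq → PFunc n' N (Fin n × Fin N)
        eq (self a)       = atP (μ a) (ι a)
        eq (edge a b _ _) = atP (μ a) (ι b) +P atP (μ b) (ι a)
        eq (cone a j)     = atP (μ a) (J j)
        eq (pin a _ i)    = constP (μ a i)
        eq (off a _ i)    = constP (μ a i)

        Pin : Pts n' N → Set (c ⊔ ℓ)
        Pin p = Injective (λ x → at (eq x) p)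

        open-Pin : Open Pin
        open-Pin = open-injective (↔-sym Fin.*↔×) eq

      none : Fin 0 → Fin n
      none ()

      open Pins {n} {4} {0} id none using (Pin; open-Pin; self; edge; pin; off)

      record Motion (z : Tri) (p : Pts n 4) (m : Fin n → V 4) : Set ℓ where
        constructor motion
        field
          m-self : ∀ a → dot (m a) (p a) ≈ 0#
          m-edge : ∀ a b c → z a b c ≉0 → dot (m a) (p b) + dot (m b) (p a) ≈ 0#

      -- Alternating forms on k⁴ have dimension six, that of the infinitesimal isometries of
      -- 3-space, whose place they take.
      Trivial : Tri → Pts n 4 → (Fin n → V 4) → Set (c ⊔ ℓ)
      Trivial z p m = Σ (Alt 4) λ B → ∀ a b c → z a b c ≉0 → ∀ y → app B (p a) y ≈ dot (m a) y

      Rigid : Tri → Pts n 4 → Set (c ⊔ ℓ)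
      Rigid z p = ∀ m → Motion z p m → DN (Trivial z p m)

      distinct₃ : ∀ {a b c : Fin n} → a ≢ b → a ≢ c → b ≢ c → Distinct (a ∷ b ∷ c ∷ [])
      distinct₃ ab ac bc = (λ { zero → ab ; (suc zero) → ac }) distinct-∷
        (λ { zero → bc }) distinct-∷ (λ ()) distinct-∷ distinct-[]

      distinct₄ : ∀ {a b c d : Fin n} → a ≢ b → a ≢ c → a ≢ d → b ≢ c → b ≢ d → c ≢ d → Distinct (a ∷ b ∷ c ∷ d ∷ [])
      distinct₄ ab ac ad bc bd cd = (λ { zero → ab ; (suc zero) → ac ; (suc (suc zero)) → ad }) distinct-∷ distinct₃ bc bd cd

      cyc-distinct : ∀ {z} → Cyc z → ∀ {a b c} → z a b c ≉0 → Distinct (a ∷ b ∷ c ∷ [])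
      cyc-distinct cz nz = distinct₃ (Cyc.≢₁₂ cz nz) (Cyc.≢₁₃ cz nz) (Cyc.≢₂₃ cz nz)

      cyc-indep : ∀ {z} → Cyc z → ∀ {p : Pts n 4} → Ind 3 p → ∀ {a b c} → z a b c ≉0 → LinIndep (at-pts p (a ∷ b ∷ c ∷ []))
      cyc-indep cz ind {a} {b} {c} nz = ind (a ∷ b ∷ c ∷ []) (cyc-distinct cz nz)

      kill₃ : ∀ {p : Pts n 4} {a b c} → LinIndep (at-pts p (a ∷ b ∷ c ∷ [])) → (B : Alt 4) →
        (∀ y → app B (p a) y ≈ 0#) → (∀ y → app B (p b) y ≈ 0#) → (∀ y → app B (p c) y ≈ 0#) → ∀ x y → app B x y ≈ 0#
      kill₃ li B ka kb kc = alt-zero _ li B (λ { zero → ka ; (suc zero) → kb ; (suc (suc zero)) → kc })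

      zero-coords : ∀ {N} {f : V N} → (∀ y → dot f y ≈ 0#) → f ≐ zeroV
      zero-coords {f = f} e i = trans (sym (dot-δ f i)) (e (δ i))

      -- A single triangle has only trivial motions: `extend` applied to its three independent
      -- points.
      through : ∀ {p : Pts n 4} {m : Fin n → V 4} {a b c} → LinIndep (at-pts p (a ∷ b ∷ c ∷ [])) → (∀ a → dot (m a) (p a) ≈ 0#) →
        dot (m a) (p b) + dot (m b) (p a) ≈ 0# → dot (m a) (p c) + dot (m c) (p a) ≈ 0# →
        dot (m b) (p c) + dot (m c) (p b) ≈ 0# →
        DN (Σ (Alt 4) λ B → (∀ y → app B (p a) y ≈ dot (m a) y) × (∀ y → app B (p b) y ≈ dot (m b) y)
                           × (∀ y → app B (p c) y ≈ dot (m c) y))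
      through {p} {m} {a} {b} {c} li sf ab ac bc =
        extend′ (at-pts p (a ∷ b ∷ c ∷ [])) (λ i → m (lookup (a ∷ b ∷ c ∷ []) i)) li
          (λ i → sf (lookup (a ∷ b ∷ c ∷ []) i))
          (λ { zero zero n → ⊥-elim (n ≡.refl) ; zero (suc zero) n → ab ; zero (suc (suc zero)) n → ac
             ; (suc zero) zero n → trans (+-comm _ _) ab ; (suc zero) (suc zero) n → ⊥-elim (n ≡.refl)
             ; (suc zero) (suc (suc zero)) n → bc
             ; (suc (suc zero)) zero n → trans (+-comm _ _) ac ; (suc (suc zero)) (suc zero) n → trans (+-comm _ _) bc
             ; (suc (suc zero)) (suc (suc zero)) n → ⊥-elim (n ≡.refl) }) >>= λ { (B , e) →
        return (B , e zero , e (suc zero) , e (suc (suc zero))) }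

      vertex-cases : ∀ (z : Tri) a {x y : Carrier} →
        (∀ b c → z a b c ≉0 → x ≈ y) → ((∀ b c → z a b c ≈ 0#) → x ≈ y) → x ≈ y
      vertex-cases z a f g = by-cases (∀ b c → z a b c ≈ 0#) g
        (λ n → stable (λ k → n (λ b c → stable (λ nz → k (f b c nz)))))

      -- Sets a vector field to zero on A; as membership in A need not be decidable, the new field
      -- exists up to double negation only.
      masked : ∀ {q N} (A : Fin n → Set q) (f : Fin n → V N) →
        DN (∃[ g ] (∀ a → ¬ A a → g a ≐ f a) × (∀ a → A a → g a ≐ zeroV))
      masked {N = N} A f = dn-Fin {P = λ a → Σ (V N) λ g → (¬ A a → g ≐ f a) × (A a → g ≐ zeroV)} (λ a → lem (A a) >>= λ
        { (inj₁ x) → return ((λ _ → 0#) , (λ nx → ⊥-elim (nx x)) , (λ _ _ → refl))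
        ; (inj₂ nx) → return (f a , (λ _ _ → refl) , (λ x → ⊥-elim (nx x))) }) >>= λ g →
        return ((λ a → proj₁ (g a)) , (λ a → proj₁ (proj₂ (g a))) , (λ a → proj₂ (proj₂ (g a))))

      Rigid⇒Pin : ∀ {z p a b c} → Cyc z → Ind 3 p → z a b c ≉0 → Rigid z p → Pin z a b c p
      Rigid⇒Pin {z} {p} {a} {b} {c} cz ind nz rig m e (x , i) = stable
        (rig m' (motion (λ a → e (self a)) (λ a b c nz → e (edge a b c nz))) >>= λ { (B , match) →
        let pinned : ∀ d → d ≡ a ⊎ d ≡ b ⊎ d ≡ c → ∀ d' d'' → z d d' d'' ≉0 → ∀ y → app B (p d) y ≈ 0#
            pinned d w d' d'' nz y = trans (match d d' d'' nz y) (dot-0ˡ (λ i → e (pin d w i)))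
            B0 = kill₃ {p} (cyc-indep cz {p} ind nz) B
              (pinned a (inj₁ ≡.refl) b c nz)
              (pinned b (inj₂ (inj₁ ≡.refl)) c a (≉0-resp (Cyc.rot cz a b c) nz))
              (pinned c (inj₂ (inj₂ ≡.refl)) a b (≉0-resp (Cyc.rot² cz a b c) nz))
        in return (vertex-cases z x
          (λ b c nz → zero-coords (λ y → trans (sym (match x b c nz y)) (B0 _ y)) i)
          (λ zz → e (off x zz i))) })
        where
          m' : Fin n → V 4
          m' a i = m (a , i)

      -- Subtracting the form through the pinned triangle turns any motion into a pinned one, which
      -- vanishes.
      Pin⇒Rigid : ∀ {z p a b c} → Cyc z → Ind 3 p → z a b c ≉0 → Pin z a b c p → Rigid z p
      Pin⇒Rigid {z} {p} {a} {b} {c} cz ind nz inj m (motion ms me) =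
        through {p} {m} (cyc-indep cz {p} ind nz) ms
          (me a b c nz) (me a c b (λ e → nz (trans (Cyc.sw′ cz a b c) (neg-0 e))))
          (me b c a (≉0-resp (Cyc.rot cz a b c) nz)) >>= λ { (B , ka , kb , kc) →
        masked (λ a → ∀ b c → z a b c ≈ 0#) (λ a i → m a i - coords (appF B (p a)) i) >>= λ { (g , on₀ , off₀) →
        let m' : Fin n × Fin 4 → Carrier
            m' x = g (proj₁ x) (proj₂ x)

            on : ∀ {a b c} → z a b c ≉0 → ∀ i → m' (a , i) ≈ m a i - coords (appF B (p a)) i
            on {a} nz = on₀ a (λ zz → nz (zz _ _))

            off' : ∀ {a} → (∀ b c → z a b c ≈ 0#) → ∀ i → m' (a , i) ≈ 0#
            off' {a} zz = off₀ a zz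

            dot-on : ∀ {a b c} → z a b c ≉0 → ∀ y → dot (λ i → m' (a , i)) y ≈ dot (m a) y - app B (p a) y
            dot-on {a} nz y = trans (dot-cong (on nz) (λ _ → refl)) (trans (dot-subˡ _ _ y)
              (+-congˡ (-‿cong (dot-coords (appF B (p a)) y))))

            pinned : ∀ {d b c} → z d b c ≉0 → (∀ y → app B (p d) y ≈ dot (m d) y) → ∀ i → m' (d , i) ≈ 0#
            pinned {d} nz k = zero-coords (λ y → trans (dot-on nz y) (trans (+-congˡ (-‿cong (k y))) (-‿inverseʳ _)))

            sol : ∀ x → fn (at (Pins.eq id none z a b c x) p) m' ≈ 0#
            sol = λ
              { (self d) → vertex-cases z d
                  (λ b c nz → trans (dot-on nz (p d)) (+-0 (ms d) (neg-0 (Alt.alt B (p d)))))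
                  (λ zz → dot-0ˡ (off' zz))
              ; (edge d d' d'' nz') → begin
                  dot (λ i → m' (d , i)) (p d') + dot (λ i → m' (d' , i)) (p d)
                    ≈⟨ +-cong (dot-on nz' (p d')) (dot-on (≉0-resp (Cyc.rot cz d d' d'') nz') (p d)) ⟩
                  (dot (m d) (p d') - app B (p d) (p d')) + (dot (m d') (p d) - app B (p d') (p d))
                    ≈⟨ +-congˡ (+-congˡ (-‿cong (Alt.anti B (p d') (p d)))) ⟩
                  (dot (m d) (p d') - app B (p d) (p d')) + (dot (m d') (p d) - (- app B (p d) (p d')))
                    ≈⟨ solve 3 (λ x y b → (x :- b) :+ (y :- :- b) := x :+ y) refl _ _ _ ⟩
                  dot (m d) (p d') + dot (m d') (p d)
                    ≈⟨ me d d' d'' nz' ⟩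
                  0# ∎
              ; (pin d (inj₁ ≡.refl) i) → pinned nz ka i
              ; (pin d (inj₂ (inj₁ ≡.refl)) i) → pinned (≉0-resp (Cyc.rot cz a b c) nz) kb i
              ; (pin d (inj₂ (inj₂ ≡.refl)) i) → pinned (≉0-resp (Cyc.rot² cz a b c) nz) kc i
              ; (off d zz i) → off' zz i }
        in return (B , λ d d' d'' nz' y → begin
            app B (p d) y
              ≈⟨ solve 2 (λ b m → b := m :- (m :- b)) refl _ _ ⟩
            dot (m d) y - (dot (m d) y - app B (p d) y)
              ≈⟨ +-congˡ (-‿cong (dot-on nz' y)) ⟨
            dot (m d) y - dot (λ i → m' (d , i)) y
              ≈⟨ +-congˡ (neg-0 (dot-0ˡ (λ i → inj m' sol (d , i)))) ⟩
            dot (m d) y + 0#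
              ≈⟨ +-identityʳ _ ⟩
            dot (m d) y ∎) } }

      data Kind (u v a : Fin n) : Set where
        is-u : a ≡ u → Kind u v a
        is-v : a ≡ v → Kind u v a
        oth  : a ≢ u → a ≢ v → Kind u v a

      kind : ∀ u v a → Kind u v a
      kind u v a with a Fin.≟ u | a Fin.≟ v
      ... | yes e | _     = is-u e
      ... | no _  | yes e = is-v e
      ... | no x  | no y  = oth x y

      module Contract (z : Tri) (cz : Cyc z) (u v : Fin n) (u≢v : u ≢ v) where
        open Close u

        v≢u : v ≢ u
        v≢u e = u≢v (≡.sym e)

        ω : Fin n → Carrier
        ω a = δ v a - δ u a

        ∑ω : ∑ ω ≈ 0#
        ∑ω = trans (Σ-sub _ _) (trans (+-cong (one v) (-‿cong (one u))) (-‿inverseʳ _))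
          where
            one : ∀ w → ∑ (δ w) ≈ 1#
            one w = trans (Σ-cong (λ a → sym (*-identityʳ _))) (Σ-δ w (λ _ → 1#))

        ω-u : ω u ≈ - 1#
        ω-u = trans (+-cong (reflexive (δ-≢ v≢u)) (-‿cong (reflexive (δ-≡ u)))) (+-identityˡ _)

        ω-v : ω v ≈ 1#
        ω-v = trans (+-cong (reflexive (δ-≡ v)) (neg-0 (reflexive (δ-≢ u≢v)))) (+-identityʳ _)

        ω-o : ∀ {a} → a ≢ u → a ≢ v → ω a ≈ 0#
        ω-o nu nv = +-0 (reflexive (δ-≢ (λ e → nv (≡.sym e)))) (neg-0 (reflexive (δ-≢ (λ e → nu (≡.sym e)))))

        ∧-ooo : ∀ {r a b c} → ω a ≈ 0# → ω b ≈ 0# → ω c ≈ 0# → (ω ∧₃ r) a b c ≈ 0#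
        ∧-ooo ea eb ec = +-0 (*-0ˡ ea) (+-0 (*-0ˡ (neg-0 eb)) (*-0ˡ ec))

        ∧-uoo : ∀ {r b c} → ω b ≈ 0# → ω c ≈ 0# → (ω ∧₃ r) u b c ≈ - r b c
        ∧-uoo eb ec = trans (+-cong (*-congʳ ω-u) (+-0 (*-0ˡ (neg-0 eb)) (*-0ˡ ec)))
          (solve 1 (λ r → :- :1 :* r :+ :0 := :- r) refl _)

        ∧-v : ∀ {r b c} → (∀ a → r v a ≈ 0#) → (ω ∧₃ r) v b c ≈ r b c
        ∧-v {r} {b} {c} rv = trans (+-cong (*-congʳ ω-v) (+-0 (*-0ʳ (rv c)) (*-0ʳ (rv b))))
          (solve 1 (λ r → :1 :* r :+ :0 := r) refl _)

        -- The image of z under the contraction of v to u. The correction is the suspension of the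
        -- link of v, so z′ is a cycle without any check at single triangles.
        z′ : Tri
        z′ a b c = z a b c - 1# * (ω ∧₃ z v) a b c

        cyc-z′ : Cyc z′
        cyc-z′ = cyc-sub cz (cyc-∧ ∑ω (Cyc.linkAt cz v)) 1#

        z′-split : ∀ a b c → z a b c ≈ z′ a b c + (ω ∧₃ z v) a b c
        z′-split a b c = solve 2 (λ z w → z := (z :- :1 :* w) :+ w) refl _ _

        z′-v : ∀ b c → z′ v b c ≈ 0#
        z′-v b c = trans (+-congˡ (-‿cong (*-congˡ (∧-v (Cyc.dg cz v)))))
          (solve 1 (λ z → z :- :1 :* z := :0) refl _)

        z′-ooo : ∀ {a b c} → ω a ≈ 0# → ω b ≈ 0# → ω c ≈ 0# → z′ a b c ≈ z a b c
        z′-ooo ea eb ec = trans (+-congˡ (neg-0 (*-0ʳ (∧-ooo {z v} ea eb ec)))) (+-identityʳ _)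

        z′-uoo : ∀ {b c} → ω b ≈ 0# → ω c ≈ 0# → z′ u b c ≈ z u b c + z v b c
        z′-uoo eb ec = trans (+-congˡ (-‿cong (*-congˡ (∧-uoo {z v} eb ec))))
          (solve 2 (λ x y → x :- :1 :* :- y := x :+ y) refl _ _)

        -- A triangle uab of z′ may come from uab or from vab in z. The weight α decides where it is
        -- lifted to: to v if uab is absent from z, to u otherwise. Either way the lifted triangle
        -- belongs to z.
        module Choice (α : Fin n → Fin n → Carrier)
          (αP : ∀ a b → (z u a b ≈ 0# × α a b ≈ 1#) ⊎ (z u a b ≉0 × α a b ≈ 0#)) where

          α-sym : ∀ a b → α a b ≈ α b a
          α-sym a b with αP a b | αP b a
          ... | inj₁ (_ , e) | inj₁ (_ , f) = trans e (sym f)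
          ... | inj₂ (_ , e) | inj₂ (_ , f) = trans e (sym f)
          ... | inj₁ (zz , _) | inj₂ (nz , _) = ⊥-elim (nz (trans (Cyc.sw′ cz u b a) (neg-0 zz)))
          ... | inj₂ (nz , _) | inj₁ (zz , _) = ⊥-elim (nz (trans (Cyc.sw′ cz u a b) (neg-0 zz)))

          module LiftPart (y : Tri) (cy : Cyc y) (le : y ⊑ z′) where

            y-v : ∀ b c → y v b c ≈ 0#
            y-v b c = le v b c (z′-v b c)

            y-·v : ∀ a c → y a v c ≈ 0#
            y-·v a c = trans (Cyc.rot cy a v c) (y-v c a)

            y-··v : ∀ a b → y a b v ≈ 0#
            y-··v a b = trans (Cyc.rot² cy a b v) (y-v a b)

            r₀ : Fin n → Fin n → Carrier
            r₀ a b = α a b * y u a b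

            alt-r₀ : Alt₂ r₀
            alt-r₀ = record
              { anti = λ a b → trans (*-cong (α-sym a b) (Cyc.sw′ cy u a b))
                  (solve 2 (λ a y → a :* :- y := :- (a :* y)) refl _ _)
              ; diag = λ a → *-0ʳ (Cyc.dg₂₃ cy u a) }

            r : Fin n → Fin n → Carrier
            r = close r₀

            cyc-r : Cyc₂ r
            cyc-r = cyc-close alt-r₀

            r-vanish : ∀ {a} → a ≢ u → (∀ b → y u a b ≈ 0#) → ∀ b → r a b ≈ 0#
            r-vanish {a} nu ya b = +-0 (*-0ʳ (ya b)) (+-0 (*-0ʳ (Σ-0 (λ c → *-0ʳ (ya c))))
              (*-0ˡ (reflexive (δ-≢ (λ e → nu (≡.sym e))))))

            r-v : ∀ b → r v b ≈ 0#
            r-v = r-vanish v≢u (y-·v u)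

            r-oo : ∀ {a b} → a ≢ u → b ≢ u → r a b ≈ α a b * y u a b
            r-oo na nb = trans (+-congˡ (+-0 (*-0ˡ (neg-0 (reflexive (δ-≢ (λ e → nb (≡.sym e))))))
              (*-0ˡ (reflexive (δ-≢ (λ e → na (≡.sym e))))))) (+-identityʳ _)

            -- A lift of y along the contraction: the triangles chosen by α are moved from u to v,
            -- and triangles on the edge uv, the ones contributed by `close`, repair the boundary.
            -- Only these may lie outside z.
            D : Tri
            D a b c = y a b c + (ω ∧₃ r) a b c

            cyc-D : Cyc D
            cyc-D = cyc-+ cy (cyc-∧ ∑ω cyc-r)

            D-v : ∀ b c → D v b c ≈ r b c
            D-v b c = trans (+-cong (y-v b c) (∧-v r-v)) (+-identityˡ _)

            D-ooo : ∀ {a b c} → ω a ≈ 0# → ω b ≈ 0# → ω c ≈ 0# → D a b c ≈ y a b c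
            D-ooo ea eb ec = trans (+-congˡ (∧-ooo {r} ea eb ec)) (+-identityʳ _)

            D-uoo : ∀ {b c} → b ≢ u → b ≢ v → c ≢ u → c ≢ v → D u b c ≈ y u b c - α b c * y u b c
            D-uoo bu bv cu cv = +-congˡ (trans (∧-uoo {r} (ω-o bu bv) (ω-o cu cv)) (-‿cong (r-oo bu cu)))

            D-voo : ∀ {b c} → b ≢ u → c ≢ u → D v b c ≈ α b c * y u b c
            D-voo bu cu = trans (D-v _ _) (r-oo bu cu)

            sup-ooo : ∀ {a b c} → ω a ≈ 0# → ω b ≈ 0# → ω c ≈ 0# → D a b c ≉0 → z a b c ≉0
            sup-ooo ea eb ec nD zz = nD (trans (D-ooo ea eb ec) (le _ _ _ (trans (z′-ooo ea eb ec) zz)))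

            sup-uoo : ∀ {b c} → b ≢ u → b ≢ v → c ≢ u → c ≢ v → D u b c ≉0 → z u b c ≉0
            sup-uoo {b} {c} bu bv cu cv nD zz with αP b c
            ... | inj₁ (_ , α1) = nD (trans (D-uoo bu bv cu cv) (trans (+-congˡ (-‿cong (*-congʳ α1)))
                    (solve 1 (λ y → y :- :1 :* y := :0) refl _)))
            ... | inj₂ (nz , _) = nz zz

            sup-voo : ∀ {b c} → b ≢ u → b ≢ v → c ≢ u → c ≢ v → D v b c ≉0 → z v b c ≉0
            sup-voo {b} {c} bu bv cu cv nD zz with αP b c
            ... | inj₂ (_ , α0) = nD (trans (D-voo bu cu) (*-0ˡ α0))
            ... | inj₁ (zu , _) = nD (trans (D-voo bu cu) (*-0ʳ (le u b c
                    (trans (z′-uoo (ω-o bu bv) (ω-o cu cv)) (+-0 zu zz)))))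

            lift-uoo : ∀ {b c} → b ≢ u → b ≢ v → c ≢ u → c ≢ v → y u b c ≉0 → D u b c ≉0 ⊎ D v b c ≉0
            lift-uoo {b} {c} bu bv cu cv ny with αP b c
            ... | inj₁ (_ , α1) = inj₂ (λ e → ny (trans (sym (trans (*-congʳ α1) (*-identityˡ _))) (trans (sym (D-voo bu cu)) e)))
            ... | inj₂ (_ , α0) = inj₁ (λ e → ny (trans (sym (trans (+-congˡ (neg-0 (*-0ˡ α0))) (+-identityʳ _)))
                    (trans (sym (D-uoo bu bv cu cv)) e)))

            y-of-D : ∀ {b c} → b ≢ u → b ≢ v → c ≢ u → c ≢ v → D u b c ≉0 → y u b c ≉0
            y-of-D bu bv cu cv nD zz = nD (trans (D-uoo bu bv cu cv) (+-0 zz (neg-0 (*-0ʳ zz))))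

            -- The coefficients of D around the edge ub sum to zero, so the triangle ubv cannot be
            -- the only one there.
            avoid-v : ∀ {b c} → b ≢ u → D u b c ≉0 → DN (∃[ x ] (x ≢ u × x ≢ v × D u b x ≉0))
            avoid-v {b} {c} bu nD k with kind u v c
            ... | is-u ≡.refl = nD (Cyc.dg₁₃ cyc-D u b)
            ... | oth cu cv   = k (c , cu , cv , nD)
            ... | is-v ≡.refl = nD (begin
              D u b v                             ≈⟨ Σ-δ v (D u b) ⟨
              ∑ (λ x → δ v x * D u b x)           ≈⟨ Σ-cong only ⟩
              ∑ (D u b)                           ≈⟨ Cyc.cycle cyc-D u b ⟩
              0#                                  ∎)
              where
                only : ∀ x → δ v x * D u b x ≈ D u b x
                only x with kind u v x
                ... | is-u ≡.refl = trans (*-0ʳ (Cyc.dg₁₃ cyc-D u b)) (sym (Cyc.dg₁₃ cyc-D u b))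
                ... | is-v ≡.refl = trans (*-congʳ (reflexive (δ-≡ v))) (*-identityˡ _)
                ... | oth xu xv   = trans (*-0ˡ (reflexive (δ-≢ (λ e → xv (≡.sym e))))) (sym (stable (λ nx → k (x , xu , xv , nx))))

            avoid-u : ∀ {b c} → b ≢ v → D v b c ≉0 → DN (∃[ x ] (x ≢ u × x ≢ v × D v b x ≉0))
            avoid-u {b} {c} bv nD k with kind u v c
            ... | is-v ≡.refl = nD (Cyc.dg₁₃ cyc-D v b)
            ... | oth cu cv   = k (c , cu , cv , nD)
            ... | is-u ≡.refl = nD (begin
              D v b u                             ≈⟨ Σ-δ u (D v b) ⟨
              ∑ (λ x → δ u x * D v b x)           ≈⟨ Σ-cong only ⟩
              ∑ (D v b)                           ≈⟨ Cyc.cycle cyc-D v b ⟩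
              0#                                  ∎)
              where
                only : ∀ x → δ u x * D v b x ≈ D v b x
                only x with kind u v x
                ... | is-v ≡.refl = trans (*-0ʳ (Cyc.dg₁₃ cyc-D v b)) (sym (Cyc.dg₁₃ cyc-D v b))
                ... | is-u ≡.refl = trans (*-congʳ (reflexive (δ-≡ u))) (*-identityˡ _)
                ... | oth xu xv   = trans (*-0ˡ (reflexive (δ-≢ (λ e → xu (≡.sym e))))) (sym (stable (λ nx → k (x , xu , xv , nx))))

            E : Fin n → Fin n → Set ℓ
            E a b = ∃[ c ] z a b c ≉0

            E-sym : ∀ {a b} → E a b → E b a
            E-sym (c , nz) = c , λ e → nz (trans (Cyc.sw cz _ _ c) (neg-0 e))

            edge-u : ∀ {b c} → E u v → D u b c ≉0 → DN (E u b)
            edge-u {b} euv nD with kind u v b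
            ... | is-u ≡.refl = ⊥-elim (nD (Cyc.dg cyc-D u _))
            ... | is-v ≡.refl = return euv
            ... | oth bu bv   = avoid-v bu nD >>= λ { (x , xu , xv , nx) → return (x , sup-uoo bu bv xu xv nx) }

            edge-v : ∀ {b c} → E u v → D v b c ≉0 → DN (E v b)
            edge-v {b} euv nD with kind u v b
            ... | is-v ≡.refl = ⊥-elim (nD (Cyc.dg cyc-D v _))
            ... | is-u ≡.refl = return (E-sym euv)
            ... | oth bu bv   = avoid-u bv nD >>= λ { (x , xu , xv , nx) → return (x , sup-voo bu bv xu xv nx) }

            D-sw : ∀ {a b c} → D a b c ≉0 → D b a c ≉0
            D-sw nD e = nD (trans (Cyc.sw cyc-D _ _ _) (neg-0 e))

            -- Triangles of D on uv need not lie in z, yet their edges do: uv by assumption, and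
            -- each other edge lies in a further triangle of D avoiding uv. Hence motions of z
            -- restrict to motions of D.
            edges : ∀ {a b c} → E u v → D a b c ≉0 → DN (E a b)
            edges {a} {b} {c} euv nD = go (kind u v a) (kind u v b) (kind u v c) nD
              where
                go : Kind u v a → Kind u v b → Kind u v c → D a b c ≉0 → DN (E a b)
                go (is-u ≡.refl) _ _ nD = edge-u euv nD
                go (is-v ≡.refl) _ _ nD = edge-v euv nD
                go (oth _ _) (is-u ≡.refl) _ nD = E-sym <$> edge-u euv (D-sw nD)
                go (oth _ _) (is-v ≡.refl) _ nD = E-sym <$> edge-v euv (D-sw nD)
                go (oth au av) (oth bu bv) (oth cu cv) nD = return (c , sup-ooo (ω-o au av) (ω-o bu bv) (ω-o cu cv) nD)
                go (oth au av) (oth bu bv) (is-u ≡.refl) nD = return (u , ≉0-resp (sym (Cyc.rot² cz a b u))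
                  (sup-uoo au av bu bv (≉0-resp (Cyc.rot² cyc-D a b u) nD)))
                go (oth au av) (oth bu bv) (is-v ≡.refl) nD = return (v , ≉0-resp (sym (Cyc.rot² cz a b v))
                  (sup-voo au av bu bv (≉0-resp (Cyc.rot² cyc-D a b v) nD)))

            no-uv⇒⊑ : (∀ x → D u v x ≈ 0#) → D ⊑ z
            no-uv⇒⊑ nuv a b c zz = stable (λ nD → go (kind u v a) (kind u v b) (kind u v c) nD zz)
              where
                fromU : ∀ b c → D u b c ≉0 → z u b c ≉0
                fromU b c nD with kind u v b | kind u v c
                ... | is-u ≡.refl | _ = ⊥-elim (nD (Cyc.dg cyc-D u c))
                ... | is-v ≡.refl | _ = ⊥-elim (nD (nuv c))
                ... | oth _ _ | is-u ≡.refl = ⊥-elim (nD (Cyc.dg₁₃ cyc-D u b))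
                ... | oth _ _ | is-v ≡.refl = ⊥-elim (nD (trans (Cyc.sw′ cyc-D u b v) (neg-0 (nuv b))))
                ... | oth bu bv | oth cu cv = sup-uoo bu bv cu cv nD
                fromV : ∀ b c → D v b c ≉0 → z v b c ≉0
                fromV b c nD with kind u v b | kind u v c
                ... | is-v ≡.refl | _ = ⊥-elim (nD (Cyc.dg cyc-D v c))
                ... | is-u ≡.refl | _ = ⊥-elim (nD (trans (Cyc.sw cyc-D v u c) (neg-0 (nuv c))))
                ... | oth _ _ | is-v ≡.refl = ⊥-elim (nD (Cyc.dg₁₃ cyc-D v b))
                ... | oth _ _ | is-u ≡.refl = ⊥-elim (nD (trans (Cyc.rot² cyc-D v b u) (nuv b)))
                ... | oth bu bv | oth cu cv = sup-voo bu bv cu cv nD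
                go : Kind u v a → Kind u v b → Kind u v c → D a b c ≉0 → z a b c ≉0
                go (is-u ≡.refl) _ _ nD = fromU b c nD
                go (is-v ≡.refl) _ _ nD = fromV b c nD
                go (oth _ _) (is-u ≡.refl) _ nD = ≉0-resp (sym (Cyc.rot cz a u c)) (fromU c a (≉0-resp (Cyc.rot cyc-D a u c) nD))
                go (oth _ _) (is-v ≡.refl) _ nD = ≉0-resp (sym (Cyc.rot cz a v c)) (fromV c a (≉0-resp (Cyc.rot cyc-D a v c) nD))
                go (oth _ _) (oth _ _) (is-u ≡.refl) nD = ≉0-resp (sym (Cyc.rot² cz a b u)) (fromU a b (≉0-resp (Cyc.rot² cyc-D a b u) nD))
                go (oth _ _) (oth _ _) (is-v ≡.refl) nD = ≉0-resp (sym (Cyc.rot² cz a b v)) (fromV a b (≉0-resp (Cyc.rot² cyc-D a b v) nD))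
                go (oth au av) (oth bu bv) (oth cu cv) nD = sup-ooo (ω-o au av) (ω-o bu bv) (ω-o cu cv) nD

            module Split (mz : Minimal z) (x₀ : Fin n) (zuv : z u v x₀ ≉0) (ny : NonZero y) where

              -- Otherwise D lies within z and is a multiple t z by minimality. Comparing at u v x₀
              -- gives t = 0, so D, its link at v and finally y would vanish.
              uv-present : ¬ (∀ x → D u v x ≈ 0#)
              uv-present nuv = Minimal.unique mz D cyc-D (no-uv⇒⊑ nuv) λ { (t , e) →
                let t0 : t ≈ 0#
                    t0 = cancel zuv (trans (*-comm _ _) (trans (sym (e u v x₀)) (nuv x₀)))
                    D0 : ∀ a b c → D a b c ≈ 0#
                    D0 a b c = trans (e a b c) (*-0ˡ t0)
                    rz : ∀ a b → r a b ≈ 0#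
                    rz a b = trans (sym (D-v a b)) (D0 v a b)
                in ny (λ a b c → begin
                  y a b c ≈⟨ +-identityʳ _ ⟨
                  y a b c + 0# ≈⟨ +-congˡ (+-0 (*-0ʳ (rz b c)) (+-0 (*-0ʳ (rz a c)) (*-0ʳ (rz a b)))) ⟨
                  D a b c ≈⟨ D0 a b c ⟩
                  0# ∎) }

              -- The points of u, w₁, w₂ and a direction q span k⁴ and force equal velocities at u
              -- and v when v is moved to u. The triangle u w₁ x avoids v, belongs to y as well, and
              -- is the one to be pinned.
              record Fork : Set ℓ where
                field
                  w₁ w₂ x : Fin n
                  w₁≢w₂ : w₁ ≢ w₂
                  n₁ : D u v w₁ ≉0
                  n₂ : D u v w₂ ≉0
                  x≢u : x ≢ u
                  x≢v : x ≢ v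
                  nx : D u w₁ x ≉0

              fork : DN Fork
              fork = find≉0 uv-present >>= λ { (w₁ , n₁) →
                second w₁ n₁ >>= λ { (w₂ , w₁≢w₂ , n₂) →
                avoid-v (λ e → Cyc.≢₁₃ cyc-D n₁ (≡.sym e)) (λ e → n₁ (trans (Cyc.sw′ cyc-D u v w₁) (neg-0 e))) >>= λ { (x , xu , xv , nx) →
                return (record { w₁ = w₁ ; w₂ = w₂ ; x = x ; w₁≢w₂ = w₁≢w₂ ; n₁ = n₁ ; n₂ = n₂ ; x≢u = xu ; x≢v = xv ; nx = nx }) } } }
                where
                  second : ∀ w → D u v w ≉0 → DN (∃[ w' ] (w ≢ w' × D u v w' ≉0))
                  second w nw k = nw (begin
                    D u v w                       ≈⟨ Σ-δ w (D u v) ⟨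
                    ∑ (λ x → δ w x * D u v x)     ≈⟨ Σ-cong (λ x → by-cases (w ≡ x)
                          (λ { ≡.refl → trans (*-congʳ (reflexive (δ-≡ w))) (*-identityˡ _) })
                          (λ ne → trans (*-0ˡ (reflexive (δ-≢ ne))) (sym (stable (λ nx → k (x , ne , nx)))))) ⟩
                    ∑ (D u v)                     ≈⟨ Cyc.cycle cyc-D u v ⟩
                    0#                            ∎)

              -- The point of v moves into that of u along q; dividing the equation
              -- of the edge uv by t keeps it meaningful at t = 0.
              module At (p' : Pts n 4) (ind : Ind 3 p') (rig : Rigid y p') (f : Fork) (q : V 4)
                (li : LinIndep (cons q (at-pts p' (u ∷ Fork.w₁ f ∷ Fork.w₂ f ∷ [])))) where
                open Fork f

                pos : (a : Fin n) → V 4 → Kind u v a → V 4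
                pos a s (is-v _) = s
                pos a s _        = p' a

                P₀ P₁ : Pts n 4
                P₀ a = pos a (p' u) (kind u v a)
                P₁ a = pos a (λ i → p' u i + q i) (kind u v a)

                pos-v : ∀ {s} (k : Kind u v v) → pos v s k ≡ s
                pos-v (is-u e)  = ⊥-elim (v≢u e)
                pos-v (is-v _)  = ≡.refl
                pos-v (oth _ n) = ⊥-elim (n ≡.refl)

                pos-≢ : ∀ {a s} → a ≢ v → (k : Kind u v a) → pos a s k ≡ p' a
                pos-≢ n (is-u _)  = ≡.refl
                pos-≢ n (is-v e)  = ⊥-elim (n e)
                pos-≢ n (oth _ _) = ≡.refl

                U = Fin n × Fin 4

                qdiff : Func U
                qdiff = ΣF (λ i → ev (u , i) Fʳ* q i) +F (- 1#) *F ΣF (λ i → ev (v , i) Fʳ* q i)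

                module DP = Pins {n} {4} {0} id none D u w₁ x

                modEdge : ∀ a b → Kind u v a → Kind u v b → PFunc n 4 U
                modEdge a b (is-u _) (is-v _) = constP qdiff
                modEdge a b (is-v _) (is-u _) = constP qdiff
                modEdge a b _ _ = atP (DP.μ a) b +P atP (DP.μ b) a

                modEq : DP.Eq → PFunc n 4 U
                modEq (edge a b _ _) = modEdge a b (kind u v a) (kind u v b)
                modEq e = DP.eq e

                edge-other : ∀ p m {a b} → ¬ (a ≡ u × b ≡ v) → ¬ (a ≡ v × b ≡ u) → (ka : Kind u v a) (kb : Kind u v b) →
                  fn (at (modEdge a b ka kb) p) m ≈ dot (λ i → m (a , i)) (p b) + dot (λ i → m (b , i)) (p a)
                edge-other p m h₁ h₂ (is-u e) (is-v f) = ⊥-elim (h₁ (e , f))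
                edge-other p m h₁ h₂ (is-v e) (is-u f) = ⊥-elim (h₂ (e , f))
                edge-other p m h₁ h₂ (is-u e) (is-u f) = refl
                edge-other p m h₁ h₂ (is-u e) (oth _ _) = refl
                edge-other p m h₁ h₂ (is-v e) (is-v f) = refl
                edge-other p m h₁ h₂ (is-v e) (oth _ _) = refl
                edge-other p m h₁ h₂ (oth _ _) _ = refl

                module Inj (m : U → Carrier) (sol : ∀ e → fn (at (modEq e) P₀) m ≈ 0#) where
                  m' : Fin n → V 4
                  m' a i = m (a , i)

                  pt : ∀ {a} → a ≢ v → P₀ a ≡ p' a
                  pt n = pos-≢ n (kind u v _)

                  pt-v : P₀ v ≡ p' u
                  pt-v = pos-v (kind u v v)

                  self≢ : ∀ a → a ≢ v → dot (m' a) (p' a) ≈ 0#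
                  self≢ a n = ≡.subst (λ s → dot (m' a) s ≈ 0#) (pt n) (sol (self a))

                  self-v : dot (m' v) (p' u) ≈ 0#
                  self-v = ≡.subst (λ s → dot (m' v) s ≈ 0#) pt-v (sol (self v))

                  edge₀ : ∀ {a b c} → ¬ (a ≡ u × b ≡ v) → ¬ (a ≡ v × b ≡ u) → D a b c ≉0 →
                    dot (m' a) (P₀ b) + dot (m' b) (P₀ a) ≈ 0#
                  edge₀ {a} {b} {c} h₁ h₂ nD = trans (sym (edge-other P₀ m h₁ h₂ (kind u v a) (kind u v b))) (sol (edge a b c nD))

                  edge≢ : ∀ {a b c} → a ≢ v → b ≢ v → D a b c ≉0 → dot (m' a) (p' b) + dot (m' b) (p' a) ≈ 0#
                  edge≢ {a} {b} av bv nD = ≡.subst₂ (λ s t → dot (m' a) s + dot (m' b) t ≈ 0#) (pt bv) (pt av)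
                    (edge₀ (λ e → bv (proj₂ e)) (λ e → av (proj₁ e)) nD)

                  edge-vb : ∀ {b c} → b ≢ u → b ≢ v → D v b c ≉0 → dot (m' v) (p' b) + dot (m' b) (p' u) ≈ 0#
                  edge-vb {b} bu bv nD = ≡.subst₂ (λ s t → dot (m' v) s + dot (m' b) t ≈ 0#) (pt bv) pt-v
                    (edge₀ (λ e → v≢u (proj₁ e)) (λ e → bu (proj₂ e)) nD)

                  agree : ∀ {w} → D u v w ≉0 → dot (m' u) (p' w) - dot (m' v) (p' w) ≈ 0#
                  agree {w} nw = begin
                    dot (m' u) (p' w) - dot (m' v) (p' w)
                      ≈⟨ solve 3 (λ a b c → a :- b := (a :+ c) :- (b :+ c)) refl _ _ (dot (m' w) (p' u)) ⟩
                    (dot (m' u) (p' w) + dot (m' w) (p' u)) - (dot (m' v) (p' w) + dot (m' w) (p' u))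
                      ≈⟨ +-0 (edge≢ u≢v wv (λ e → nw (trans (Cyc.sw′ cyc-D u v w) (neg-0 e))))
                           (neg-0 (edge-vb wu wv (≉0-resp (Cyc.rot cyc-D u v w) nw))) ⟩
                    0# ∎
                    where
                      wu : w ≢ u
                      wu e = Cyc.≢₁₃ cyc-D nw (≡.sym e)
                      wv : w ≢ v
                      wv e = Cyc.≢₂₃ cyc-D nw (≡.sym e)

                  q-eq : dot (m' u) q - dot (m' v) q ≈ 0#
                  q-eq = trans (+-congˡ (solve 1 (λ y → :- y := :- :1 :* y) refl _))
                    (≡.subst (λ F → fn (at F P₀) m ≈ 0#) (uv (kind u v u) (kind u v v)) (sol (edge u v w₁ n₁)))
                    where
                      uv : (k : Kind u v u) (l : Kind u v v) → modEdge u v k l ≡ constP qdiff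
                      uv (is-v e)  _        = ⊥-elim (u≢v e)
                      uv (oth n _) _        = ⊥-elim (n ≡.refl)
                      uv (is-u _) (is-u e)  = ⊥-elim (v≢u e)
                      uv (is-u _) (is-v _)  = ≡.refl
                      uv (is-u _) (oth _ n) = ⊥-elim (n ≡.refl)

                  -- The difference of the two velocities kills q by the divided edge equation, p_u
                  -- by the self equations, and p_w₁, p_w₂ since both u and v are joined to w₁ and
                  -- w₂; these four vectors are independent.
                  m-uv : m' u ≐ m' v
                  m-uv i = begin
                    m' u i                      ≈⟨ solve 2 (λ a b → a := b :+ (a :- b)) refl _ _ ⟩
                    m' v i + (m' u i - m' v i)  ≈⟨ +-congˡ (zero-coords {f = nv} (λ s → func-zero _ li (dotF nv) kills s) i) ⟩
                    m' v i + 0#                 ≈⟨ +-identityʳ _ ⟩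
                    m' v i                      ∎
                    where
                      nv : V 4
                      nv i = m' u i - m' v i
                      kills : ∀ i → dot nv (cons q (at-pts p' (u ∷ w₁ ∷ w₂ ∷ [])) i) ≈ 0#
                      kills zero = trans (dot-subˡ _ _ q) q-eq
                      kills (suc zero) = trans (dot-subˡ _ _ _) (+-0 (self≢ u u≢v) (neg-0 self-v))
                      kills (suc (suc zero)) = trans (dot-subˡ _ _ _) (agree n₁)
                      kills (suc (suc (suc zero))) = trans (dot-subˡ _ _ _) (agree n₂)

                  y≢v₁ : ∀ {a b c} → y a b c ≉0 → a ≢ v
                  y≢v₁ ny ≡.refl = ny (y-v _ _)

                  y≢v₂ : ∀ {a b c} → y a b c ≉0 → b ≢ v
                  y≢v₂ ny ≡.refl = ny (y-·v _ _)

                  y≢v₃ : ∀ {a b c} → y a b c ≉0 → c ≢ v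
                  y≢v₃ ny ≡.refl = ny (y-··v _ _)

                  edge-u· : ∀ {b c} → y u b c ≉0 → dot (m' u) (p' b) + dot (m' b) (p' u) ≈ 0#
                  edge-u· {b} {c} nyu with lift-uoo bu (y≢v₂ nyu) cu (y≢v₃ nyu) nyu
                    where
                      bu : b ≢ u
                      bu e = Cyc.≢₁₂ cy nyu (≡.sym e)
                      cu : c ≢ u
                      cu e = Cyc.≢₁₃ cy nyu (≡.sym e)
                  ... | inj₁ nD = edge≢ u≢v (y≢v₂ nyu) nD
                  ... | inj₂ nD = trans (+-congʳ (dot-cong m-uv (λ _ → refl))) (edge-vb (λ e → Cyc.≢₁₂ cy nyu (≡.sym e)) (y≢v₂ nyu) nD)

                  y-edge : ∀ a b c → y a b c ≉0 → dot (m' a) (p' b) + dot (m' b) (p' a) ≈ 0#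
                  y-edge a b c nya with kind u v a | kind u v b | kind u v c
                  ... | is-v ≡.refl | _ | _ = ⊥-elim (y≢v₁ nya ≡.refl)
                  ... | _ | is-v ≡.refl | _ = ⊥-elim (y≢v₂ nya ≡.refl)
                  ... | _ | _ | is-v ≡.refl = ⊥-elim (y≢v₃ nya ≡.refl)
                  ... | is-u ≡.refl | _ | _ = edge-u· nya
                  ... | oth au av | is-u ≡.refl | _ = trans (+-comm _ _) (edge-u· (λ e → nya (trans (Cyc.sw cy a u c) (neg-0 e))))
                  ... | oth au av | oth bu bv | oth cu cv = edge≢ av bv (λ e → nya (trans (sym (D-ooo (ω-o au av) (ω-o bu bv) (ω-o cu cv))) e))
                  ... | oth au av | oth bu bv | is-u ≡.refl with lift-uoo au av bu bv (≉0-resp (Cyc.rot² cy a b u) nya)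
                  ...   | inj₁ nD = edge≢ av bv (≉0-resp (sym (Cyc.rot² cyc-D a b u)) nD)
                  ...   | inj₂ nD = edge≢ av bv (≉0-resp (sym (Cyc.rot² cyc-D a b v)) nD)

                  y-pins : y u w₁ x ≉0
                  y-pins = y-of-D (λ e → Cyc.≢₁₂ cyc-D nx (≡.sym e)) (λ e → Cyc.≢₂₃ cyc-D n₁ (≡.sym e)) x≢u x≢v nx

                  -- The vertex v does not occur in y, so its velocity is masked before the rigidity
                  -- of y is applied, and is recovered afterwards from that of u.
                  conclude : ∀ w → m w ≈ 0#
                  conclude (a , i) = stable (masked (λ a → a ≡ v) m' >>= λ { (g , gon , goff) →
                    let g-dot : ∀ a → a ≢ v → ∀ s → dot (g a) s ≈ dot (m' a) s
                        g-dot a n s = dot-cong (gon a n) (λ _ → refl)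
                    in rig g (motion
                      (λ a → by-cases (a ≡ v) (λ e → dot-0ˡ (goff a e)) (λ n → trans (g-dot a n _) (self≢ a n)))
                      (λ a b c nya → trans (+-cong (g-dot a (y≢v₁ nya) _) (g-dot b (y≢v₂ nya) _)) (y-edge a b c nya))) >>= λ { (B , match) →
                    let pinned : ∀ {d d' d''} → d ≡ u ⊎ d ≡ w₁ ⊎ d ≡ x → y d d' d'' ≉0 → ∀ s → app B (p' d) s ≈ 0#
                        pinned w nyd s = trans (match _ _ _ nyd s) (trans (g-dot _ (y≢v₁ nyd) s) (dot-0ˡ (λ i → sol (pin _ w i))))
                        B0 = kill₃ {p'} (cyc-indep cy {p'} ind y-pins) B
                          (pinned (inj₁ ≡.refl) y-pins)
                          (pinned (inj₂ (inj₁ ≡.refl)) (≉0-resp (Cyc.rot cy _ _ _) y-pins))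
                          (pinned (inj₂ (inj₂ ≡.refl)) (≉0-resp (Cyc.rot² cy _ _ _) y-pins))
                        onY : ∀ {a b c} → y a b c ≉0 → m' a ≐ zeroV
                        onY {a} nya = zero-coords (λ s → trans (sym (g-dot a (y≢v₁ nya) s)) (trans (sym (match _ _ _ nya s)) (B0 _ s)))
                        rest : a ≢ v → m' a i ≈ 0#
                        rest av = vertex-cases y a (λ b c nya → onY nya i) (λ yz → sol (off a (λ b c →
                          let au : a ≢ u
                              au = λ { ≡.refl → y-pins (yz _ _) }
                              ra : ∀ b → r a b ≈ 0#
                              ra = r-vanish au (λ b → trans (Cyc.sw cy u a b) (neg-0 (yz u b)))
                          in +-0 (yz b c) (+-0 (*-0ˡ (ω-o au av)) (+-0 (*-0ʳ (ra c)) (*-0ʳ (ra b))))) i))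
                    in return (by-cases (a ≡ v) (λ { ≡.refl → trans (sym (m-uv i)) (onY y-pins i) }) rest) } })

                -- The modified system is injective at t = 0, hence for almost all t; at a nonzero
                -- such t every solution of the true system solves the modified one.
                pinned-D : DN (∃[ p ] DP.Pin p)
                pinned-D = along (cof-∧ cof-≉0 (Open.open′ (open-injective (↔-sym Fin.*↔×) modEq) P₀ P₁ (λ m sol → Inj.conclude m sol)))
                  (proj₁ infinite) (proj₂ infinite) >>= λ { (k , good) →
                  return (line P₀ P₁ (proj₁ infinite k) , λ m sol → proj₂ (good k ℕ.≤-refl) m (transfer (proj₁ infinite k) (proj₁ (good k ℕ.≤-refl)) m sol)) }
                  where
                    transfer : ∀ t → t ≉0 → ∀ m → (∀ e → fn (at (DP.eq e) (line P₀ P₁ t)) m ≈ 0#) →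
                      ∀ e → fn (at (modEq e) (line P₀ P₁ t)) m ≈ 0#
                    transfer t nt m sol = λ
                      { (self a) → sol (self a) ; (pin a w i) → sol (pin a w i) ; (off a w i) → sol (off a w i)
                      ; (edge a b c nD) → go a b c nD (kind u v a) (kind u v b) }
                      where
                        p = line P₀ P₁ t
                        m' : Fin n → V 4
                        m' a i = m (a , i)

                        p-v : ∀ i → p v i ≈ p' u i + t * q i
                        p-v i = trans (+-cong (reflexive (≡.cong (λ s → s i) (pos-v (kind u v v))))
                          (*-congˡ (+-cong (reflexive (≡.cong (λ s → s i) (pos-v (kind u v v))))
                            (-‿cong (reflexive (≡.cong (λ s → s i) (pos-v (kind u v v))))))))
                          (solve 3 (λ a t q → a :+ t :* ((a :+ q) :- a) := a :+ t :* q) refl _ _ _)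

                        p-u : ∀ i → p u i ≈ p' u i
                        p-u i = trans (+-cong (reflexive (≡.cong (λ s → s i) (pos-≢ u≢v (kind u v u))))
                          (*-congˡ (+-cong (reflexive (≡.cong (λ s → s i) (pos-≢ u≢v (kind u v u))))
                            (-‿cong (reflexive (≡.cong (λ s → s i) (pos-≢ u≢v (kind u v u))))))))
                          (solve 2 (λ a t → a :+ t :* (a :- a) := a) refl _ _)

                        at-v : ∀ a → dot (m' a) (p v) ≈ dot (m' a) (p u) + t * dot (m' a) q
                        at-v a = trans (Func.cong (dotF (m' a)) (λ i → trans (p-v i) (+-congʳ (sym (p-u i)))))
                          (trans (Func.add (dotF (m' a)) _ _) (+-congˡ (Func.mul (dotF (m' a)) _ _)))

                        quv : dot (m' u) (p v) + dot (m' v) (p u) ≈ 0# → fn qdiff m ≈ 0#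
                        quv e = cancel nt (begin
                          t * (dot (m' u) q + - 1# * dot (m' v) q)
                            ≈⟨ solve 5 (λ t a b c d → t :* (a :+ :- :1 :* b) := ((c :+ t :* a) :+ d) :- c :- (d :+ t :* b)) refl _ _ _ (dot (m' u) (p u)) (dot (m' v) (p u)) ⟩
                          ((dot (m' u) (p u) + t * dot (m' u) q) + dot (m' v) (p u)) - dot (m' u) (p u) - (dot (m' v) (p u) + t * dot (m' v) q)
                            ≈⟨ +-cong (+-cong (+-congʳ (sym (at-v u))) refl) (-‿cong (sym (at-v v))) ⟩
                          (dot (m' u) (p v) + dot (m' v) (p u)) - dot (m' u) (p u) - dot (m' v) (p v)
                            ≈⟨ +-0 (+-0 e (neg-0 (sol (self u)))) (neg-0 (sol (self v))) ⟩
                          0# ∎)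

                        go : ∀ a b c → D a b c ≉0 → (ka : Kind u v a) (kb : Kind u v b) → fn (at (modEdge a b ka kb) p) m ≈ 0#
                        go a b c nD (is-u ≡.refl) (is-v ≡.refl) = quv (sol (edge u v c nD))
                        go a b c nD (is-v ≡.refl) (is-u ≡.refl) = quv (trans (+-comm _ _) (sol (edge v u c nD)))
                        go a b c nD (is-u e) (is-u f) = sol (edge a b c nD)
                        go a b c nD (is-u e) (oth _ _) = sol (edge a b c nD)
                        go a b c nD (is-v e) (is-v f) = sol (edge a b c nD)
                        go a b c nD (is-v e) (oth _ _) = sol (edge a b c nD)
                        go a b c nD (oth _ _) _ = sol (edge a b c nD)

              -- Vertex splitting: D arises from y by splitting u into u and v, which preserves
              -- rigidity at suitable points.
              pinned : DN (∃[ p ] (Ind 3 p × Rigid y p)) →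
                DN (∃[ a ] ∃[ b ] ∃[ c ] (D a b c ≉0 × ∃[ p ] Pin D a b c p))
              pinned ih = fork >>= λ f → ih >>= λ { (p' , ind , rig) →
                let open Fork f in
                complete _ (ind (u ∷ w₁ ∷ w₂ ∷ []) (distinct₃ (Cyc.≢₁₃ cyc-D n₁) (Cyc.≢₁₃ cyc-D n₂) w₁≢w₂)) >>= λ { (q , li) →
                At.pinned-D p' ind rig f q li >>= λ pp →
                return (u , w₁ , x , nx , pp) } }

    -- Rigidity of minimal cycles

    module Fogelsanger where

      open Geometry
      open Cycles
      open Rigidity

      module Step (z : Tri) (mz : Minimal z) (u v x₀ : Fin n) (zuv : z u v x₀ ≉0) where
        cz = Minimal.cyc mz
        open Contract z cz u v (Cyc.≢₁₂ cz zuv)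
        open Close u

        module WithParts (α : Fin n → Fin n → Carrier)
          (αP : ∀ a b → (z u a b ≈ 0# × α a b ≈ 1#) ⊎ (z u a b ≉0 × α a b ≈ 0#))
          (dec : Decomposition z′) where

          open Decomposition dec renaming (size to K; part to y)
          module L (i : Fin K) = Choice.LiftPart α αP (y i) (Minimal.cyc (minimal i)) (within i)

          -- What the lifts of the parts miss: z differs from the sum of the D's by the suspension
          -- of R with apexes v and u.
          R : Fin n → Fin n → Carrier
          R a b = z v a b - ∑ (λ i → L.r i a b)

          cyc-R : Cyc₂ R
          cyc-R = record
            { alt₂ = record
                { anti = λ a b → trans (+-cong (Cyc.sw′ cz v a b) (-‿cong (trans (Σ-cong (λ i → Cyc₂.anti (L.cyc-r i) a b)) (Σ-neg _))))
                    (solve 2 (λ x y → :- x :- :- y := :- (x :- y)) refl _ _)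
                ; diag = λ a → +-0 (Cyc.dg₂₃ cz v a) (neg-0 (Σ-0 (λ i → Cyc₂.diag (L.cyc-r i) a))) }
            ; cycle = λ a → trans (Σ-sub _ _) (+-0 (Cyc.cycle cz v a) (neg-0 (trans (Σ-swap _) (Σ-0 (λ i → Cyc₂.cycle (L.cyc-r i) a))))) }

          z-split : ∀ a b c → z a b c ≈ ∑ (λ i → L.D i a b c) + (ω ∧₃ R) a b c
          z-split a b c = begin
            z a b c
              ≈⟨ trans (z′-split a b c) (+-congʳ (total a b c)) ⟩
            Y + (ω a * z v b c + (- ω b * z v a c + ω c * z v a b))
              ≈⟨ solve 10 (λ Y wa wb wc zbc zac zab rbc rac rab →
                   Y :+ (wa :* zbc :+ (:- wb :* zac :+ wc :* zab))
                   := (Y :+ (wa :* rbc :+ (:- wb :* rac :+ wc :* rab)))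
                      :+ (wa :* (zbc :- rbc) :+ (:- wb :* (zac :- rac) :+ wc :* (zab :- rab)))) refl
                   Y (ω a) (ω b) (ω c) (z v b c) (z v a c) (z v a b) (ρ b c) (ρ a c) (ρ a b) ⟩
            (Y + (ω a * ρ b c + (- ω b * ρ a c + ω c * ρ a b))) + (ω ∧₃ R) a b c
              ≈⟨ +-congʳ (sym (trans (Σ-+ _ _) (+-congˡ (trans (Σ-+ _ _) (+-cong (Σ-* _ _) (trans (Σ-+ _ _) (+-cong (Σ-* _ _) (Σ-* _ _)))))))) ⟩
            ∑ (λ i → L.D i a b c) + (ω ∧₃ R) a b c ∎
            where
              Y = ∑ (λ i → y i a b c)
              ρ : Fin n → Fin n → Carrier
              ρ a b = ∑ (λ i → L.r i a b)

          R-v : ∀ c → R v c ≈ 0#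
          R-v c = +-0 (Cyc.dg cz v c) (neg-0 (Σ-0 (λ i → L.r-v i c)))

          R-≢v₁ : ∀ {b c} → R b c ≉0 → b ≢ v
          R-≢v₁ nR ≡.refl = nR (R-v _)

          R-≢v₂ : ∀ {b c} → R b c ≉0 → c ≢ v
          R-≢v₂ nR ≡.refl = nR (trans (Cyc₂.anti cyc-R _ _) (neg-0 (R-v _)))

          R-value : ∀ {b c} → b ≢ u → c ≢ u → b ≢ v → c ≢ v →
            R b c ≈ z v b c - α b c * (z u b c + z v b c)
          R-value {b} {c} bu cu bv cv = +-congˡ (-‿cong (begin
            ∑ (λ i → L.r i b c)               ≈⟨ Σ-cong (λ i → L.r-oo i bu cu) ⟩
            ∑ (λ i → α b c * y i u b c)       ≈⟨ Σ-* _ _ ⟩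
            α b c * ∑ (λ i → y i u b c)       ≈⟨ *-congˡ (total u b c) ⟨
            α b c * z′ u b c                  ≈⟨ *-congˡ (z′-uoo (ω-o bu bv) (ω-o cu cv)) ⟩
            α b c * (z u b c + z v b c)       ∎))

          -- The choice of α pays off here: where uab is absent from z, R cancels completely. So R
          -- lives on edges bc for which ubc and vbc are both in z, and uvbc is a tetrahedron all of
          -- whose edges are in z.
          R⇒tetra : ∀ {b c} → b ≢ u → c ≢ u → R b c ≉0 → z u b c ≉0 × z v b c ≉0
          R⇒tetra {b} {c} bu cu nR with αP b c
          ... | inj₁ (zu , α1) = ⊥-elim (nR (trans (R-value bu cu (R-≢v₁ nR) (R-≢v₂ nR))
                  (trans (+-congˡ (-‿cong (*-cong α1 (+-congʳ zu)))) (solve 1 (λ x → x :- :1 :* (:0 :+ x) := :0) refl _))))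
          ... | inj₂ (nu , α0) = nu , λ zv → nR (trans (R-value bu cu (R-≢v₁ nR) (R-≢v₂ nR)) (+-0 zv (neg-0 (*-0ˡ α0))))

          R₀ : Fin n → Fin n → Carrier
          R₀ = away R

          alt-R₀ : Alt₂ R₀
          alt-R₀ = alt-away (Cyc₂.alt₂ cyc-R)

          R₀-≢u₁ : ∀ {b c} → R₀ b c ≉0 → b ≢ u
          R₀-≢u₁ nR ≡.refl = nR (*-0ˡ (*-0ˡ χ-u))

          R₀-≢u₂ : ∀ {b c} → R₀ b c ≉0 → c ≢ u
          R₀-≢u₂ nR ≡.refl = nR (*-0ˡ (*-0ʳ χ-u))

          R₀⇒R : ∀ {b c} → R₀ b c ≉0 → R b c ≉0
          R₀⇒R nR e = nR (*-0ʳ e)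

          module AtPoints (p : Pts n 4) (ind₃ : Ind 3 p) (ind₄ : Ind 4 p) (rigD : ∀ i → Rigid (L.D i) p)
            (m : Fin n → V 4) (mo : Motion z p m) where
            open Motion mo

            Match : Alt 4 → Fin n → Set (c ⊔ ℓ)
            Match B g = ∀ s → app B (p g) s ≈ dot (m g) s

            motion-D : ∀ i → Motion (L.D i) p m
            motion-D i = motion m-self (λ a b c nD → stable (L.edges i (x₀ , zuv) nD >>= λ { (c' , nz) → return (m-edge a b c' nz) }))

            -- A tetrahedron is rigid: the form through u, v, b agrees with m also at c, because the
            -- difference kills the four independent points.
            tetra : ∀ b c → DN (Σ (Alt 4) λ B → R₀ b c ≉0 → Match B u × Match B v × Match B b × Match B c)
            tetra b c = lem (R₀ b c ≈ 0#) >>= λ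
              { (inj₁ zz) → return (0A , λ nR → ⊥-elim (nR zz))
              ; (inj₂ nR) → solid (R⇒tetra (R₀-≢u₁ nR) (R₀-≢u₂ nR) (R₀⇒R nR)) nR }
              where
                solid : z u b c ≉0 × z v b c ≉0 → R₀ b c ≉0 → DN _
                solid (nu , nv) nR = through {p} {m} (ind₃ (u ∷ v ∷ b ∷ []) (distinct₃ uv ub vb)) m-self
                  (m-edge u v x₀ zuv) (m-edge u b c nu) (m-edge v b c nv) >>= λ { (B , mu , mv , mb) →
                  return (B , λ _ → mu , mv , mb , λ s → begin
                    app B (p c) s                       ≈⟨ solve 2 (λ a b → a := b :- (b :- a)) refl _ _ ⟩
                    dot (m c) s - (dot (m c) s - app B (p c) s)
                      ≈⟨ +-congˡ (-‿cong (+-congˡ (solve 1 (λ y → :- y := :- :1 :* y) refl _))) ⟩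
                    dot (m c) s - fn (F B) s
                      ≈⟨ +-congˡ (neg-0 (func-zero (at-pts p (u ∷ v ∷ b ∷ c ∷ []))
                           (ind₄ (u ∷ v ∷ b ∷ c ∷ []) (distinct₄ uv ub uc vb vc bc)) (F B) (kills B mu mv mb) s)) ⟩
                    dot (m c) s + 0#                    ≈⟨ +-identityʳ _ ⟩
                    dot (m c) s                         ∎) }
                  where
                    uv = Cyc.≢₁₂ cz zuv
                    ub = Cyc.≢₁₂ cz nu
                    uc = Cyc.≢₁₃ cz nu
                    vb = Cyc.≢₁₂ cz nv
                    vc = Cyc.≢₁₃ cz nv
                    bc = Cyc.≢₂₃ cz nu
                    F : Alt 4 → Func (Fin 4)
                    F B = dotF (m c) +F (- 1#) *F appF B (p c)
                    kill : ∀ B g → Match B g → dot (m g) (p c) + dot (m c) (p g) ≈ 0# → fn (F B) (p g) ≈ 0#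
                    kill B g mg e = begin
                      dot (m c) (p g) + - 1# * app B (p c) (p g)    ≈⟨ +-congˡ (*-congˡ (Alt.anti B (p c) (p g))) ⟩
                      dot (m c) (p g) + - 1# * - app B (p g) (p c)  ≈⟨ +-congˡ (*-congˡ (-‿cong (mg (p c)))) ⟩
                      dot (m c) (p g) + - 1# * - dot (m g) (p c)    ≈⟨ solve 2 (λ x y → x :+ :- :1 :* :- y := y :+ x) refl _ _ ⟩
                      dot (m g) (p c) + dot (m c) (p g)             ≈⟨ e ⟩
                      0#                                            ∎
                    kills : ∀ B → Match B u → Match B v → Match B b → ∀ i → fn (F B) (at-pts p (u ∷ v ∷ b ∷ c ∷ []) i) ≈ 0#
                    kills B mu mv mb zero = kill B u mu (m-edge u c b (λ e → nu (trans (Cyc.sw′ cz u b c) (neg-0 e))))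
                    kills B mu mv mb (suc zero) = kill B v mv (m-edge v c b (λ e → nv (trans (Cyc.sw′ cz v b c) (neg-0 e))))
                    kills B mu mv mb (suc (suc zero)) = kill B b mb (m-edge b c u (≉0-resp (Cyc.rot cz u b c) nu))
                    kills B mu mv mb (suc (suc (suc zero))) = +-0 (m-self c) (*-0ʳ (Alt.alt B (p c)))

            module Glue (B : ∀ i → Trivial (L.D i) p m)
              (T : ∀ b c → Σ (Alt 4) λ B → R₀ b c ≉0 → Match B u × Match B v × Match B b × Match B c) where

              S : Fin n → Fin n → Alt 4
              S a b = R₀ a b *A proj₁ (T a b)

              R̃ : Fin n → Fin n → Alt 4
              R̃ a b = S a b +A ((- δ u b) *A ΣA (S a) +A δ u a *A ΣA (S b))

              -- The decomposition of z with each piece weighted by the form that describes m on it.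
              -- The result is a form-valued 2-cycle with β(a, b, c)(p_a, ·) = z(a, b, c) m_a.
              β : Fin n → Fin n → Fin n → Alt 4
              β a b c = ΣA (λ i → L.D i a b c *A proj₁ (B i)) +A (ω a *A R̃ b c +A ((- ω b) *A R̃ a c +A ω c *A R̃ a b))

              -- The forms for bc and for cb are chosen independently, but agree at three
              -- independent points and are therefore equal.
              alt-S : ∀ s t → Alt₂ (λ a b → app (S a b) s t)
              alt-S s t = record { anti = anti ; diag = λ a → *-0ˡ (Alt₂.diag alt-R₀ a) }
                where
                  anti : ∀ a b → R₀ a b * app (proj₁ (T a b)) s t ≈ - (R₀ b a * app (proj₁ (T b a)) s t)
                  anti a b = unless0 (R₀ a b)
                    (λ zz → trans (*-0ˡ zz) (sym (neg-0 (*-0ˡ (trans (Alt₂.anti alt-R₀ b a) (neg-0 zz))))))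
                    (λ nR →
                      let nR' : R₀ b a ≉0
                          nR' e = nR (trans (Alt₂.anti alt-R₀ a b) (neg-0 e))
                          (mu , mv , ma , _) = proj₂ (T a b) nR
                          (mu' , mv' , _ , ma') = proj₂ (T b a) nR'
                          C = proj₁ (T a b) +A (- 1#) *A proj₁ (T b a)
                          (nu , nv) = R⇒tetra (R₀-≢u₁ nR) (R₀-≢u₂ nR) (R₀⇒R nR)
                          diff : ∀ g → Match (proj₁ (T a b)) g → Match (proj₁ (T b a)) g → ∀ t → app C (p g) t ≈ 0#
                          diff g h h' t = trans (+-cong (h t) (*-congˡ (h' t))) (solve 1 (λ x → x :+ :- :1 :* x := :0) refl _)
                          same : app C s t ≈ 0#
                          same = kill₃ {p} (ind₃ (u ∷ v ∷ a ∷ []) (distinct₃ (Cyc.≢₁₂ cz zuv) (Cyc.≢₁₂ cz nu) (Cyc.≢₁₂ cz nv))) C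
                            (diff u mu mu') (diff v mv mv') (diff a ma ma') s t
                      in begin
                        R₀ a b * app (proj₁ (T a b)) s t
                          ≈⟨ solve 3 (λ r x y → r :* x := r :* (x :+ :- :1 :* y) :+ r :* y) refl _ _ (app (proj₁ (T b a)) s t) ⟩
                        R₀ a b * app C s t + R₀ a b * app (proj₁ (T b a)) s t
                          ≈⟨ +-cong (*-0ʳ same) (*-congʳ (Alt₂.anti alt-R₀ a b)) ⟩
                        0# + - R₀ b a * app (proj₁ (T b a)) s t
                          ≈⟨ solve 2 (λ r x → :0 :+ :- r :* x := :- (r :* x)) refl _ _ ⟩
                        - (R₀ b a * app (proj₁ (T b a)) s t) ∎)

              cyc-β : ∀ s t → Cyc (λ a b c → app (β a b c) s t)
              cyc-β s t = cyc-+ (cyc-∑ (λ i → scaled i)) (cyc-∧ ∑ω (cyc-close (alt-S s t)))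
                where
                  scaled : ∀ i → Cyc (λ a b c → L.D i a b c * app (proj₁ (B i)) s t)
                  scaled i = record
                    { sw = λ a b c → trans (*-congʳ (Cyc.sw cD a b c)) (sym (-‿distribˡ-* _ _))
                    ; sw′ = λ a b c → trans (*-congʳ (Cyc.sw′ cD a b c)) (sym (-‿distribˡ-* _ _))
                    ; dg = λ a c → *-0ˡ (Cyc.dg cD a c)
                    ; cycle = λ a b → trans (Σ-*ʳ _ _) (*-0ˡ (Cyc.cycle cD a b)) }
                    where cD = L.cyc-D i

              S-match : ∀ g b c → (R₀ b c ≉0 → Match (proj₁ (T b c)) g) → ∀ t → app (S b c) (p g) t ≈ R₀ b c * dot (m g) t
              S-match g b c h t = unless0 (R₀ b c) (λ zz → trans (*-0ˡ zz) (sym (*-0ˡ zz))) (λ nR → *-congˡ (h nR t))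

              ΣS-match : ∀ g b → (∀ c → R₀ b c ≉0 → Match (proj₁ (T b c)) g) → ∀ t → app (ΣA (S b)) (p g) t ≈ ∑ (R₀ b) * dot (m g) t
              ΣS-match g b h t = trans (Σ-cong (λ c → S-match g b c (h c) t)) (Σ-*ʳ _ _)

              expand : ∀ b c s → R b c * s ≈ R₀ b c * s + (- δ u c * (∑ (R₀ b) * s) + δ u b * (∑ (R₀ c) * s))
              expand b c s = trans (*-congʳ (close-away cyc-R b c))
                (solve 6 (λ r d e p q s → (r :+ (:- d :* p :+ e :* q)) :* s := r :* s :+ (:- d :* (p :* s) :+ e :* (q :* s))) refl _ _ _ _ _ _)

              via : ∀ g → (∀ b c → R₀ b c ≉0 → Match (proj₁ (T b c)) g) → ∀ b c t → app (R̃ b c) (p g) t ≈ R b c * dot (m g) t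
              via g h b c t = trans (+-cong (S-match g b c (h b c) t)
                (+-cong (*-congˡ (ΣS-match g b (h b) t)) (*-congˡ (ΣS-match g c (h c) t)))) (sym (expand b c _))

              via-u : ∀ b c t → app (R̃ b c) (p u) t ≈ R b c * dot (m u) t
              via-u = via u (λ b c nR → proj₁ (proj₂ (T b c) nR))

              via-v : ∀ b c t → app (R̃ b c) (p v) t ≈ R b c * dot (m v) t
              via-v = via v (λ b c nR → proj₁ (proj₂ (proj₂ (T b c) nR)))

              via-first : ∀ b c t → app (R̃ b c) (p b) t ≈ R b c * dot (m b) t
              via-first b c t = by-cases (u ≡ b) (λ { ≡.refl → via-u b c t }) λ ub →
                let δ0 : δ u b ≈ 0#
                    δ0 = reflexive (δ-≢ ub)
                    h : ∀ c → R₀ b c ≉0 → Match (proj₁ (T b c)) b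
                    h c nR = proj₁ (proj₂ (proj₂ (proj₂ (T b c) nR)))
                in trans (+-cong (S-match b b c (h c) t)
                     (+-cong (*-congˡ (ΣS-match b b h t)) (trans (*-0ˡ δ0) (sym (*-0ˡ δ0))))) (sym (expand b c _))

              via-ω : ∀ a b c t → ω a * app (R̃ b c) (p a) t ≈ ω a * (R b c * dot (m a) t)
              via-ω a b c t with kind u v a
              ... | is-u ≡.refl = *-congˡ (via-u b c t)
              ... | is-v ≡.refl = *-congˡ (via-v b c t)
              ... | oth au av   = trans (*-0ˡ (ω-o au av)) (sym (*-0ˡ (ω-o au av)))

              β-match : ∀ a b c t → app (β a b c) (p a) t ≈ z a b c * dot (m a) t
              β-match a b c t = begin
                ∑ (λ i → L.D i a b c * app (proj₁ (B i)) (p a) t)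
                  + (ω a * app (R̃ b c) (p a) t + (- ω b * app (R̃ a c) (p a) t + ω c * app (R̃ a b) (p a) t))
                  ≈⟨ +-cong (trans (Σ-cong (λ i → unless0 (L.D i a b c) (λ zz → trans (*-0ˡ zz) (sym (*-0ˡ zz)))
                       (λ nD → *-congˡ (proj₂ (B i) a b c nD t)))) (Σ-*ʳ _ _))
                     (+-cong (via-ω a b c t) (+-cong (*-congˡ (via-first a c t)) (*-congˡ (via-first a b t)))) ⟩
                ∑ (λ i → L.D i a b c) * s + (ω a * (R b c * s) + (- ω b * (R a c * s) + ω c * (R a b * s)))
                  ≈⟨ solve 8 (λ d s wa wb wc x y z → d :* s :+ (wa :* (x :* s) :+ (:- wb :* (y :* s) :+ wc :* (z :* s)))
                       := (d :+ (wa :* x :+ (:- wb :* y :+ wc :* z))) :* s) refl _ _ _ _ _ _ _ _ ⟩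
                (∑ (λ i → L.D i a b c) + (ω ∧₃ R) a b c) * s
                  ≈⟨ *-congʳ (z-split a b c) ⟨
                z a b c * s ∎
                where s = dot (m a) t

              -- Where z vanishes, β(a, b, c) kills p_a, p_b and p_c, hence is zero as a form on k⁴.
              β⊑z : ∀ s t → (λ a b c → app (β a b c) s t) ⊑ z
              β⊑z s t a b c zz = by-cases (a ≡ b) (λ { ≡.refl → Cyc.dg (cyc-β s t) a c }) λ ab →
                by-cases (a ≡ c) (λ { ≡.refl → Cyc.dg₁₃ (cyc-β s t) a b }) λ ac →
                by-cases (b ≡ c) (λ { ≡.refl → Cyc.dg₂₃ (cyc-β s t) a b }) λ bc →
                kill₃ {p} (ind₃ (a ∷ b ∷ c ∷ []) (distinct₃ ab ac bc)) (β a b c)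
                  (λ t → trans (β-match a b c t) (*-0ˡ zz))
                  (λ t → trans (Cyc.rot (cyc-β (p b) t) a b c) (trans (β-match b c a t) (*-0ˡ (trans (sym (Cyc.rot cz a b c)) zz))))
                  (λ t → trans (Cyc.rot² (cyc-β (p c) t) a b c) (trans (β-match c a b t) (*-0ˡ (trans (sym (Cyc.rot² cz a b c)) zz))))
                  s t

              -- By minimality every component of β is a multiple of z, so β is z times one constant
              -- form, read off at u v x₀. This is where the minimality of z forces the separate
              -- forms to coincide.
              trivial : Trivial z p m
              trivial = inv _ zuv *A β u v x₀ , λ a b c nz t → stable
                (Minimal.unique mz _ (cyc-β (p a) t) (β⊑z (p a) t) >>= λ { (τ , e) →
                let τ-m : τ ≈ dot (m a) t
                    τ-m = begin
                      τ                                   ≈⟨ solve 2 (λ x y → x := y :+ (x :- y)) refl _ _ ⟩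
                      dot (m a) t + (τ - dot (m a) t)     ≈⟨ +-congˡ (cancel nz (begin
                        z a b c * (τ - dot (m a) t)         ≈⟨ solve 3 (λ z x y → z :* (x :- y) := x :* z :- z :* y) refl _ _ _ ⟩
                        τ * z a b c - z a b c * dot (m a) t ≈⟨ +-cong (sym (e a b c)) (-‿cong (sym (β-match a b c t))) ⟩
                        app (β a b c) (p a) t - app (β a b c) (p a) t ≈⟨ -‿inverseʳ _ ⟩
                        0# ∎)) ⟩
                      dot (m a) t + 0#                    ≈⟨ +-identityʳ _ ⟩
                      dot (m a) t                         ∎
                in return (begin
                  inv _ zuv * app (β u v x₀) (p a) t      ≈⟨ *-congˡ (e u v x₀) ⟩
                  inv _ zuv * (τ * z u v x₀)              ≈⟨ solve 3 (λ i t z → i :* (t :* z) := z :* i :* t) refl _ _ _ ⟩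
                  z u v x₀ * inv _ zuv * τ                ≈⟨ trans (*-congʳ (inv-r zuv)) (*-identityˡ _) ⟩
                  τ                                       ≈⟨ τ-m ⟩
                  dot (m a) t                             ∎) })

          rigid-at : ∀ p → Ind 3 p → Ind 4 p → (∀ i → Rigid (L.D i) p) → Rigid z p
          rigid-at p ind₃ ind₄ rigD m mo =
            dn-Fin (λ i → rigD i m (AtPoints.motion-D p ind₃ ind₄ rigD m mo i)) >>= λ B →
            dn-Fin (λ b → dn-Fin (λ c → AtPoints.tetra p ind₃ ind₄ rigD m mo b c)) >>= λ T →
            return (AtPoints.Glue.trivial p ind₃ ind₄ rigD m mo B T)

          -- Each lift is rigid at points of its own; openness provides points in general position
          -- at which all of them are rigid simultaneously.
          rigid : (∀ i → DN (∃[ p ] (Ind 3 p × Rigid (y i) p))) → DN (∃[ p ] (Ind 3 p × Rigid z p))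
          rigid ih = dn-Fin (λ i → L.Split.pinned i mz x₀ zuv (Minimal.nonzero (minimal i)) (ih i)) >>= λ pins →
            meet (open-∧ (open-Ind 3) (open-Ind 4))
              (open-∀ (λ i → Pins.open-Pin {n} {4} {0} id none (L.D i) (proj₁ (pins i)) (proj₁ (proj₂ (pins i))) (proj₁ (proj₂ (proj₂ (pins i))))))
              (meet (open-Ind 3) (open-Ind 4) (exists-Ind 3 (s≤s (s≤s (s≤s z≤n)))) (exists-Ind 4 ℕ.≤-refl))
              (meet-∀ (λ i → Pins.open-Pin {n} {4} {0} id none (L.D i) _ _ _) (λ i → return (proj₂ (proj₂ (proj₂ (proj₂ (pins i))))))) >>= λ
              { (p , (ind₃ , ind₄) , pin) → return (p , ind₃ , rigid-at p ind₃ ind₄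
                  (λ i → Pin⇒Rigid (L.cyc-D i) ind₃ (proj₁ (proj₂ (proj₂ (proj₂ (pins i))))) (pin i))) }

      -- Fogelsanger's theorem; points of projective 3-space are vectors of k⁴.
      minimal-rigid′ : ∀ k {z} (A : Subset n) → ∣ A ∣ ≤ k → (∀ a b c → z a b c ≉0 → a Sub.∈ A) → Minimal z →
        DN (∃[ p ] (Ind 3 p × Rigid z p))
      minimal-rigid′ k {z} A le sup mz = find₃ (Minimal.nonzero mz) >>= λ { (u , v , x₀ , zuv) → contract k le u v x₀ zuv }
        where
          cz = Minimal.cyc mz
          contract : ∀ k → ∣ A ∣ ≤ k → ∀ u v x₀ → z u v x₀ ≉0 → DN (∃[ p ] (Ind 3 p × Rigid z p))
          contract zero le u v x₀ zuv = ⊥-elim (ℕ.n≮0 (ℕ.<-≤-trans (Sub.x∈p⇒∣p-x∣<∣p∣ (sup u v x₀ zuv)) le))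
          contract (suc k) le u v x₀ zuv =
            dn-Fin (λ a → dn-Fin (λ b → choose a b)) >>= λ α →
            decompose cyc-z′ >>= λ dec →
            WithParts.rigid (λ a b → proj₁ (α a b)) (λ a b → proj₂ (α a b)) dec
              (λ i → minimal-rigid′ k (A Sub.- v)
                (ℕ.≤-pred (ℕ.≤-trans (Sub.x∈p⇒∣p-x∣<∣p∣ (sup v x₀ u (≉0-resp (Cyc.rot cz u v x₀) zuv))) le))
                (λ a b c ny → support a b c (⊑-≉0 (Decomposition.within dec i) ny)) (Decomposition.minimal dec i))
            where
              open Step z mz u v x₀ zuv using (module WithParts)
              open Contract z cz u v (Cyc.≢₁₂ cz zuv)

              choose : ∀ a b → DN (Σ Carrier λ α → (z u a b ≈ 0# × α ≈ 1#) ⊎ (z u a b ≉0 × α ≈ 0#))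
              choose a b = lem (z u a b ≈ 0#) >>= λ
                { (inj₁ e) → return (1# , inj₁ (e , refl)) ; (inj₂ n) → return (0# , inj₂ (n , refl)) }

              -- Contraction introduces no vertex and loses v, so the induction runs on the number
              -- of vertices.
              support : ∀ a b c → z′ a b c ≉0 → a Sub.∈ A Sub.- v
              support a b c nz = Sub.x∈p∧x≢y⇒x∈p-y inA (λ { ≡.refl → nz (z′-v b c) })
                where
                  inA : a Sub.∈ A
                  inA with a Sub.∈? A
                  ... | yes e = e
                  ... | no na = ⊥-elim (nz (+-0 (out b c)
                          (neg-0 (*-0ʳ (+-0 (*-0ˡ (ω-o (λ { ≡.refl → na (sup u v x₀ zuv) })
                            (λ { ≡.refl → na (sup v x₀ u (≉0-resp (Cyc.rot cz u v x₀) zuv)) })))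
                            (+-0 (*-0ʳ (trans (Cyc.sw cz v a c) (neg-0 (out v c)))) (*-0ʳ (trans (Cyc.sw cz v a b) (neg-0 (out v b))))))))))
                    where
                      out : ∀ b c → z a b c ≈ 0#
                      out b c = stable (λ n → na (sup a b c n))

      minimal-rigid : ∀ {z} → Minimal z → DN (∃[ p ] (Ind 3 p × Rigid z p))
      minimal-rigid = minimal-rigid′ _ Sub.⊤ ℕ.≤-refl (λ _ _ _ _ → Sub.∈⊤)

    -- Chains, contraction with a vertex, and homology

    module Simplicial where

      Ch : Cx n → ℕ → (Subset n → Carrier) → Set ℓ
      Ch = WithField.Chain 𝔽

      sgn-+ : ∀ a b → sgn (a ℕ.+ b) ≈ sgn a * sgn b
      sgn-+ zero    b = sym (*-identityˡ _)
      sgn-+ (suc a) b = trans (-‿cong (sgn-+ a b)) (-‿distribˡ-* _ _)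

      sgn² : ∀ a → sgn a * sgn a ≈ 1#
      sgn² zero    = *-identityˡ _
      sgn² (suc a) = trans (solve 1 (λ s → :- s :* :- s := s :* s) refl _) (sgn² a)

      sgn-≉0 : ∀ a → sgn a ≉0
      sgn-≉0 a e = 1≉0 (trans (sym (sgn² a)) (*-0ˡ e))

      opaque
        iF : Fin n → Subset n → Func (Subset n)
        iF u F = if lookup F u then 0F else (sgn (below F u) *F ev (ins u F))

      -- Contraction with the vertex u; it takes chains of Γ to chains of the link of u.
      i : Fin n → (Subset n → Carrier) → Subset n → Carrier
      i u ψ F = fn (iF u F) ψ

      opaque
        unfolding iF

        i-in : ∀ {u F} ψ → lookup F u ≡ true → i u ψ F ≈ 0#
        i-in ψ e rewrite e = refl

        i-out : ∀ {u F} ψ → lookup F u ≡ false → i u ψ F ≈ sgn (below F u) * ψ (ins u F)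
        i-out ψ e rewrite e = refl

      -- The boundary as the sum of all vertex contractions. It mentions no complex, agrees with `∂`
      -- on chains of a complex by `∂-Bd`, and its rules reduce to the anticommutation `ii-anti`.
      BdF : Subset n → Func (Subset n)
      BdF F = ΣF (λ u → iF u F)

      Bd : (Subset n → Carrier) → Subset n → Carrier
      Bd ψ F = fn (BdF F) ψ

      fn-∑ : ∀ {I m} (f : Func I) (x : Fin m → I → Carrier) → fn f (λ a → ∑ (λ j → x j a)) ≈ ∑ (λ j → fn f (x j))
      fn-∑ f x = trans (Func.cong f (λ a → Σ-cong (λ j → sym (*-identityˡ _))))
        (trans (Func.sum f (λ _ → 1#) x) (Σ-cong (λ j → *-identityˡ _)))

      fn-neg : ∀ {I} (f : Func I) (x : I → Carrier) → fn f (λ a → - x a) ≈ - fn f x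
      fn-neg f x = trans (Func.cong f (λ a → solve 1 (λ y → :- y := :- :1 :* y) refl _))
        (trans (Func.mul f _ _) (solve 1 (λ y → :- :1 :* y := :- y) refl _))

      ii-diag : ∀ u ψ F → i u (i u ψ) F ≈ 0#
      ii-diag u ψ F = bool-case (lookup F u) (λ e → i-in (i u ψ) e)
        (λ e → trans (i-out (i u ψ) e) (*-0ʳ (i-in ψ (ins-≡ u F))))

      ii-anti : ∀ u v ψ F → i u (i v ψ) F ≈ - i v (i u ψ) F
      ii-anti u v ψ F with u Fin.≟ v
      ... | yes ≡.refl = trans (ii-diag u ψ F) (sym (neg-0 (ii-diag u ψ F)))
      ... | no u≢v = bool-case (lookup F u)
        (λ eu → trans (i-in (i v ψ) eu) (sym (neg-0 (vanish v u eu))))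
        (λ eu → bool-case (lookup F v)
          (λ ev → trans (vanish u v ev) (sym (neg-0 (i-in (i u ψ) ev))))
          (λ ev → begin
            i u (i v ψ) F
              ≈⟨ value u v u≢v eu ev ⟩
            s (toℕ u <ᵇ toℕ v) * (sgn (below F u) * sgn (below F v) * ψ (ins v (ins u F)))
              ≈⟨ *-cong (flip) (*-cong (*-comm _ _) (reflexive (≡.cong ψ (ins-comm v u F)))) ⟩
            - s (toℕ v <ᵇ toℕ u) * (sgn (below F v) * sgn (below F u) * ψ (ins u (ins v F)))
              ≈⟨ -‿distribˡ-* _ _ ⟨
            - (s (toℕ v <ᵇ toℕ u) * (sgn (below F v) * sgn (below F u) * ψ (ins u (ins v F))))
              ≈⟨ -‿cong (value v u (λ e → u≢v (≡.sym e)) ev eu) ⟨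
            - i v (i u ψ) F ∎))
        where
          vanish : ∀ u v → lookup F v ≡ true → i u (i v ψ) F ≈ 0#
          vanish u v ev = bool-case (lookup F u) (λ e → i-in (i v ψ) e)
            (λ e → trans (i-out (i v ψ) e) (*-0ʳ (i-in ψ (ins-mono u F ev))))

          s : Bool → Carrier
          s b = sgn (if b then 1 else 0)

          flip : s (toℕ u <ᵇ toℕ v) ≈ - s (toℕ v <ᵇ toℕ u)
          flip rewrite <ᵇ-flip u≢v with toℕ v <ᵇ toℕ u
          ... | true  = sym (-‿involutive _)
          ... | false = refl

          value : ∀ u v → u ≢ v → lookup F u ≡ false → lookup F v ≡ false →
            i u (i v ψ) F ≈ s (toℕ u <ᵇ toℕ v) * (sgn (below F u) * sgn (below F v) * ψ (ins v (ins u F)))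
          value u v n eu ev = begin
            i u (i v ψ) F
              ≈⟨ trans (i-out (i v ψ) eu) (*-congˡ (i-out ψ (≡.trans (ins-≢ F (λ e → n (≡.sym e))) ev))) ⟩
            sgn (below F u) * (sgn (below (ins u F) v) * ψ (ins v (ins u F)))
              ≈⟨ *-congˡ (*-congʳ (trans (reflexive (≡.cong sgn (below-ins u v F eu))) (sgn-+ (if toℕ u <ᵇ toℕ v then 1 else 0) _))) ⟩
            sgn (below F u) * (s (toℕ u <ᵇ toℕ v) * sgn (below F v) * ψ (ins v (ins u F)))
              ≈⟨ solve 4 (λ a s b p → a :* (s :* b :* p) := s :* (a :* b :* p)) refl _ _ _ _ ⟩
            s (toℕ u <ᵇ toℕ v) * (sgn (below F u) * sgn (below F v) * ψ (ins v (ins u F))) ∎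

      Bd-i : ∀ v ψ F → Bd (i v ψ) F ≈ - i v (Bd ψ) F
      Bd-i v ψ F = begin
        ∑ (λ u → i u (i v ψ) F)       ≈⟨ Σ-cong (λ u → ii-anti u v ψ F) ⟩
        ∑ (λ u → - i v (i u ψ) F)     ≈⟨ Σ-neg _ ⟩
        - ∑ (λ u → i v (i u ψ) F)     ≈⟨ -‿cong (fn-∑ (iF v F) (λ u → i u ψ)) ⟨
        - i v (Bd ψ) F                ∎

      Bd-Bd : ∀ ψ F → Bd (Bd ψ) F ≈ 0#
      Bd-Bd ψ F = trans (Σ-cong (λ u → fn-∑ (iF u F) (λ v → i v ψ)))
        (Σ-alt (λ u v → i u (i v ψ) F) (λ u v → ii-anti u v ψ F) (λ u → ii-diag u ψ F))

      ch-face : ∀ {Γ s ψ F} → Ch Γ s ψ → ψ F ≉0 → Γ F ≡ true × ∣ F ∣ ≡ s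
      ch-face {Γ} {s} {ψ} {F} h nz = bool-case (faceOfSize Γ s F) (face-of {Γ = Γ}) (λ e → ⊥-elim (nz (h F e)))

      ch-intro : ∀ {Γ s ψ} → (∀ F → ψ F ≉0 → Γ F ≡ true × ∣ F ∣ ≡ s) → Ch Γ s ψ
      ch-intro {Γ} {s} {ψ} h F e = stable (λ nz → true≢false (face-intro {Γ = Γ} (proj₁ (h F nz)) (proj₂ (h F nz))) e)

      ch-same : ∀ {Γ Γ' s ψ} → (∀ F → Γ F ≡ Γ' F) → Ch Γ s ψ → Ch Γ' s ψ
      ch-same h ch F e = ch F (≡.trans (≡.cong (_∧ _) (h F)) e)

      i-≉0 : ∀ {u ψ F} → i u ψ F ≉0 → lookup F u ≡ false × ψ (ins u F) ≉0
      i-≉0 {u} {ψ} {F} nz = bool-case (lookup F u) (λ e → ⊥-elim (nz (i-in ψ e)))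
        (λ e → e , λ z → nz (trans (i-out ψ e) (*-0ʳ z)))

      ch-i : ∀ {Γ s ψ} v → Ch Γ (suc s) ψ → Ch (link Γ ⁅ v ⁆) s (i v ψ)
      ch-i {Γ} {s} {ψ} v ch = ch-intro {link Γ ⁅ v ⁆} (λ F nz →
        let (e , nψ) = i-≉0 nz
            (f , sz) = ch-face {Γ} ch nψ
        in link-intro {Γ = Γ} e f , ℕ.suc-injective (≡.trans (≡.sym (size-ins v F e)) sz))

      ch-Bd : ∀ {Γ s ψ} → Down Γ → Ch Γ (suc s) ψ → Ch Γ s (Bd ψ)
      ch-Bd {Γ} {s} {ψ} d ch = ch-intro {Γ} (λ F nz → bool-case (faceOfSize Γ s F) (face-of {Γ = Γ}) (λ e →
        ⊥-elim (nz (Σ-0 (λ u → stable (λ nu →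
          let (a , nψ) = i-≉0 nu
              (f , sz) = ch-face {Γ} ch nψ
          in true≢false (face-intro {Γ = Γ} (d u F f) (ℕ.suc-injective (≡.trans (≡.sym (size-ins u F a)) sz))) e))))))

      ∂-Bd : ∀ {Γ s ψ} → Down Γ → Ch Γ (suc s) ψ → ∀ F → WithField.∂ 𝔽 Γ s ψ F ≈ Bd ψ F
      ∂-Bd {Γ} {s} {ψ} d ch F with faceOfSize Γ s F in e
      ... | false = sym (ch-Bd {Γ} d ch F e)
      ... | true  = trans (reflexive (≡.sym (∑-def _))) (Σ-cong term)
        where
          term : ∀ u → (if not (lookup F u) ∧ Γ (F ∪ ⁅ u ⁆) then sgn (below F u) * ψ (F ∪ ⁅ u ⁆) else 0#) ≈ i u ψ F
          term u with lookup F u in q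
          ... | true = sym (i-in ψ q)
          ... | false with Γ (F ∪ ⁅ u ⁆) in r
          ...   | true  = sym (i-out ψ q)
          ...   | false = sym (trans (i-out ψ q) (*-0ʳ (stable (λ nz → true≢false (proj₁ (ch-face {Γ} ch nz)) r))))

      record Cycle (Γ : Cx n) (s : ℕ) (ψ : Subset n → Carrier) : Set ℓ where
        constructor mkCycle
        field
          chain  : Ch Γ s ψ
          closed : ∀ F → Bd ψ F ≈ 0#

      cycles⇒ : ∀ {Γ s ψ} → Down Γ → WithField.Cycles 𝔽 Γ (suc s) ψ → Cycle Γ (suc s) ψ
      cycles⇒ {Γ} d (ch , z) = mkCycle ch (λ F → trans (sym (∂-Bd {Γ} d ch F)) (z F))

      cycles⇐ : ∀ {Γ s ψ} → Down Γ → Cycle Γ (suc s) ψ → WithField.Cycles 𝔽 Γ (suc s) ψ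
      cycles⇐ {Γ} d (mkCycle ch z) = ch , (λ F → trans (∂-Bd {Γ} d ch F) (z F))

      cycle-same : ∀ {Γ Γ' s ψ} → (∀ F → Γ F ≡ Γ' F) → Cycle Γ s ψ → Cycle Γ' s ψ
      cycle-same {Γ} {Γ'} h (mkCycle ch z) = mkCycle (ch-same {Γ} {Γ'} h ch) z

      BettiB : Cx n → ℕ → ℕ → Set (c ⊔ ℓ)
      BettiB Γ t b = ∃[ z ] ∃[ bb ] (Basis (WithField.Cycles 𝔽 Γ t) z × Basis (WithField.Boundaries 𝔽 Γ t) bb × b ℕ.+ bb ≡ z)

      no-chains : ∀ {Γ s ψ} → (∀ F → Γ F ≡ true → ∣ F ∣ ≢ s) → Ch Γ s ψ → ∀ F → ψ F ≈ 0#
      no-chains {Γ} h ch F = stable (λ nz → h F (proj₁ (ch-face {Γ} ch nz)) (proj₂ (ch-face {Γ} ch nz)))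

      -- In the top degree there is nothing to bound: a basis vector of the boundaries would be
      -- zero, so the Betti number counts cycles.
      basis-top : ∀ {Γ t b} → Down Γ → (∀ F → Γ F ≡ true → ∣ F ∣ ≢ suc t) → BettiB Γ t b → Basis (WithField.Cycles 𝔽 Γ t) b
      basis-top {Γ} {t} {b} d none (z , zero , B , _ , e) rewrite ℕ.+-identityʳ b | e = B
      basis-top {Γ} {t} d none (z , suc bb , _ , (e , eS , li , _) , _) = ⊥-elim (LinIndep-≉0 li zero (λ F →
        trans (proj₂ (proj₂ (eS zero)) F) (trans (∂-Bd {Γ} d (proj₁ (proj₂ (eS zero))) F)
          (Func.zer (BdF F) (no-chains {Γ} none (proj₁ (proj₂ (eS zero))))))))

      Top : Cx n → ℕ → Set (c ⊔ ℓ)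
      Top Γ s = ∃[ ζ ] (Cycle Γ s ζ × ¬ (∀ F → ζ F ≈ 0#) × (∀ x → Cycle Γ s x → DN (∃[ t ] ∀ F → x F ≈ t * ζ F)))

      top : ∀ {Γ s} → Down Γ → (∀ F → Γ F ≡ true → ∣ F ∣ ≢ suc (suc s)) → BettiB Γ (suc s) 1 → Top Γ (suc s)
      top {Γ} {s} d none be with basis-top {Γ} d none be
      ... | e , eS , li , sp = e zero , cycles⇒ {Γ} d (eS zero) , LinIndep-≉0 li zero ,
        λ x cx → sp x (cycles⇐ {Γ} d cx) >>= λ { (γ , q) → return (γ zero , λ F →
          trans (q F) (trans (∑-suc _) (trans (+-congˡ (∑-zero _)) (+-identityʳ _)))) }

      Acyclic : Cx n → ℕ → Set (c ⊔ ℓ)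
      Acyclic Γ s = ∀ x → Cycle Γ s x → DN (∃[ ψ ] (Ch Γ (suc s) ψ × (∀ F → x F ≈ Bd ψ F)))

      -- A zero Betti number makes the dimensions of boundaries and cycles equal; `same-dimension`
      -- then writes a cycle in the basis of boundaries, whose preimages are known.
      acyclic : ∀ {Γ s} → Down Γ → BettiB Γ (suc s) 0 → Acyclic Γ (suc s)
      acyclic {Γ} {s} d (z , bb , bz , bb' , ≡.refl) x cx =
        same-dimension bz bb' inc x (cycles⇐ {Γ} d cx) >>= λ { (γ , q) →
        return (lincomb γ (λ j → proj₁ (pre j)) ,
          (λ F e → Σ-0 (λ j → *-0ʳ (proj₁ (proj₂ (pre j)) F e))) ,
          λ F → trans (q F) (trans (Σ-cong (λ j → *-congˡ (trans (proj₂ (proj₂ (pre j)) F) (∂-Bd {Γ} d (proj₁ (proj₂ (pre j))) F))))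
            (sym (Func.sum (BdF F) γ (λ j → proj₁ (pre j)))))) }
        where
          pre = proj₁ (proj₂ bb')
          inc : ∀ y → WithField.Boundaries 𝔽 Γ (suc s) y → WithField.Cycles 𝔽 Γ (suc s) y
          inc y (ψ , ch , e) = cycles⇐ {Γ} d (mkCycle
            (λ F f → trans (e F) (trans (∂-Bd {Γ} d ch F) (ch-Bd {Γ} d ch F f)))
            (λ F → trans (Func.cong (BdF F) (λ G → trans (e G) (∂-Bd {Γ} d ch G))) (Bd-Bd ψ F)))

    -- Homology 2-spheres and the stresses around them

    module Local where

      open Geometry
      open Cycles
      open Rigidity using (module Pins; Rigid; masked; vertex-cases; zero-coords)
      open Fogelsanger using (minimal-rigid)
      open Simplicial

      ch-vertex : ∀ {Γ ψ a} → Ch Γ 1 ψ → i a ψ Sub.⊥ ≉0 → Face Γ (a ∷ [])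
      ch-vertex {Γ} {ψ} {a} ch nz = proj₁ (ch-face {link Γ ⁅ a ⁆} {0} (ch-i {Γ} a ch) nz)

      single : (Fin n → Carrier) → Subset n → Carrier
      single f F = ∑ (λ u → unitSub (ins u Sub.⊥) F * f u)

      ins⊥-inj : ∀ {u w : Fin n} → ins u Sub.⊥ ≡ ins w Sub.⊥ → u ≡ w
      ins⊥-inj {u} {w} e with u Fin.≟ w
      ... | yes q = q
      ... | no ne = ⊥-elim (true≢false (≡.trans (≡.cong (λ F → lookup F u) (≡.sym e)) (ins-≡ u Sub.⊥))
              (≡.trans (ins-≢ Sub.⊥ ne) (lookup-⊥ u)))

      single-at : ∀ f w → single f (ins w Sub.⊥) ≈ f w
      single-at f w = trans (Σ-cong (λ u → *-congʳ (by-cases (u ≡ w)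
          (λ { ≡.refl → trans (unitSub-≡ (ins u Sub.⊥)) (reflexive (≡.sym (δ-≡ u))) })
          (λ ne → trans (Summable.unit-off (summable-Subset n) _ _ (ne ∘ ins⊥-inj)) (reflexive (≡.sym (δ-≢ (λ e → ne (≡.sym e))))))))) 
        (trans (Σ-cong (λ u → *-congʳ (by-cases (u ≡ w) (λ { ≡.refl → refl })
          (λ ne → trans (reflexive (δ-≢ (λ e → ne (≡.sym e)))) (reflexive (≡.sym (δ-≢ (λ e → ne (≡.sym e)))))))))
          (Σ-δ w f))

      i-⊥ : ∀ ψ u → i u ψ Sub.⊥ ≈ ψ (ins u Sub.⊥)
      i-⊥ ψ u = trans (i-out ψ (lookup-⊥ u)) (trans (*-congʳ (reflexive (≡.cong sgn (below-⊥ u)))) (*-identityˡ _))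

      single-chain : ∀ {Γ f} → (∀ u → f u ≉0 → Face Γ (u ∷ [])) → Ch Γ 1 (single f)
      single-chain {Γ} {f} h = ch-intro {Γ} λ F nz → bool-case (faceOfSize Γ 1 F) (face-of {Γ = Γ}) λ e →
        ⊥-elim (nz (Σ-0 (λ u → by-cases (ins u Sub.⊥ ≡ F)
          (λ { ≡.refl → *-0ʳ (stable (λ nf → true≢false (face-intro {Γ = Γ} (proj₂ (link-face {Γ = Γ} {u} {Sub.⊥} (h u nf)))
              (≡.trans (size-ins u Sub.⊥ (lookup-⊥ u)) (≡.cong suc (size-⊥ {n})))) e)) })
          (λ ne → *-0ˡ (Summable.unit-off (summable-Subset n) _ _ ne)))))

      single-cycle : ∀ {Γ f} → Down Γ → (∀ u → f u ≉0 → Face Γ (u ∷ [])) → ∑ f ≈ 0# → Cycle Γ 1 (single f)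
      single-cycle {Γ} {f} d h s = mkCycle (single-chain {Γ} h) λ F → stable λ nz →
        nz (≡.subst (λ G → Bd (single f) G ≈ 0#) (≡.sym (size-0 F (proj₂ (ch-face {Γ} (ch-Bd {Γ} d (single-chain {Γ} h)) nz))))
          (trans (Σ-cong (λ u → trans (i-⊥ (single f) u) (single-at f u))) s))

      ∑δ : ∀ (u : Fin n) → ∑ (δ u) ≈ 1#
      ∑δ u = trans (Σ-cong (λ a → sym (*-identityʳ _))) (Σ-δ u (λ _ → 1#))

      module _ {Γ : Cx n} (d : Down Γ) where

        -- Connectedness drawn from homology without paths: the 0-cycle u - w bounds a 1-chain, and
        -- the indicator of P, constant along edges, pairs to zero with a boundary.
        connected : ∀ {q} → Acyclic Γ 1 → (P : Fin n → Set q) →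
          (∀ u w → Face Γ (w ∷ u ∷ []) → P u → DN (P w)) →
          ∀ u w → Face Γ (u ∷ []) → Face Γ (w ∷ []) → P u → DN (P w)
        connected ac P step u w fu fw pu =
          ac (single f) (single-cycle {Γ} {f} d supp sum-f) >>= λ { (η , ch , e) →
          dn-Fin (λ a → choose a) >>= λ χ →
          let h : Fin n → Fin n → Carrier
              h a b = i a (i b η) Sub.⊥

              h-face : ∀ {a b} → h a b ≉0 → Face Γ (a ∷ b ∷ [])
              h-face {a} {b} nz = ch-vertex {link Γ ⁅ b ⁆} (ch-i {Γ} b ch) nz

              same : ∀ a b → h a b ≉0 → proj₁ (χ a) ≈ proj₁ (χ b)
              same a b nz = stable (agree (χ a) (χ b) (step b a (h-face nz)) (step a b (face-swap Γ a b [] (h-face nz))))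

              -- Constancy of the indicator along edges makes g alternating, so its double sum
              -- vanishes; that sum is the pairing of u - w with the indicator.
              g : Fin n → Fin n → Carrier
              g a b = proj₁ (χ a) * h a b

              g-anti : ∀ a b → g a b ≈ - g b a
              g-anti a b = unless0 (h a b)
                (λ z → trans (*-0ʳ z) (sym (neg-0 (*-0ʳ (trans (ii-anti b a η Sub.⊥) (neg-0 z))))))
                (λ nz → trans (*-cong (same a b nz) (ii-anti a b η Sub.⊥)) (solve 2 (λ x y → x :* :- y := :- (x :* y)) refl _ _))

              pairing : ∑ (λ a → f a * proj₁ (χ a)) ≈ 0#
              pairing = trans (Σ-cong (λ a → begin
                  f a * proj₁ (χ a)                   ≈⟨ *-comm _ _ ⟩
                  proj₁ (χ a) * f a                   ≈⟨ *-congˡ (single-at f a) ⟨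
                  proj₁ (χ a) * single f (ins a Sub.⊥) ≈⟨ *-congˡ (e _) ⟩
                  proj₁ (χ a) * Bd η (ins a Sub.⊥)    ≈⟨ *-congˡ (i-⊥ (Bd η) a) ⟨
                  proj₁ (χ a) * i a (Bd η) Sub.⊥      ≈⟨ *-congˡ (fn-∑ (iF a Sub.⊥) (λ x → i x η)) ⟩
                  proj₁ (χ a) * ∑ (λ x → h a x)       ≈⟨ Σ-* _ _ ⟨
                  ∑ (g a)                             ∎))
                (Σ-alt g g-anti (λ a → *-0ʳ (ii-diag a η Sub.⊥)))

              χ-eq : proj₁ (χ u) - proj₁ (χ w) ≈ 0#
              χ-eq = trans (sym (trans (Σ-cong (λ a → solve 3 (λ x y c → (x :- y) :* c := x :* c :- y :* c) refl _ _ _))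
                (trans (Σ-sub _ _) (+-cong (Σ-δ u (λ a → proj₁ (χ a))) (-‿cong (Σ-δ w (λ a → proj₁ (χ a)))))))) pairing
          in conclude (χ u) (χ w) χ-eq }
          where
            f : Fin n → Carrier
            f a = δ u a - δ w a

            supp : ∀ a → f a ≉0 → Face Γ (a ∷ [])
            supp a nz with u Fin.≟ a | w Fin.≟ a
            ... | yes ≡.refl | _ = fu
            ... | no _ | yes ≡.refl = fw
            ... | no _ | no _ = ⊥-elim (nz (-‿inverseʳ _))

            sum-f : ∑ f ≈ 0#
            sum-f = trans (Σ-sub _ _) (trans (+-cong (∑δ u) (-‿cong (∑δ w))) (-‿inverseʳ _))

            Val : Fin n → Set _
            Val a = Σ Carrier λ χ → (P a × χ ≈ 1#) ⊎ (¬ P a × χ ≈ 0#)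

            choose : ∀ a → DN (Val a)
            choose a = lem (P a) >>= λ { (inj₁ p) → return (1# , inj₁ (p , refl)) ; (inj₂ np) → return (0# , inj₂ (np , refl)) }

            agree : ∀ {a b} (x : Val a) (y : Val b) → (P b → DN (P a)) → (P a → DN (P b)) → DN (proj₁ x ≈ proj₁ y)
            agree (_ , inj₁ (_ , e)) (_ , inj₁ (_ , f)) s t = return (trans e (sym f))
            agree (_ , inj₂ (_ , e)) (_ , inj₂ (_ , f)) s t = return (trans e (sym f))
            agree (_ , inj₁ (p , _)) (_ , inj₂ (np , _)) s t = ⊥-elim (t p np)
            agree (_ , inj₂ (np , _)) (_ , inj₁ (p , _)) s t = ⊥-elim (s p np)

            conclude : (x : Val u) (y : Val w) → proj₁ x - proj₁ y ≈ 0# → DN (P w)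
            conclude _ (_ , inj₁ (p , _)) _ = return p
            conclude (_ , inj₂ (np , _)) _ _ = ⊥-elim (np pu)
            conclude (x , inj₁ (_ , e)) (y , inj₂ (_ , f)) z = ⊥-elim (1≉0 (begin
              1#        ≈⟨ e ⟨
              x         ≈⟨ solve 1 (λ x → x := x :- :0) refl _ ⟩
              x - 0#    ≈⟨ +-congˡ (-‿cong f) ⟨
              x - y     ≈⟨ z ⟩
              0#        ∎))

      same-ratio : ∀ {x y ρ} (n : y ≉0) → x ≈ ρ * y → x * inv y n ≈ ρ
      same-ratio {x} {y} {ρ} n e = trans (*-congʳ e) (trans (*-assoc _ _ _) (trans (*-congˡ (inv-r n)) (*-identityʳ _)))

      -- What is used of a homology 2-sphere, degrees counting vertices: edge links have a unique
      -- fundamental cycle, vertex links and L itself are connected, 1-cycles bound, and there is a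
      -- fundamental 2-cycle.
      record LocalSphere (L : Cx n) : Set (c ⊔ ℓ) where
        field
          down  : Down L
          topE  : ∀ a b → Face L (b ∷ a ∷ []) → Top (lk L (b ∷ a ∷ [])) 1
          connV : ∀ a → Face L (a ∷ []) → Acyclic (lk L (a ∷ [])) 1
          conn  : Acyclic L 1
          acyc₂ : Acyclic L 2
          fund  : ∃[ ζ ] (Cycle L 3 ζ × ¬ (∀ F → ζ F ≈ 0#))

      -- The ratio of two cycles is constant around an edge by `topE`, then spreads through vertex
      -- links and through L by connectedness. The three levels are kept apart because the stress
      -- argument meets functions that satisfy the cycle condition around one vertex only.
      module Unique {L : Cx n} (S : LocalSphere L) where
        open LocalSphere S

        record Cyc¹ (a b : Fin n) (f : Fin n → Carrier) : Set ℓ where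
          constructor cyc¹
          field
            supp¹ : ∀ x → f x ≉0 → Face L (x ∷ b ∷ a ∷ [])
            sum¹  : ∑ f ≈ 0#

        unique¹ : ∀ {a b f g x₀} → Face L (b ∷ a ∷ []) → Cyc¹ a b f → Cyc¹ a b g → (n₀ : g x₀ ≉0) →
          DN ((∀ x → Face L (x ∷ b ∷ a ∷ []) → g x ≉0) × (∀ x → f x ≈ f x₀ * inv (g x₀) n₀ * g x))
        unique¹ {a} {b} {f} {g} {x₀} fab cf cg n₀ with topE a b fab
        ... | ζ , _ , nz , uniq = multiple cf >>= λ { (t , et) → multiple cg >>= λ { (s , es) →
          dn-Fin (λ x → dn-→ (λ fx → nonvanishing s es x fx)) >>= λ nv →
          return (nv , λ x → begin
            f x                                 ≈⟨ et x ⟩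
            t * Z x                             ≈⟨ solve 2 (λ t z → t :* z := t :* z :* :1) refl _ _ ⟩
            t * Z x * 1#                        ≈⟨ *-congˡ (inv-r n₀) ⟨
            t * Z x * (g x₀ * inv (g x₀) n₀)    ≈⟨ *-congˡ (*-congʳ (es x₀)) ⟩
            t * Z x * (s * Z x₀ * inv (g x₀) n₀) ≈⟨ solve 5 (λ t z s w i → t :* z :* (s :* w :* i) := t :* w :* i :* (s :* z)) refl _ _ _ _ _ ⟩
            t * Z x₀ * inv (g x₀) n₀ * (s * Z x) ≈⟨ *-cong (*-congʳ (et x₀)) (es x) ⟨
            f x₀ * inv (g x₀) n₀ * g x          ∎) } }
          where
            dΓ = down-lk (b ∷ a ∷ []) down
            Z : Fin n → Carrier
            Z x = ζ (ins x Sub.⊥)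
            multiple : ∀ {h} → Cyc¹ a b h → DN (∃[ t ] ∀ x → h x ≈ t * Z x)
            multiple {h} (cyc¹ su sm) = uniq (single h) (single-cycle {lk L (b ∷ a ∷ [])} {h} dΓ su sm) >>= λ { (t , e) →
              return (t , λ x → trans (sym (single-at h x)) (e _)) }
            -- Tested on the 0-cycle x - x₀: it is a multiple of the fundamental cycle and has value
            -- 1 at x, so the latter cannot vanish there.
            nonvanishing : ∀ s → (∀ x → g x ≈ s * Z x) → ∀ x → Face L (x ∷ b ∷ a ∷ []) → DN (g x ≉0)
            nonvanishing s es x fx = multiple (cyc¹ su sm) >>= λ { (t , e) → return (λ gx → 1≉0 (begin
                1#                ≈⟨ trans (+-cong (reflexive (δ-≡ x)) (neg-0 (reflexive (δ-≢ (x≢ gx))))) (+-identityʳ _) ⟨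
                δ x x - δ x₀ x    ≈⟨ e x ⟩
                t * Z x           ≈⟨ *-0ʳ (cancel s≉ (trans (sym (es x)) gx)) ⟩
                0#                ∎)) }
              where
                s≉ : s ≉0
                s≉ z = n₀ (trans (es x₀) (*-0ˡ z))
                x≢ : g x ≈ 0# → x₀ ≢ x
                x≢ gx ≡.refl = n₀ gx
                su : ∀ y → δ x y - δ x₀ y ≉0 → Face L (y ∷ b ∷ a ∷ [])
                su y nz with x Fin.≟ y | x₀ Fin.≟ y
                ... | yes ≡.refl | _ = fx
                ... | no _ | yes ≡.refl = Cyc¹.supp¹ cg y n₀
                ... | no _ | no _ = ⊥-elim (nz (-‿inverseʳ _))
                sm : ∑ (λ y → δ x y - δ x₀ y) ≈ 0#
                sm = trans (Σ-sub _ _) (trans (+-cong (∑δ x) (-‿cong (∑δ x₀))) (-‿inverseʳ _))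

        record Cyc² (a : Fin n) (f : Fin n → Fin n → Carrier) : Set ℓ where
          constructor cyc²
          field
            supp² : ∀ x y → f x y ≉0 → Face L (y ∷ x ∷ a ∷ [])
            cy²   : Cyc₂ f

        row : ∀ {a f} → Cyc² a f → ∀ b → Cyc¹ a b (f b)
        row (cyc² su cy) b = cyc¹ (su b) (Cyc₂.cycle cy b)

        unique² : ∀ {a f g x₀ y₀} → Face L (a ∷ []) → Cyc² a f → Cyc² a g → (n₀ : g x₀ y₀ ≉0) →
          DN ((∀ x y → Face L (y ∷ x ∷ a ∷ []) → g x y ≉0) × (∀ x y → f x y ≈ f x₀ y₀ * inv (g x₀ y₀) n₀ * g x y))
        unique² {a} {f} {g} {x₀} {y₀} fa cf cg n₀ =
          dn-Fin (λ x → dn-→ (λ fx → reach x fx)) >>= λ all →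
          return ((λ x y fxy → proj₁ (all x (face-tail L y (x ∷ a ∷ []) down fxy)) y fxy)
            , λ x y → by-cases (Face L (x ∷ a ∷ [])) (λ fx → proj₂ (all x fx) y)
                (λ nf → trans (out cf x y nf) (sym (*-0ʳ (out cg x y nf)))))
          where
            ρ = f x₀ y₀ * inv (g x₀ y₀) n₀
            P : Fin n → Set ℓ
            P x = (∀ y → Face L (y ∷ x ∷ a ∷ []) → g x y ≉0) × (∀ y → f x y ≈ ρ * g x y)

            out : ∀ {h} → Cyc² a h → ∀ x y → ¬ Face L (x ∷ a ∷ []) → h x y ≈ 0#
            out ch x y nf = stable (λ nh → nf (face-tail L y (x ∷ a ∷ []) down (Cyc².supp² ch x y nh)))

            f₀ : Face L (x₀ ∷ a ∷ [])
            f₀ = face-tail L y₀ (x₀ ∷ a ∷ []) down (Cyc².supp² cg x₀ y₀ n₀)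

            step : ∀ u w → Face L (w ∷ u ∷ a ∷ []) → P u → DN (P w)
            step u w fwu (nv , eq) = unique¹ (face-tail L u (w ∷ a ∷ []) down (face-swap L w u (a ∷ []) fwu)) (row cf w) (row cg w) nwu >>= λ { (nv' , eq') →
              return (nv' , λ y → trans (eq' y) (*-congʳ (same-ratio nwu (trans (Cyc₂.anti (Cyc².cy² cf) w u)
                (trans (-‿cong (eq w)) (trans (solve 2 (λ r g → :- (r :* g) := r :* :- g) refl _ _)
                  (*-congˡ (sym (Cyc₂.anti (Cyc².cy² cg) w u))))))))) }
              where
                nwu : g w u ≉0
                nwu e = nv w fwu (trans (Cyc₂.anti (Cyc².cy² cg) u w) (neg-0 e))

            reach : ∀ x → Face L (x ∷ a ∷ []) → DN (P x)
            reach x fx = unique¹ f₀ (row cf x₀) (row cg x₀) n₀ >>= λ p₀ →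
              connected (down-lk (a ∷ []) down) (connV a fa) P step x₀ x f₀ fx p₀

        record Cyc³ (f : Tri) : Set ℓ where
          constructor cyc³
          field
            supp³ : ∀ x y w → f x y w ≉0 → Face L (w ∷ y ∷ x ∷ [])
            cy³   : Cyc f

        slice : ∀ {f} → Cyc³ f → ∀ a → Cyc² a (f a)
        slice (cyc³ su cy) a = cyc² (su a) (Cyc.linkAt cy a)

        unique³ : ∀ {f g x₀ y₀ w₀} → Cyc³ f → Cyc³ g → (n₀ : g x₀ y₀ w₀ ≉0) →
          DN ((∀ x y w → Face L (w ∷ y ∷ x ∷ []) → g x y w ≉0) × (∀ x y w → f x y w ≈ f x₀ y₀ w₀ * inv (g x₀ y₀ w₀) n₀ * g x y w))
        unique³ {f} {g} {x₀} {y₀} {w₀} cf cg n₀ =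
          dn-Fin (λ x → dn-→ (λ fx → reach x fx)) >>= λ all →
          return ((λ x y w fxy → proj₁ (all x (vertex {x} {y} {w} fxy)) y w fxy)
            , λ x y w → by-cases (Face L (x ∷ [])) (λ fx → proj₂ (all x fx) y w)
                (λ nf → trans (out cf x y w nf) (sym (*-0ʳ (out cg x y w nf)))))
          where
            vertex : ∀ {x y w} → Face L (w ∷ y ∷ x ∷ []) → Face L (x ∷ [])
            vertex {x} {y} {w} fxy = face-tail L y (x ∷ []) down (face-tail L w (y ∷ x ∷ []) down fxy)

            ρ = f x₀ y₀ w₀ * inv (g x₀ y₀ w₀) n₀
            P : Fin n → Set ℓ
            P x = (∀ y w → Face L (w ∷ y ∷ x ∷ []) → g x y w ≉0) × (∀ y w → f x y w ≈ ρ * g x y w)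

            out : ∀ {h} → Cyc³ h → ∀ x y w → ¬ Face L (x ∷ []) → h x y w ≈ 0#
            out ch x y w nf = stable (λ nh → nf (vertex {x} {y} {w} (Cyc³.supp³ ch x y w nh)))

            f₀ : Face L (x₀ ∷ [])
            f₀ = vertex {x₀} {y₀} {w₀} (Cyc³.supp³ cg x₀ y₀ w₀ n₀)

            third : ∀ u w → Face L (w ∷ u ∷ []) → DN (∃[ t ] Face L (t ∷ w ∷ u ∷ []))
            third u w fwu with topE u w fwu
            ... | ζ , mkCycle ch _ , nz , _ = find≉0 nz >>= λ { (F , nF) →
              let Γ = lk L (w ∷ u ∷ [])
                  (fF , sF) = ch-face {Γ} ch nF
                  (t , tF) = member F sF
              in return (t , ch-vertex {Γ} ch (λ e → nF (begin
                ζ F                     ≈⟨ reflexive (≡.cong ζ (≡.trans (≡.sym (ins-del t F tF)) (≡.cong (ins t)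
                                             (size-0 (del t F) (ℕ.suc-injective (≡.trans (≡.sym (size-del t F tF)) sF)))))) ⟩
                ζ (ins t Sub.⊥)         ≈⟨ i-⊥ ζ t ⟨
                i t ζ Sub.⊥             ≈⟨ e ⟩
                0#                      ∎))) }

            step : ∀ u w → Face L (w ∷ u ∷ []) → P u → DN (P w)
            step u w fwu (nv , eq) = third u w fwu >>= λ { (t , ft) →
              let nwu : g w u t ≉0
                  nwu e = nv w t ft (trans (Cyc.sw (Cyc³.cy³ cg) u w t) (neg-0 e))
              in unique² (face-tail L u (w ∷ []) down (face-swap L w u [] fwu)) (slice cf w) (slice cg w) nwu >>= λ { (nv' , eq') →
                return (nv' , λ y v → trans (eq' y v) (*-congʳ (same-ratio nwu (trans (Cyc.sw (Cyc³.cy³ cf) w u t)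
                  (trans (-‿cong (eq w t)) (trans (solve 2 (λ r g → :- (r :* g) := r :* :- g) refl _ _)
                    (*-congˡ (sym (Cyc.sw (Cyc³.cy³ cg) w u t))))))))) } }

            reach : ∀ x → Face L (x ∷ []) → DN (P x)
            reach x fx = unique² f₀ (slice cf x₀) (slice cg x₀) n₀ >>= λ p₀ →
              connected down conn P step x₀ x f₀ fx p₀

        -- The oriented coefficient of ψ on abc; the iterated contraction supplies the sign of the
        -- ordering.
        tri : (Subset n → Carrier) → Tri
        tri ψ a b c = i a (i b (i c ψ)) Sub.⊥

        tri-face : ∀ {ψ} → Ch L 3 ψ → ∀ x y w → tri ψ x y w ≉0 → Face L (w ∷ y ∷ x ∷ [])
        tri-face {ψ} ch x y w nz = face-reverse L x y w []
          (ch-vertex {lk L (y ∷ w ∷ [])} (ch-i {lk L (w ∷ [])} y (ch-i {L} w ch)) nz)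

        tri-sum : ∀ ψ a b → ∑ (tri ψ a b) ≈ i a (i b (Bd ψ)) Sub.⊥
        tri-sum ψ a b = sym (trans (Func.cong (iF a Sub.⊥) (λ F → fn-∑ (iF b F) (λ x → i x ψ))) (fn-∑ (iF a Sub.⊥) (λ x → i b (i x ψ))))

        tri-sw : ∀ ψ a b c → tri ψ a b c ≈ - tri ψ b a c
        tri-sw ψ a b c = ii-anti a b (i c ψ) Sub.⊥

        tri-sw′ : ∀ ψ a b c → tri ψ a b c ≈ - tri ψ a c b
        tri-sw′ ψ a b c = trans (Func.cong (iF a Sub.⊥) (ii-anti b c ψ)) (fn-neg (iF a Sub.⊥) _)

        tri-dg : ∀ ψ a c → tri ψ a a c ≈ 0#
        tri-dg ψ a c = ii-diag a (i c ψ) Sub.⊥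

        tri-cycle : ∀ {ψ} → Cycle L 3 ψ → Cyc³ (tri ψ)
        tri-cycle {ψ} (mkCycle ch cl) = cyc³ (tri-face ch) (record
          { sw = tri-sw ψ ; sw′ = tri-sw′ ψ ; dg = tri-dg ψ
          ; cycle = λ a b → trans (tri-sum ψ a b) (Func.zer (iF a Sub.⊥) (λ F → Func.zer (iF b F) cl)) })

        z : Tri
        z = tri (proj₁ fund)

        z-cyc : Cyc³ z
        z-cyc = tri-cycle (proj₁ (proj₂ fund))

        cz : Cyc z
        cz = Cyc³.cy³ z-cyc

        z-nonzero : NonZero z
        z-nonzero zz = proj₂ (proj₂ fund) (peel {L} (λ c chc → peel {lk L (c ∷ [])} (λ b chb →
            peel {lk L (b ∷ c ∷ [])} (λ a cha → at⊥ {lk L (a ∷ b ∷ c ∷ [])} (zz a b c) cha) chb) chc) ch)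
          where
            ch = Cycle.chain (proj₁ (proj₂ fund))

            at⊥ : ∀ {Γ ψ} → ψ Sub.⊥ ≈ 0# → Ch Γ 0 ψ → ∀ F → ψ F ≈ 0#
            at⊥ {Γ} {ψ} e ch F = stable (λ nz → nz (≡.subst (λ G → ψ G ≈ 0#) (≡.sym (size-0 F (proj₂ (ch-face {Γ} ch nz)))) e))

            peel′ : ∀ {Γ s ψ} → Ch Γ (suc s) ψ → (∀ a F → i a ψ F ≈ 0#) → ∀ F → ψ F ≈ 0#
            peel′ {Γ} {s} {ψ} ch h F = stable (λ nz →
              let (a , aF) = member F (proj₂ (ch-face {Γ} ch nz))
              in sgn-≉0 (below (del a F) a) (stable (λ ns → nz (trans (reflexive (≡.cong ψ (≡.sym (ins-del a F aF))))
                   (cancel ns (trans (sym (i-out ψ (del-≡ a F))) (h a (del a F))))))))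

            peel : ∀ {Γ s ψ} → (∀ a → Ch (link Γ ⁅ a ⁆) s (i a ψ) → ∀ F → i a ψ F ≈ 0#) → Ch Γ (suc s) ψ → ∀ F → ψ F ≈ 0#
            peel {Γ} h ch = peel′ {Γ} ch (λ a → h a (ch-i {Γ} a ch))

        -- This puts spheres within reach of `minimal-rigid`: a cycle within the fundamental one is
        -- a multiple of it by `unique³`.
        z-minimal : Minimal z
        z-minimal = record { cyc = cz ; nonzero = z-nonzero ; unique = λ y cy le → find₃ z-nonzero >>= λ { (a , b , c , nz) →
          unique³ (cyc³ (λ x y' w ny → Cyc³.supp³ z-cyc x y' w (⊑-≉0 le ny)) cy) z-cyc nz >>= λ { (_ , e) → return (_ , e) } } }

        z-face : ∀ x y w → Face L (w ∷ y ∷ x ∷ []) → z x y w ≉0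
        z-face x y w f e = find₃ z-nonzero λ { (a , b , c , nz) → unique³ z-cyc z-cyc nz λ { (nv , _) → nv x y w f e } }

      IJF : ∀ {r} → Vec (Fin n) r → Subset n → Func (Subset n)
      IJF []      F = ev F
      IJF (j ∷ J) F = iF j F ∘F IJF J

      IJ : ∀ {r} → Vec (Fin n) r → (Subset n → Carrier) → Subset n → Carrier
      IJ J ψ F = fn (IJF J F) ψ

      ch-IJ : ∀ {Γ r} (J : Vec (Fin n) r) {m s ψ} → m ≡ r ℕ.+ s → Ch Γ m ψ → Ch (lk Γ J) s (IJ J ψ)
      ch-IJ []      ≡.refl ch = ch
      ch-IJ {Γ} {suc r} (j ∷ J) {s = s} e ch = ch-i {lk Γ J} j (ch-IJ {Γ} J (≡.trans e (≡.sym (ℕ.+-suc r s))) ch)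

      Bd-IJ : ∀ {r} (J : Vec (Fin n) r) {ψ} → (∀ F → Bd ψ F ≈ 0#) → ∀ F → Bd (IJ J ψ) F ≈ 0#
      Bd-IJ []      z F = z F
      Bd-IJ (j ∷ J) {ψ} z F = trans (Bd-i j (IJ J ψ) F) (neg-0 (Func.zer (iF j F) (Bd-IJ J z)))

      Van : Fin n → (Subset n → Carrier) → Set ℓ
      Van g ψ = ∀ F → lookup F g ≡ true → ψ F ≈ 0#

      van-kill : ∀ {g ψ} → Van g ψ → ∀ F → i g ψ F ≈ 0#
      van-kill {g} {ψ} v F = stable (λ nz → proj₂ (i-≉0 nz) (v (ins g F) (ins-≡ g F)))

      van-i : ∀ {g ψ} u → Van g ψ → Van g (i u ψ)
      van-i u v F e = stable (λ nz → proj₂ (i-≉0 nz) (v (ins u F) (ins-mono u F e)))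

      van-IJ : ∀ {g ψ r} (J : Vec (Fin n) r) → Van g ψ → Van g (IJ J ψ)
      van-IJ []      v = v
      van-IJ (j ∷ J) v = van-i j (van-IJ J v)

      van-IJ-kill : ∀ {g ψ r} (J : Vec (Fin n) r) k → lookup J k ≡ g → Van g ψ → ∀ F → IJ J ψ F ≈ 0#
      van-IJ-kill (j ∷ J) zero    ≡.refl v = van-kill (van-IJ J v)
      van-IJ-kill (j ∷ J) (suc k) e v F = Func.zer (iF j F) (van-IJ-kill J k e v)

      -- Contracted with J, the stress is a form-valued 1-cycle on the sphere L, hence the boundary
      -- of a 2-chain b. Evaluated at p_u, b is a multiple of the fundamental cycle z around u, and
      -- the factors form an infinitesimal motion of the cone over L. By pinned rigidity that motion
      -- comes from one form B, so b = z B, and its boundary, the stress, vanishes.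
      module StressFree {Δ : Cx n} {r : ℕ} (J : Vec (Fin n) r) (S : LocalSphere (lk Δ J)) {n' : ℕ} (ι : Fin n → Fin n')
        (p : Pts n' (4 ℕ.+ r))
        (indep : ∀ a b c → Face (lk Δ J) (c ∷ b ∷ a ∷ []) → LinIndep (λ k → p (ι (lookup (a ∷ b ∷ c ∷ J) k))))
        {a₀ b₀ c₀ : Fin n} (n₀ : Unique.z S a₀ b₀ c₀ ≉0)
        (pinned : Pins.Pin {N = 4 ℕ.+ r} ι (λ k → ι (lookup J k)) (Unique.z S) a₀ b₀ c₀ p)
        {K m : ℕ} (base : Fin K → Alt (4 ℕ.+ r)) (cc : Fin K → Subset n → Carrier) (m-eq : m ≡ r ℕ.+ 2)
        (cyc : ∀ τ → Cycle Δ m (cc τ))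
        (stress : ∀ v F y → lookup F v ≡ true → app (ΣA (λ τ → cc τ F *A base τ)) (p (ι v)) y ≈ 0#) where

        open Unique S
        L = lk Δ J
        N = 4 ℕ.+ r

        A : V N → V N → Subset n → Carrier
        A x y F = app (ΣA (λ τ → cc τ F *A base τ)) x y

        module WithPrimitive (ψ : Fin K → Subset n → Carrier) (chψ : ∀ τ → Ch L 3 (ψ τ))
          (prim : ∀ τ F → IJ J (cc τ) F ≈ Bd (ψ τ) F) where

          b : Fin n → Fin n → Fin n → Alt N
          b u v w = ΣA (λ τ → tri (ψ τ) u v w *A base τ)

          bt : V N → V N → Tri
          bt x y u v w = app (b u v w) x y

          combination : ∀ (f : Func (Subset n)) x y → fn f (λ F → A x y F) ≈ ∑ (λ τ → fn f (cc τ) * app (base τ) x y)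
          combination f x y = begin
            fn f (λ F → ∑ (λ τ → cc τ F * app (base τ) x y))
              ≈⟨ Func.cong f (λ F → Σ-cong (λ τ → *-comm _ _)) ⟩
            fn f (lincomb (λ τ → app (base τ) x y) cc)
              ≈⟨ Func.sum f _ _ ⟩
            ∑ (λ τ → app (base τ) x y * fn f (cc τ))
              ≈⟨ Σ-cong (λ τ → *-comm _ _) ⟩
            ∑ (λ τ → fn f (cc τ) * app (base τ) x y) ∎

          s : V N → V N → Fin n → Fin n → Carrier
          s x y u v = i u (i v (IJ J (A x y))) Sub.⊥

          b-sum : ∀ x y u v → ∑ (bt x y u v) ≈ s x y u v
          b-sum x y u v = begin
            ∑ (λ w → ∑ (λ τ → tri (ψ τ) u v w * app (base τ) x y))
              ≈⟨ trans (Σ-swap _) (Σ-cong (λ τ → Σ-*ʳ _ _)) ⟩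
            ∑ (λ τ → ∑ (tri (ψ τ) u v) * app (base τ) x y)
              ≈⟨ Σ-cong (λ τ → *-congʳ (trans (tri-sum (ψ τ) u v)
                   (Func.cong (iF u Sub.⊥) (λ F → Func.cong (iF v F) (λ G → sym (prim τ G)))))) ⟩
            ∑ (λ τ → i u (i v (IJ J (cc τ))) Sub.⊥ * app (base τ) x y)
              ≈⟨ combination (iF u Sub.⊥ ∘F (λ F → iF v F ∘F IJF J)) x y ⟨
            s x y u v ∎

          van : ∀ g y → Van g (A (p (ι g)) y)
          van g y F e = stress g F y e

          s-first : ∀ u v y → s (p (ι u)) y u v ≈ 0#
          s-first u v y = van-kill (van-i v (van-IJ J (van u y))) Sub.⊥

          s-cone : ∀ k u v y → s (p (ι (lookup J k))) y u v ≈ 0#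
          s-cone k u v y = Func.zer (iF u Sub.⊥) (λ F → Func.zer (iF v F) (van-IJ-kill J k ≡.refl (van (lookup J k) y)))

          bt-sw : ∀ x y u v w → bt x y u v w ≈ - bt x y v u w
          bt-sw x y u v w = trans (Σ-cong (λ τ → trans (*-congʳ (tri-sw (ψ τ) u v w)) (sym (-‿distribˡ-* _ _)))) (Σ-neg _)

          bt-sw′ : ∀ x y u v w → bt x y u v w ≈ - bt x y u w v
          bt-sw′ x y u v w = trans (Σ-cong (λ τ → trans (*-congʳ (tri-sw′ (ψ τ) u v w)) (sym (-‿distribˡ-* _ _)))) (Σ-neg _)

          bt-rot : ∀ x y u v w → bt x y u v w ≈ bt x y v w u
          bt-rot x y u v w = trans (bt-sw x y u v w) (trans (-‿cong (bt-sw′ x y v u w)) (-‿involutive _))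

          bt-dg : ∀ x y u w → bt x y u u w ≈ 0#
          bt-dg x y u w = Σ-0 (λ τ → *-0ˡ (tri-dg (ψ τ) u w))

          bt-face : ∀ x y u v w → bt x y u v w ≉0 → Face L (w ∷ v ∷ u ∷ [])
          bt-face x y u v w nz = bool-case (lk L (w ∷ v ∷ u ∷ []) Sub.⊥) id
            (λ e → ⊥-elim (nz (Σ-0 (λ τ → *-0ˡ (stable (λ nt → true≢false (tri-face (chψ τ) u v w nt) e))))))

          bt-zero : ∀ x y u v w → z u v w ≈ 0# → bt x y u v w ≈ 0#
          bt-zero x y u v w zz = stable (λ nb → z-face u v w (bt-face x y u v w nb) zz)

          -- The stress kills p_u on faces containing u, so b evaluated at p_u has no boundary on
          -- the edges at u, though it may have one elsewhere.
          slice-cyc : ∀ u y → Cyc² u (bt (p (ι u)) y u)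
          slice-cyc u y = cyc² (bt-face (p (ι u)) y u) (record
            { alt₂ = record { anti = bt-sw′ _ _ u ; diag = λ v → trans (bt-rot _ _ u v v) (bt-dg _ _ v u) }
            ; cycle = λ v → trans (b-sum _ _ u v) (s-first u v y) })

          cone-cyc : ∀ k y → Cyc³ (bt (p (ι (lookup J k))) y)
          cone-cyc k y = cyc³ (bt-face _ y) (record
            { sw = bt-sw _ _ ; sw′ = bt-sw′ _ _ ; dg = bt-dg _ _ ; cycle = λ u v → trans (b-sum _ _ u v) (s-cone k u v y) })

          z-vertex : ∀ {u v w} → z u v w ≉0 → Face L (u ∷ [])
          z-vertex {u} {v} {w} nz = face-tail L v (u ∷ []) (LocalSphere.down S)
            (face-tail L w (v ∷ u ∷ []) (LocalSphere.down S) (Cyc³.supp³ z-cyc u v w nz))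

          Velocity : Fin n → Set (c ⊔ ℓ)
          Velocity u = Σ (V N) λ μ → ∀ v w y → bt (p (ι u)) y u v w ≈ z u v w * dot μ y

          velocity : ∀ u → DN (Velocity u)
          velocity u = lem (∀ v w → z u v w ≈ 0#) >>= λ
            { (inj₁ zz) → return ((λ _ → 0#) , λ v w y → trans (bt-zero _ y u v w (zz v w)) (sym (*-0ˡ (zz v w))))
            ; (inj₂ nz) → (λ k → nz (λ v w → stable (λ nw → k (v , w , nw)))) >>= λ { (v₁ , w₁ , n₁) →
                let μF = inv _ n₁ *F appF (b u v₁ w₁) (p (ι u))
                in return (coords μF , λ v w y → stable (unique² (z-vertex n₁) (slice-cyc u y) (slice z-cyc u) n₁ >>= λ { (_ , e) →
                  return (begin
                    bt (p (ι u)) y u v w                                       ≈⟨ e v w ⟩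
                    bt (p (ι u)) y u v₁ w₁ * inv (z u v₁ w₁) n₁ * z u v w      ≈⟨ trans (*-comm _ _) (*-congˡ (*-comm _ _)) ⟩
                    z u v w * fn μF y                                          ≈⟨ *-congˡ (dot-coords μF y) ⟨
                    z u v w * dot (coords μF) y                                ∎) })) } }

          -- The candidate form, normalised on the pinned triangle so that it matches the velocities
          -- there.
          B : Alt N
          B = inv _ n₀ *A b a₀ b₀ c₀

          B-cone : ∀ k y u v w → bt (p (ι (lookup J k))) y u v w ≈ z u v w * app B (p (ι (lookup J k))) y
          B-cone k y u v w = stable (unique³ (cone-cyc k y) z-cyc n₀ >>= λ { (_ , e) →
            return (trans (e u v w) (trans (*-comm _ _) (*-congˡ (*-comm _ _)))) })

          module WithVelocities (vel : ∀ u → Velocity u) where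
            μ : Fin n → V N
            μ u = proj₁ (vel u)

            match : ∀ u v w y → bt (p (ι u)) y u v w ≈ z u v w * dot (μ u) y
            match u = proj₂ (vel u)

            match₂ : ∀ u v w y → bt (p (ι v)) y u v w ≈ z u v w * dot (μ v) y
            match₂ u v w y = trans (bt-rot _ y u v w) (trans (match v w u y) (*-congʳ (sym (Cyc.rot cz u v w))))

            match₃ : ∀ u v w y → bt (p (ι w)) y u v w ≈ z u v w * dot (μ w) y
            match₃ u v w y = trans (bt-rot _ y u v w) (trans (match₂ v w u y) (*-congʳ (sym (Cyc.rot cz u v w))))

            cross : ∀ {x y u v w μx μy} → z u v w ≉0 → bt x y u v w ≈ z u v w * μx → bt y x u v w ≈ z u v w * μy → μx + μy ≈ 0#
            cross {x} {y} {u} {v} {w} {μx} {μy} nz e f = cancel nz (begin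
              z u v w * (μx + μy)                 ≈⟨ distribˡ _ _ _ ⟩
              z u v w * μx + z u v w * μy         ≈⟨ +-cong e f ⟨
              bt x y u v w + bt y x u v w         ≈⟨ +-congʳ (Alt.anti (b u v w) x y) ⟩
              - bt y x u v w + bt y x u v w       ≈⟨ -‿inverseˡ _ ⟩
              0#                                  ∎)

            self₀ : ∀ {u v w} → z u v w ≉0 → dot (μ u) (p (ι u)) ≈ 0#
            self₀ {u} {v} {w} nz = cancel nz (trans (sym (match u v w _)) (Alt.alt (b u v w) _))

            B-at : ∀ {x} (μx : V N → Carrier) → (∀ y → bt x y a₀ b₀ c₀ ≈ z a₀ b₀ c₀ * μx y) → ∀ y → app B x y ≈ μx y
            B-at μx e y = trans (*-congˡ (e y)) (trans (solve 3 (λ i z m → i :* (z :* m) := z :* i :* m) refl _ _ _)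
              (trans (*-congʳ (inv-r n₀)) (*-identityˡ _)))

            -- The difference between the velocities and B solves the pinned system; its edge and
            -- cone equations hold because b(u, v, w) and B are alternating.
            agree : DN (∀ u v w → z u v w ≉0 → ∀ y → app B (p (ι u)) y ≈ dot (μ u) y)
            agree = masked (λ u → ∀ v w → z u v w ≈ 0#) (λ u k → μ u k - coords (appF B (p (ι u))) k) >>= λ { (g , on₀ , off₀) →
              let m' : Fin n × Fin N → Carrier
                  m' x = g (proj₁ x) (proj₂ x)

                  dot-on : ∀ {u v w} → z u v w ≉0 → ∀ y → dot (g u) y ≈ dot (μ u) y - app B (p (ι u)) y
                  dot-on {u} nz y = trans (dot-cong (on₀ u (λ zz → nz (zz _ _))) (λ _ → refl)) (trans (dot-subˡ _ _ y)
                    (+-congˡ (-‿cong (dot-coords (appF B (p (ι u))) y))))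

                  pinned₀ : ∀ {u v w} → z u v w ≉0 → (∀ y → app B (p (ι u)) y ≈ dot (μ u) y) → ∀ k → g u k ≈ 0#
                  pinned₀ nz e = zero-coords (λ y → trans (dot-on nz y) (trans (+-congˡ (-‿cong (e y))) (-‿inverseʳ _)))

                  off-or : ∀ u {x} → (∀ v w → z u v w ≉0 → dot (g u) x ≈ 0#) → dot (g u) x ≈ 0#
                  off-or u h = vertex-cases z u h (λ zz → dot-0ˡ (off₀ u zz))

                  sol : ∀ e → fn (at (Pins.eq {N = N} ι (λ k → ι (lookup J k)) z a₀ b₀ c₀ e) p) m' ≈ 0#
                  sol = λ
                    { (Pins.self u) → off-or u (λ v w nz → trans (dot-on nz _) (+-0 (self₀ nz) (neg-0 (Alt.alt B _))))
                    ; (Pins.edge u v w nz) → begin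
                        dot (g u) (p (ι v)) + dot (g v) (p (ι u))
                          ≈⟨ +-cong (dot-on nz _) (dot-on (≉0-resp (Cyc.rot cz u v w) nz) _) ⟩
                        (dot (μ u) (p (ι v)) - app B (p (ι u)) (p (ι v))) + (dot (μ v) (p (ι u)) - app B (p (ι v)) (p (ι u)))
                          ≈⟨ +-congˡ (+-congˡ (-‿cong (Alt.anti B _ _))) ⟩
                        (dot (μ u) (p (ι v)) - app B (p (ι u)) (p (ι v))) + (dot (μ v) (p (ι u)) - (- app B (p (ι u)) (p (ι v))))
                          ≈⟨ solve 3 (λ x y b → (x :- b) :+ (y :- :- b) := x :+ y) refl _ _ _ ⟩
                        dot (μ u) (p (ι v)) + dot (μ v) (p (ι u))
                          ≈⟨ cross nz (match u v w _) (match₂ u v w _) ⟩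
                        0# ∎
                    ; (Pins.cone u k) → off-or u (λ v w nz → begin
                        dot (g u) (p (ι (lookup J k)))
                          ≈⟨ dot-on nz _ ⟩
                        dot (μ u) (p (ι (lookup J k))) - app B (p (ι u)) (p (ι (lookup J k)))
                          ≈⟨ +-congˡ (-‿cong (Alt.anti B _ _)) ⟩
                        dot (μ u) (p (ι (lookup J k))) - (- app B (p (ι (lookup J k))) (p (ι u)))
                          ≈⟨ +-congˡ (-‿involutive _) ⟩
                        dot (μ u) (p (ι (lookup J k))) + app B (p (ι (lookup J k))) (p (ι u))
                          ≈⟨ cross nz (match u v w _) (B-cone k _ u v w) ⟩
                        0# ∎)
                    ; (Pins.pin u (inj₁ ≡.refl) k) → pinned₀ n₀ (B-at (dot (μ u)) (match a₀ b₀ c₀)) k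
                    ; (Pins.pin u (inj₂ (inj₁ ≡.refl)) k) → pinned₀ (≉0-resp (Cyc.rot cz _ _ _) n₀) (B-at (dot (μ u)) (match₂ a₀ b₀ c₀)) k
                    ; (Pins.pin u (inj₂ (inj₂ ≡.refl)) k) → pinned₀ (≉0-resp (Cyc.rot² cz _ _ _) n₀) (B-at (dot (μ u)) (match₃ a₀ b₀ c₀)) k
                    ; (Pins.off u zz k) → off₀ u zz k }
              in return (λ u v w nz y → begin
                  app B (p (ι u)) y
                    ≈⟨ solve 2 (λ b m → b := m :- (m :- b)) refl _ _ ⟩
                  dot (μ u) y - (dot (μ u) y - app B (p (ι u)) y)
                    ≈⟨ +-congˡ (-‿cong (dot-on nz y)) ⟨
                  dot (μ u) y - dot (g u) y
                    ≈⟨ +-congˡ (neg-0 (dot-0ˡ (λ k → pinned m' sol (u , k)))) ⟩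
                  dot (μ u) y + 0#
                    ≈⟨ +-identityʳ _ ⟩
                  dot (μ u) y ∎) }

            -- Both sides agree at u, v, w and the vertices of J, which are N - 1 independent
            -- points, so `alt-zero` applies to the difference.
            b-is-zB : (∀ u v w → z u v w ≉0 → ∀ y → app B (p (ι u)) y ≈ dot (μ u) y) →
              ∀ u v w x y → bt x y u v w ≈ z u v w * app B x y
            b-is-zB ag u v w x y = unless0 (z u v w)
              (λ zz → trans (bt-zero x y u v w zz) (sym (*-0ˡ zz)))
              (λ nz → begin
                bt x y u v w
                  ≈⟨ solve 2 (λ b c → b := c :+ (b :+ :- :1 :* c)) refl _ _ ⟩
                z u v w * app B x y + (bt x y u v w + - 1# * (z u v w * app B x y))
                  ≈⟨ +-congˡ (alt-zero _ (indep u v w (Cyc³.supp³ z-cyc u v w nz)) (b u v w +A (- 1#) *A (z u v w *A B)) (kills nz) x y) ⟩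
                z u v w * app B x y + 0#
                  ≈⟨ +-identityʳ _ ⟩
                z u v w * app B x y ∎)
              where
                same : ∀ {x} (f : V N → Carrier) → (∀ y → bt x y u v w ≈ z u v w * f y) → (∀ y → app B x y ≈ f y) →
                  ∀ y → bt x y u v w + - 1# * (z u v w * app B x y) ≈ 0#
                same f e e' y = trans (+-cong (e y) (*-congˡ (*-congˡ (e' y)))) (solve 1 (λ x → x :+ :- :1 :* x := :0) refl _)
                kills : z u v w ≉0 → ∀ k y → app (b u v w +A (- 1#) *A (z u v w *A B)) (p (ι (lookup (u ∷ v ∷ w ∷ J) k))) y ≈ 0#
                kills nz zero = same (dot (μ u)) (match u v w) (ag u v w nz)
                kills nz (suc zero) = same (dot (μ v)) (match₂ u v w) (ag v w u (≉0-resp (Cyc.rot cz u v w) nz))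
                kills nz (suc (suc zero)) = same (dot (μ w)) (match₃ u v w) (ag w u v (≉0-resp (Cyc.rot² cz u v w) nz))
                kills nz (suc (suc (suc k))) = same (app B (p (ι (lookup J k)))) (λ y → B-cone k y u v w) (λ y → refl)

        stress-free : ∀ x y u v → i u (i v (IJ J (A x y))) Sub.⊥ ≈ 0#
        stress-free x y u v = stable (
          dn-Fin (λ τ → LocalSphere.acyc₂ S (IJ J (cc τ)) (mkCycle (ch-IJ {Δ} J m-eq (Cycle.chain (cyc τ))) (Bd-IJ J (Cycle.closed (cyc τ))))) >>= λ pr →
          dn-Fin (WithPrimitive.velocity (λ τ → proj₁ (pr τ)) (λ τ → proj₁ (proj₂ (pr τ))) (λ τ → proj₂ (proj₂ (pr τ)))) >>= λ vel →
          let module P = WithPrimitive (λ τ → proj₁ (pr τ)) (λ τ → proj₁ (proj₂ (pr τ))) (λ τ → proj₂ (proj₂ (pr τ)))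
              module Q = P.WithVelocities vel
          in Q.agree >>= λ ag → return (begin
            i u (i v (IJ J (A x y))) Sub.⊥      ≈⟨ P.b-sum x y u v ⟨
            ∑ (P.bt x y u v)                    ≈⟨ Σ-cong (λ w → Q.b-is-zB ag u v w x y) ⟩
            ∑ (λ w → z u v w * app P.B x y)     ≈⟨ Σ-*ʳ _ _ ⟩
            ∑ (z u v) * app P.B x y             ≈⟨ *-0ˡ (Cyc.cycle cz u v) ⟩
            0#                                  ∎))

    -- Generic points and the vanishing of stresses on Δ

    module Stress where

      open Geometry
      open Cycles
      open Rigidity using (module Pins; Rigid; Rigid⇒Pin; none; vertex-cases)
      open Fogelsanger using (minimal-rigid)
      open Simplicial
      open Local

      SphereB : Cx n → ℕ → Set (c ⊔ ℓ)
      SphereB Γ e = ∀ t → BettiB Γ t (if t ≡ᵇ e then 1 else 0)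

      -- Here d = 4 + d'. The bound 2 ≤ r expresses that singularities are isolated: only vertex
      -- links may fail to be spheres.
      record Mfd (Δ : Cx n) (d' : ℕ) : Set (c ⊔ ℓ) where
        field
          down  : Down Δ
          small : ∀ F → Δ F ≡ true → ∣ F ∣ ≤ 4 ℕ.+ d'
          sph   : ∀ {r} (J : Vec (Fin n) r) → 2 ≤ r → Face Δ J → SphereB (lk Δ J) ((4 ℕ.+ d') ℕ.∸ r)

      -- The indices 0 and 1 are auxiliary points besides the vertices.
      ι : Fin n → Fin (2 ℕ.+ n)
      ι v = suc (suc v)

      ι-inj : ∀ {u v} → ι u ≡ ι v → u ≡ v
      ι-inj e = Fin.suc-injective (Fin.suc-injective e)

      module _ {Δ : Cx n} {d' : ℕ} (M : Mfd Δ d') where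
        open Mfd M

        top-of : ∀ {r} (J : Vec (Fin n) r) {e} → r ℕ.+ suc e ≡ 4 ℕ.+ d' → SphereB (lk Δ J) (suc e) → Top (lk Δ J) (suc e)
        top-of {r} J {e} eq sp = top {lk Δ J} (down-lk J down)
          (λ F f sz → ℕ.<-irrefl ≡.refl (ℕ.≤-trans (≡.subst (λ k → suc k ≤ 2 ℕ.+ e ℕ.+ r) (≡.sym (≡.trans (≡.sym eq) (ℕ.+-comm r (suc e)))) ℕ.≤-refl)
            (≡.subst (λ k → k ℕ.+ r ≤ 4 ℕ.+ d') sz (lk-small {Γ = Δ} small J F f))))
          (≡.subst (λ b → BettiB (lk Δ J) (suc e) (if b then 1 else 0)) (≡ᵇ-refl e) (sp (suc e)))

        -- A list of d - 3 vertices has a 2-dimensional link. For d = 4 this is a vertex link and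
        -- possibly singular, so its sphericity is an argument of its own.
        localSphere : (J : Vec (Fin n) (suc d')) → SphereB (lk Δ J) 3 → LocalSphere (lk Δ J)
        localSphere J sp = record
          { down = down-lk J down
          ; topE = λ a b f → top-of (b ∷ a ∷ J) (≡.trans (ℕ.+-comm (3 ℕ.+ d') 1) ≡.refl) (sphere-at 1 (b ∷ a ∷ J) ≡.refl f)
          ; connV = λ a f → acyclic {lk Δ (a ∷ J)} (down-lk (a ∷ J) down) (sphere-at 2 (a ∷ J) ≡.refl f 1)
          ; conn = acyclic {lk Δ J} (down-lk J down) (sp 1)
          ; acyc₂ = acyclic {lk Δ J} (down-lk J down) (sp 2)
          ; fund = let (ζ , cy , nz , _) = top-of J (≡.trans (ℕ.+-comm (suc d') 3) ≡.refl) sp in ζ , cy , nz }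
          where
            sphere-at : ∀ e {r} (J : Vec (Fin n) (2 ℕ.+ r)) → e ℕ.+ r ≡ 2 ℕ.+ d' → Face Δ J → SphereB (lk Δ J) e
            sphere-at e {r} J eq f = ≡.subst (SphereB (lk Δ J)) (≡.trans (≡.cong (ℕ._∸ r) (≡.sym eq)) (ℕ.m+n∸n≡m e r)) (sph J (s≤s (s≤s z≤n)) f)

        r = suc d'
        N = 4 ℕ.+ r

        -- Coning preserves rigidity: with the sphere in the first four coordinates and the apexes
        -- at the remaining unit vectors, the cone equations kill the extra coordinates and leave
        -- the pinned system in k⁴.
        module ConePin (J : Vec (Fin n) r) (S : LocalSphere (lk Δ J)) where
          open Unique S

          embed : ∀ m {r} → V m → V (m ℕ.+ r)
          embed zero    x k       = 0#
          embed (suc m) x zero    = x zero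
          embed (suc m) x (suc k) = embed m (x ∘ suc) k

          dot-embed : ∀ m {r} (f : V (m ℕ.+ r)) (x : V m) → dot f (embed m x) ≈ dot (λ k → f (k Fin.↑ˡ r)) x
          dot-embed zero    f x = trans (Σ-0 (λ k → zeroʳ _)) (sym (∑-zero _))
          dot-embed (suc m) f x = trans (∑-suc _) (trans (+-congˡ (dot-embed m (f ∘ suc) (x ∘ suc))) (sym (∑-suc _)))

          pt : Pts n 4 → ∀ v → Dec (∃[ k ] lookup J k ≡ v) → V N
          pt p₄ v (yes (k , _)) = δ (4 Fin.↑ʳ k)
          pt p₄ v (no _)        = embed 4 (p₄ v)

          in-J? : ∀ v → Dec (∃[ k ] lookup J k ≡ v)
          in-J? v = Fin.any? (λ k → lookup J k Fin.≟ v)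

          P : Pts n 4 → Pts (2 ℕ.+ n) N
          P p₄ zero          = λ _ → 0#
          P p₄ (suc zero)    = λ _ → 0#
          P p₄ (suc (suc v)) = pt p₄ v (in-J? v)

          on-cone : ∀ {a b c} → z a b c ≉0 → ∀ i j → lookup (c ∷ b ∷ a ∷ J) i ≡ lookup (c ∷ b ∷ a ∷ J) j → i ≡ j
          on-cone {a} {b} {c} nz = face-distinct {Γ = Δ} (c ∷ b ∷ a ∷ J) down (Cyc³.supp³ z-cyc a b c nz)

          off-J : ∀ {a b c} → z a b c ≉0 → ¬ (∃[ k ] lookup J k ≡ a)
          off-J nz (k , e) = 2≢3+ (on-cone nz (suc (suc zero)) (suc (suc (suc k))) (≡.sym e))

          P-vertex : ∀ p₄ {a b c} → z a b c ≉0 → P p₄ (ι a) ≡ embed 4 (p₄ a)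
          P-vertex p₄ {a} nz with in-J? a
          ... | yes q = ⊥-elim (off-J nz q)
          ... | no _  = ≡.refl

          P-cone : ∀ p₄ {a b c} → z a b c ≉0 → ∀ k → P p₄ (ι (lookup J k)) ≡ δ (4 Fin.↑ʳ k)
          P-cone p₄ nz k with in-J? (lookup J k)
          ... | no q = ⊥-elim (q (k , ≡.refl))
          ... | yes (k' , e) = ≡.cong (λ k → δ (4 Fin.↑ʳ k)) (Fin.suc-injective (Fin.suc-injective (Fin.suc-injective
                  (on-cone nz (suc (suc (suc k'))) (suc (suc (suc k))) e))))

          split-coords : ∀ {q} {Q : Fin N → Set q} → (∀ k → Q (k Fin.↑ˡ r)) → (∀ k → Q (4 Fin.↑ʳ k)) → ∀ k → Q k
          split-coords {Q = Q} f g k with Fin.splitAt 4 k in e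
          ... | inj₁ k' = ≡.subst Q (Fin.splitAt⁻¹-↑ˡ e) (f k')
          ... | inj₂ k' = ≡.subst Q (Fin.splitAt⁻¹-↑ʳ e) (g k')

          cone-pin : ∀ {a₀ b₀ c₀} → z a₀ b₀ c₀ ≉0 → DN (∃[ p ] Pins.Pin {N = N} ι (λ k → ι (lookup J k)) z a₀ b₀ c₀ p)
          cone-pin {a₀} {b₀} {c₀} n₀ = minimal-rigid z-minimal >>= λ { (p₄ , ind , rig) →
            return (P p₄ , λ m sol →
              let m₄ : Fin n × Fin 4 → Carrier
                  m₄ x = m (proj₁ x , proj₂ x Fin.↑ˡ r)

                  at₄ : ∀ a {b b' c} → z b b' c ≉0 → dot (λ k → m₄ (a , k)) (p₄ b) ≈ dot (λ k → m (a , k)) (P p₄ (ι b))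
                  at₄ a {b} nz = trans (sym (dot-embed 4 (λ k → m (a , k)) (p₄ b)))
                    (reflexive (≡.cong (dot (λ k → m (a , k))) (≡.sym (P-vertex p₄ nz))))

                  zero₄ : ∀ x → m₄ x ≈ 0#
                  zero₄ = Rigid⇒Pin cz ind n₀ rig m₄ λ
                    { (Pins.self a) → vertex-cases z a (λ b c nz → trans (at₄ a nz) (sol (Pins.self a)))
                        (λ zz → Σ-0 (λ k → *-0ˡ (sol (Pins.off a zz (k Fin.↑ˡ r)))))
                    ; (Pins.edge a b c nz) → trans (+-cong (at₄ a (≉0-resp (Cyc.rot cz a b c) nz)) (at₄ b nz)) (sol (Pins.edge a b c nz))
                    ; (Pins.pin a w k) → sol (Pins.pin a w (k Fin.↑ˡ r))
                    ; (Pins.off a zz k) → sol (Pins.off a zz (k Fin.↑ˡ r)) }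

                  cone₀ : ∀ a k → m (a , 4 Fin.↑ʳ k) ≈ 0#
                  cone₀ a k = trans (sym (dot-δ (λ k → m (a , k)) (4 Fin.↑ʳ k)))
                    (trans (reflexive (≡.cong (dot (λ k → m (a , k))) (≡.sym (P-cone p₄ n₀ k)))) (sol (Pins.cone a k)))
              in λ { (a , k) → split-coords {Q = λ k → m (a , k) ≈ 0#} (λ k → zero₄ (a , k)) (cone₀ a) k }) }

        Pinned : (J : Vec (Fin n) r) → Set (c ⊔ ℓ)
        Pinned J = Σ (LocalSphere (lk Δ J)) λ S → ∃[ a ] ∃[ b ] ∃[ c ] (Unique.z S a b c ≉0)

        PinAt : ∀ J → Pinned J → Pts (2 ℕ.+ n) N → Set (c ⊔ ℓ)
        PinAt J (S , a , b , c , _) = Pins.Pin {N = N} ι (λ k → ι (lookup J k)) (Unique.z S) a b c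

        -- A nonzero coordinate disguised as injectivity of a system in one unknown, so that
        -- openness comes from `open-injective`.
        Nonzero₀ : Fin n → Pts (2 ℕ.+ n) N → Set (c ⊔ ℓ)
        Nonzero₀ v p = Injective {X = ⊤} {U = Fin 1} (λ _ → ev zero Fʳ* p (ι v) zero)

        -- The choices in `sp` are made before the points, since openness refers to a fixed pinned
        -- triangle for each J. The field `first` will allow functionals killing p_v to be given by
        -- their last d coordinates.
        record Generic (sp : ∀ J → Pinned J ⊎ ¬ LocalSphere (lk Δ J)) : Set (c ⊔ ℓ) where
          field
            p     : Pts (2 ℕ.+ n) N
            ind   : Ind N p
            first : ∀ v → p (ι v) zero ≉0
            pins  : ∀ J (π : Pinned J) → sp J ≡ inj₁ π → PinAt J π p

        generic : ∀ sp → DN (Generic sp)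
        generic sp = meet (open-∧ (open-Ind N) (open-∀ open-nz)) (open-∀Vec {P = λ J → Req J (sp J)} open-pin)
            (meet (open-Ind N) (open-∀ open-nz) (exists-Ind N ℕ.≤-refl) (return ((λ _ _ → 1#) , λ v m e → λ { zero →
              trans (sym (*-identityʳ _)) (e tt) })))
            (meet-∀Vec {P = λ J → Req J (sp J)} open-pin pin-witness) >>= λ { (p , (ind , nz) , pin) → return (record
              { p = p ; ind = ind
              ; first = λ v e → 1≉0 (nz v (λ _ → 1#) (λ _ → *-0ʳ e) zero)
              ; pins = λ J π e → ≡.subst (λ s → Req J s p) e (pin J) }) }
          where
            open-nz : ∀ v → Open (Nonzero₀ v)
            open-nz v = open-injective ↔-refl (λ _ → coordP (ev zero) (ι v) zero)

            Req : ∀ J → Pinned J ⊎ ¬ LocalSphere (lk Δ J) → Pts (2 ℕ.+ n) N → Set (c ⊔ ℓ)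
            Req J (inj₁ π) p = PinAt J π p
            Req J (inj₂ _) p = Lift _ ⊤

            open-req : ∀ J (s : Pinned J ⊎ ¬ LocalSphere (lk Δ J)) → Open (Req J s)
            open-req J (inj₁ (S , a , b , c , _)) = Pins.open-Pin {N = N} ι (λ k → ι (lookup J k)) (Unique.z S) a b c
            open-req J (inj₂ _) = record { resp = λ _ x → x ; open′ = λ a b x → cof (λ e _ → return (0 , λ _ _ → x)) }

            open-pin : ∀ J → Open (Req J (sp J))
            open-pin J = open-req J (sp J)

            pin-witness : ∀ J → DN (∃[ p ] Req J (sp J) p)
            pin-witness J = go (sp J)
              where
                go : (s : Pinned J ⊎ ¬ LocalSphere (lk Δ J)) → DN (∃[ p ] Req J s p)
                go (inj₁ (S , a , b , c , nz)) = ConePin.cone-pin J S nz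
                go (inj₂ _) = return ((λ _ _ → 0#) , lift tt)

        pinned? : DN (∀ J → Pinned J ⊎ ¬ LocalSphere (lk Δ J))
        pinned? = dn-Vec (λ J → lem (LocalSphere (lk Δ J)) >>= λ
          { (inj₁ S) → find₃ (Unique.z-nonzero S) >>= λ { (a , b , c , nz) → return (inj₁ (S , a , b , c , nz)) }
          ; (inj₂ ns) → return (inj₂ ns) })

      IJ-∷ʳ : ∀ {k} (E : Vec (Fin n) k) a ψ F → IJ (E ∷ʳ a) ψ F ≈ IJ E (i a ψ) F
      IJ-∷ʳ []      a ψ F = refl
      IJ-∷ʳ (e ∷ E) a ψ F = Func.cong (iF e F) (IJ-∷ʳ E a ψ)

      -- Contracting with the vertices of F one after the other changes the coefficient at F by
      -- signs only.
      pluck : ∀ k {ψ F} → ∣ F ∣ ≡ k → ψ F ≉0 → ∃[ E ] IJ {k} E ψ Sub.⊥ ≉0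
      pluck zero {ψ} {F} sz nz = [] , ≡.subst (λ G → ψ G ≉0) (size-0 F sz) nz
      pluck (suc k) {ψ} {F} sz nz =
        let (a , aF) = member F sz
            (E , nE) = pluck k {i a ψ} {del a F} (ℕ.suc-injective (≡.trans (≡.sym (size-del a F aF)) sz))
              (λ e → *-≉0 (sgn-≉0 (below (del a F) a)) nz (trans (*-congˡ (reflexive (≡.cong ψ (≡.sym (ins-del a F aF)))))
                (trans (sym (i-out ψ (del-≡ a F))) e)))
        in E ∷ʳ a , λ e → nE (trans (sym (IJ-∷ʳ E a ψ Sub.⊥)) e)

      module Vanish {Δ : Cx n} {d' : ℕ} (M : Mfd Δ d') {sp} (gen : Generic M sp)
        {K : ℕ} (base : Fin K → Alt (4 ℕ.+ suc d')) (cc : Fin K → Subset n → Carrier)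
        (cyc : ∀ τ → Cycle Δ (3 ℕ.+ d') (cc τ))
        (stress : ∀ v F y → lookup F v ≡ true → app (ΣA (λ τ → cc τ F *A base τ)) (Generic.p gen (ι v)) y ≈ 0#) where

        open Mfd M
        open Generic gen

        A : V (5 ℕ.+ d') → V (5 ℕ.+ d') → Subset n → Carrier
        A x y F = app (ΣA (λ τ → cc τ F *A base τ)) x y

        A-chain : ∀ x y → Ch Δ (3 ℕ.+ d') (A x y)
        A-chain x y F e = Σ-0 (λ τ → *-0ˡ (Cycle.chain (cyc τ) F e))

        indep-of : ∀ {k} (E : Vec (Fin (2 ℕ.+ n)) k) → Distinct E → ∀ {m} (G : Vec (Fin (2 ℕ.+ n)) m) → m ≡ 5 ℕ.+ d' → Distinct G →
          (f : Fin k → Fin m) → (∀ i → lookup G (f i) ≡ lookup E i) → LinIndep (λ i → p (lookup E i))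
        indep-of {k} E dE {m} G ≡.refl dG f fe γ z j = trans (sym (value j))
          (ind G dG (λ g → ∑ (λ j → γ j * δ (f j) g)) (λ a → begin
            ∑ (λ g → ∑ (λ j → γ j * δ (f j) g) * p (lookup G g) a)
              ≈⟨ Σ-cong (λ g → sym (Σ-*ʳ _ _)) ⟩
            ∑ (λ g → ∑ (λ j → γ j * δ (f j) g * p (lookup G g) a))
              ≈⟨ Σ-swap _ ⟩
            ∑ (λ j → ∑ (λ g → γ j * δ (f j) g * p (lookup G g) a))
              ≈⟨ Σ-cong (λ j → trans (Σ-cong (λ g → *-assoc _ _ _)) (trans (Σ-* _ _) (*-congˡ (Σ-δ (f j) (λ g → p (lookup G g) a))))) ⟩
            ∑ (λ j → γ j * p (lookup G (f j)) a)
              ≈⟨ Σ-cong (λ j → *-congˡ (reflexive (≡.cong (λ v → p v a) (fe j)))) ⟩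
            ∑ (λ j → γ j * p (lookup E j) a)
              ≈⟨ z a ⟩
            0# ∎) (f j))
          where
            f-inj : ∀ i j → f i ≡ f j → i ≡ j
            f-inj i j e = dE i j (≡.trans (≡.sym (fe i)) (≡.trans (≡.cong (lookup G) e) (fe j)))
            value : ∀ j → ∑ (λ j' → γ j' * δ (f j') (f j)) ≈ γ j
            value j = trans (Σ-cong (λ j' → *-congˡ (reflexive (δ-inj f f-inj j' j)))) (Σ-δʳ j γ)

        indep-face : ∀ (E : Vec (Fin n) (4 ℕ.+ d')) → (∀ i j → lookup E i ≡ lookup E j → i ≡ j) → LinIndep (λ k → p (ι (lookup E k)))
        indep-face E dE γ z = indep-of {4 ℕ.+ d'} (Vec.map ι E)
            (λ i j e → dE i j (ι-inj (≡.trans (≡.sym (Vec.lookup-map i ι E)) (≡.trans e (Vec.lookup-map j ι E)))))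
            -- An auxiliary point fills the D = N - 1 vertices up to N, the number for which
            -- independence is assumed.
            (zero ∷ Vec.map ι E) ≡.refl
            ((λ j e → phantom (≡.trans e (Vec.lookup-map j ι E))) distinct-∷
              (λ i j e → dE i j (ι-inj (≡.trans (≡.sym (Vec.lookup-map i ι E)) (≡.trans e (Vec.lookup-map j ι E))))))
            suc (λ _ → ≡.refl) γ (λ a → trans (Σ-cong (λ j → *-congˡ (reflexive (≡.cong (λ v → p v a) (Vec.lookup-map j ι E))))) (z a))
          where
            phantom : ∀ {v} → zero ≢ ι v
            phantom ()

        at-sphere : ∀ (J : Vec (Fin n) (suc d')) → LocalSphere (lk Δ J) → ∀ x y u v → i u (i v (IJ J (A x y))) Sub.⊥ ≈ 0#
        at-sphere J S x y u v with sp J in eq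
        ... | inj₂ ns = ⊥-elim (ns S)
        ... | inj₁ π@(S' , a , b , c' , nz) = StressFree.stress-free {Δ} J S' ι p
            (λ a b c f → indep-face (a ∷ b ∷ c ∷ J) (rev a b c f))
            nz (pins J π eq) base cc (ℕ.+-comm 2 (suc d')) cyc stress x y u v
          where
            rev : ∀ a b c → Face (lk Δ J) (c ∷ b ∷ a ∷ []) → ∀ i j → lookup (a ∷ b ∷ c ∷ J) i ≡ lookup (a ∷ b ∷ c ∷ J) j → i ≡ j
            rev a b c f = face-distinct {Γ = Δ} (a ∷ b ∷ c ∷ J) down (face-reverse (lk Δ J) c b a [] f)

        from-lists : (∀ x y (E : Vec (Fin n) (3 ℕ.+ d')) → Face Δ E → IJ E (A x y) Sub.⊥ ≈ 0#) → ∀ x y F → A x y F ≈ 0#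
        from-lists h x y F = stable (λ nz →
          let (E , nE) = pluck (3 ℕ.+ d') (proj₂ (ch-face {Δ} (A-chain x y) nz)) nz
          in nE (h x y E (proj₁ (ch-face {lk Δ E} {0} (ch-IJ {Δ} E (≡.sym (ℕ.+-identityʳ _)) (A-chain x y)) nE))))

        -- For d ≥ 5 the list J has at least two entries, so no singular vertex is met and every
        -- contraction is covered by `at-sphere`.
        vanish-high : 1 ≤ d' → ∀ x y F → A x y F ≈ 0#
        vanish-high le = from-lists λ { x y (u ∷ v ∷ J) f →
          at-sphere J (localSphere M J (≡.subst (SphereB (lk Δ J)) (ℕ.m+n∸n≡m 3 d')
            (sph J (s≤s le) (face-tail Δ v J down (face-tail Δ u (v ∷ J) down f))))) x y u v }

      module VanishLow {Δ : Cx n} (M : Mfd Δ 0) {sp} (gen : Generic M sp)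
        {K : ℕ} (base : Fin K → Alt 5) (cc : Fin K → Subset n → Carrier)
        (cyc : ∀ τ → Cycle Δ 3 (cc τ))
        (stress : ∀ v F y → lookup F v ≡ true → app (ΣA (λ τ → cc τ F *A base τ)) (Generic.p gen (ι v)) y ≈ 0#)
        (S : List (Fin n)) (le : length S ≤ 5) (nonsing : ∀ v → ¬ (v ∈ S) → DN (SphereB (lk Δ (v ∷ [])) 3)) where

        open Mfd M
        open Generic gen
        open Vanish M gen base cc cyc stress
        open DecList (Fin._≟_ {n}) using (_∈?_)

        t : V 5 → V 5 → Fin n → Fin n → Fin n → Carrier
        t x y a b c = i a (i b (i c (A x y))) Sub.⊥

        t-sw : ∀ x y a b c → t x y a b c ≈ - t x y b a c
        t-sw x y a b c = ii-anti a b (i c (A x y)) Sub.⊥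

        t-sw′ : ∀ x y a b c → t x y a b c ≈ - t x y a c b
        t-sw′ x y a b c = trans (Func.cong (iF a Sub.⊥) (ii-anti b c (A x y))) (fn-neg (iF a Sub.⊥) _)

        t-rot : ∀ x y a b c → t x y a b c ≈ t x y b c a
        t-rot x y a b c = trans (t-sw x y a b c) (trans (-‿cong (t-sw′ x y b a c)) (-‿involutive _))

        t-sum : ∀ x y a b → ∑ (t x y a b) ≈ 0#
        t-sum x y a b = trans (sym (trans (Func.cong (iF a Sub.⊥) (λ F → fn-∑ (iF b F) (λ w → i w (A x y))))
            (fn-∑ (iF a Sub.⊥) (λ w → i b (i w (A x y))))))
          (Func.zer (iF a Sub.⊥) (λ F → Func.zer (iF b F) (λ G → begin
            Bd (A x y) G
              ≈⟨ Func.cong (BdF G) (λ H → Σ-cong (λ τ → *-comm _ _)) ⟩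
            Bd (lincomb (λ τ → app (base τ) x y) cc) G
              ≈⟨ Func.sum (BdF G) _ _ ⟩
            ∑ (λ τ → app (base τ) x y * Bd (cc τ) G)
              ≈⟨ Σ-0 (λ τ → *-0ʳ (Cycle.closed (cyc τ) G)) ⟩
            0# ∎)))

        t-third : ∀ y a b c → t (p (ι c)) y a b c ≈ 0#
        t-third y a b c = Func.zer (iF a Sub.⊥) (λ F → Func.zer (iF b F) (van-kill (λ G e → stress c G y e)))

        t-second : ∀ y a b c → t (p (ι b)) y a b c ≈ 0#
        t-second y a b c = trans (t-sw′ _ y a b c) (neg-0 (t-third y a c b))

        t-first : ∀ y a b c → t (p (ι a)) y a b c ≈ 0#
        t-first y a b c = trans (t-rot _ y a b c) (t-third y b c a)

        t-regular : ∀ x y a b c → ¬ (c ∈ S) → t x y a b c ≈ 0#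
        t-regular x y a b c c∉ = stable (nonsing c c∉ >>= λ sp₃ → return (at-sphere (c ∷ []) (localSphere M (c ∷ []) sp₃) x y a b))

        t-alt : Fin n → Fin n → Fin n → Alt 5
        t-alt a b c = ΣA (λ τ → i a (i b (i c (cc τ))) Sub.⊥ *A base τ)

        t-app : ∀ x y a b c → app (t-alt a b c) x y ≈ t x y a b c
        t-app x y a b c = sym (begin
          t x y a b c
            ≈⟨ Func.cong f (λ F → Σ-cong (λ τ → *-comm _ _)) ⟩
          fn f (lincomb (λ τ → app (base τ) x y) cc)
            ≈⟨ Func.sum f _ _ ⟩
          ∑ (λ τ → app (base τ) x y * fn f (cc τ))
            ≈⟨ Σ-cong (λ τ → *-comm _ _) ⟩
          ∑ (λ τ → fn f (cc τ) * app (base τ) x y) ∎)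
          where f = iF a Sub.⊥ ∘F (λ F → iF b F ∘F (λ G → iF c G))

        -- The form t(u, v, j) kills the points of u, v and j by the stress condition. Together with
        -- those of g and h they are a basis of k⁵, so only the value at (p_g, p_h) is left to be
        -- checked.
        singular : ∀ x y u v j → u ≢ v → u ≢ j → v ≢ j → u ∈ S → v ∈ S → j ∈ S → t x y u v j ≈ 0#
        singular x y u v j uv uj vj u∈ v∈ j∈ with Covering.others S le uv uj vj u∈ v∈ j∈
        ... | g , h , dist , cover = trans (sym (t-app x y u v j)) (alt-zero (λ k → p (lookup (g ∷ ι u ∷ ι v ∷ ι j ∷ []) k)) indep₄ T kills x y)
          where
            T = t-alt u v j

            indep₄ : LinIndep (λ k → p (lookup (g ∷ ι u ∷ ι v ∷ ι j ∷ []) k))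
            indep₄ = indep-of (g ∷ ι u ∷ ι v ∷ ι j ∷ []) (distinct-skip dist)
                (g ∷ h ∷ ι u ∷ ι v ∷ ι j ∷ []) ≡.refl dist (punchIn (suc zero)) (skip-lookup g h (ι u ∷ ι v ∷ ι j ∷ []))

            -- The cycle condition around uv isolates j: a regular w contributes nothing by the
            -- sphere argument, and any other singular w is g or h, whose point the form at (u, v,
            -- w) kills.
            gh : t (p g) (p h) u v j ≈ 0#
            gh = begin
              t (p g) (p h) u v j                           ≈⟨ Σ-δ j (t (p g) (p h) u v) ⟨
              ∑ (λ w → δ j w * t (p g) (p h) u v w)         ≈⟨ Σ-cong only ⟩
              ∑ (t (p g) (p h) u v)                         ≈⟨ t-sum (p g) (p h) u v ⟩
              0#                                            ∎
              where
                zero-off : ∀ w → j ≢ w → t (p g) (p h) u v w ≈ 0#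
                zero-off w jw with w ∈? S
                ... | no w∉ = t-regular (p g) (p h) u v w w∉
                ... | yes w∈ with w Fin.≟ u | w Fin.≟ v
                ...   | yes ≡.refl | _ = trans (t-rot _ _ w v w) (trans (t-rot _ _ v w w) (ii-diag w (i v (A (p g) (p h))) Sub.⊥))
                ...   | no _ | yes ≡.refl = trans (t-rot _ _ u w w) (ii-diag w (i u (A (p g) (p h))) Sub.⊥)
                ...   | no wu | no wv with cover w∈ wu wv (λ e → jw (≡.sym e))
                ...     | inj₁ ≡.refl = t-third (p h) u v w
                ...     | inj₂ ≡.refl = trans (sym (t-app (p g) (p h) u v w)) (trans (Alt.anti (t-alt u v w) (p g) (p h))
                            (neg-0 (trans (t-app (p h) (p g) u v w) (t-third (p g) u v w))))
                only : ∀ w → δ j w * t (p g) (p h) u v w ≈ t (p g) (p h) u v w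
                only w = by-cases (j ≡ w) (λ { ≡.refl → trans (*-congʳ (reflexive (δ-≡ j))) (*-identityˡ _) })
                  (λ ne → trans (*-0ʳ (zero-off w ne)) (sym (zero-off w ne)))

            from : ∀ {x} → (∀ y → t x y u v j ≈ 0#) → ∀ y → app T x y ≈ 0#
            from e y = trans (t-app _ y u v j) (e y)

            kill-g : ∀ y → app T (p g) y ≈ 0#
            kill-g = func-zero (λ k → p (lookup (g ∷ h ∷ ι u ∷ ι v ∷ ι j ∷ []) k)) (ind (g ∷ h ∷ ι u ∷ ι v ∷ ι j ∷ []) dist) (appF T (p g)) λ
              { zero → Alt.alt T (p g)
              ; (suc zero) → trans (t-app (p g) (p h) u v j) gh
              ; (suc (suc zero)) → trans (Alt.anti T _ _) (neg-0 (from (λ y → t-first y u v j) (p g)))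
              ; (suc (suc (suc zero))) → trans (Alt.anti T _ _) (neg-0 (from (λ y → t-second y u v j) (p g)))
              ; (suc (suc (suc (suc zero)))) → trans (Alt.anti T _ _) (neg-0 (from (λ y → t-third y u v j) (p g))) }

            kills : ∀ k y → app T (p (lookup (g ∷ ι u ∷ ι v ∷ ι j ∷ []) k)) y ≈ 0#
            kills = Fin₄-cases kill-g (from (λ y → t-first y u v j)) (from (λ y → t-second y u v j)) (from (λ y → t-third y u v j))

        vanish-low : ∀ x y F → A x y F ≈ 0#
        vanish-low = from-lists λ { x y (u ∷ v ∷ j ∷ []) f → go x y u v j (face-distinct {Γ = Δ} (u ∷ v ∷ j ∷ []) down f) (u ∈? S) (v ∈? S) (j ∈? S) }
          where
            go : ∀ x y u v j → (∀ a b → lookup (u ∷ v ∷ j ∷ []) a ≡ lookup (u ∷ v ∷ j ∷ []) b → a ≡ b) →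
              Dec (u ∈ S) → Dec (v ∈ S) → Dec (j ∈ S) → t x y u v j ≈ 0#
            go x y u v j di (no u∉) _ _ = trans (t-rot x y u v j) (t-regular x y v j u u∉)
            go x y u v j di _ (no v∉) _ = trans (t-sw′ x y u v j) (neg-0 (t-regular x y u j v v∉))
            go x y u v j di _ _ (no j∉) = t-regular x y u v j j∉
            go x y u v j di (yes u∈) (yes v∈) (yes j∈) = singular x y u v j
              (λ e → ne₁ (di zero (suc zero) e)) (λ e → ne₂ (di zero (suc (suc zero)) e)) (λ e → ne₃ (di (suc zero) (suc (suc zero)) e)) u∈ v∈ j∈
              where
                ne₁ : zero {2} ≢ suc zero
                ne₁ ()
                ne₂ : zero {2} ≢ suc (suc zero)
                ne₂ ()
                ne₃ : suc {2} zero ≢ suc (suc zero)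
                ne₃ ()

    -- Duality of chains and cochains

    module Pairing where

      open Simplicial

      opaque
        eF : Fin n → Subset n → Func (Subset n)
        eF u G = if lookup G u then (sgn (below G u) *F ev (del u G)) else 0F

      -- Exterior multiplication by the vertex u, the adjoint of i u.
      e : Fin n → (Subset n → Carrier) → Subset n → Carrier
      e u φ G = fn (eF u G) φ

      opaque
        unfolding eF

        e-in : ∀ {u G} φ → lookup G u ≡ true → e u φ G ≈ sgn (below G u) * φ (del u G)
        e-in φ q rewrite q = refl

        e-out : ∀ {u G} φ → lookup G u ≡ false → e u φ G ≈ 0#
        e-out φ q rewrite q = refl

      ⟨_,_⟩ : (Subset n → Carrier) → (Subset n → Carrier) → Carrier
      ⟨ α , φ ⟩ = pair (summable-Subset n) α φ

      -- Both sums run over the pairs of F without u and F ∪ u; h is the common summand of such a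
      -- pair.
      sum-shift : ∀ {n} (u : Fin n) (h : Subset n → Subset n → Carrier) (f g : Subset n → Carrier) →
        (∀ F → lookup F u ≡ true → f F ≈ 0#) → (∀ F → lookup F u ≡ false → f F ≈ h F (ins u F)) →
        (∀ G → lookup G u ≡ false → g G ≈ 0#) → (∀ G → lookup G u ≡ true → g G ≈ h (del u G) G) →
        sumSub f ≈ sumSub g
      sum-shift {suc n} zero h f g f-in f-out g-out g-in = begin
        sumSub (f ∘ (false ∷_)) + sumSub (f ∘ (true ∷_))
          ≈⟨ +-cong (sumSub-cong {n} (λ F → trans (f-out (false ∷ F) ≡.refl)
               (trans (reflexive (≡.cong (λ G → h (false ∷ F) (true ∷ G)) (Sub.∪-identityʳ F)))
                 (trans (reflexive (≡.cong (λ G → h (false ∷ G) (true ∷ F)) (≡.sym (Sub.p─⊥≡p F)))) (sym (g-in (true ∷ F) ≡.refl))))))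
             (sumSub-0 {n} (λ F → f-in (true ∷ F) ≡.refl)) ⟩
        sumSub (g ∘ (true ∷_)) + 0#
          ≈⟨ trans (+-comm _ _) (+-congʳ (sym (sumSub-0 {n} (λ G → g-out (false ∷ G) ≡.refl)))) ⟩
        sumSub (g ∘ (false ∷_)) + sumSub (g ∘ (true ∷_)) ∎
      sum-shift {suc n} (suc u) h f g f-in f-out g-out g-in = +-cong
        (sum-shift u (λ F G → h (false ∷ F) (false ∷ G)) _ _ (λ F → f-in (false ∷ F)) (λ F → f-out (false ∷ F)) (λ F → g-out (false ∷ F)) (λ F → g-in (false ∷ F)))
        (sum-shift u (λ F G → h (true ∷ F) (true ∷ G)) _ _ (λ F → f-in (true ∷ F)) (λ F → f-out (true ∷ F)) (λ F → g-out (true ∷ F)) (λ F → g-in (true ∷ F)))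

      adjoint : ∀ u α φ → ⟨ i u α , φ ⟩ ≈ ⟨ α , e u φ ⟩
      adjoint u α φ = sum-shift u (λ F G → sgn (below F u) * α G * φ F) _ _
        (λ F q → *-0ˡ (i-in α q))
        (λ F q → *-congʳ (i-out α q))
        (λ G q → *-0ʳ (e-out φ q))
        (λ G q → trans (*-congˡ (e-in φ q)) (trans (*-congˡ (*-congʳ (reflexive (≡.cong sgn (≡.sym (below-del u G))))))
          (solve 3 (λ a s p → a :* (s :* p) := s :* a :* p) refl _ _ _)))

      Cob : (Subset n → Carrier) → Subset n → Carrier
      Cob φ G = ∑ (λ u → e u φ G)

      pair-∑ʳ : ∀ {m} α (φ : Fin m → Subset n → Carrier) → ⟨ α , (λ G → ∑ (λ u → φ u G)) ⟩ ≈ ∑ (λ u → ⟨ α , φ u ⟩)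
      pair-∑ʳ α φ = trans (Summable.pair-cong (summable-Subset n) {α} {α} (λ _ → refl) (λ G → refl))
        (trans (Func.cong sumSubF (λ G → sym (Σ-* (α G) (λ u → φ u G)))) (fn-∑ sumSubF (λ u G → α G * φ u G)))

      pair-∑ˡ : ∀ {m} (α : Fin m → Subset n → Carrier) φ → ⟨ (λ G → ∑ (λ u → α u G)) , φ ⟩ ≈ ∑ (λ u → ⟨ α u , φ ⟩)
      pair-∑ˡ α φ = trans (Func.cong sumSubF (λ G → sym (Σ-*ʳ (λ u → α u G) (φ G)))) (fn-∑ sumSubF (λ u G → α u G * φ G))

      Bd-Cob : ∀ α φ → ⟨ Bd α , φ ⟩ ≈ ⟨ α , Cob φ ⟩
      Bd-Cob α φ = trans (pair-∑ˡ (λ u → i u α) φ) (trans (Σ-cong (λ u → adjoint u α φ)) (sym (pair-∑ʳ α (λ u → e u φ))))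

      e-i : ∀ v x → (∀ G → lookup G v ≡ false → x G ≈ 0#) → ∀ G → e v (i v x) G ≈ x G
      e-i v x sup G = bool-case (lookup G v)
        (λ q → trans (e-in (i v x) q) (trans (*-congˡ (trans (i-out x (del-≡ v G)) (*-cong (reflexive (≡.cong sgn (below-del v G)))
          (reflexive (≡.cong x (ins-del v G q)))))) (trans (sym (*-assoc _ _ _)) (trans (*-congʳ (sgn² (below G v))) (*-identityˡ _)))))
        (λ q → trans (e-out (i v x) q) (sym (sup G q)))

      i-e : ∀ v α → (∀ F → lookup F v ≡ true → α F ≈ 0#) → ∀ F → i v (e v α) F ≈ α F
      i-e v α sup F = bool-case (lookup F v)
        (λ q → trans (i-in (e v α) q) (sym (sup F q)))
        (λ q → trans (i-out (e v α) q) (trans (*-congˡ (trans (e-in α (ins-≡ v F)) (*-cong (reflexive (≡.cong sgn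
            (≡.trans (≡.sym (below-del v (ins v F))) (≡.cong (λ G → below G v) (del-ins v F q)))))
            (reflexive (≡.cong α (del-ins v F q)))))) (trans (sym (*-assoc _ _ _)) (trans (*-congʳ (sgn² (below F v))) (*-identityˡ _)))))

      ch-e : ∀ {Γ s α} v → Ch (link Γ ⁅ v ⁆) s α → Ch Γ (suc s) (e v α)
      ch-e {Γ} {s} {α} v ch = ch-intro {Γ} (λ G nz → bool-case (lookup G v)
        (λ q →
          let (f , sz) = ch-face {link Γ ⁅ v ⁆} ch (λ z → nz (trans (e-in α q) (*-0ʳ z)))
              (_ , f') = link-face {Γ = Γ} {v} {del v G} f
          in ≡.subst (λ H → Γ H ≡ true) (ins-del v G q) f' , ≡.trans (size-del v G q) (≡.cong suc sz))
        (λ q → ⊥-elim (nz (e-out α q))))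

      ch-off : ∀ {Γ s α v} → Ch (link Γ ⁅ v ⁆) s α → ∀ F → lookup F v ≡ true → α F ≈ 0#
      ch-off {Γ} {s} {α} {v} ch F q = stable (λ nz → true≢false q (proj₁ (link-face {Γ = Γ} {v} {F} (proj₁ (ch-face {link Γ ⁅ v ⁆} ch nz)))))

      δ-Cob : ∀ {Γ s φ G} → faceOfSize Γ (suc s) G ≡ true → WithField.δ 𝔽 Γ s φ G ≈ Cob φ G
      δ-Cob {Γ} {s} {φ} {G} f rewrite f = trans (reflexive (≡.sym (∑-def _))) (Σ-cong term)
        where
          term : ∀ u → (if lookup G u then sgn (below G u) * φ (G Sub.- u) else 0#) ≈ e u φ G
          term u with lookup G u in q
          ... | true  = sym (e-in φ q)
          ... | false = sym (e-out φ q)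

      δ-chain : ∀ Γ s φ → Ch Γ (suc s) (WithField.δ 𝔽 Γ s φ)
      δ-chain Γ s φ G f rewrite f = refl

      pair-δ : ∀ {Γ s α φ} → Ch Γ (suc s) α → ⟨ α , WithField.δ 𝔽 Γ s φ ⟩ ≈ ⟨ Bd α , φ ⟩
      pair-δ {Γ} {s} {α} {φ} ch = trans (Func.cong sumSubF (λ G → bool-case (faceOfSize Γ (suc s) G)
          (λ f → *-congˡ (δ-Cob {Γ} f)) (λ f → trans (*-0ˡ (ch G f)) (sym (*-0ˡ (ch G f))))))
        (sym (Bd-Cob α φ))

      -- Through `i v`, cochains supported on the faces at v become cochains of the link, without
      -- change of the pairing; thus relative cohomology at v can be tested on chains of the link.
      link-pair : ∀ v α x → (∀ G → lookup G v ≡ false → x G ≈ 0#) → ⟨ i v α , i v x ⟩ ≈ ⟨ α , x ⟩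
      link-pair v α x sup = trans (adjoint v α (i v x)) (Func.cong sumSubF (λ G → *-congˡ (e-i v x sup G)))

    -- Bounding numbers of faces by dimensions

    module Count (Δ : Cx n) (down : Down Δ) where

      open Simplicial
      open Pairing

      unit-chain : ∀ {Γ s G} → faceOfSize Γ s G ≡ true → Ch Γ s (unitSub G)
      unit-chain {Γ} {s} {G} f F q = Summable.unit-off (summable-Subset n) G F (λ { ≡.refl → true≢false f q })

      -- Rank and nullity: a face minus a combination of the chosen preimages with the same boundary
      -- is a cycle.
      facets-bound : ∀ {s β bb} → Basis (WithField.Cycles 𝔽 Δ (suc s)) β → Basis (WithField.Boundaries 𝔽 Δ s) bb →
        fSize Δ (suc s) ≤ β ℕ.+ bb
      facets-bound {s} {β} {bb} (Z , _ , _ , spZ) (bnd , pre , _ , spB) =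
        spanned-bound {A = Subset n} {R = Fin β ⊎ Fin bb} (↔-sym Fin.+↔⊎) Comb
          (λ j → unitSub (face j)) (units-indep (summable-Subset n) face face-inj) span
        where
          sz = size-faces Δ (suc s)
          face : Fin (fSize Δ (suc s)) → Subset n
          face j = proj₁ (Inverse.from sz j)
          face-inj : ∀ i j → face i ≡ face j → i ≡ j
          face-inj i j q = from-injective sz i j (faceT-≡ q)
          ψ : Fin bb → Subset n → Carrier
          ψ k = proj₁ (pre k)
          Comb : Subset n → Func (Fin β ⊎ Fin bb)
          Comb F = ΣF (λ k → ev (inj₁ k) Fʳ* Z k F) +F ΣF (λ k → ev (inj₂ k) Fʳ* ψ k F)
          span : ∀ j → DN (∃[ γ ] ∀ F → unitSub (face j) F ≈ fn (Comb F) γ)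
          span j = spB (WithField.∂ 𝔽 Δ s x) (x , chx , λ _ → refl) >>= λ { (γ , eγ) →
            let x' : Subset n → Carrier
                x' F = x F - lincomb γ ψ F
                cx' : Cycle Δ (suc s) x'
                cx' = mkCycle (λ F q → +-0 (chx F q) (neg-0 (Σ-0 (λ k → *-0ʳ (proj₁ (proj₂ (pre k)) F q)))))
                  (λ F → begin
                    Bd x' F                                   ≈⟨ sub (BdF F) x (lincomb γ ψ) ⟩
                    Bd x F - Bd (lincomb γ ψ) F               ≈⟨ +-cong (sym (∂-Bd {Δ} down chx F)) (-‿cong (Func.sum (BdF F) γ ψ)) ⟩
                    WithField.∂ 𝔽 Δ s x F - ∑ (λ k → γ k * Bd (ψ k) F)
                      ≈⟨ +-cong (eγ F) (-‿cong (Σ-cong (λ k → *-congˡ (trans (sym (∂-Bd {Δ} down (proj₁ (proj₂ (pre k))) F)) (sym (proj₂ (proj₂ (pre k)) F)))))) ⟩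
                    lincomb γ bnd F - lincomb γ bnd F         ≈⟨ -‿inverseʳ _ ⟩
                    0#                                        ∎)
            in spZ x' (cycles⇐ {Δ} down cx') >>= λ { (γ' , eγ') →
              return ([ γ' , γ ]′ , λ F → begin
                x F                                 ≈⟨ solve 2 (λ x y → x := (x :- y) :+ y) refl _ _ ⟩
                x' F + lincomb γ ψ F                ≈⟨ +-congʳ (eγ' F) ⟩
                lincomb γ' Z F + lincomb γ ψ F      ∎) } }
            where
              x = unitSub (face j)
              chx = unit-chain {Δ} (proj₂ (Inverse.from sz j))

      At : (Fin n × Subset n → Carrier) → Fin n → Subset n → Carrier
      At x v G = x (v , G)

      Supported : (Fin n × Subset n → Carrier) → Set ℓ
      Supported x = ∀ v G → lookup G v ≡ false → x (v , G) ≈ 0#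

      tilde : (Fin n × Subset n → Carrier) → Fin n × Subset n → Carrier
      tilde x (v , F) = i v (At x v) F

      S² : Summable (Fin n × Subset n)
      S² = summable-× (summable-Subset n)

      -- Nothing is lost in passing to links, as `e v` inverts `i v` on what is supported at v.
      tilde-indep : ∀ {k} {x : Fin k → Fin n × Subset n → Carrier} → (∀ j → Supported (x j)) → LinIndep x → LinIndep (λ j → tilde (x j))
      tilde-indep {k} {x} sup li γ z = li γ λ { (v , G) →
        let X : Subset n → Carrier
            X G = ∑ (λ j → γ j * x j (v , G))
        in trans (sym (e-i v X (λ G q → Σ-0 (λ j → *-0ʳ (sup j v G q))) G))
          (Func.zer (eF v G) (λ F → trans (Func.sum (iF v F) γ (λ j → At (x j) v)) (z (v , F)))) }

      δ-supported : ∀ v s {ψ} → (∀ F → lookup F v ≡ false → ψ F ≈ 0#) → ∀ G → lookup G v ≡ false → WithField.δ 𝔽 Δ s ψ G ≈ 0#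
      δ-supported v s {ψ} sup G q = bool-case (faceOfSize Δ (suc s) G)
        (λ f → trans (δ-Cob {Δ} f) (Σ-0 (λ u → bool-case (lookup G u)
          (λ r → trans (e-in ψ r) (*-0ʳ (sup (del u G) (≡.trans (del-≢ G (λ { ≡.refl → true≢false r q })) q))))
          (λ r → e-out ψ r))))
        (λ f → δ-chain Δ s ψ G f)

      δ-zero : ∀ s G → WithField.δ 𝔽 Δ s zeroV G ≈ 0#
      δ-zero s G = bool-case (faceOfSize Δ (suc s) G)
        (λ f → trans (δ-Cob {Δ} f) (Σ-0 (λ u → Func.zer (eF u G) (λ _ → refl)))) (λ f → δ-chain Δ s zeroV G f)

      -- Tested against the coboundary of the unit cochain at H ∪ v, which picks out, up to sign,
      -- the boundary of α at H.
      annihilator-cycle : ∀ {s} v {α} → Ch (link Δ ⁅ v ⁆) (suc s) α →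
        (∀ ψ → WithField.RelCochain 𝔽 Δ v (suc s) ψ → ⟨ α , i v (WithField.δ 𝔽 Δ (suc s) ψ) ⟩ ≈ 0#) → ∀ H → Bd α H ≈ 0#
      annihilator-cycle {s} v {α} ch ann H = stable λ nz →
        let L = link Δ ⁅ v ⁆
            dL = down-link {Γ = Δ} v down
            (fH , sH) = ch-face {L} (ch-Bd {L} dL ch) nz
            (vH , fvH) = link-face {Γ = Δ} {v} {H} fH
            ψ = unitSub (ins v H)
            relψ : WithField.RelCochain 𝔽 Δ v (suc s) ψ
            relψ = unit-chain {Δ} (face-intro {Γ = Δ} fvH (≡.trans (size-ins v H vH) (≡.cong suc sH)))
              , λ F q → Summable.unit-off (summable-Subset n) (ins v H) F (λ { ≡.refl → true≢false (ins-≡ v H) q })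
            α̃ = e v α
            iα̃ : ∀ F → i v α̃ F ≈ α F
            iα̃ = i-e v α (ch-off {Δ} ch)
            D = WithField.δ 𝔽 Δ (suc s) ψ
            zero-at : Bd α̃ (ins v H) ≈ 0#
            zero-at = begin
              Bd α̃ (ins v H)             ≈⟨ Summable.pick (summable-Subset n) (ins v H) (Bd α̃) ⟨
              ⟨ ψ , Bd α̃ ⟩               ≈⟨ Func.cong (sumSubF {n}) (λ G → *-comm _ _) ⟩
              ⟨ Bd α̃ , ψ ⟩               ≈⟨ pair-δ {Δ} (ch-e {Δ} v ch) ⟨
              ⟨ α̃ , D ⟩                  ≈⟨ link-pair v α̃ D (δ-supported v (suc s) (proj₂ relψ)) ⟨
              ⟨ i v α̃ , i v D ⟩          ≈⟨ Func.cong (sumSubF {n}) (λ G → *-congʳ (iα̃ G)) ⟩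
              ⟨ α , i v D ⟩              ≈⟨ ann ψ relψ ⟩
              0#                         ∎
        in nz (begin
          Bd α H            ≈⟨ Func.cong (BdF H) iα̃ ⟨
          Bd (i v α̃) H      ≈⟨ Bd-i v α̃ H ⟩
          - i v (Bd α̃) H    ≈⟨ neg-0 (trans (i-out (Bd α̃) vH) (*-0ʳ zero-at)) ⟩
          0#                ∎)

      module _ {s : ℕ} where

        RelBoundaries : (Fin n × Subset n → Carrier) → Set (c ⊔ ℓ)
        RelBoundaries x = ∀ v → WithField.RelCoboundary 𝔽 Δ v (3 ℕ.+ s) (At x v)

        relB-supported : ∀ {x} → RelBoundaries x → Supported x
        relB-supported h v G q = let (ψ , rel , eq) = h v in trans (eq G) (δ-supported v (2 ℕ.+ s) (proj₂ rel) G q)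

        relB-chain : ∀ {x} → RelBoundaries x → ∀ v → Ch Δ (3 ℕ.+ s) (At x v)
        relB-chain h v F q = let (ψ , rel , eq) = h v in trans (eq F) (δ-chain Δ (2 ℕ.+ s) ψ F q)

        -- From the unit chain of a ridge its projection onto the duals of the relative coboundaries
        -- is subtracted. What remains annihilates all of these, and is a cycle in each link by
        -- `annihilator-cycle`.
        ridges-bound : ∀ {zv : Fin n → ℕ} {bb'} → (∀ v → Basis (WithField.Cycles 𝔽 (link Δ ⁅ v ⁆) (2 ℕ.+ s)) (zv v)) →
          Basis RelBoundaries bb' → sumN (λ v → fSize (link Δ ⁅ v ⁆) (2 ℕ.+ s)) ≤ sumN zv ℕ.+ bb'
        ridges-bound {zv} {bb'} bz (x , xS , li , sp) = decidable-stable (_ ℕ.≤? _)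
          (dual-basis S² (λ j → tilde (x j)) (tilde-indep (λ j → relB-supported (xS j)) li) >>= λ Y → return (bound Y))
          where
            L : Fin n → Cx n
            L v = link Δ ⁅ v ⁆
            dL : ∀ v → Down (L v)
            dL v = down-link {Γ = Δ} v down

            bound : Dual S² (λ j → tilde (x j)) → sumN (λ v → fSize (L v) (2 ℕ.+ s)) ≤ sumN zv ℕ.+ bb'
            bound Y = spanned-bound {A = Fin n × Subset n} {R = Σ (Fin n) (λ v → Fin (zv v)) ⊎ Fin bb'}
                (size-⊎ (size-Σ (λ v → ↔-refl)) ↔-refl) Comb
                (λ j → Summable.unit S² (pos j)) (units-indep S² pos pos-inj) span
              where
                module Y = Dual Y
                sz : Σ (Fin n) (λ v → FaceT (L v) (2 ℕ.+ s)) ↔ Fin _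
                sz = size-Σ (λ v → size-faces (L v) (2 ℕ.+ s))
                pos : Fin _ → Fin n × Subset n
                pos j = let (v , F , _) = Inverse.from sz j in v , F
                pos-inj : ∀ i j → pos i ≡ pos j → i ≡ j
                pos-inj i j q = from-injective sz i j (pos-≡ (Inverse.from sz i) (Inverse.from sz j) q)
                  where
                    pos-≡ : (a b : Σ (Fin n) (λ v → FaceT (L v) (2 ℕ.+ s))) → (proj₁ a , proj₁ (proj₂ a)) ≡ (proj₁ b , proj₁ (proj₂ b)) → a ≡ b
                    pos-≡ (v , F , p) (.v , .F , r) ≡.refl = ≡.cong (λ p → v , F , p) (Decidable⇒UIP.≡-irrelevant Bool._≟_ p r)

                Comb : Fin n × Subset n → Func (Σ (Fin n) (λ v → Fin (zv v)) ⊎ Fin bb')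
                Comb (v , F) = ΣF (λ k → ev (inj₁ (v , k)) Fʳ* proj₁ (bz v) k F) +F ΣF (λ k → ev (inj₂ k) Fʳ* Y.vec k (v , F))

                span : ∀ j → DN (∃[ γ ] ∀ a → Summable.unit S² (pos j) a ≈ fn (Comb a) γ)
                span j = dn-Fin (λ v → proj₂ (proj₂ (proj₂ (bz v))) (At y' v) (cycles⇐ {L v} (dL v) (mkCycle (chain-y' v) (closed-y' v)))) >>= λ γ →
                  return ([ (λ { (v , k) → proj₁ (γ v) k }) , pr ]′ , λ { (v , F) → begin
                    y (v , F)                               ≈⟨ solve 2 (λ x y → x := (x :- y) :+ y) refl _ _ ⟩
                    y' (v , F) + lincomb pr Y.vec (v , F)   ≈⟨ +-congʳ (proj₂ (γ v) F) ⟩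
                    _                                       ∎ })
                  where
                    y : Fin n × Subset n → Carrier
                    y = Summable.unit S² (pos j)
                    pr : Fin bb' → Carrier
                    pr k = pair S² y (tilde (x k))
                    y' : Fin n × Subset n → Carrier
                    y' a = y a - lincomb pr Y.vec a

                    chain-y' : ∀ v → Ch (L v) (2 ℕ.+ s) (At y' v)
                    chain-y' v F q = +-0
                      (Summable.unit-off S² (pos j) (v , F) (λ { ≡.refl → true≢false (proj₂ (proj₂ (Inverse.from sz j))) q }))
                      (neg-0 (Σ-0 (λ k → *-0ʳ (Y.support k (v , F) (λ l → ch-i {Δ} v (relB-chain (xS l) v) F q)))))

                    ann : ∀ l → pair S² y' (tilde (x l)) ≈ 0#
                    ann l = begin
                      pair S² y' (tilde (x l))
                        ≈⟨ sub (pairF S² (tilde (x l))) y (lincomb pr Y.vec) ⟩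
                      pr l - pair S² (lincomb pr Y.vec) (tilde (x l))
                        ≈⟨ +-congˡ (-‿cong (trans (Func.sum (pairF S² (tilde (x l))) pr Y.vec)
                             (trans (Σ-cong (λ k → *-congˡ (Y.dual k l))) (Σ-δʳ l pr)))) ⟩
                      pr l - pr l
                        ≈⟨ -‿inverseʳ _ ⟩
                      0# ∎

                    closed-y' : ∀ v F → Bd (At y' v) F ≈ 0#
                    closed-y' v = annihilator-cycle {1 ℕ.+ s} v (chain-y' v) λ ψ relψ → stable (sp (X v ψ) (X-rel v ψ relψ) >>= λ { (γ , eγ) → return (begin
                      ⟨ At y' v , i v (dψ ψ) ⟩
                        ≈⟨ Σ-δ v (λ v' → ⟨ At y' v' , i v' (dψ ψ) ⟩) ⟨
                      ∑ (λ v' → δ v v' * ⟨ At y' v' , i v' (dψ ψ) ⟩)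
                        ≈⟨ Σ-cong (λ v' → trans (sym (Func.mul (sumSubF {n}) _ _)) (Func.cong (sumSubF {n}) (λ F →
                             trans (solve 3 (λ d a b → d :* (a :* b) := a :* (d :* b)) refl _ _ _) (*-congˡ (sym (Func.mul (iF v' F) _ _)))))) ⟩
                      pair S² y' (tilde (X v ψ))
                        ≈⟨ Summable.pair-cong S² {y'} {y'} (λ _ → refl) (λ { (v' , F) → trans (Func.cong (iF v' F) (λ G → eγ (v' , G)))
                             (Func.sum (iF v' F) γ (λ l → At (x l) v')) }) ⟩
                      pair S² y' (lincomb γ (λ l → tilde (x l)))
                        ≈⟨ Func.cong (Summable.total S²) (λ a → *-comm _ _) ⟩
                      fn (pairF S² y') (lincomb γ (λ l → tilde (x l)))
                        ≈⟨ Func.sum (pairF S² y') γ (λ l → tilde (x l)) ⟩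
                      ∑ (λ l → γ l * fn (pairF S² y') (tilde (x l)))
                        ≈⟨ Σ-0 (λ l → *-0ʳ (trans (Func.cong (Summable.total S²) (λ a → *-comm _ _)) (ann l))) ⟩
                      0# ∎) })
                      where
                        dψ : (Subset n → Carrier) → Subset n → Carrier
                        dψ ψ = WithField.δ 𝔽 Δ (2 ℕ.+ s) ψ
                        X : Fin n → (Subset n → Carrier) → Fin n × Subset n → Carrier
                        X v ψ (v' , G) = δ v v' * dψ ψ G
                        X-rel : ∀ v ψ → WithField.RelCochain 𝔽 Δ v (2 ℕ.+ s) ψ → RelBoundaries (X v ψ)
                        X-rel v ψ rel v' = go (v Fin.≟ v')
                          where
                            go : Dec (v ≡ v') → WithField.RelCoboundary 𝔽 Δ v' (3 ℕ.+ s) (At (X v ψ) v')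
                            go (yes ≡.refl) = ψ , rel , λ G → trans (*-congʳ (reflexive (δ-≡ v))) (*-identityˡ _)
                            go (no ne) = zeroV , ((λ _ _ → refl) , (λ _ _ → refl)) ,
                              λ G → trans (*-0ˡ (reflexive (δ-≢ ne))) (sym (δ-zero (2 ℕ.+ s) G))

    -- The linear system and the triviality of its solutions

    module System where

      open Geometry
      open Simplicial
      open Pairing
      open Stress hiding (N; r)

      -- The products of two coordinate functionals, the first index below the second: a basis of
      -- the alternating forms, dual to evaluation at pairs of unit vectors.
      plucker : ∀ {N} → Fin (pairs N) → Alt N
      plucker {N} τ = wedge (ev (lo (Inverse.from (size-pairs N) τ))) (ev (hi (Inverse.from (size-pairs N) τ)))

      plucker-dual : ∀ {N} (τ σ : Fin (pairs N)) →
        app (plucker {N} τ) (δ (lo (Inverse.from (size-pairs N) σ))) (δ (hi (Inverse.from (size-pairs N) σ))) ≈ δ τ σ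
      plucker-dual {N} τ σ = trans (+-congˡ cross) (trans (+-identityʳ _) diag)
        where
          s = Inverse.from (size-pairs N) σ
          t = Inverse.from (size-pairs N) τ
          cross : - δ (hi s) (lo t) * δ (lo s) (hi t) ≈ 0#
          cross = by-cases (hi s ≡ lo t)
            (λ e → *-0ʳ (reflexive (δ-≢ (λ f → ℕ.<-asym (≡.subst (λ k → lo s Fin.< k) e (lo<hi s))
              (≡.subst (λ k → lo t Fin.< k) (≡.sym f) (lo<hi t))))))
            (λ ne → *-0ˡ (neg-0 (reflexive (δ-≢ ne))))
          diag : δ (lo s) (lo t) * δ (hi s) (hi t) ≈ δ τ σ
          diag = by-cases (τ ≡ σ)
            (λ { ≡.refl → trans (*-cong (reflexive (δ-≡ (lo t))) (reflexive (δ-≡ (hi t)))) (trans (*-identityˡ _) (reflexive (≡.sym (δ-≡ τ)))) })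
            (λ ne → trans (by-cases (lo s ≡ lo t)
                (λ e → *-0ʳ (reflexive (δ-≢ (λ f → ne (≡.sym (from-inj (lo-hi-inj s t e f)))))))
                (λ nl → *-0ˡ (reflexive (δ-≢ nl))))
              (reflexive (≡.sym (δ-≢ ne))))
            where
              from-inj : s ≡ t → σ ≡ τ
              from-inj q = ≡.trans (≡.sym (Inverse.strictlyInverseˡ (size-pairs N) σ))
                (≡.trans (≡.cong (Inverse.to (size-pairs N)) q) (Inverse.strictlyInverseˡ (size-pairs N) τ))

      -- The one point at which the cases d ≥ 5 and d = 4 part; the count below is common to both.
      StressVanishes : Cx n → (d' : ℕ) → Pts (2 ℕ.+ n) (5 ℕ.+ d') → Set (c ⊔ ℓ)
      StressVanishes Δ d' p = ∀ {K} (base : Fin K → Alt (5 ℕ.+ d')) (cc : Fin K → Subset n → Carrier) →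
        (∀ τ → Cycle Δ (3 ℕ.+ d') (cc τ)) →
        (∀ v F y → lookup F v ≡ true → app (ΣA (λ τ → cc τ F *A base τ)) (p (ι v)) y ≈ 0#) →
        ∀ x y F → app (ΣA (λ τ → cc τ F *A base τ)) x y ≈ 0#

      -- The kernel of Σ ι* enters through `xW`, whose components are relative cocycles, and through
      -- `cobound`, the consequence of homological isolation.
      module Main {Δ : Cx n} {d' : ℕ} (M : Mfd Δ d') {sp} (gen : Generic M sp)
        (vanish : StressVanishes Δ d' (Generic.p gen))
        {z w : ℕ} {bv lb : Fin n → ℕ}
        (bz : Basis (WithField.Cycles 𝔽 Δ (3 ℕ.+ d')) z)
        (bB : ∀ v → Basis (WithField.Boundaries 𝔽 (link Δ ⁅ v ⁆) (2 ℕ.+ d')) (bv v))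
        (bT : ∀ v → Basis (WithField.Cycles 𝔽 (link Δ ⁅ v ⁆) (3 ℕ.+ d')) (lb v))
        (xW : Fin w → Fin n × Subset n → Carrier) (liW : LinIndep xW)
        (cocycle : ∀ k v → WithField.RelCocycle 𝔽 Δ v (3 ℕ.+ d') (λ G → xW k (v , G)))
        (cobound : ∀ k v → DN (WithField.Coboundary 𝔽 Δ (3 ℕ.+ d') (λ G → xW k (v , G)))) where

        open Mfd M
        open Generic gen
        open Count Δ down

        N D K : ℕ
        N = 5 ℕ.+ d'
        D = 4 ℕ.+ d'
        K = pairs N

        L : Fin n → Cx n
        L v = link Δ ⁅ v ⁆

        dL : ∀ v → Down (L v)
        dL v = down-link {Γ = Δ} v down

        base : Fin K → Alt N
        base = plucker {N}

        Z : Fin z → Subset n → Carrier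
        Z = proj₁ bz

        β : ∀ v → Fin (bv v) → Subset n → Carrier
        β v = proj₁ (bB v)

        ψ : ∀ v → Fin (bv v) → Subset n → Carrier
        ψ v k = proj₁ (proj₁ (proj₂ (bB v)) k)

        ch-ψ : ∀ v k → Ch (L v) (3 ℕ.+ d') (ψ v k)
        ch-ψ v k = proj₁ (proj₂ (proj₁ (proj₂ (bB v)) k))

        Bd-ψ : ∀ v k F → Bd (ψ v k) F ≈ β v k F
        Bd-ψ v k F = sym (trans (proj₂ (proj₂ (proj₁ (proj₂ (bB v)) k)) F) (∂-Bd {L v} (dL v) (ch-ψ v k) F))

        X : ∀ v → Fin (lb v) → Subset n → Carrier
        X v = proj₁ (bT v)

        cyc-X : ∀ v k → Cycle (L v) (3 ℕ.+ d') (X v k)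
        cyc-X v k = cycles⇒ {L v} (dL v) (proj₁ (proj₂ (bT v)) k)

        cyc-Z : ∀ k → Cycle Δ (3 ℕ.+ d') (Z k)
        cyc-Z k = cycles⇒ {Δ} down (proj₁ (proj₂ bz) k)

        supW : ∀ k → Supported (xW k)
        supW k v G q = proj₂ (proj₁ (cocycle k v)) G q

        chW : ∀ k v → Ch Δ (3 ℕ.+ d') (At (xW k) v)
        chW k v = proj₁ (proj₁ (cocycle k v))

        -- In this order: the coefficients of the form-valued (d-2)-cycle c; those of
        -- the chains μ in the vertex links, as preimages of boundaries and as top
        -- cycles; and the multipliers θ of vectors dual to the basis of the kernel.
        Unknown : Set
        Unknown = (Fin z × Fin K) ⊎ ((Σ (Fin n) (λ v → Fin (bv v)) × Fin D) ⊎ ((Σ (Fin n) (λ v → Fin (lb v)) × Fin D) ⊎ (Fin w × Fin D)))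

        Ridge : Set
        Ridge = Σ (Fin n) (λ v → FaceT (L v) (2 ℕ.+ d'))

        -- In this order: Bd μ + i c + Σ θ Y = 0 in each vertex link; compatibility of
        -- the chains of u and v on one facet of the link of each edge uv; and
        -- half of the components of m on each facet.
        Equation : Set
        Equation = (Ridge × Fin D) ⊎ (FaceT Δ 2 ⊎ (FaceT Δ D × Fin K))

        pattern uZ k τ = inj₁ (k , τ)
        pattern uB v k j = inj₂ (inj₁ ((v , k) , j))
        pattern uX v k j = inj₂ (inj₂ (inj₁ ((v , k) , j)))
        pattern uθ k j = inj₂ (inj₂ (inj₂ (k , j)))

        pt : Fin n → V N
        pt v = p (ι v)

        -- The ratio for which `κF v j`, coordinate j + 1 minus q times coordinate 0, kills p_v.
        -- These d functionals form a basis of the annihilator of p_v, so m_v is given by d scalar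
        -- chains μ.
        q : Fin n → Fin D → Carrier
        q v j = pt v (suc j) * inv _ (first v)

        κF : Fin n → Fin D → Func (Fin N)
        κF v j = ev (suc j) +F (- q v j) *F ev zero

        cF : Fin K → Subset n → Func Unknown
        cF τ F = ΣF (λ k → ev (uZ k τ) Fʳ* Z k F)

        AF : V N → V N → Subset n → Func Unknown
        AF x y F = ΣF (λ τ → cF τ F Fʳ* app (base τ) x y)

        βF : Fin n → Fin D → Subset n → Func Unknown
        βF v j F = ΣF (λ k → ev (uB v k j) Fʳ* β v k F)

        μF : Fin n → Fin D → Subset n → Func Unknown
        μF v j F = ΣF (λ k → ev (uB v k j) Fʳ* ψ v k F) +F ΣF (λ k → ev (uX v k j) Fʳ* X v k F)

        mF : Fin n → V N → Subset n → Func Unknown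
        mF v y F = ΣF (λ j → μF v j F Fʳ* fn (κF v j) y)

        -- The link of an edge is a homology sphere with one-dimensional top homology, so a top
        -- cycle is zero once it vanishes at a single face H of the fundamental cycle. This makes
        -- one equation per edge enough.
        record EdgeData (E : FaceT Δ 2) : Set (c ⊔ ℓ) where
          field
            u v      : Fin n
            spans    : proj₁ E ≡ ins u (ins v Sub.⊥)
            H        : Subset n
            faithful : ∀ x → Cycle (lk Δ (u ∷ v ∷ [])) (2 ℕ.+ d') x → x H ≈ 0# → ∀ F → x F ≈ 0#

        edgeData : ∀ E → DN (EdgeData E)
        edgeData (E , fE) =
          let (f , sz) = face-of {Γ = Δ} fE
              (u , uE) = member E sz
              sz₁ = ℕ.suc-injective (≡.trans (≡.sym (size-del u E uE)) sz)
              (v , vE) = member (del u E) sz₁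
              empty = size-0 (del v (del u E)) (ℕ.suc-injective (≡.trans (≡.sym (size-del v (del u E) vE)) sz₁))
              spans : E ≡ ins u (ins v Sub.⊥)
              spans = ≡.trans (≡.sym (ins-del u E uE)) (≡.cong (ins u) (≡.trans (≡.sym (ins-del v (del u E) vE)) (≡.cong (ins v) empty)))
              v≢u : v ≢ u
              v≢u = λ q → true≢false (≡.subst (λ a → lookup (del u E) a ≡ true) q vE) (del-≡ u E)
              face : Face Δ (u ∷ v ∷ [])
              face = link-intro {Γ = L v} {u} {Sub.⊥} (lookup-⊥ u) (link-intro {Γ = Δ} {v} {ins u Sub.⊥}
                (≡.trans (ins-≢ Sub.⊥ v≢u) (lookup-⊥ v))
                (≡.subst (λ G → Δ G ≡ true) (≡.trans spans (ins-comm u v Sub.⊥)) f))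
              (ζ , cy , nz , uniq) = top-of M (u ∷ v ∷ []) ≡.refl (sph (u ∷ v ∷ []) ℕ.≤-refl face)
          in find≉0 nz >>= λ { (H , nH) → return (record { u = u ; v = v ; spans = spans ; H = H
               ; faithful = λ x cx xH F → stable (uniq x cx >>= λ { (t , e) → return (trans (e F) (*-0ˡ (cancel nH (trans (*-comm _ _) (trans (sym (e H)) xH))))) }) }) }

        module WithData (ed : ∀ E → EdgeData E) (Yd : Dual S² (λ k → tilde (xW k))) where

          Y = Dual.vec Yd

          rF : Fin n → Fin n → Subset n → Func Unknown
          rF u v H = (iF u H ∘F mF v (pt u)) +F (- 1#) *F (iF v H ∘F mF u (pt v))

          enum : (G : FaceT Δ D) → Enumeration (proj₁ G) D
          enum (G , f) = enumerate D G (proj₂ (face-of {Γ = Δ} f))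

          -- A basis of W: an auxiliary point, put first, and the d vertices of the facet.
          frame : (G : FaceT Δ D) → Fin N → V N
          frame G zero    = p zero
          frame G (suc k) = pt (Enumeration.vertex (enum G) k)

          -- Imposed for l < k only: m at a vertex of G vanishes on the frame vectors that precede
          -- it. This gives binomial(d+1, 2) equations, the later vectors being left to the edge
          -- equations. The zero clause is a default, since the larger index of a pair is never
          -- zero.
          facetF : (G : FaceT Δ D) → Fin N → Fin N → Func Unknown
          facetF G l zero    = 0F
          facetF G l (suc k) = mF v (frame G l) (del v (proj₁ G))
            where v = Enumeration.vertex (enum G) k

          eqF : Equation → Func Unknown
          eqF (inj₁ ((v , F , _) , j)) = βF v j F +F (iF v F ∘F AF (pt v) (δ (suc j)) +F ΣF (λ k → ev (uθ k j) Fʳ* Y k (v , F)))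
          eqF (inj₂ (inj₁ E)) = rF (EdgeData.u (ed E)) (EdgeData.v (ed E)) (EdgeData.H (ed E))
          eqF (inj₂ (inj₂ (G , τ))) = facetF G (lo (Inverse.from (size-pairs N) τ)) (hi (Inverse.from (size-pairs N) τ))

          module Solution (x : Unknown → Carrier) (sol : ∀ e → fn (eqF e) x ≈ 0#) where

            cc : Fin K → Subset n → Carrier
            cc τ F = fn (cF τ F) x

            A : V N → V N → Subset n → Carrier
            A a b F = fn (AF a b F) x

            form : Subset n → Alt N
            form F = ΣA (λ τ → cc τ F *A base τ)

            bnd : Fin n → Fin D → Subset n → Carrier
            bnd v j F = fn (βF v j F) x

            μ : Fin n → Fin D → Subset n → Carrier
            μ v j F = fn (μF v j F) x

            m : Fin n → V N → Subset n → Carrier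
            m v y F = fn (mF v y F) x

            lin-cycle : ∀ {k} {Γ : Cx n} {s} (γ : Fin k → Carrier) (f : Fin k → Subset n → Carrier) →
              (∀ i → Cycle Γ s (f i)) → Cycle Γ s (lincomb γ f)
            lin-cycle γ f h = mkCycle (λ F r → Σ-0 (λ i → *-0ʳ (Cycle.chain (h i) F r)))
              (λ F → trans (Func.sum (BdF F) γ f) (Σ-0 (λ i → *-0ʳ (Cycle.closed (h i) F))))

            cyc-cc : ∀ τ → Cycle Δ (3 ℕ.+ d') (cc τ)
            cyc-cc τ = lin-cycle (λ k → x (uZ k τ)) Z cyc-Z

            flip-lin : ∀ {k} (γ : Fin k → Carrier) (f : Fin k → Subset n → Carrier) (g : Func (Subset n)) →
              fn g (λ F → ∑ (λ i → f i F * γ i)) ≈ ∑ (λ i → fn g (f i) * γ i)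
            flip-lin γ f g = trans (Func.cong g (λ F → Σ-cong (λ i → *-comm _ _))) (trans (Func.sum g γ f) (Σ-cong (λ i → *-comm _ _)))

            cyc-A : ∀ a b → Cycle Δ (3 ℕ.+ d') (A a b)
            cyc-A a b = mkCycle (λ F r → Σ-0 (λ τ → *-0ˡ (Cycle.chain (cyc-cc τ) F r)))
              (λ F → trans (flip-lin _ cc (BdF F)) (Σ-0 (λ τ → *-0ˡ (Cycle.closed (cyc-cc τ) F))))

            ch-μ : ∀ v j → Ch (L v) (3 ℕ.+ d') (μ v j)
            ch-μ v j F r = +-0 (Σ-0 (λ k → *-0ʳ (ch-ψ v k F r))) (Σ-0 (λ k → *-0ʳ (Cycle.chain (cyc-X v k) F r)))

            Bd-μ : ∀ v j F → Bd (μ v j) F ≈ bnd v j F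
            Bd-μ v j F = trans (Func.add (BdF F) _ _) (trans (+-cong
              (trans (Func.sum (BdF F) (λ k → x (uB v k j)) (ψ v)) (Σ-cong (λ k → *-congˡ (Bd-ψ v k F))))
              (trans (Func.sum (BdF F) (λ k → x (uX v k j)) (X v)) (Σ-0 (λ k → *-0ʳ (Cycle.closed (cyc-X v k) F)))))
              (+-identityʳ _))

            ch-m : ∀ v y → Ch (L v) (3 ℕ.+ d') (m v y)
            ch-m v y F r = Σ-0 (λ j → *-0ˡ (ch-μ v j F r))

            c-at : Fin D → Fin n → Subset n → Carrier
            c-at j v = A (pt v) (δ (suc j))

            row : Fin D → Fin n × Subset n → Carrier
            row j (v , F) = bnd v j F + (i v (c-at j v) F + ∑ (λ k → x (uθ k j) * Y k (v , F)))

            -- Equations are imposed at ridges only. Elsewhere each term is zero as a chain of the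
            -- link, for Y by the field `support`.
            row-0 : ∀ j a → row j a ≈ 0#
            row-0 j (v , F) = bool-case (faceOfSize (L v) (2 ℕ.+ d') F)
              (λ f → sol (inj₁ ((v , F , f) , j)))
              (λ r → +-0 (trans (sym (Bd-μ v j F)) (ch-Bd {L v} (dL v) (ch-μ v j) F r))
                (+-0 (ch-i {Δ} v (Cycle.chain (cyc-A (pt v) (δ (suc j)))) F r)
                  (Σ-0 (λ k → *-0ʳ (Dual.support Yd k (v , F) (λ l → ch-i {Δ} v (chW l v) F r))))))

            pair-bnd : ∀ k v j → ⟨ bnd v j , i v (At (xW k) v) ⟩ ≈ 0#
            pair-bnd k v j = begin
              ⟨ bnd v j , i v x' ⟩              ≈⟨ Func.cong (sumSubF {n}) (λ F → *-congʳ (as-link F)) ⟩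
              ⟨ (λ F → - i v (Bd α̃) F) , i v x' ⟩ ≈⟨ trans (Func.cong (sumSubF {n}) (λ F → sym (-‿distribˡ-* _ _))) (fn-neg (sumSubF {n}) _) ⟩
              - ⟨ i v (Bd α̃) , i v x' ⟩         ≈⟨ -‿cong (link-pair v (Bd α̃) x' (λ G → supW k v G)) ⟩
              - ⟨ Bd α̃ , x' ⟩                   ≈⟨ -‿cong (pair-δ {Δ} (ch-e {Δ} v (ch-μ v j))) ⟨
              - ⟨ α̃ , WithField.δ 𝔽 Δ (3 ℕ.+ d') x' ⟩ ≈⟨ neg-0 (Summable.pair-0 (summable-Subset n) {α̃} (λ G → *-0ʳ (proj₂ (cocycle k v) G))) ⟩
              0#                                ∎
              where
                x' = At (xW k) v
                α̃ = e v (μ v j)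
                as-link : ∀ F → bnd v j F ≈ - i v (Bd α̃) F
                as-link F = trans (sym (Bd-μ v j F)) (trans (Func.cong (BdF F) (λ G → sym (i-e v (μ v j) (ch-off {Δ} (ch-μ v j)) G))) (Bd-i v α̃ F))

            -- Homological isolation at work: each component of a kernel element is a coboundary of
            -- Δ, and c evaluated at p_v is a cycle of Δ.
            pair-c : ∀ k v j → ⟨ i v (c-at j v) , i v (At (xW k) v) ⟩ ≈ 0#
            pair-c k v j = stable (cobound k v >>= λ { (φ , _ , eφ) → return (begin
              ⟨ i v (c-at j v) , i v (At (xW k) v) ⟩    ≈⟨ link-pair v (c-at j v) (At (xW k) v) (supW k v) ⟩
              ⟨ c-at j v , At (xW k) v ⟩                ≈⟨ Func.cong (sumSubF {n}) (λ G → *-congˡ (eφ G)) ⟩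
              ⟨ c-at j v , WithField.δ 𝔽 Δ (2 ℕ.+ d') φ ⟩ ≈⟨ pair-δ {Δ} (Cycle.chain (cyc-A (pt v) (δ (suc j)))) ⟩
              ⟨ Bd (c-at j v) , φ ⟩                     ≈⟨ Summable.pair-0 (summable-Subset n) {Bd (c-at j v)} (λ G → *-0ˡ (Cycle.closed (cyc-A (pt v) (δ (suc j))) G)) ⟩
              0#                                        ∎) })

            -- Pairing the boundary equations with the kernel element k removes the boundary of μ
            -- and the term in c, and by duality leaves exactly this multiplier.
            θ-0 : ∀ k j → x (uθ k j) ≈ 0#
            θ-0 k j = begin
              x (uθ k j)
                ≈⟨ solve 1 (λ t → t := :0 :+ (:0 :+ t)) refl _ ⟩
              0# + (0# + x (uθ k j))
                ≈⟨ +-cong (sym (Σ-0 (λ v → pair-bnd k v j))) (+-cong (sym (Σ-0 (λ v → pair-c k v j)))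
                     (sym (trans (Σ-cong (λ l → *-congˡ (Dual.dual Yd l k))) (Σ-δʳ k (λ l → x (uθ l j)))))) ⟩
              pair S² (λ a → bnd (proj₁ a) j (proj₂ a)) T
                + (pair S² (λ a → i (proj₁ a) (c-at j (proj₁ a)) (proj₂ a)) T + ∑ (λ l → x (uθ l j) * pair S² (Y l) T))
                ≈⟨ +-congˡ (+-congˡ (sym (Func.sum (pairF S² T) (λ l → x (uθ l j)) Y))) ⟩
              pair S² (λ a → bnd (proj₁ a) j (proj₂ a)) T
                + (pair S² (λ a → i (proj₁ a) (c-at j (proj₁ a)) (proj₂ a)) T + pair S² (lincomb (λ l → x (uθ l j)) Y) T)
                ≈⟨ trans (Func.add (pairF S² T) _ _) (+-congˡ (Func.add (pairF S² T) _ _)) ⟨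
              pair S² (row j) T
                ≈⟨ Func.zer (pairF S² T) (row-0 j) ⟩
              0# ∎
              where T = tilde (xW k)

            Bd-μ-c : ∀ v j F → Bd (μ v j) F ≈ - i v (c-at j v) F
            Bd-μ-c v j F = begin
              Bd (μ v j) F
                ≈⟨ Bd-μ v j F ⟩
              bnd v j F
                ≈⟨ solve 3 (λ a b t → a := (a :+ (b :+ t)) :- t :- b) refl _ (i v (c-at j v) F) (∑ (λ k → x (uθ k j) * Y k (v , F))) ⟩
              row j (v , F) - ∑ (λ k → x (uθ k j) * Y k (v , F)) - i v (c-at j v) F
                ≈⟨ +-congʳ (+-0 (row-0 j (v , F)) (neg-0 (Σ-0 (λ k → *-0ˡ (θ-0 k j))))) ⟩
              0# - i v (c-at j v) F
                ≈⟨ +-identityˡ _ ⟩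
              - i v (c-at j v) F ∎

            -- Write y as Σ κ_j(y) e_(j+1) plus a multiple of p_v; the last term does not contribute
            -- as B is alternating.
            expand : ∀ v (B : Alt N) y → app B (pt v) y ≈ ∑ (λ j → app B (pt v) (δ (suc j)) * fn (κF v j) y)
            expand v B y = begin
              app B (pt v) y
                ≈⟨ Func.cong (appF B (pt v)) coordinates ⟩
              app B (pt v) (λ i → lincomb (λ j → fn (κF v j) y) (λ j → δ (suc j)) i + y zero * inv _ (first v) * pt v i)
                ≈⟨ Func.add (appF B (pt v)) _ _ ⟩
              app B (pt v) (lincomb (λ j → fn (κF v j) y) (λ j → δ (suc j))) + app B (pt v) (λ i → y zero * inv _ (first v) * pt v i)
                ≈⟨ +-cong (Func.sum (appF B (pt v)) _ _) (trans (Func.mul (appF B (pt v)) _ _) (*-0ʳ (Alt.alt B (pt v)))) ⟩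
              ∑ (λ j → fn (κF v j) y * app B (pt v) (δ (suc j))) + 0#
                ≈⟨ trans (+-identityʳ _) (Σ-cong (λ j → *-comm _ _)) ⟩
              ∑ (λ j → app B (pt v) (δ (suc j)) * fn (κF v j) y) ∎
              where
                coordinates : ∀ i → y i ≈ lincomb (λ j → fn (κF v j) y) (λ j → δ (suc j)) i + y zero * inv _ (first v) * pt v i
                coordinates zero = sym (trans (+-cong (Σ-0 (λ j → *-0ʳ (reflexive (δ-≢ {i = suc j} {zero} (λ ())))))
                    (trans (*-assoc _ _ _) (*-congˡ (trans (*-comm _ _) (inv-r (first v)))))) (trans (+-identityˡ _) (*-identityʳ _)))
                coordinates (suc k) = sym (trans (+-congʳ (trans (Σ-cong (λ j → *-congˡ (reflexive (δ-inj suc (λ _ _ → Fin.suc-injective) j k)))) (Σ-δʳ k (λ j → fn (κF v j) y))))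
                  (solve 4 (λ a p i y → (a :+ :- (p :* i) :* y) :+ y :* i :* p := a) refl _ _ _ _))

            Bd-m : ∀ v y F → Bd (m v y) F ≈ - i v (A (pt v) y) F
            Bd-m v y F = begin
              Bd (m v y) F
                ≈⟨ flip-lin _ (μ v) (BdF F) ⟩
              ∑ (λ j → Bd (μ v j) F * fn (κF v j) y)
                ≈⟨ Σ-cong (λ j → trans (*-congʳ (Bd-μ-c v j F)) (sym (-‿distribˡ-* _ _))) ⟩
              ∑ (λ j → - (i v (c-at j v) F * fn (κF v j) y))
                ≈⟨ Σ-neg _ ⟩
              - ∑ (λ j → i v (c-at j v) F * fn (κF v j) y)
                ≈⟨ -‿cong (flip-lin _ (λ j → c-at j v) (iF v F)) ⟨
              - i v (λ G → ∑ (λ j → c-at j v G * fn (κF v j) y)) F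
                ≈⟨ -‿cong (Func.cong (iF v F) (λ G → sym (expand v (form G) y))) ⟩
              - i v (A (pt v) y) F ∎

            m-self : ∀ v F → m v (pt v) F ≈ 0#
            m-self v F = Σ-0 (λ j → *-0ʳ (begin
              pt v (suc j) + - q v j * pt v zero
                ≈⟨ solve 3 (λ a i p → a :+ :- (a :* i) :* p := a :- a :* (p :* i)) refl _ _ _ ⟩
              pt v (suc j) - pt v (suc j) * (pt v zero * inv _ (first v))
                ≈⟨ +-congˡ (-‿cong (*-congˡ (inv-r (first v)))) ⟩
              pt v (suc j) - pt v (suc j) * 1#
                ≈⟨ solve 1 (λ a → a :- a :* :1 := :0) refl _ ⟩
              0# ∎))

            r : Fin n → Fin n → Subset n → Carrier
            r u v H = fn (rF u v H) x

            r-swap : ∀ u v H → r u v H ≈ - r v u H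
            r-swap u v H = solve 2 (λ a b → a :+ :- :1 :* b := :- (b :+ :- :1 :* a)) refl _ _

            Bd-im : ∀ u v y F → Bd (i u (m v y)) F ≈ i u (i v (A (pt v) y)) F
            Bd-im u v y F = trans (Bd-i u (m v y) F) (trans (-‿cong (trans (Func.cong (iF u F) (Bd-m v y)) (fn-neg (iF u F) _))) (-‿involutive _))

            -- Both halves of the discrepancy have boundary the contraction of c(p_v, p_u) with v
            -- and u: the sign from exchanging contractions cancels the one from exchanging
            -- arguments.
            r-cycle : ∀ u v → Cycle (lk Δ (u ∷ v ∷ [])) (2 ℕ.+ d') (r u v)
            r-cycle u v = mkCycle
              (λ F f → +-0 (ch-i {L v} u (ch-m v (pt u)) F f)
                (*-0ʳ (ch-same {lk Δ (v ∷ u ∷ [])} {lk Δ (u ∷ v ∷ [])} (λ G → link-swap Δ u v G) (ch-i {L u} v (ch-m u (pt v))) F f)))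
              (λ F → begin
                Bd (r u v) F
                  ≈⟨ trans (Func.add (BdF F) _ _) (+-congˡ (Func.mul (BdF F) _ _)) ⟩
                Bd (i u (m v (pt u))) F + - 1# * Bd (i v (m u (pt v))) F
                  ≈⟨ +-cong (Bd-im u v (pt u) F) (*-congˡ (trans (Bd-im v u (pt v) F) (swapped F))) ⟩
                i u (i v (A (pt v) (pt u))) F + - 1# * i u (i v (A (pt v) (pt u))) F
                  ≈⟨ solve 1 (λ a → a :+ :- :1 :* a := :0) refl _ ⟩
                0# ∎)
              where
                swapped : ∀ F → i v (i u (A (pt u) (pt v))) F ≈ i u (i v (A (pt v) (pt u))) F
                swapped F = begin
                  i v (i u (A (pt u) (pt v))) F
                    ≈⟨ ii-anti v u (A (pt u) (pt v)) F ⟩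
                  - i u (i v (A (pt u) (pt v))) F
                    ≈⟨ -‿cong (Func.cong (iF u F) (λ G → trans (Func.cong (iF v G) (λ H → Alt.anti (form H) (pt u) (pt v))) (fn-neg (iF v G) _))) ⟩
                  - i u (λ G → - i v (A (pt v) (pt u)) G) F
                    ≈⟨ trans (-‿cong (fn-neg (iF u F) _)) (-‿involutive _) ⟩
                  i u (i v (A (pt v) (pt u))) F ∎

            r-chosen : ∀ E F → r (EdgeData.u (ed E)) (EdgeData.v (ed E)) F ≈ 0#
            r-chosen E F = EdgeData.faithful (ed E) _ (r-cycle _ _) (sol (inj₂ (inj₁ E))) F

            -- `EdgeData` fixes one order of the two ends; the other order differs by a sign.
            r-zero : ∀ u v → Face Δ (u ∷ v ∷ []) → ∀ F → r u v F ≈ 0#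
            r-zero u v f F = go (E.u Fin.≟ u) (E.v Fin.≟ v) (E.u Fin.≟ v) (E.v Fin.≟ u)
              where
                fv = link-face {Γ = L v} {u} {Sub.⊥} f
                fu = link-face {Γ = Δ} {v} {ins u Sub.⊥} (proj₂ fv)
                u≢v : u ≢ v
                u≢v ≡.refl = true≢false (ins-≡ v Sub.⊥) (proj₁ fu)
                E₀ = ins v (ins u Sub.⊥)
                E : FaceT Δ 2
                E = E₀ , face-intro {Γ = Δ} (proj₂ fu) (≡.trans (size-ins v (ins u Sub.⊥) (proj₁ fu)) (≡.cong suc (≡.trans (size-ins u Sub.⊥ (lookup-⊥ u)) (≡.cong suc (size-⊥ {n})))))
                module E = EdgeData (ed E)
                u' : lookup E₀ E.u ≡ true
                u' = ≡.trans (≡.cong (λ G → lookup G E.u) E.spans) (ins-≡ E.u (ins E.v Sub.⊥))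
                v' : lookup E₀ E.v ≡ true
                v' = ≡.trans (≡.cong (λ G → lookup G E.v) E.spans) (ins-mono E.u (ins E.v Sub.⊥) (ins-≡ E.v Sub.⊥))
                both : ∀ {a} → E.u ≡ a → E.v ≡ a → ∀ b → lookup E₀ b ≡ true → b ≡ a
                both p q b lb = [ (λ e → ≡.trans e q) , (λ e → ≡.trans e p) ]′
                  (ins-pair E.v E.u (≡.trans (≡.cong (λ G → lookup G b) (≡.sym E.spans)) lb))
                inU : lookup E₀ u ≡ true
                inU = ins-mono v (ins u Sub.⊥) (ins-≡ u Sub.⊥)
                inV : lookup E₀ v ≡ true
                inV = ins-≡ v (ins u Sub.⊥)
                go : Dec (E.u ≡ u) → Dec (E.v ≡ v) → Dec (E.u ≡ v) → Dec (E.v ≡ u) → r u v F ≈ 0#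
                go (yes e) (yes e') _ _ = ≡.subst₂ (λ a b → r a b F ≈ 0#) e e' (r-chosen E F)
                go _ _ (yes e) (yes e') = trans (r-swap u v F) (neg-0 (≡.subst₂ (λ a b → r a b F ≈ 0#) e e' (r-chosen E F)))
                go (no nu) _ (no nv) _ = ⊥-elim ([ nu , nv ]′ (ins-pair u v u'))
                go _ (no nv) _ (no nu) = ⊥-elim ([ nu , nv ]′ (ins-pair u v v'))
                go (yes e) _ _ (yes e') = ⊥-elim (u≢v (≡.sym (both e e' v inV)))
                go _ (yes e) (yes e') _ = ⊥-elim (u≢v (both e' e u inU))

            mYF : Fin n → Subset n → Func (Fin N)
            mYF v F = ΣF (λ j → μ v j F *F κF v j)

            -- On the facet F ∪ v the functional m_v(F) vanishes on the whole frame: before v by the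
            -- facet equations, at v by `m-self`, and after v through the edge equations.
            m-zero : ∀ v y F → m v y F ≈ 0#
            m-zero v y F = stable λ nz →
              let (fF , sF) = ch-face {L v} (ch-m v y) nz
                  (vF , fG) = link-face {Γ = Δ} {v} {F} fF
                  G : FaceT Δ D
                  G = ins v F , face-intro {Γ = Δ} fG (≡.trans (size-ins v F vF) (≡.cong suc sF))
                  module En = Enumeration (enum G)
                  (k , ek) = En.onto v (ins-≡ v F)
              in nz (func-zero (frame G) (frame-indep G) (mYF v F) (kills v F vF G ≡.refl k ek) y)
              where
                frame-indep : ∀ G → LinIndep (frame G)
                frame-indep G γ s = ind (tabulate (coned En.vertex)) (coned-distinct En.inj) γ (λ a → trans (Σ-cong (λ l → *-congˡ (reflexive
                    (≡.trans (≡.cong (λ b → p b a) (Vec.lookup∘tabulate (coned En.vertex) l)) (frame-idx l a))))) (s a))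
                  where
                    module En = Enumeration (enum G)
                    frame-idx : ∀ l a → p (coned En.vertex l) a ≡ frame G l a
                    frame-idx zero    a = ≡.refl
                    frame-idx (suc k) a = ≡.refl

                facet-eq : ∀ G l k → l Fin.< suc k → m (Enumeration.vertex (enum G) k) (frame G l) (del (Enumeration.vertex (enum G) k) (proj₁ G)) ≈ 0#
                facet-eq G l k lt =
                  let (τ , el , eh) = pair-of l (suc k) lt
                      back = Inverse.strictlyInverseʳ (size-pairs N) τ
                  in ≡.subst₂ (λ a b → fn (facetF G a b) x ≈ 0#) (≡.trans (≡.cong lo back) el) (≡.trans (≡.cong hi back) eh)
                       (sol (inj₂ (inj₂ (G , Inverse.to (size-pairs N) τ))))

                kills : ∀ v F → lookup F v ≡ false → (G : FaceT Δ D) → proj₁ G ≡ ins v F → ∀ k → Enumeration.vertex (enum G) k ≡ v →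
                  ∀ l → m v (frame G l) F ≈ 0#
                kills v F vF G eG k ≡.refl l with Fin.<-cmp l (suc k)
                ... | tri< lt _ _ = ≡.subst (λ H → m v (frame G l) H ≈ 0#) (≡.trans (≡.cong (del v) eG) (del-ins v F vF)) (facet-eq G l k lt)
                ... | tri≈ _ ≡.refl _ = m-self v F
                -- For a later vertex v' the edge equation trades m_v(p_v') for m_v'(p_v), up to
                -- signs; in the frame v precedes v', so that value is covered by a facet equation.
                ... | tri> _ _ gt = later l gt
                  where
                    module En = Enumeration (enum G)
                    later : ∀ l → suc k Fin.< l → m v (frame G l) F ≈ 0#
                    later (suc k') gt = cancel (sgn-≉0 (below H v')) (begin
                      sgn (below H v') * m v (pt v') F
                        ≈⟨ *-congˡ (reflexive (≡.cong (m v (pt v')) (≡.sym (ins-del v' F v'F)))) ⟩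
                      sgn (below H v') * m v (pt v') (ins v' H)
                        ≈⟨ i-out (m v (pt v')) (del-≡ v' F) ⟨
                      i v' (m v (pt v')) H
                        ≈⟨ solve 2 (λ a b → b := a :- (a :+ :- :1 :* b)) refl (i v (m v' (pt v)) H) _ ⟩
                      i v (m v' (pt v)) H - r v v' H
                        ≈⟨ +-cong (trans (i-out (m v' (pt v)) vH) (*-0ʳ (trans (reflexive (≡.cong (m v' (pt v)) (≡.sym eH))) (facet-eq G (suc k) k' gt))))
                             (neg-0 (r-zero v v' face H)) ⟩
                      0# + 0#
                        ≈⟨ +-identityˡ _ ⟩
                      0# ∎)
                      where
                        v' = En.vertex k'
                        H = del v' F
                        v'≢v : v' ≢ v
                        v'≢v e = ℕ.<-irrefl (≡.cong toℕ (≡.sym (En.inj k' k e))) (ℕ.≤-pred gt)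
                        v'F : lookup F v' ≡ true
                        v'F = ≡.trans (≡.sym (ins-≢ F v'≢v)) (≡.trans (≡.cong (λ G → lookup G v') (≡.sym eG)) (En.inside k'))
                        vH : lookup H v ≡ false
                        vH = ≡.trans (del-≢ F (λ e → v'≢v (≡.sym e))) vF
                        eH : del v' (proj₁ G) ≡ ins v H
                        eH = ≡.trans (≡.cong (del v') eG) (del-ins-swap v'≢v F)
                        faceH : lk Δ (v ∷ v' ∷ []) H ≡ true
                        faceH = link-intro {Γ = L v'} {v} {H} vH (link-intro {Γ = Δ} {v'} {ins v H}
                          (≡.trans (ins-≢ H v'≢v) (del-≡ v' F))
                          (≡.subst (λ G → Δ G ≡ true) (≡.trans eG (≡.trans (≡.cong (ins v) (≡.sym (ins-del v' F v'F))) (ins-comm v v' H))) (proj₁ (face-of {Γ = Δ} (proj₂ G)))))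
                        face : Face Δ (v ∷ v' ∷ [])
                        face = down-⊥ {Γ = lk Δ (v ∷ v' ∷ [])} (down-lk (v ∷ v' ∷ []) down) {H} faceH

            -- With m_v = 0 its boundary vanishes, and this boundary is minus the contraction of
            -- c(p_v, ·) with v.
            stress : ∀ v F y → lookup F v ≡ true → app (form F) (pt v) y ≈ 0#
            stress v F y vF = cancel (sgn-≉0 (below (del v F) v)) (begin
              sgn (below (del v F) v) * A (pt v) y F
                ≈⟨ *-congˡ (reflexive (≡.cong (A (pt v) y) (≡.sym (ins-del v F vF)))) ⟩
              sgn (below (del v F) v) * A (pt v) y (ins v (del v F))
                ≈⟨ i-out (A (pt v) y) (del-≡ v F) ⟨
              i v (A (pt v) y) (del v F)
                ≈⟨ trans (sym (-‿involutive _)) (-‿cong (sym (Bd-m v y (del v F)))) ⟩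
              - Bd (m v y) (del v F)
                ≈⟨ neg-0 (Func.zer (BdF (del v F)) (m-zero v y)) ⟩
              0# ∎)

            cc-0 : ∀ τ F → cc τ F ≈ 0#
            cc-0 τ F = begin
              cc τ F                                              ≈⟨ Σ-δʳ τ (λ σ → cc σ F) ⟨
              ∑ (λ σ → cc σ F * δ σ τ)                            ≈⟨ Σ-cong (λ σ → *-congˡ (sym (plucker-dual {N} σ τ))) ⟩
              app (form F) (δ (lo (Inverse.from (size-pairs N) τ))) (δ (hi (Inverse.from (size-pairs N) τ)))
                                                                  ≈⟨ vanish base cc cyc-cc stress (δ (lo (Inverse.from (size-pairs N) τ))) (δ (hi (Inverse.from (size-pairs N) τ))) F ⟩
              0#                                                  ∎

            μ-0 : ∀ v j F → μ v j F ≈ 0#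
            μ-0 v j F = begin
              μ v j F                                             ≈⟨ Σ-δʳ j (λ k → μ v k F) ⟨
              ∑ (λ k → μ v k F * δ k j)                           ≈⟨ Σ-cong (λ k → *-congˡ (sym (κ-δ k))) ⟩
              m v (δ (suc j)) F                                   ≈⟨ m-zero v (δ (suc j)) F ⟩
              0#                                                  ∎
              where
                κ-δ : ∀ k → fn (κF v k) (δ (suc j)) ≈ δ k j
                κ-δ k = trans (+-cong (trans (reflexive (δ-inj suc (λ _ _ → Fin.suc-injective) j k)) (δ-sym j k))
                  (*-0ʳ (reflexive (δ-≢ {i = suc j} {zero} (λ ()))))) (+-identityʳ _)
                  where
                    δ-sym : ∀ (a b : Fin D) → δ a b ≈ δ b a
                    δ-sym a b = by-cases (a ≡ b) (λ { ≡.refl → refl })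
                      (λ ne → trans (reflexive (δ-≢ ne)) (reflexive (≡.sym (δ-≢ (λ e → ne (≡.sym e))))))

            -- The chains being zero, independence of the chosen cycles and boundaries returns their
            -- coefficients; those of top cycles come last, once the preimages of boundaries are
            -- gone from μ.
            x-0 : ∀ a → x a ≈ 0#
            x-0 (uZ k τ) = proj₁ (proj₂ (proj₂ bz)) (λ k → x (uZ k τ)) (cc-0 τ) k
            x-0 (uB v k j) = uB-0 v k j
              where
                uB-0 : ∀ v k j → x (uB v k j) ≈ 0#
                uB-0 v k j = proj₁ (proj₂ (proj₂ (bB v))) (λ k → x (uB v k j)) (λ F → trans (sym (Bd-μ v j F)) (Func.zer (BdF F) (μ-0 v j))) k
            x-0 (uX v k j) = proj₁ (proj₂ (proj₂ (bT v))) (λ k → x (uX v k j)) (λ F → begin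
              ∑ (λ k → x (uX v k j) * X v k F)
                ≈⟨ +-identityˡ _ ⟨
              0# + ∑ (λ k → x (uX v k j) * X v k F)
                ≈⟨ +-congʳ (Σ-0 (λ k → *-0ˡ (x-0 (uB v k j)))) ⟨
              μ v j F
                ≈⟨ μ-0 v j F ⟩
              0# ∎) k
            x-0 (uθ k j) = θ-0 k j

        unknowns equations : ℕ
        unknowns = z ℕ.* K ℕ.+ (sumN bv ℕ.* D ℕ.+ (sumN lb ℕ.* D ℕ.+ w ℕ.* D))
        equations = sumN (λ v → fSize (L v) (2 ℕ.+ d')) ℕ.* D ℕ.+ (fSize Δ 2 ℕ.+ fSize Δ D ℕ.* K)

        size-Unknown : Unknown ↔ Fin unknowns
        size-Unknown = size-⊎ (size-× ↔-refl ↔-refl) (size-⊎ (size-× (size-Σ (λ v → ↔-refl)) ↔-refl)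
          (size-⊎ (size-× (size-Σ (λ v → ↔-refl)) ↔-refl) (size-× ↔-refl ↔-refl)))

        size-Equation : Equation ↔ Fin equations
        size-Equation = size-⊎ (size-× (size-Σ (λ v → size-faces (L v) (2 ℕ.+ d'))) ↔-refl)
          (size-⊎ (size-faces Δ 2) (size-× (size-faces Δ D) ↔-refl))

        main-inequality : unknowns ≤ equations
        main-inequality with unknowns ℕ.≤? equations
        ... | yes le = le
        ... | no nle = ⊥-elim ((dn-sized (size-faces Δ 2) edgeData >>= λ ed →
          dual-basis S² (λ k → tilde (xW k)) (tilde-indep supW liW) >>= λ Yd →
          underdetermined′ size-Unknown size-Equation (ℕ.≰⇒> nle) (WithData.eqF ed Yd) >>= λ { (x , nz , sol) →
          return (nz (WithData.Solution.x-0 ed Yd x sol)) }) id)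

    -- From the count to Betti numbers

    module Conclusion where
      open Simplicial
      open Stress using (Mfd; Generic; pinned?; generic; SphereB; module Vanish; module VanishLow)
      open System using (StressVanishes; module Main)

      basis-map : ∀ {p q} {I : Set} {S : (I → Carrier) → Set p} {S' : (I → Carrier) → Set q} {r} →
        (∀ x → S x → S' x) → (∀ x → S' x → S x) → Basis S r → Basis S' r
      basis-map f g (e , eS , li , sp) = e , (λ j → f _ (eS j)) , li , λ x Sx → sp x (g x Sx)

      betti-same : ∀ {Γ Γ' : Cx n} → (∀ F → Γ F ≡ Γ' F) → Down Γ → Down Γ' → ∀ {t b} → BettiB Γ t b → BettiB Γ' t b
      betti-same {Γ} {Γ'} h dΓ dΓ' {t} (z , bb , bz , bB , e) = z , bb ,
        basis-map (cyc t h dΓ dΓ') (cyc t (λ F → ≡.sym (h F)) dΓ' dΓ) bz ,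
        basis-map (bnd h dΓ dΓ') (bnd (λ F → ≡.sym (h F)) dΓ' dΓ) bB , e
        where
          cyc : ∀ {Γ Γ' : Cx n} t → (∀ F → Γ F ≡ Γ' F) → Down Γ → Down Γ' → ∀ x → WithField.Cycles 𝔽 Γ t x → WithField.Cycles 𝔽 Γ' t x
          cyc {Γ} {Γ'} zero    h d d' x ch = ch-same {Γ} {Γ'} h ch
          cyc {Γ} {Γ'} (suc s) h d d' x cy = cycles⇐ {Γ'} d' (cycle-same {Γ} {Γ'} h (cycles⇒ {Γ} d cy))
          bnd : ∀ {Γ Γ' : Cx n} → (∀ F → Γ F ≡ Γ' F) → Down Γ → Down Γ' → ∀ x → WithField.Boundaries 𝔽 Γ t x → WithField.Boundaries 𝔽 Γ' t x
          bnd {Γ} {Γ'} h d d' x (ψ , ch , e) = ψ , ch-same {Γ} {Γ'} h ch ,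
            λ F → trans (e F) (trans (∂-Bd {Γ} d ch F) (sym (∂-Bd {Γ'} d' (ch-same {Γ} {Γ'} h ch) F)))

      stress-high : ∀ {Δ d'} (M : Mfd Δ (suc d')) {sp} (gen : Generic M sp) → StressVanishes Δ (suc d') (Generic.p gen)
      stress-high M gen base cc cyc stress = Vanish.vanish-high M gen base cc cyc stress (s≤s z≤n)

      stress-low : ∀ {Δ} (M : Mfd Δ 0) S → length S ≤ 5 → (∀ v → ¬ (v ∈ S) → DN (SphereB (lk Δ (v ∷ [])) 3)) →
        ∀ {sp} (gen : Generic M sp) → StressVanishes Δ 0 (Generic.p gen)
      stress-low M S len regular gen base cc cyc stress = VanishLow.vanish-low M gen base cc cyc stress S len regular

      Kernel : Cx n → ℕ → (Fin n × Subset n → Carrier) → Set (c ⊔ ℓ)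
      Kernel Δ t x = (∀ v → WithField.RelCocycle 𝔽 Δ v t (λ F → x (v , F))) × WithField.Coboundary 𝔽 Δ t (λ F → WithField.ΣFin 𝔽 (λ v → x (v , F)))

      module Numbers {Δ : Cx n} {d' : ℕ} (M : Mfd Δ d')
        (vanish : ∀ {sp} (gen : Generic M sp) → StressVanishes Δ d' (Generic.p gen))
        {β₁ β₂ κ w bb' : ℕ} {lβ₁ lβ₂ : Fin n → ℕ}
        (b₁ : BettiB Δ (3 ℕ.+ d') β₁) (b₂ : BettiB Δ (4 ℕ.+ d') β₂)
        (l₁ : ∀ v → BettiB (link Δ ⁅ v ⁆) (2 ℕ.+ d') (lβ₁ v)) (l₂ : ∀ v → BettiB (link Δ ⁅ v ⁆) (3 ℕ.+ d') (lβ₂ v))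
        (bW : Basis (Kernel Δ (3 ℕ.+ d')) w)
        (bR : Basis (λ (x : Fin n × Subset n → Carrier) → ∀ v → WithField.RelCoboundary 𝔽 Δ v (3 ℕ.+ d') (λ F → x (v , F))) bb')
        (w-eq : κ ℕ.+ bb' ≡ w)
        (cobound : ∀ k v → DN (WithField.Coboundary 𝔽 Δ (3 ℕ.+ d') (λ G → proj₁ bW k (v , G)))) where

        open Mfd M using (down; small)
        open Count Δ down using (ridges-bound; facets-bound)

        D K z bb f₂ : ℕ
        D = 4 ℕ.+ d'
        K = pairs (suc D)
        z = proj₁ b₁
        bb = proj₁ (proj₂ b₁)
        f₂ = fSize Δ 2

        zv bv : Fin n → ℕ
        zv v = proj₁ (l₁ v)
        bv v = proj₁ (proj₂ (l₁ v))

        too-big : ∀ {r} (J : Vec (Fin n) r) s → D < s ℕ.+ r → ∀ F → lk Δ J F ≡ true → ∣ F ∣ ≢ s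
        too-big {r} J s lt F f sz = ℕ.<-irrefl ≡.refl (ℕ.<-≤-trans lt (≡.subst (λ k → k ℕ.+ r ≤ D) sz (lk-small {Γ = Δ} small J F f)))

        top-Δ : Basis (WithField.Cycles 𝔽 Δ D) β₂
        top-Δ = basis-top {Δ} down (too-big [] (suc D) (≡.subst (D <_) (≡.sym (ℕ.+-identityʳ (suc D))) ℕ.≤-refl)) b₂

        top-link : ∀ v → Basis (WithField.Cycles 𝔽 (link Δ ⁅ v ⁆) (3 ℕ.+ d')) (lβ₂ v)
        top-link v = basis-top {link Δ ⁅ v ⁆} (down-link {Γ = Δ} v down)
          (too-big (v ∷ []) (4 ℕ.+ d') (≡.subst (D <_) (ℕ.+-comm 1 D) ℕ.≤-refl)) (l₂ v)

        -- Each cycle space is homology plus boundaries and w = κ + bb'; with the bounds on ridges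
        -- and facets inserted, the dimensions of all boundary and coboundary spaces occur on both
        -- sides.
        inequality : β₁ ℕ.* K ℕ.+ sumN lβ₂ ℕ.* D ℕ.+ κ ℕ.* D ≤ sumN lβ₁ ℕ.* D ℕ.+ f₂ ℕ.+ β₂ ℕ.* K
        inequality = decidable-stable (_ ℕ.≤? _) (pinned? M >>= λ sp → generic M sp >>= λ gen → return (cancelled
            (Main.main-inequality M gen (vanish gen) (proj₁ (proj₂ (proj₂ b₁))) (λ v → proj₁ (proj₂ (proj₂ (proj₂ (l₁ v))))) top-link
              (proj₁ bW) (proj₁ (proj₂ (proj₂ bW))) (λ k v → proj₁ (proj₁ (proj₂ bW) k) v) cobound)))
          where
            ridges : sumN (λ v → fSize (link Δ ⁅ v ⁆) (2 ℕ.+ d')) ≤ sumN zv ℕ.+ bb'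
            ridges = ridges-bound (λ v → proj₁ (proj₂ (proj₂ (l₁ v)))) bR
            facets : fSize Δ D ≤ β₂ ℕ.+ bb
            facets = facets-bound top-Δ (proj₁ (proj₂ (proj₂ (proj₂ b₁))))

            sumN-+ : ∀ {m} (f g h : Fin m → ℕ) → (∀ i → f i ℕ.+ g i ≡ h i) → sumN f ℕ.+ sumN g ≡ sumN h
            sumN-+ {zero}  f g h e = ≡.refl
            sumN-+ {suc m} f g h e = ≡.trans (shuffle (f zero) (sumN (f ∘ suc)) (g zero) (sumN (g ∘ suc)))
              (≡.cong₂ ℕ._+_ (e zero) (sumN-+ (f ∘ suc) (g ∘ suc) (h ∘ suc) (e ∘ suc)))
              where
                shuffle : ∀ a b c d → (a ℕ.+ b) ℕ.+ (c ℕ.+ d) ≡ (a ℕ.+ c) ℕ.+ (b ℕ.+ d)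
                shuffle = ℕSolver.solve-∀

            cancelled : z ℕ.* K ℕ.+ (sumN bv ℕ.* D ℕ.+ (sumN lβ₂ ℕ.* D ℕ.+ w ℕ.* D))
                ≤ sumN (λ v → fSize (link Δ ⁅ v ⁆) (2 ℕ.+ d')) ℕ.* D ℕ.+ (f₂ ℕ.+ fSize Δ D ℕ.* K) →
              β₁ ℕ.* K ℕ.+ sumN lβ₂ ℕ.* D ℕ.+ κ ℕ.* D ≤ sumN lβ₁ ℕ.* D ℕ.+ f₂ ℕ.+ β₂ ℕ.* K
            -- The cancelled amount collects the boundaries of Δ weighted by K, and the boundaries
            -- of the links together with the relative coboundaries weighted by D.
            cancelled le = ℕ.+-cancelˡ-≤ (bb ℕ.* K ℕ.+ (sumN bv ℕ.+ bb') ℕ.* D) _ _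
              (≡.subst₂ _≤_
                (≡.trans (≡.cong₂ (λ a b → a ℕ.* K ℕ.+ (sumN bv ℕ.* D ℕ.+ (sumN lβ₂ ℕ.* D ℕ.+ b ℕ.* D))) (≡.sym z-eq) (≡.sym w-eq))
                  (left β₁ bb K (sumN bv) D (sumN lβ₂) κ bb'))
                (≡.trans (≡.cong (λ a → (a ℕ.+ bb') ℕ.* D ℕ.+ (f₂ ℕ.+ (β₂ ℕ.+ bb) ℕ.* K)) (≡.sym (sumN-+ lβ₁ bv zv (λ v → proj₂ (proj₂ (proj₂ (proj₂ (l₁ v))))))))
                  (right (sumN lβ₁) (sumN bv) bb' D f₂ β₂ bb K))
                (ℕ.≤-trans le (ℕ.+-mono-≤ (ℕ.*-monoˡ-≤ D ridges) (ℕ.+-monoʳ-≤ f₂ (ℕ.*-monoˡ-≤ K facets)))))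
              where
                z-eq = proj₂ (proj₂ (proj₂ (proj₂ b₁)))
                left : ∀ β bb K bv D l κ b' → (β ℕ.+ bb) ℕ.* K ℕ.+ (bv ℕ.* D ℕ.+ (l ℕ.* D ℕ.+ (κ ℕ.+ b') ℕ.* D))
                  ≡ (bb ℕ.* K ℕ.+ (bv ℕ.+ b') ℕ.* D) ℕ.+ (β ℕ.* K ℕ.+ l ℕ.* D ℕ.+ κ ℕ.* D)
                left = ℕSolver.solve-∀
                right : ∀ l bv b' D f β bb K → (l ℕ.+ bv ℕ.+ b') ℕ.* D ℕ.+ (f ℕ.+ (β ℕ.+ bb) ℕ.* K)
                  ≡ (bb ℕ.* K ℕ.+ (bv ℕ.+ b') ℕ.* D) ℕ.+ (l ℕ.* D ℕ.+ f ℕ.+ β ℕ.* K)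
                right = ℕSolver.solve-∀

open import Data.Nat.Combinatorics using (_C_; nC1≡n; nCk+nC[k+1]≡[n+1]C[k+1])

-- Passage to the field with double-negated equality

stabilise : ∀ {c ℓ} → Field c ℓ → Field c ℓ
stabilise 𝔽 = record
  { commRing = record
      { Carrier = Carrier ; _≈_ = λ x y → DN (x ≈ y) ; _+_ = _+_ ; _*_ = _*_ ; -_ = -_ ; 0# = 0# ; 1# = 1#
      ; isCommutativeRing = record
          { isRing = record
              { +-isAbelianGroup = record
                  { isGroup = record
                      { isMonoid = record
                          { isSemigroup = record
                              { isMagma = record
                                  { isEquivalence = record
                                      { refl = return refl
                                      ; sym = λ e → sym <$> e
                                      ; trans = λ e f → e >>= λ e → f >>= λ f → return (trans e f) }
                                  ; ∙-cong = λ e f → e >>= λ e → f >>= λ f → return (+-cong e f) }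
                              ; assoc = λ x y z → return (+-assoc x y z) }
                          ; identity = (λ x → return (+-identityˡ x)) , λ x → return (+-identityʳ x) }
                      ; inverse = (λ x → return (-‿inverseˡ x)) , λ x → return (-‿inverseʳ x)
                      ; ⁻¹-cong = λ e → -‿cong <$> e }
                  ; comm = λ x y → return (+-comm x y) }
              ; *-cong = λ e f → e >>= λ e → f >>= λ f → return (*-cong e f)
              ; *-assoc = λ x y z → return (*-assoc x y z)
              ; *-identity = (λ x → return (*-identityˡ x)) , λ x → return (*-identityʳ x)
              ; distrib = (λ x y z → return (distribˡ x y z)) , λ x y z → return (distribʳ x y z) }
          ; *-comm = λ x y → return (*-comm x y) } }
  ; 0≉1 = λ e → e 0≉1
  ; inverse = λ x n → let (y , e) = inverse x (λ e → n (return e)) in y , return e }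
  where open Field 𝔽

module Transfer {c ℓ : Level} (𝔽 : Field c ℓ) (infinite : Infinite 𝔽) where

  𝔽′ = stabilise 𝔽

  stable : ∀ {x y : Field.Carrier 𝔽′} → DN (Field._≈_ 𝔽′ x y) → Field._≈_ 𝔽′ x y
  stable d k = d (λ e → e k)

  infinite′ : Infinite 𝔽′
  infinite′ = e , λ m n q → decide m n q
    where
      e = proj₁ infinite
      decide : ∀ m n → Field._≈_ 𝔽′ (e m) (e n) → m ≡ n
      decide m n q with m ℕ.≟ n
      ... | yes eq = eq
      ... | no ne  = ⊥-elim (q (λ r → ne (proj₂ infinite m n r)))

  module F = WithField 𝔽
  module F′ = WithField 𝔽′
  open Field 𝔽 hiding (zero)

  Basis : ∀ {p} {I : Set} → ((I → Carrier) → Set p) → ℕ → Set (c ⊔ ℓ ⊔ p)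
  Basis = StableField.Basis 𝔽′ stable infinite′

  -- The sums over the two fields are distinct recursive functions, so although the operations
  -- coincide, equality of sums takes an induction.
  Σ-same : ∀ {m} {f g : Fin m → Carrier} → (∀ i → f i ≡ g i) → F′.ΣFin f ≡ F.ΣFin g
  Σ-same {zero}  h = ≡.refl
  Σ-same {suc m} h = ≡.cong₂ _+_ (h zero) (Σ-same (h ∘ suc))

  sgn-same : ∀ k → F′.sgn k ≡ F.sgn k
  sgn-same zero    = ≡.refl
  sgn-same (suc k) = ≡.cong -_ (sgn-same k)

  module _ {n : ℕ} (Γ : Cx n) where

    ∂-same : ∀ s ψ F → F′.∂ Γ s ψ F ≡ F.∂ Γ s ψ F
    ∂-same s ψ F with faceOfSize Γ s F
    ... | false = ≡.refl
    ... | true  = Σ-same (λ u → term u)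
      where
        term : ∀ u → (if not (lookup F u) ∧ Γ (F ∪ ⁅ u ⁆) then F′.sgn (below F u) * ψ (F ∪ ⁅ u ⁆) else 0#)
                   ≡ (if not (lookup F u) ∧ Γ (F ∪ ⁅ u ⁆) then F.sgn (below F u) * ψ (F ∪ ⁅ u ⁆) else 0#)
        term u = ≡.cong (λ s → if not (lookup F u) ∧ Γ (F ∪ ⁅ u ⁆) then s * ψ (F ∪ ⁅ u ⁆) else 0#) (sgn-same (below F u))

    δ-same : ∀ s φ G → F′.δ Γ s φ G ≡ F.δ Γ s φ G
    δ-same s φ G with faceOfSize Γ (suc s) G
    ... | false = ≡.refl
    ... | true  = Σ-same (λ u → ≡.cong (λ s → if lookup G u then s * φ (G Sub.- u) else 0#) (sgn-same (below G u)))

  -- Backwards a double negation has to be pulled out of quantifiers over faces and vertices; these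
  -- are finite, so it can be, at the price of one outer double negation.
  record _⇄_ {p q} {I : Set} (S : (I → Carrier) → Set p) (S′ : (I → Carrier) → Set q) : Set (c ⊔ p ⊔ q) where
    field
      fwd : ∀ x → S x → S′ x
      bwd : ∀ x → S′ x → DN (S x)
  open _⇄_

  -- Independence over the stabilised field assumes a relation up to double negation at each index;
  -- `shift` gathers these into one relation over the original field.
  basis : ∀ {p q} {I : Set} {S : (I → Carrier) → Set p} {S′ : (I → Carrier) → Set q} {r} →
    (∀ {a} {P : I → Set a} → (∀ i → DN (P i)) → DN (∀ i → P i)) → S ⇄ S′ → F.Dim S r → Basis S′ r
  basis {I = I} {r = r} shift h (e , eS , li , sp) = e , (λ j → fwd h _ (eS j)) ,
    (λ γ z j → shift (λ a → (λ q → ≡.subst (_≈ 0#) (same γ a) q) <$> z a) >>= λ z′ → return (li γ z′ j)) ,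
    λ x Sx → bwd h x Sx >>= λ Sx′ → let (γ , q) = sp x Sx′ in
      return (γ , λ a → return (≡.subst (x a ≈_) (≡.sym (same γ a)) (q a)))
    where
      same : ∀ γ a → StableField.∑ 𝔽′ stable infinite′ (λ j → γ j * e j a) ≡ F.lincomb γ e a
      same γ a = ≡.trans (StableField.∑-def 𝔽′ stable infinite′ _) (Σ-same {r} (λ j → ≡.refl))

  module _ {n : ℕ} (Γ : Cx n) where

    chain : ∀ s → F.Chain Γ s ⇄ F′.Chain Γ s
    chain s = record { fwd = λ x h F e → return (h F e) ; bwd = λ x h → dn-Subset (λ F → dn-→ (h F)) }

    zeros : ∀ {f g : Subset n → Carrier} → (∀ F → f F ≡ g F) → (∀ F → DN (f F ≈ 0#)) → DN (∀ F → g F ≈ 0#)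
    zeros h z = dn-Subset (λ F → (λ q → ≡.subst (_≈ 0#) (h F) q) <$> z F)

    equals : ∀ {x f g : Subset n → Carrier} → (∀ F → f F ≡ g F) → (∀ F → DN (x F ≈ f F)) → DN (∀ F → x F ≈ g F)
    equals {x} h z = dn-Subset (λ F → (λ q → ≡.subst (x F ≈_) (h F) q) <$> z F)

    cycles : ∀ t → F.Cycles Γ t ⇄ F′.Cycles Γ t
    cycles zero = chain 0
    cycles (suc s) = record
      { fwd = λ { x (ch , z) → fwd (chain (suc s)) x ch , λ F → return (≡.subst (_≈ 0#) (≡.sym (∂-same Γ s x F)) (z F)) }
      ; bwd = λ { x (ch , z) → bwd (chain (suc s)) x ch >>= λ ch → zeros (∂-same Γ s x) z >>= λ z → return (ch , z) } }

    boundaries : ∀ t → F.Boundaries Γ t ⇄ F′.Boundaries Γ t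
    boundaries t = record
      { fwd = λ { x (ψ , ch , e) → ψ , fwd (chain (suc t)) ψ ch , λ F → return (≡.subst (x F ≈_) (≡.sym (∂-same Γ t ψ F)) (e F)) }
      ; bwd = λ { x (ψ , ch , e) → bwd (chain (suc t)) ψ ch >>= λ ch → equals (∂-same Γ t ψ) e >>= λ e → return (ψ , ch , e) } }

    coboundary : ∀ s → F.Coboundary Γ (suc s) ⇄ F′.Coboundary Γ (suc s)
    coboundary s = record
      { fwd = λ { x (ψ , ch , e) → ψ , fwd (chain s) ψ ch , λ F → return (≡.subst (x F ≈_) (≡.sym (δ-same Γ s ψ F)) (e F)) }
      ; bwd = λ { x (ψ , ch , e) → bwd (chain s) ψ ch >>= λ ch → equals (δ-same Γ s ψ) e >>= λ e → return (ψ , ch , e) } }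

    relCochain : ∀ v s → F.RelCochain Γ v s ⇄ F′.RelCochain Γ v s
    relCochain v s = record
      { fwd = λ { x (ch , h) → fwd (chain s) x ch , λ F e → return (h F e) }
      ; bwd = λ { x (ch , h) → bwd (chain s) x ch >>= λ ch → dn-Subset (λ F → dn-→ (h F)) >>= λ h → return (ch , h) } }

    relCocycle : ∀ v t → F.RelCocycle Γ v t ⇄ F′.RelCocycle Γ v t
    relCocycle v t = record
      { fwd = λ { x (rc , z) → fwd (relCochain v t) x rc , λ F → return (≡.subst (_≈ 0#) (≡.sym (δ-same Γ t x F)) (z F)) }
      ; bwd = λ { x (rc , z) → bwd (relCochain v t) x rc >>= λ rc → zeros (δ-same Γ t x) z >>= λ z → return (rc , z) } }

    relCoboundary : ∀ v s → F.RelCoboundary Γ v (suc s) ⇄ F′.RelCoboundary Γ v (suc s)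
    relCoboundary v s = record
      { fwd = λ { x (ψ , rc , e) → ψ , fwd (relCochain v s) ψ rc , λ F → return (≡.subst (x F ≈_) (≡.sym (δ-same Γ s ψ F)) (e F)) }
      ; bwd = λ { x (ψ , rc , e) → bwd (relCochain v s) ψ rc >>= λ rc → equals (δ-same Γ s ψ) e >>= λ e → return (ψ , rc , e) } }

    kernel-sum : ∀ (x : Fin n × Subset n → Carrier) F → F′.ΣFin (λ v → x (v , F)) ≡ F.ΣFin (λ v → x (v , F))
    kernel-sum x F = Σ-same {n} (λ v → ≡.refl)

    Kernel : ℕ → (Fin n × Subset n → Carrier) → Set (c ⊔ ℓ)
    Kernel s x = (∀ v → F.RelCocycle Γ v (suc s) (λ F → x (v , F))) × F.Coboundary Γ (suc s) (λ F → F.ΣFin (λ v → x (v , F)))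

    Kernel′ : ℕ → (Fin n × Subset n → Carrier) → Set (c ⊔ ℓ)
    Kernel′ s x = (∀ v → F′.RelCocycle Γ v (suc s) (λ F → x (v , F))) × F′.Coboundary Γ (suc s) (λ F → F′.ΣFin (λ v → x (v , F)))

    kernel : ∀ s → Kernel s ⇄ Kernel′ s
    kernel s = record
      { fwd = λ { x (rc , cb) → (λ v → fwd (relCocycle v (suc s)) _ (rc v)) ,
          (let (φ , ch , e) = fwd (coboundary s) _ cb in φ , ch , λ F → ≡.subst (λ y → DN (y ≈ F′.δ Γ s φ F)) (≡.sym (kernel-sum x F)) (e F)) }
      ; bwd = λ { x (rc , φ , ch , e) → dn-Fin (λ v → bwd (relCocycle v (suc s)) _ (rc v)) >>= λ rc →
          bwd (coboundary s) (λ F → F.ΣFin (λ v → x (v , F))) (φ , ch , λ F → ≡.subst (λ y → DN (y ≈ F′.δ Γ s φ F)) (kernel-sum x F) (e F)) >>= λ cb →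
          return (rc , cb) } }

    relBoundaries : ∀ s → (λ (x : Fin n × Subset n → Carrier) → ∀ v → F.RelCoboundary Γ v (suc s) (λ F → x (v , F)))
      ⇄ (λ x → ∀ v → F′.RelCoboundary Γ v (suc s) (λ F → x (v , F)))
    relBoundaries s = record
      { fwd = λ x h v → fwd (relCoboundary v s) _ (h v)
      ; bwd = λ x h → dn-Fin (λ v → bwd (relCoboundary v s) _ (h v)) }

  dn-× : ∀ {n a} {P : Fin n × Subset n → Set a} → (∀ i → DN (P i)) → DN (∀ i → P i)
  dn-× f = dn-Fin (λ v → dn-Subset (λ F → f (v , F))) >>= λ g → return (λ { (v , F) → g v F })

  betti : ∀ {n} (Γ : Cx n) {t b} → F.Betti Γ t b → StableField.Simplicial.BettiB 𝔽′ stable infinite′ n Γ t b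
  betti Γ {t} (z , bb , dz , db , e) = z , bb , basis dn-Subset (cycles Γ t) dz , basis dn-Subset (boundaries Γ t) db , e

pairs-C : ∀ N → pairs N ≡ N C 2
pairs-C zero    = ≡.refl
pairs-C (suc N) = ≡.trans (≡.cong₂ ℕ._+_ (≡.sym (nC1≡n N)) (pairs-C N)) (nCk+nC[k+1]≡[n+1]C[k+1] N 1)

-- Reading off the hypotheses, and the final arithmetic

module Assemble {c ℓ : Level} (𝔽 : Field c ℓ) (infinite : Infinite 𝔽) (n d' : ℕ) (Δ : Cx n)
  (hyp : WithField.HomologicallyIsolatedSing 𝔽 Δ (4 ℕ.+ d')) where

  open Transfer 𝔽 infinite
  open WithField.HomologicallyIsolatedSing hyp
  open WithField.PseudomanifoldIsolatedSing pseudomanifold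

  D : ℕ
  D = 4 ℕ.+ d'

  down : Down Δ
  down u F e = IsComplex.closed complex F (ins u F) (Sub.p⊆p∪q ⁅ u ⁆) e

  small : ∀ F → Δ F ≡ true → ∣ F ∣ ≤ D
  small F f = go ∣ F ∣ ≡.refl
    where
      go : ∀ k → ∣ F ∣ ≡ k → k ≤ D
      go zero    sz = z≤n
      go (suc k) sz =
        let (v , vF) = member F sz
            sz' = ℕ.suc-injective (≡.trans (≡.sym (size-del v F vF)) sz)
        in s≤s (≡.subst (_≤ 3 ℕ.+ d') sz' (proj₁ (linkManifold v) (del v F)
             (link-intro {Γ = Δ} {v} {del v F} (del-≡ v F) (≡.subst (λ G → Δ G ≡ true) (≡.sym (ins-del v F vF)) f))))

  -- The last entry provides the vertex link, a homology manifold; the remaining entries form a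
  -- nonempty face of it because r ≥ 2.
  sphere : ∀ {r} (J : Vec (Fin n) r) → 2 ≤ r → Face Δ J → StableField.Stress.SphereB 𝔽′ stable infinite′ n (lk Δ J) (D ℕ.∸ r)
  sphere {suc (suc r)} J le f t with Vec.initLast J
  ... | J₀ , v , ≡.refl = StableField.Conclusion.betti-same 𝔽′ stable infinite′ n
      (λ F → ≡.sym (≡.trans (lk-∷ʳ Δ J₀ v F) (proj₁ info F)))
      (λ u F e → ≡.trans (≡.sym (proj₁ info F)) (down-lk J₀ dv u F (≡.trans (proj₁ info (ins u F)) e)))
      (down-lk (J₀ ∷ʳ v) down)
      (betti (link (link Δ ⁅ v ⁆) (vertexSet J₀))
        (≡.subst (λ k → F.Betti (link (link Δ ⁅ v ⁆) (vertexSet J₀)) t (if t ≡ᵇ k then 1 else 0)) (≡.cong (λ t → 3 ℕ.+ d' ℕ.∸ t) (proj₂ (proj₂ info)))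
          (proj₂ (linkManifold v) (vertexSet J₀) (proj₁ (proj₂ info)) (≡.subst (0 <_) (≡.sym (proj₂ (proj₂ info))) (s≤s z≤n)) t)))
    where
      dv : Down (link Δ ⁅ v ⁆)
      dv = down-link {Γ = Δ} v down
      info = lk-link (link Δ ⁅ v ⁆) J₀ dv (≡.trans (≡.sym (lk-∷ʳ Δ J₀ v Sub.⊥)) f)
  sphere {suc zero} J (s≤s ()) f
  sphere {zero} J () f

  manifold : StableField.Stress.Mfd 𝔽′ stable infinite′ n Δ d'
  manifold = record { down = down ; small = small ; sph = sphere }

  module Bounds (vanish : ∀ {sp} (gen : StableField.Stress.Generic 𝔽′ stable infinite′ n manifold sp) →
      StableField.System.StressVanishes 𝔽′ stable infinite′ n Δ d' (StableField.Stress.Generic.p gen))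
    {β₁ β₂ κ : ℕ} {lβ₁ lβ₂ : Fin n → ℕ}
    (b₁ : F.Betti Δ (3 ℕ.+ d') β₁) (b₂ : F.Betti Δ D β₂) (kd : F.KerDim Δ (3 ℕ.+ d') κ)
    (l₁ : ∀ v → F.Betti (link Δ ⁅ v ⁆) (2 ℕ.+ d') (lβ₁ v)) (l₂ : ∀ v → F.Betti (link Δ ⁅ v ⁆) (3 ℕ.+ d') (lβ₂ v)) where

    K f₂ : ℕ
    K = pairs (suc D)
    f₂ = fSize Δ 2

    bW : Basis (Kernel′ Δ (2 ℕ.+ d')) (proj₁ kd)
    bW = basis dn-× (kernel Δ (2 ℕ.+ d')) (proj₁ (proj₂ (proj₂ kd)))

    -- Independence of the images, in degree d - 2, splits the vanishing of a sum of classes into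
    -- the vanishing of each. It is stated for the original field, hence the detour there and back.
    cobound : ∀ k v → DN (F′.Coboundary Δ (3 ℕ.+ d') (λ G → proj₁ bW k (v , G)))
    cobound k v = _⇄_.bwd (kernel Δ (2 ℕ.+ d')) (proj₁ bW k) (proj₁ (proj₂ bW) k) >>= λ { (rc , cb) →
      return (_⇄_.fwd (coboundary Δ (2 ℕ.+ d')) _ (independent (3 ℕ.+ d') (s≤s z≤n) ℕ.≤-refl (λ v G → proj₁ bW k (v , G)) rc cb v)) }

    inequality : β₁ ℕ.* K ℕ.+ sumN lβ₂ ℕ.* D ℕ.+ κ ℕ.* D ≤ sumN lβ₁ ℕ.* D ℕ.+ f₂ ℕ.+ β₂ ℕ.* K
    inequality = StableField.Conclusion.Numbers.inequality 𝔽′ stable infinite′ n manifold vanish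
      (betti Δ b₁) (betti Δ b₂) (λ v → betti (link Δ ⁅ v ⁆) (l₁ v)) (λ v → betti (link Δ ⁅ v ⁆) (l₂ v))
      bW (basis dn-× (relBoundaries Δ (2 ℕ.+ d')) (proj₁ (proj₂ (proj₂ (proj₂ kd))))) (proj₂ (proj₂ (proj₂ (proj₂ kd)))) cobound

    -- Counts the empty face. In g₂ this number has the positive coefficient K and the number of
    -- vertices the coefficient -D, so one-sided estimates are enough for both.
    f₀≥1 : 1 ≤ fSize Δ 0
    f₀≥1 = inhabited (Inverse.to (size-faces Δ 0) (Sub.⊥ , face-intro {Γ = Δ} (down-⊥ {Γ = Δ} down (proj₁ (proj₂ (proj₁ pure)))) (size-⊥ {n})))
      where
        inhabited : ∀ {k} → Fin k → 1 ≤ k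
        inhabited {suc k} _ = s≤s z≤n

    f₁≤n : fSize Δ 1 ≤ n
    f₁≤n = Fin.injective⇒≤ {f = vertex} (λ {i} {j} e → inj i j e)
      where
        face : Fin (fSize Δ 1) → FaceT Δ 1
        face = Inverse.from (size-faces Δ 1)
        pick : (F : FaceT Δ 1) → Σ (Fin n) λ v → proj₁ F ≡ ins v Sub.⊥
        pick (F , f) =
          let sz = proj₂ (face-of {Γ = Δ} f)
              (v , vF) = member F sz
          in v , ≡.trans (≡.sym (ins-del v F vF)) (≡.cong (ins v) (size-0 (del v F) (ℕ.suc-injective (≡.trans (≡.sym (size-del v F vF)) sz))))
        vertex : Fin (fSize Δ 1) → Fin n
        vertex j = proj₁ (pick (face j))
        inj : ∀ i j → vertex i ≡ vertex j → i ≡ j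
        inj i j e = from-injective (size-faces Δ 1) i j (faceT-≡ {Γ = Δ}
          (≡.trans (proj₂ (pick (face i))) (≡.trans (≡.cong (λ v → ins v Sub.⊥) e) (≡.sym (proj₂ (pick (face j)))))))

    -- The empty face receives binomial(D, 2) from h₂ and D from -h₁, together K; the vertices
    -- receive -(D - 1) and -1.
    g₂-value : g₂ Δ D ≡ + f₂ ℤ.+ + K ℤ.* + fSize Δ 0 ℤ.- + D ℤ.* + fSize Δ 1
    g₂-value = ≡.trans (≡.cong₂ (λ a b → (((+ 1 ℤ.* (+ (D C 2) ℤ.* + fSize Δ 0)) ℤ.+ ((ℤ.- + 1) ℤ.* (+ a ℤ.* + fSize Δ 1)))
          ℤ.+ (+ 1 ℤ.* (+ 1 ℤ.* + f₂))) ℤ.- (((ℤ.- + 1) ℤ.* (+ b ℤ.* + fSize Δ 0)) ℤ.+ (+ 1 ℤ.* (+ 1 ℤ.* + fSize Δ 1)))) (nC1≡n (3 ℕ.+ d')) (nC1≡n D))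
      (≡.trans (collect (+ (D C 2)) (+ fSize Δ 0) (+ (3 ℕ.+ d')) (+ fSize Δ 1) (+ f₂) (+ D))
        (≡.cong₂ (λ a b → + f₂ ℤ.+ a ℤ.* + fSize Δ 0 ℤ.- b ℤ.* + fSize Δ 1)
          (≡.cong +_ (≡.trans (ℕ.+-comm (D C 2) D) (≡.cong (D ℕ.+_) (≡.sym (pairs-C D))))) (≡.cong +_ (ℕ.+-comm (3 ℕ.+ d') 1))))
      where
        collect : ∀ C f₀ e f₁ f D → (((+ 1 ℤ.* (C ℤ.* f₀)) ℤ.+ ((ℤ.- + 1) ℤ.* (e ℤ.* f₁))) ℤ.+ (+ 1 ℤ.* (+ 1 ℤ.* f)))
            ℤ.- (((ℤ.- + 1) ℤ.* (D ℤ.* f₀)) ℤ.+ (+ 1 ℤ.* (+ 1 ℤ.* f₁)))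
          ≡ f ℤ.+ (C ℤ.+ D) ℤ.* f₀ ℤ.- (e ℤ.+ + 1) ℤ.* f₁
        collect = ℤSolver.solve-∀

    sumFin-value : ∀ {m} (a b : Fin m → ℕ) → sumFin (λ v → + a v ℤ.- + b v ℤ.+ + 1) ≡ + sumN a ℤ.- + sumN b ℤ.+ + m
    sumFin-value {zero}  a b = ≡.refl
    sumFin-value {suc m} a b = ≡.trans (≡.cong (λ t → (+ a zero ℤ.- + b zero ℤ.+ + 1) ℤ.+ t) (sumFin-value (a ∘ suc) (b ∘ suc)))
      (shuffle (+ a zero) (+ b zero) (+ sumN (a ∘ suc)) (+ sumN (b ∘ suc)) (+ m))
      where
        shuffle : ∀ a b c d m → (a ℤ.- b ℤ.+ + 1) ℤ.+ (c ℤ.- d ℤ.+ m) ≡ (a ℤ.+ c) ℤ.- (b ℤ.+ d) ℤ.+ (+ 1 ℤ.+ m)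
        shuffle = ℤSolver.solve-∀

    conclude : (+ ((D ℕ.+ 1) C 2)) ℤ.* (+ β₁ ℤ.- + β₂ ℤ.+ + 1) ℤ.+ + D ℤ.* + κ
        ℤ.- + D ℤ.* sumFin (λ v → + lβ₁ v ℤ.- + lβ₂ v ℤ.+ + 1) ℤ.≤ g₂ Δ D
    conclude = ≡.subst₂ ℤ._≤_
        (≡.cong₂ (λ k s → + k ℤ.* (+ β₁ ℤ.- + β₂ ℤ.+ + 1) ℤ.+ + D ℤ.* + κ ℤ.- + D ℤ.* s)
          (≡.trans (pairs-C (suc D)) (≡.cong (_C 2) (ℕ.+-comm 1 D))) (≡.sym (sumFin-value lβ₁ lβ₂)))
        (≡.sym (≡.trans g₂-value (≡.sym total)))
        (ℤ.i≤i+j left (+ slack))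
      where
        δ₁ = proj₁ (ℕ.m≤n⇒∃[o]m+o≡n inequality)
        e₁ = proj₂ (ℕ.m≤n⇒∃[o]m+o≡n inequality)
        δ₂ = proj₁ (ℕ.m≤n⇒∃[o]m+o≡n f₀≥1)
        e₂ = proj₂ (ℕ.m≤n⇒∃[o]m+o≡n f₀≥1)
        δ₃ = proj₁ (ℕ.m≤n⇒∃[o]m+o≡n f₁≤n)
        e₃ = proj₂ (ℕ.m≤n⇒∃[o]m+o≡n f₁≤n)
        -- The excesses of the three estimates, weighted by the coefficients with which they enter
        -- g₂; they account for the whole difference of the two sides.
        slack = δ₁ ℕ.+ K ℕ.* δ₂ ℕ.+ D ℕ.* δ₃
        left = + K ℤ.* (+ β₁ ℤ.- + β₂ ℤ.+ + 1) ℤ.+ + D ℤ.* + κ ℤ.- + D ℤ.* (+ sumN lβ₁ ℤ.- + sumN lβ₂ ℤ.+ + n)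

        cast₃ : ∀ a b c d e f → + (a ℕ.* b ℕ.+ c ℕ.* d ℕ.+ e ℕ.* f) ≡ + a ℤ.* + b ℤ.+ + c ℤ.* + d ℤ.+ + e ℤ.* + f
        cast₃ a b c d e f = ≡.trans (ℤ.pos-+ (a ℕ.* b ℕ.+ c ℕ.* d) (e ℕ.* f)) (≡.cong₂ ℤ._+_
          (≡.trans (ℤ.pos-+ (a ℕ.* b) (c ℕ.* d)) (≡.cong₂ ℤ._+_ (ℤ.pos-* a b) (ℤ.pos-* c d))) (ℤ.pos-* e f))

        f₂-eq : + f₂ ≡ (+ β₁ ℤ.* + K ℤ.+ + sumN lβ₂ ℤ.* + D ℤ.+ + κ ℤ.* + D ℤ.+ + δ₁) ℤ.- + sumN lβ₁ ℤ.* + D ℤ.- + β₂ ℤ.* + K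
        f₂-eq = ≡.trans (isolate (+ f₂) (+ sumN lβ₁ ℤ.* + D) (+ β₂ ℤ.* + K))
          (≡.cong (λ t → t ℤ.- + sumN lβ₁ ℤ.* + D ℤ.- + β₂ ℤ.* + K) (≡.trans (≡.sym cast-right)
            (≡.trans (≡.cong +_ (≡.sym e₁)) (≡.trans (ℤ.pos-+ (β₁ ℕ.* K ℕ.+ sumN lβ₂ ℕ.* D ℕ.+ κ ℕ.* D) δ₁)
              (≡.cong (λ t → t ℤ.+ + δ₁) (cast₃ β₁ K (sumN lβ₂) D κ D))))))
          where
            isolate : ∀ f a b → f ≡ (a ℤ.+ f ℤ.+ b) ℤ.- a ℤ.- b
            isolate = ℤSolver.solve-∀
            cast-right : + (sumN lβ₁ ℕ.* D ℕ.+ f₂ ℕ.+ β₂ ℕ.* K) ≡ + sumN lβ₁ ℤ.* + D ℤ.+ + f₂ ℤ.+ + β₂ ℤ.* + K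
            cast-right = ≡.trans (ℤ.pos-+ (sumN lβ₁ ℕ.* D ℕ.+ f₂) (β₂ ℕ.* K)) (≡.cong₂ ℤ._+_
              (≡.trans (ℤ.pos-+ (sumN lβ₁ ℕ.* D) f₂) (≡.cong (λ t → t ℤ.+ + f₂) (ℤ.pos-* (sumN lβ₁) D))) (ℤ.pos-* β₂ K))

        total : left ℤ.+ + slack ≡ + f₂ ℤ.+ + K ℤ.* + fSize Δ 0 ℤ.- + D ℤ.* + fSize Δ 1
        total = ≡.trans (≡.cong₂ (λ m s → + K ℤ.* (+ β₁ ℤ.- + β₂ ℤ.+ + 1) ℤ.+ + D ℤ.* + κ ℤ.- + D ℤ.* (+ sumN lβ₁ ℤ.- + sumN lβ₂ ℤ.+ m) ℤ.+ s)
            (≡.trans (≡.cong +_ (≡.sym e₃)) (ℤ.pos-+ (fSize Δ 1) δ₃))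
            (≡.trans (ℤ.pos-+ (δ₁ ℕ.+ K ℕ.* δ₂) (D ℕ.* δ₃)) (≡.cong₂ ℤ._+_ (≡.trans (ℤ.pos-+ δ₁ (K ℕ.* δ₂)) (≡.cong (λ t → + δ₁ ℤ.+ t) (ℤ.pos-* K δ₂))) (ℤ.pos-* D δ₃))))
          (≡.trans (balance (+ K) (+ β₁) (+ β₂) (+ D) (+ κ) (+ sumN lβ₁) (+ sumN lβ₂) (+ fSize Δ 1) (+ δ₃) (+ δ₁) (+ δ₂))
            (≡.cong₂ (λ f f₀ → f ℤ.+ + K ℤ.* f₀ ℤ.- + D ℤ.* + fSize Δ 1) (≡.sym f₂-eq) (≡.trans (≡.sym (ℤ.pos-+ 1 δ₂)) (≡.cong +_ e₂))))
          where
            balance : ∀ K β₁ β₂ D κ l₁ l₂ f₁ δ₃ δ₁ δ₂ →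
              K ℤ.* (β₁ ℤ.- β₂ ℤ.+ + 1) ℤ.+ D ℤ.* κ ℤ.- D ℤ.* (l₁ ℤ.- l₂ ℤ.+ (f₁ ℤ.+ δ₃)) ℤ.+ (δ₁ ℤ.+ K ℤ.* δ₂ ℤ.+ D ℤ.* δ₃)
              ≡ ((β₁ ℤ.* K ℤ.+ l₂ ℤ.* D ℤ.+ κ ℤ.* D ℤ.+ δ₁) ℤ.- l₁ ℤ.* D ℤ.- β₂ ℤ.* K) ℤ.+ K ℤ.* (+ 1 ℤ.+ δ₂) ℤ.- D ℤ.* f₁
            balance = ℤSolver.solve-∀

theorem4p9 :
  ∀ {c ℓ} (𝔽 : Field c ℓ) → Infinite 𝔽 →
  ∀ (n d : ℕ) (Δ : Cx n) →
  WithField.HomologicallyIsolatedSing 𝔽 Δ d →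
  (5 ≤ d ⊎ (d ≡ 4 × WithField.AtMostSingularities 𝔽 Δ d 5)) →
  ∀ (β₁ β₂ κ : ℕ) (lβ₁ lβ₂ : Fin n → ℕ) →
  WithField.Betti 𝔽 Δ (d ∸ 1) β₁ →
  WithField.Betti 𝔽 Δ d β₂ →
  WithField.KerDim 𝔽 Δ (d ∸ 1) κ →
  (∀ v → WithField.Betti 𝔽 (link Δ ⁅ v ⁆) (d ∸ 2) (lβ₁ v)) →
  (∀ v → WithField.Betti 𝔽 (link Δ ⁅ v ⁆) (d ∸ 1) (lβ₂ v)) →
  (+ ((d Data.Nat.+ 1) C 2)) ℤ.* (+ β₁ ℤ.- + β₂ ℤ.+ + 1)
    ℤ.+ + d ℤ.* + κ
    ℤ.- + d ℤ.* sumFin (λ v → + lβ₁ v ℤ.- + lβ₂ v ℤ.+ + 1)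
    ℤ.≤ g₂ Δ d
theorem4p9 𝔽 inf n .(5 ℕ.+ d″) Δ hyp (inj₁ (s≤s (s≤s (s≤s (s≤s (s≤s (z≤n {d″}))))))) β₁ β₂ κ lβ₁ lβ₂ b₁ b₂ kd l₁ l₂ =
  Assemble.Bounds.conclude 𝔽 inf n (suc d″) Δ hyp
    (StableField.Conclusion.stress-high (stabilise 𝔽) (Transfer.stable 𝔽 inf) (Transfer.infinite′ 𝔽 inf) n (Assemble.manifold 𝔽 inf n (suc d″) Δ hyp))
    b₁ b₂ kd l₁ l₂
theorem4p9 𝔽 inf n .4 Δ hyp (inj₂ (≡.refl , S , len , sing)) β₁ β₂ κ lβ₁ lβ₂ b₁ b₂ kd l₁ l₂ =
  Assemble.Bounds.conclude 𝔽 inf n 0 Δ hyp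
    (StableField.Conclusion.stress-low (stabilise 𝔽) (Transfer.stable 𝔽 inf) (Transfer.infinite′ 𝔽 inf) n (Assemble.manifold 𝔽 inf n 0 Δ hyp) S len
      -- A vertex outside S is not singular, so up to double negation its link is a homology sphere.
      (λ v v∉ k → v∉ (sing v (λ sph → k (λ t → Transfer.betti 𝔽 inf (link Δ ⁅ v ⁆) (sph t))))))
    b₁ b₂ kd l₁ l₂
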